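{- The preemptive Lazy Bureaucrat Problem under Constraint II with objective (1) (minimize the total time spent working) is NP-complete (in the ordinary sense, with numbers encoded in binary).
   Context: An instance of the Lazy Bureaucrat Problem consists of jobs $1,\dots,n$; job $i$ has a processing time $t_i$, an arrival time $a_i$ and a deadline $d_i$, all nonnegative integers. A single processor (the bureaucrat) processes at most one job at each time. In the preemptive setting a job may be interrupted and resumed later at no cost. For a schedule, let $y_i(\tau)$ be the amount of job $i$ processed before time $\tau$; no job is processed for more than $t_i$ in total, and job $i$ is completed if it receives $t_i$ units of processing by time $d_i$. Under Constraint II, job $i$ is executable (may be processed) at time $\tau$ iff $a_i\le\tau$, $y_i(\tau)<t_i$ and $\tau\le d_i-t_i+y_i(\tau)$ (the job can still be completed by its deadline if processed without interruption from $\tau$). A schedule is feasible if it only processes executable jobs and obeys the busy requirement: the processor is idle at time $\tau$ only if no job is executable at $\tau$. Objective (1) is the total time spent working, $\sum_i y_i(\infty)$; the decision version asks whether some feasible schedule has objective value at most a given $B$.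
   Formalization: Time is rational rather than real: a schedule consists of finitely many pieces with rational durations, and executability and the busy requirement are imposed at all rational times τ ≥ 0. -}

module Defs where

open import Data.Bool.Base using (Bool; true; false; if_then_else_)
open import Data.Fin.Base using (Fin)
import Data.Fin.Properties as Fin
open import Data.Integer.Base using (+_)
open import Data.List.Base using (List; []; _∷_; _++_; length; foldr; concatMap; allFin)
import Data.List.Base as List
open import Data.Maybe.Base using (Maybe; just; nothing)
import Data.Maybe.Base as Maybe
import Data.Maybe.Properties as Maybe
open import Data.Nat.Base using (ℕ; zero; suc)
import Data.Nat.Base as ℕ
open import Data.Nat.Binary.Base using (ℕᵇ; 2[1+_]; 1+[2_])
import Data.Nat.Binary.Base as ℕᵇ
open import Data.Product.Base using (Σ; Σ-syntax; ∃-syntax; _×_; _,_)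
open import Data.Rational.Base using (ℚ; 0ℚ; _+_; _-_; _≤_; _<_; _⊔_; _⊓_; _/_)
open import Data.Rational.Properties using (_<?_)
open import Data.Vec.Base using (Vec; lookup; toList)
import Data.Vec.Base as Vec
open import Function.Bundles using (_⇔_)
open import Relation.Binary.PropositionalEquality.Core using (_≡_)
open import Relation.Nullary.Decidable.Core using (does)
open import Relation.Nullary.Negation.Core using (¬_)

------------------------------------------------------------------------
-- Deterministic multi-tape Turing machines

data Symbol (g : ℕ) : Set where
  blank : Symbol g
  bit   : Bool → Symbol g
  aux   : Fin g → Symbol g

data Move : Set where
  left stay right : Move

-- A two-way infinite tape: the cells to the left of the head (nearest
-- first), the scanned cell, and the cells to the right of the head
-- (nearest first).  All cells that are not listed are blank.
record Tape (g : ℕ) : Set where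
  constructor tape
  field
    before  : List (Symbol g)
    scanned : Symbol g
    after   : List (Symbol g)

tapeFrom : ∀ {g} → List (Symbol g) → List (Symbol g) → Tape g
tapeFrom ls []       = tape ls blank []
tapeFrom ls (s ∷ rs) = tape ls s rs

move : ∀ {g} → Move → Tape g → Tape g
move left  (tape []       s rs) = tape [] blank (s ∷ rs)
move left  (tape (l ∷ ls) s rs) = tape ls l (s ∷ rs)
move stay  t                    = t
move right (tape ls       s rs) = tapeFrom (s ∷ ls) rs

writeMove : ∀ {g} → Symbol g × Move → Tape g → Tape g
writeMove (s , m) (tape ls _ rs) = move m (tape ls s rs)

-- A machine with m input tapes and some further work tapes.  It halts
-- when the transition function returns nothing.
record TM (m : ℕ) : Set where
  field
    workTapes  : ℕ
    auxSymbols : ℕ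
    states     : ℕ
    start      : Fin states

  tapes : ℕ
  tapes = m ℕ.+ workTapes

  field
    δ : Fin states → Vec (Symbol auxSymbols) tapes →
        Maybe (Fin states × Vec (Symbol auxSymbols × Move) tapes)

  Config : Set
  Config = Fin states × Vec (Tape auxSymbols) tapes

  step : Config → Maybe Config
  step (q , ts) =
    Maybe.map (λ { (q′ , acts) → q′ , Vec.zipWith writeMove acts ts })
              (δ q (Vec.map Tape.scanned ts))

  -- The i-th input word is on the i-th tape, the head on its first letter.
  initial : Vec (List Bool) m → Config
  initial ws = start , Vec.map (λ w → tapeFrom [] (List.map bit w)) ws
                       Vec.++ Vec.replicate workTapes (tapeFrom [] [])

  -- The halting configuration, if it is reached after at most k steps.
  run : ℕ → Config → Maybe Config
  run k c with step c
  run k       c | nothing = just c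
  run zero    c | just _  = nothing
  run (suc k) c | just c′ = run k c′

leadingBits : ∀ {g} → List (Symbol g) → List Bool
leadingBits (bit b ∷ ss) = b ∷ leadingBits ss
leadingBits _            = []

-- The output is the longest word of bits on the first tape that starts
-- at the head and extends to the right.
output : ∀ {m} (M : TM (suc m)) → TM.Config M → List Bool
output M (_ , ts) = leadingBits (Tape.scanned t ∷ Tape.after t)
  where t = Vec.head ts

------------------------------------------------------------------------
-- Polynomial time, NP and NP-completeness

-- Coefficients, the constant term first.
Polynomial : Set
Polynomial = List ℕ

eval : Polynomial → ℕ → ℕ
eval p n = foldr (λ c r → c ℕ.+ n ℕ.* r) 0 p

PolyTime : ∀ {m} → (Vec (List Bool) (suc m) → List Bool) → Set
PolyTime {m} f =
  Σ[ M ∈ TM (suc m) ] Σ[ p ∈ Polynomial ] ∀ ws →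
    Maybe.map (output M)
      (TM.run M (eval p (Vec.sum (Vec.map length ws))) (TM.initial M ws))
      ≡ just (f ws)

PolyTimeFunction : (List Bool → List Bool) → Set
PolyTimeFunction f = PolyTime {0} (λ { (w Vec.∷ Vec.[]) → f w })

PolyTimeRelation : (List Bool → List Bool → Bool) → Set
PolyTimeRelation V =
  PolyTime {1} (λ { (w Vec.∷ c Vec.∷ Vec.[]) → V w c ∷ [] })

Language : Set₁
Language = List Bool → Set

NP : Language → Set
NP L =
  Σ[ V ∈ (List Bool → List Bool → Bool) ] Σ[ p ∈ Polynomial ]
    PolyTimeRelation V ×
    (∀ w → L w ⇔ (∃[ c ] length c ℕ.≤ eval p (length w) × V w c ≡ true))

infix 4 _≤ₚ_

_≤ₚ_ : Language → Language → Set
K ≤ₚ L =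
  Σ[ f ∈ (List Bool → List Bool) ]
    PolyTimeFunction f × (∀ w → K w ⇔ L (f w))

NPHard : Language → Set₁
NPHard L = ∀ (K : Language) → NP K → K ≤ₚ L

NPComplete : Language → Set₁
NPComplete L = NP L × NPHard L

------------------------------------------------------------------------
-- Preemptive schedules

record Job : Set where
  constructor job
  field
    processing arrival deadline : ℕ

fromℕ : ℕ → ℚ
fromℕ n = + n / 1

sumℚ : List ℚ → ℚ
sumℚ = foldr _+_ 0ℚ

-- activity is just the job processed throughout the segment, or nothing
-- if the processor idles.
record Segment (n : ℕ) : Set where
  field
    activity : Maybe (Fin n)
    duration : ℚ
    positive : 0ℚ < duration

open Segment

-- Time is continuous: jobs may be preempted at arbitrary (rational)
-- times.  The segments are consecutive half-open intervals [u , v)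
-- starting at time 0; the processor idles after the last one.
Schedule : ℕ → Set
Schedule n = List (Segment n)

activityAt : ∀ {n} → Schedule n → ℚ → Maybe (Fin n)
activityAt []      τ = nothing
activityAt (s ∷ σ) τ =
  if does (τ <? duration s) then activity s else activityAt σ (τ - duration s)

processes : ∀ {n} → Segment n → Fin n → Bool
processes s i = does (Maybe.≡-dec Fin._≟_ (activity s) (just i))

-- y σ i τ is the amount of job i processed before time τ; the
-- intersection of [0 , duration s) and [0 , τ) has length
-- 0 ⊔ (duration s ⊓ τ), also for negative τ.
y : ∀ {n} → Schedule n → Fin n → ℚ → ℚ
y []      i τ = 0ℚ
y (s ∷ σ) i τ =
  (if processes s i then 0ℚ ⊔ (duration s ⊓ τ) else 0ℚ) + y σ i (τ - duration s)

y∞ : ∀ {n} → Schedule n → Fin n → ℚ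
y∞ σ i = sumℚ (List.map (λ s → if processes s i then duration s else 0ℚ) σ)

totalWork : ∀ {n} → Schedule n → ℚ
totalWork {n} σ = sumℚ (List.map (y∞ σ) (allFin n))

------------------------------------------------------------------------
-- The Lazy Bureaucrat Problem, Constraint II

module _ {n : ℕ} (jobs : Vec Job n) where

  t a d : Fin n → ℚ
  t i = fromℕ (Job.processing (lookup jobs i))
  a i = fromℕ (Job.arrival    (lookup jobs i))
  d i = fromℕ (Job.deadline   (lookup jobs i))

  Executable : Schedule n → Fin n → ℚ → Set
  Executable σ i τ =
    a i ≤ τ × y σ i τ < t i × τ ≤ d i - t i + y σ i τ

  record Feasible (σ : Schedule n) : Set where
    field
      notExceeded    : ∀ i → y∞ σ i ≤ t i
      onlyExecutable : ∀ τ → 0ℚ ≤ τ → ∀ i →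
                       activityAt σ τ ≡ just i → Executable σ i τ
      busy           : ∀ τ → 0ℚ ≤ τ → activityAt σ τ ≡ nothing →
                       ∀ i → ¬ Executable σ i τ

record Instance : Set where
  field
    {size} : ℕ
    jobs   : Vec Job size
    bound  : ℕ

YesInstance : Instance → Set
YesInstance I =
  Σ[ σ ∈ Schedule size ] Feasible jobs σ × totalWork σ ≤ fromℕ bound
  where open Instance I

------------------------------------------------------------------------
-- Binary encoding of instances

-- Each binary digit (least significant first) is preceded by true, and
-- false marks the end of the number.  ℕᵇ is bijective base 2 (digits 1
-- and 2), so n has ⌊log₂ (n + 1)⌋ digits and there are no leading zeros.
encodeℕᵇ : ℕᵇ → List Bool
encodeℕᵇ ℕᵇ.zero  = false ∷ []
encodeℕᵇ 2[1+ x ] = true ∷ false ∷ encodeℕᵇ x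
encodeℕᵇ 1+[2 x ] = true ∷ true ∷ encodeℕᵇ x

encodeℕ : ℕ → List Bool
encodeℕ n = encodeℕᵇ (ℕᵇ.fromℕ n)

encodeJob : Job → List Bool
encodeJob (job t a d) = encodeℕ t ++ encodeℕ a ++ encodeℕ d

encode : Instance → List Bool
encode I = encodeℕ bound ++ concatMap encodeJob (toList jobs)
  where open Instance I

PreemptiveLazyBureaucratII : Language
PreemptiveLazyBureaucratII w = Σ[ I ∈ Instance ] encode I ≡ w × YesInstance I

{-# OPTIONS --safe #-}
-- Membership.  A feasible schedule can be normalised by joining pieces of
-- the same job, after which it has at most quadratically many pieces.  For
-- a fixed sequence of jobs the durations are governed by linear
-- inequalities with small coefficients in the durations and the numbers of
-- the instance, so that by the theorem of Frank and Tardos they can be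
-- replaced by multiples of a common unit 1 / K with polynomially many bits.
-- Such a list of durations is the certificate.
--
-- Hardness.  A computation of a verifier on a guessed certificate is a
-- tiling of a rectangle.  Tiles become numbers whose digits force exactly
-- one tile on each position and equal colours on each edge, so that a
-- tiling is a subset with a given sum k.  A number x becomes a job of
-- length M x with arrival time 0 and deadline M (k + x) - 1, whose latest
-- start is just before M k; a further job that is too long for the bound
-- keeps the bureaucrat from idling before then.  The work is at most M k
-- iff the other jobs fill the time up to M k.
module Submission where

open import Data.Bool.Base using (Bool; true; false; not; _∧_; _∨_; _xor_; if_then_else_)
open import Data.Empty using (⊥)
open import Data.Fin.Base using (Fin; zero; suc; _↑ˡ_; _↑ʳ_; toℕ; fromℕ<)
open import Data.Fin using (#_)
import Data.Fin.Base as Fin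
import Data.Fin.Properties as Fin
open import Data.List.Base using (List; []; _∷_; _++_; length; reverse; replicate; concatMap; map)
import Data.List.Base as List
import Data.List.Properties as List
open import Data.Maybe.Base using (Maybe; just; nothing; maybe′)
import Data.Maybe.Base as Maybe
open import Data.Nat.Base
open import Data.Nat.DivMod using (m≡m%n+[m/n]*n; m%n<n; m<n*o⇒m/o<n; m*n%n≡0; [m+kn]%n≡m%n; m<n⇒m%n≡m)
open import Data.Nat.ListAction using (sum)
open import Data.Nat.Properties
open import Data.Nat.Binary.Base using (ℕᵇ; 2[1+_]; 1+[2_])
import Data.Nat.Binary.Base as ℕᵇ
import Data.Nat.Binary.Properties as ℕᵇ
open import Data.Nat.Tactic.RingSolver using (solve-∀)
open import Data.Product.Base using (Σ-syntax; ∃-syntax; _×_; _,_; proj₁; proj₂)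
open import Data.Sum.Base using (_⊎_; inj₁; inj₂)
open import Data.Integer.Base using (ℤ; 0ℤ)
import Data.Integer.Base as ℤ
import Data.Integer.DivMod as ℤ
import Data.Integer.Tactic.RingSolver as ℤ-Ring
import Data.Integer.Properties as ℤ
open import Data.Rational.Base using (ℚ; 0ℚ)
import Data.Rational.Base as ℚ
import Data.Rational.Properties as ℚ
import Data.Rational.Unnormalised.Base as ℚᵘ
import Data.Rational.Unnormalised.Properties as ℚᵘ
import Data.Rational.Solver
open import Data.Unit.Base using (⊤; tt)
open import Data.Vec.Base using (Vec; []; _∷_; lookup; _[_]≔_)
import Data.Vec.Base as Vec
import Data.Vec.Properties as Vec
open import Data.Vec.Relation.Binary.Pointwise.Inductive using (Pointwise; []; _∷_)
import Data.Vec.Relation.Binary.Pointwise.Inductive as Pointwise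
open import Data.List.Membership.Propositional using (_∈_; find)
open import Data.List.Membership.Propositional.Properties using (∈-allFin; ∈-map⁺; ∈-map⁻; ∈-concatMap⁺; ∈-concatMap⁻)
open import Data.List.Relation.Unary.AllPairs using (AllPairs; []; _∷_)
open import Data.List.Relation.Unary.Any using (here; there)
import Data.List.Relation.Unary.Any as Any
open import Data.List.Relation.Unary.All using (All; []; _∷_)
import Data.List.Relation.Unary.All as All
import Data.List.Relation.Unary.All.Properties as All
open import Function.Base using (_∘_; id; case_of_)
open import Function.Bundles using (_↔_; _⇔_; mk⇔; mk↔ₛ′; Inverse; Equivalence)
open import Relation.Binary.PropositionalEquality using (_≡_; _≢_; refl; sym; trans; cong; cong₂; subst; subst₂; module ≡-Reasoning)
open import Relation.Nullary using (¬_; Dec; yes; no; does; contradiction; Reflects; ofʸ; ofⁿ)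
open import Relation.Nullary.Decidable using (dec-true; dec-false)
open import Relation.Nullary.Reflects using (det)
open import Data.Product.Function.NonDependent.Propositional using (_×-↔_)
open import Data.Sum.Function.Propositional using (_⊎-↔_)
open import Function.Properties.Inverse using (↔-refl; ↔-sym; ↔-trans)
open import Defs hiding (t; a; d; y)

-- The time bounds must hold for concrete Turing machines. Verifier and reduction are therefore
-- written in a small register language that is compiled in three stages, with loops whose number of
-- rounds is fixed by the input length: the time bound follows from the syntax, and only what the
-- programs compute is left to prove. In return, a loop that empties a stack must leave the state
-- alone from then on.
--
-- In membership, the obstacle is that the durations are arbitrary rationals under strict
-- inequalities and disjunctions. The rounding keeps the sign of every linear form with bounded
-- coefficients, hence the truth of each condition together with the disjunct that holds. The unit
-- is one of the unknowns, so that the conditions are homogeneous and the numbers of the instance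
-- are coefficients; these may be exponentially large, and so may the rounded entries.
--
-- In hardness, preemption allows slivers of many jobs to fill the time. Scaling by M makes all
-- slivers together shorter than the gap M between two scaled subset sums. The base of the digits
-- exceeds every digit sum, so that no carry blurs the equations of the tiling.

module ℚ-Solver = Data.Rational.Solver.+-*-Solver

-- Turing machines that run programs on stacks

-- Serves twice: the control points of programs become machine states, and the data on the edges of
-- tiles become numeric colours.
record Finite (A : Set) : Set where
  field
    card : ℕ
    iso  : A ↔ Fin card

  index : A → Fin card
  index = Inverse.to iso

  element : Fin card → A
  element = Inverse.from iso

  element-index : ∀ x → element (index x) ≡ x
  element-index x = Inverse.strictlyInverseʳ iso x

open Finite

⊤-finite : Finite ⊤
⊤-finite = record { card = 1 ; iso = ↔-sym Fin.1↔⊤ }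

Bool-finite : Finite Bool
Bool-finite = record { card = 2 ; iso = ↔-sym Fin.2↔Bool }

Fin-finite : ∀ n → Finite (Fin n)
Fin-finite n = record { card = n ; iso = ↔-refl }

_×-finite_ : ∀ {A B} → Finite A → Finite B → Finite (A × B)
FA ×-finite FB = record { iso = ↔-trans (iso FA ×-↔ iso FB) (↔-sym Fin.*↔×) }

_⊎-finite_ : ∀ {A B} → Finite A → Finite B → Finite (A ⊎ B)
FA ⊎-finite FB = record { iso = ↔-trans (iso FA ⊎-↔ iso FB) (↔-sym Fin.+↔⊎) }

via : ∀ {A B} → A ↔ B → Finite B → Finite A
via f FB = record { iso = ↔-trans f (iso FB) }

-- Structured programs on a vector of stacks of bits.  pop and while
-- branch on the popped bit; while stops when the stack is empty.
infixr 5 _⨟_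
data Cmd (k : ℕ) : Set where
  skip  : Cmd k
  push  : Fin k → Bool → Cmd k
  pop   : Fin k → Cmd k → (Bool → Cmd k) → Cmd k
  _⨟_   : Cmd k → Cmd k → Cmd k
  while : Fin k → (Bool → Cmd k) → Cmd k

Stacks : ℕ → Set
Stacks = Vec (List Bool)

-- The last index counts machine steps exactly. `push` takes 2, as the head first moves left and
-- then writes; a popped bit is erased in the branching step itself.
data Runs {k} : Cmd k → Stacks k → Stacks k → ℕ → Set where
  skip       : ∀ {s} → Runs skip s s 1
  push       : ∀ {i b s} → Runs (push i b) s (s [ i ]≔ (b ∷ lookup s i)) 2
  pop-empty  : ∀ {i c f s s′ n} → lookup s i ≡ [] →
               Runs c s s′ n → Runs (pop i c f) s s′ (suc n)
  pop-bit    : ∀ {i c f s s′ n b bs} → lookup s i ≡ b ∷ bs →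
               Runs (f b) (s [ i ]≔ bs) s′ n → Runs (pop i c f) s s′ (suc n)
  seq        : ∀ {c c′ s s′ s″ n n′} → Runs c s s′ n → Runs c′ s′ s″ n′ →
               Runs (c ⨟ c′) s s″ (n + n′)
  while-stop : ∀ {i f s} → lookup s i ≡ [] → Runs (while i f) s s 1
  while-bit  : ∀ {i f s s′ s″ n n′ b bs} → lookup s i ≡ b ∷ bs →
               Runs (f b) (s [ i ]≔ bs) s′ n → Runs (while i f) s′ s″ n′ →
               Runs (while i f) s s″ (suc (n + n′))

-- Control points; those of the branches of pop come in the order
-- empty, false, true.
Point : ∀ {k} → Cmd k → Set
Point skip        = ⊤
Point (push i b)  = Bool
Point (pop i c f) = ⊤ ⊎ Point c ⊎ Point (f false) ⊎ Point (f true)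
Point (c ⨟ c′)    = Point c ⊎ Point c′
Point (while i f) = ⊤ ⊎ Point (f false) ⊎ Point (f true)

Point-finite : ∀ {k} (c : Cmd k) → Finite (Point c)
Point-finite skip        = ⊤-finite
Point-finite (push i b)  = Bool-finite
Point-finite (pop i c f) =
  ⊤-finite ⊎-finite (Point-finite c ⊎-finite (Point-finite (f false) ⊎-finite Point-finite (f true)))
Point-finite (c ⨟ c′)    = Point-finite c ⊎-finite Point-finite c′
Point-finite (while i f) = ⊤-finite ⊎-finite (Point-finite (f false) ⊎-finite Point-finite (f true))

entry : ∀ {k} (c : Cmd k) → Point c
entry skip        = tt
entry (push i b)  = false
entry (pop i c f) = inj₁ tt
entry (c ⨟ c′)    = inj₁ (entry c)
entry (while i f) = inj₁ tt

Acts : ℕ → Set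
Acts k = Vec (Symbol 0 × Move) k

keep : ∀ {g k} → Vec (Symbol g) k → Vec (Symbol g × Move) k
keep = Vec.map (_, stay)

-- Places a subprogram inside a larger one: its points are renamed by `f` and its exit becomes `e`,
-- so that leaving a subprogram costs no step of its own.
reroute : ∀ {A B : Set} {k} → (A → B) → Maybe B → Maybe A × Acts k → Maybe B × Acts k
reroute f e (just p  , as) = just (f p) , as
reroute f e (nothing , as) = e , as

-- The control point nothing is the exit.
trans′ : ∀ {k} (c : Cmd k) → Point c → Vec (Symbol 0) k → Maybe (Point c) × Acts k
trans′ skip       _     σ = nothing , keep σ
trans′ (push i b) false σ = just true , keep σ [ i ]≔ (lookup σ i , left)
trans′ (push i b) true  σ = nothing , keep σ [ i ]≔ (bit b , stay)
trans′ (pop i c f) (inj₁ tt) σ with lookup σ i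
... | blank     = just (inj₂ (inj₁ (entry c))) , keep σ
... | bit false = just (inj₂ (inj₂ (inj₁ (entry (f false))))) , keep σ [ i ]≔ (blank , right)
... | bit true  = just (inj₂ (inj₂ (inj₂ (entry (f true))))) , keep σ [ i ]≔ (blank , right)
trans′ (pop i c f) (inj₂ (inj₁ p)) σ        = reroute (inj₂ ∘ inj₁) nothing (trans′ c p σ)
trans′ (pop i c f) (inj₂ (inj₂ (inj₁ p))) σ = reroute (inj₂ ∘ inj₂ ∘ inj₁) nothing (trans′ (f false) p σ)
trans′ (pop i c f) (inj₂ (inj₂ (inj₂ p))) σ = reroute (inj₂ ∘ inj₂ ∘ inj₂) nothing (trans′ (f true) p σ)
trans′ (c ⨟ c′) (inj₁ p) σ = reroute inj₁ (just (inj₂ (entry c′))) (trans′ c p σ)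
trans′ (c ⨟ c′) (inj₂ p) σ = reroute inj₂ nothing (trans′ c′ p σ)
trans′ (while i f) (inj₁ tt) σ with lookup σ i
... | blank     = nothing , keep σ
... | bit false = just (inj₂ (inj₁ (entry (f false)))) , keep σ [ i ]≔ (blank , right)
... | bit true  = just (inj₂ (inj₂ (entry (f true)))) , keep σ [ i ]≔ (blank , right)
trans′ (while i f) (inj₂ (inj₁ p)) σ = reroute (inj₂ ∘ inj₁) (just (inj₁ tt)) (trans′ (f false) p σ)
trans′ (while i f) (inj₂ (inj₂ p)) σ = reroute (inj₂ ∘ inj₂) (just (inj₁ tt)) (trans′ (f true) p σ)

Tapes : ℕ → Set
Tapes = Vec (Tape 0)

scan : ∀ {g k} → Vec (Tape g) k → Vec (Symbol g) k
scan = Vec.map Tape.scanned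

act : ∀ {g k} → Vec (Symbol g × Move) k → Vec (Tape g) k → Vec (Tape g) k
act = Vec.zipWith writeMove

data Steps {k} (c : Cmd k) : Point c → Tapes k → Maybe (Point c) → Tapes k → ℕ → Set where
  [_]  : ∀ {p ts q as} → trans′ c p (scan ts) ≡ (q , as) → Steps c p ts q (act as ts) 1
  _then_ : ∀ {p ts p′ as q ts″ n} → trans′ c p (scan ts) ≡ (just p′ , as) →
           Steps c p′ (act as ts) q ts″ n → Steps c p ts q ts″ (suc n)

_⟫_ : ∀ {k} {c : Cmd k} {p p′ q ts ts′ ts″ n n′} →
      Steps c p ts (just p′) ts′ n → Steps c p′ ts′ q ts″ n′ → Steps c p ts q ts″ (n + n′)
[ eq ]        ⟫ s′ = eq then s′
(eq then s)   ⟫ s′ = eq then (s ⟫ s′)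

-- Within `Steps` only the last transition can reach the exit, so renaming the points and
-- redirecting the exit turns a run of the subprogram into a run of the whole.
embed : ∀ {k} {c c′ : Cmd k} (f : Point c → Point c′) (e : Maybe (Point c′)) →
        (∀ p σ → trans′ c′ (f p) σ ≡ reroute f e (trans′ c p σ)) →
        ∀ {p ts ts′ n} → Steps c p ts nothing ts′ n → Steps c′ (f p) ts e ts′ n
embed f e h {p} {ts} [ eq ]      = [ trans (h p (scan ts)) (cong (reroute f e) eq) ]
embed f e h {p} {ts} (eq then s) = trans (h p (scan ts)) (cong (reroute f e) eq) then embed f e h s

-- A stack is kept on a tape to the right of the head, its top scanned;
-- all other cells are blank.
Content : List Bool → List (Symbol 0) → Set
Content []       ss       = All (_≡ blank) ss
Content (b ∷ bs) []       = ⊥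
Content (b ∷ bs) (s ∷ ss) = s ≡ bit b × Content bs ss

record Holds (bs : List Bool) (t : Tape 0) : Set where
  constructor holds
  field
    left-blank : All (_≡ blank) (Tape.before t)
    content    : Content bs (Tape.scanned t ∷ Tape.after t)

holds-initial : ∀ w → Holds w (tapeFrom [] (map bit w))
holds-initial []      = holds [] (refl ∷ [])
holds-initial (b ∷ w) = holds [] (refl , go w)
  where
  go : ∀ w → Content w (map bit w)
  go []      = []
  go (b ∷ w) = refl , go w

holds-push : ∀ {bs} {t : Tape 0} b → Holds bs t →
             Holds (b ∷ bs) (writeMove (bit b , stay) (writeMove (Tape.scanned t , left) t))
holds-push {t = tape []       s rs} b (holds ls c)       = holds [] (refl , c)
holds-push {t = tape (l ∷ ls) s rs} b (holds (_ ∷ bl) c) = holds bl (refl , c)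

holds-pop : ∀ {b bs} {t : Tape 0} → Holds (b ∷ bs) t → Holds bs (writeMove (blank , right) t)
holds-pop {bs = []}    {tape ls s []}      (holds bl (_ , c)) = holds (refl ∷ bl) (refl ∷ [])
holds-pop {bs = []}    {tape ls s (r ∷ rs)} (holds bl (_ , c)) = holds (refl ∷ bl) c
holds-pop {bs = _ ∷ _} {tape ls s (r ∷ rs)} (holds bl (_ , c)) = holds (refl ∷ bl) c

scanned-empty : ∀ {t} → Holds [] t → Tape.scanned t ≡ blank
scanned-empty (holds _ (e ∷ _)) = e

scanned-bit : ∀ {b bs t} → Holds (b ∷ bs) t → Tape.scanned t ≡ bit b
scanned-bit (holds _ (e , _)) = e

output-holds : ∀ {bs} {t : Tape 0} → Holds bs t → leadingBits (Tape.scanned t ∷ Tape.after t) ≡ bs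
output-holds (holds _ c) = go _ _ c
  where
  go : ∀ bs ss → Content bs ss → leadingBits ss ≡ bs
  go []       []       c           = refl
  go []       (_ ∷ ss) (refl ∷ c)  = refl
  go (b ∷ bs) (_ ∷ ss) (refl , c)  = cong (b ∷_) (go bs ss c)

HoldAll : ∀ {k} → Stacks k → Tapes k → Set
HoldAll = Pointwise Holds

act-keep : ∀ {g k} (ts : Vec (Tape g) k) → act (keep (scan ts)) ts ≡ ts
act-keep []       = refl
act-keep (t ∷ ts) = cong (t ∷_) (act-keep ts)

act-at : ∀ {g k} (ts : Vec (Tape g) k) i a → act (keep (scan ts) [ i ]≔ a) ts ≡ ts [ i ]≔ writeMove a (lookup ts i)
act-at (t ∷ ts) zero    a = cong (_ ∷_) (act-keep ts)
act-at (t ∷ ts) (suc i) a = cong (t ∷_) (act-at ts i a)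

holdAll-update : ∀ {k} {s : Stacks k} {ts} i {bs t} → HoldAll s ts → Holds bs t → HoldAll (s [ i ]≔ bs) (ts [ i ]≔ t)
holdAll-update zero    (h ∷ hs) h′ = h′ ∷ hs
holdAll-update (suc i) (h ∷ hs) h′ = h ∷ holdAll-update i hs h′

lookup-scan : ∀ {k} (ts : Tapes k) i → lookup (scan ts) i ≡ Tape.scanned (lookup ts i)
lookup-scan ts i = Vec.lookup-map i Tape.scanned ts

scan-empty : ∀ {k} {s : Stacks k} {ts} i → HoldAll s ts → lookup s i ≡ [] → lookup (scan ts) i ≡ blank
scan-empty {ts = ts} i hs eq =
  trans (lookup-scan ts i) (scanned-empty (subst (λ bs → Holds bs _) eq (Pointwise.lookup hs i)))

scan-bit : ∀ {k} {s : Stacks k} {ts} i {b bs} → HoldAll s ts → lookup s i ≡ b ∷ bs → lookup (scan ts) i ≡ bit b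
scan-bit {ts = ts} i hs eq =
  trans (lookup-scan ts i) (scanned-bit (subst (λ bs → Holds bs _) eq (Pointwise.lookup hs i)))

holdAll-pop : ∀ {k} {s : Stacks k} {ts} i {b bs} → HoldAll s ts → lookup s i ≡ b ∷ bs →
              HoldAll (s [ i ]≔ bs) (act (keep (scan ts) [ i ]≔ (blank , right)) ts)
holdAll-pop {ts = ts} i hs eq = subst (HoldAll _) (sym (act-at ts i _))
  (holdAll-update i hs (holds-pop (subst (λ bs → Holds bs _) eq (Pointwise.lookup hs i))))

-- The step counts agree because `Runs` is priced after `trans′`. Each branching clause only has to
-- determine the scanned symbol from the top of the stack.
simulate : ∀ {k} {c : Cmd k} {s s′ n} → Runs c s s′ n → ∀ {ts} → HoldAll s ts →
           ∃[ ts′ ] Steps c (entry c) ts nothing ts′ n × HoldAll s′ ts′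
simulate skip {ts} hs = _ , [ refl ] , subst (HoldAll _) (sym (act-keep ts)) hs
simulate (push {i} {b}) {ts} hs = _ , (refl then [ refl ]) , subst (HoldAll _) (sym ts-eq) (holdAll-update i hs (holds-push b (Pointwise.lookup hs i)))
  where
  a₁ : Symbol 0 × Move
  a₁ = lookup (scan ts) i , left
  t₁ : Tape 0
  t₁ = writeMove (Tape.scanned (lookup ts i) , left) (lookup ts i)
  ts₁ : Tapes _
  ts₁ = act (keep (scan ts) [ i ]≔ a₁) ts
  ts₁-eq : ts₁ ≡ ts [ i ]≔ writeMove (Tape.scanned (lookup ts i) , left) (lookup ts i)
  ts₁-eq = trans (act-at ts i a₁) (cong (λ σ → ts [ i ]≔ writeMove (σ , left) (lookup ts i)) (lookup-scan ts i))
  ts-eq : act (keep (scan ts₁) [ i ]≔ (bit b , stay)) ts₁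
          ≡ ts [ i ]≔ writeMove (bit b , stay) (writeMove (Tape.scanned (lookup ts i) , left) (lookup ts i))
  ts-eq = trans (act-at ts₁ i (bit b , stay))
         (trans (cong (λ us → us [ i ]≔ writeMove (bit b , stay) (lookup us i)) ts₁-eq)
         (trans (cong (λ u → (ts [ i ]≔ t₁) [ i ]≔ writeMove (bit b , stay) u) (Vec.lookup∘update i ts t₁))
                (Vec.[]≔-idempotent ts i)))
simulate (pop-empty {i} {c} {f} eq r) {ts} hs with simulate r hs
... | ts′ , st , hs′ = ts′ , (step₁ then subst (λ us → Steps (pop i c f) _ us _ _ _) (sym (act-keep ts)) (embed (inj₂ ∘ inj₁) nothing (λ _ _ → refl) st)) , hs′
  where
  step₁ : trans′ (pop i c f) (inj₁ tt) (scan ts) ≡ (just (inj₂ (inj₁ (entry c))) , keep (scan ts))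
  step₁ rewrite scan-empty i hs eq = refl
simulate (pop-bit {i} {c} {f} {b = false} eq r) {ts} hs with simulate r (holdAll-pop i hs eq)
... | ts′ , st , hs′ = ts′ , (step₁ then embed (inj₂ ∘ inj₂ ∘ inj₁) nothing (λ _ _ → refl) st) , hs′
  where
  step₁ : trans′ (pop i c f) (inj₁ tt) (scan ts) ≡ (just (inj₂ (inj₂ (inj₁ (entry (f false))))) , keep (scan ts) [ i ]≔ (blank , right))
  step₁ rewrite scan-bit i hs eq = refl
simulate (pop-bit {i} {c} {f} {b = true} eq r) {ts} hs with simulate r (holdAll-pop i hs eq)
... | ts′ , st , hs′ = ts′ , (step₁ then embed (inj₂ ∘ inj₂ ∘ inj₂) nothing (λ _ _ → refl) st) , hs′
  where
  step₁ : trans′ (pop i c f) (inj₁ tt) (scan ts) ≡ (just (inj₂ (inj₂ (inj₂ (entry (f true))))) , keep (scan ts) [ i ]≔ (blank , right))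
  step₁ rewrite scan-bit i hs eq = refl
simulate (seq r r′) hs with simulate r hs
... | _ , st , hs′ with simulate r′ hs′
... | _ , st′ , hs″ = _ , (embed inj₁ _ (λ _ _ → refl) st ⟫ embed inj₂ nothing (λ _ _ → refl) st′) , hs″
simulate (while-stop {i} {f} eq) {ts} hs = _ , [ step₁ ] , subst (HoldAll _) (sym (act-keep ts)) hs
  where
  step₁ : trans′ (while i f) (inj₁ tt) (scan ts) ≡ (nothing , keep (scan ts))
  step₁ rewrite scan-empty i hs eq = refl
simulate (while-bit {i} {f} {b = false} eq r r′) {ts} hs with simulate r (holdAll-pop i hs eq)
... | _ , st , hs′ with simulate r′ hs′
... | _ , st′ , hs″ = _ , (step₁ then (embed (inj₂ ∘ inj₁) _ (λ _ _ → refl) st ⟫ st′)) , hs″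
  where
  step₁ : trans′ (while i f) (inj₁ tt) (scan ts) ≡ (just (inj₂ (inj₁ (entry (f false)))) , keep (scan ts) [ i ]≔ (blank , right))
  step₁ rewrite scan-bit i hs eq = refl
simulate (while-bit {i} {f} {b = true} eq r r′) {ts} hs with simulate r (holdAll-pop i hs eq)
... | _ , st , hs′ with simulate r′ hs′
... | _ , st′ , hs″ = _ , (step₁ then (embed (inj₂ ∘ inj₂) _ (λ _ _ → refl) st ⟫ st′)) , hs″
  where
  step₁ : trans′ (while i f) (inj₁ tt) (scan ts) ≡ (just (inj₂ (inj₂ (entry (f true)))) , keep (scan ts) [ i ]≔ (blank , right))
  step₁ rewrite scan-bit i hs eq = refl

-- State 0 is the halting state.
machine : ∀ {m w} → Cmd (m + w) → TM m
machine {m} {w} c = record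
  { workTapes  = w
  ; auxSymbols = 0
  ; states     = suc (card F)
  ; start      = suc (index F (entry c))
  ; δ          = δ′
  }
  where
  F : Finite (Point c)
  F = Point-finite c
  δ′ : Fin (suc (card F)) → Vec (Symbol 0) (m + w) → Maybe (Fin (suc (card F)) × Acts (m + w))
  δ′ zero    σ = nothing
  δ′ (suc p) σ = just (maybe′ (suc ∘ index F) zero (proj₁ r) , proj₂ r)
    where r = trans′ c (element F p) σ

-- `run` receives a polynomial bound and not the exact time, hence the spare fuel `e`. Fuel `n`
-- suffices for `n` steps, since `run` looks for a halt before it consumes fuel.
run-halts : ∀ {m w} (c : Cmd (m + w)) {p ts ts′ n} → Steps c p ts nothing ts′ n → ∀ e →
            TM.run (machine {m} {w} c) (n + e) (suc (index (Point-finite c) p) , ts) ≡ just (zero , ts′)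
run-halts c {p} {ts} [ eq ]      zero    rewrite element-index (Point-finite c) p | eq = refl
run-halts c {p} {ts} [ eq ]      (suc e) rewrite element-index (Point-finite c) p | eq = refl
run-halts {m} {w} c {p} {ts} (eq then s) e rewrite element-index (Point-finite c) p | eq = run-halts {m} {w} c s e

machine-correct : ∀ {m w} (c : Cmd (suc m + w)) ws {o s′ n N} →
  Runs c (ws Vec.++ Vec.replicate w []) (o ∷ s′) n → n ≤ N →
  Maybe.map (output (machine {suc m} {w} c)) (TM.run (machine {suc m} {w} c) N (TM.initial (machine {suc m} {w} c) ws)) ≡ just o
machine-correct {m} {w} c ws {n = n} {N} r n≤N with simulate r initial-holds
  where
  blanks : ∀ w → HoldAll (Vec.replicate w []) (Vec.replicate w (tapeFrom [] []))
  blanks zero    = []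
  blanks (suc w) = holds-initial [] ∷ blanks w
  initial-holds : HoldAll (ws Vec.++ Vec.replicate w [])
                          (Vec.map (λ w → tapeFrom [] (map bit w)) ws Vec.++ Vec.replicate w (tapeFrom [] []))
  initial-holds = Pointwise.++⁺ (go ws) (blanks w)
    where
    go : ∀ {m} (ws : Vec (List Bool) m) → HoldAll ws (Vec.map (λ w → tapeFrom [] (map bit w)) ws)
    go []       = []
    go (w ∷ ws) = holds-initial w ∷ go ws
... | t ∷ ts′ , st , h ∷ _
  rewrite sym (m+[n∸m]≡n n≤N) | run-halts {suc m} {w} c st (N ∸ n) = cong just (output-holds h)

-- Programs of polynomial running time

infixl 6 _⊞_
infixl 7 _⊠_

_⊞_ : Polynomial → Polynomial → Polynomial
[]      ⊞ q       = q
(a ∷ p) ⊞ []      = a ∷ p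
(a ∷ p) ⊞ (b ∷ q) = a + b ∷ p ⊞ q

_⊠_ : Polynomial → Polynomial → Polynomial
[]      ⊠ q = []
(a ∷ p) ⊠ q = map (a *_) q ⊞ (0 ∷ p ⊠ q)

eval-⊞ : ∀ p q n → eval (p ⊞ q) n ≡ eval p n + eval q n
eval-⊞ []      q       n = refl
eval-⊞ (a ∷ p) []      n = sym (+-identityʳ _)
eval-⊞ (a ∷ p) (b ∷ q) n rewrite eval-⊞ p q n = lemma a b n (eval p n) (eval q n)
  where
  lemma : ∀ a b n x y → a + b + n * (x + y) ≡ a + n * x + (b + n * y)
  lemma = solve-∀

eval-scale : ∀ a q n → eval (map (a *_) q) n ≡ a * eval q n
eval-scale a []      n = sym (*-zeroʳ a)
eval-scale a (b ∷ q) n rewrite eval-scale a q n = lemma a b n (eval q n)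
  where
  lemma : ∀ a b n y → a * b + n * (a * y) ≡ a * (b + n * y)
  lemma = solve-∀

eval-⊠ : ∀ p q n → eval (p ⊠ q) n ≡ eval p n * eval q n
eval-⊠ []      q n = refl
eval-⊠ (a ∷ p) q n rewrite eval-⊞ (map (a *_) q) (0 ∷ p ⊠ q) n | eval-scale a q n | eval-⊠ p q n =
  lemma a n (eval p n) (eval q n)
  where
  lemma : ∀ a n x y → a * y + n * (x * y) ≡ (a + n * x) * y
  lemma = solve-∀

eval-mono : ∀ p {m n} → m ≤ n → eval p m ≤ eval p n
eval-mono []      m≤n = z≤n
eval-mono (a ∷ p) m≤n = +-monoʳ-≤ a (*-mono-≤ m≤n (eval-mono p m≤n))

iter : ∀ {A : Set} → ℕ → (A → A) → A → A
iter zero    f x = x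
iter (suc n) f x = iter n f (f x)

-- Loops of clocked programs run as often as the total input is long, so
-- that such programs take polynomial time by construction.
infixr 5 _▸_
data Clocked (k : ℕ) : Set where
  nop  : Clocked k
  put  : Fin k → Bool → Clocked k
  take : Fin k → Clocked k → (Bool → Clocked k) → Clocked k
  _▸_  : Clocked k → Clocked k → Clocked k
  rep  : Clocked k → Clocked k

onTop : ∀ {A : Set} → List Bool → A → (Bool → List Bool → A) → A
onTop []       e f = e
onTop (b ∷ bs) e f = f b bs

⟦_⟧ : ∀ {k} → Clocked k → ℕ → Stacks k → Stacks k
⟦ nop ⟧        n s = s
⟦ put i b ⟧    n s = s [ i ]≔ (b ∷ lookup s i)
⟦ take i c f ⟧ n s = onTop (lookup s i) (⟦ c ⟧ n s) (λ b bs → ⟦ f b ⟧ n (s [ i ]≔ bs))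
⟦ c ▸ c′ ⟧     n s = ⟦ c′ ⟧ n (⟦ c ⟧ n s)
⟦ rep c ⟧      n s = iter n (⟦ c ⟧ n) s

depth : ∀ {k} → Clocked k → ℕ
depth nop          = 0
depth (put i b)    = 0
depth (take i c f) = depth c ⊔ (depth (f false) ⊔ depth (f true))
depth (c ▸ c′)     = depth c ⊔ depth c′
depth (rep c)      = suc (depth c)

-- `take` is charged for all its branches. A round of `rep` costs 3 besides its body, for fetching a
-- tick and pushing it on the stack of spent ticks, and 3 for winding the tick back; the 2 are the
-- final tests of the two loops.
cost : ∀ {k} → Clocked k → Polynomial
cost nop          = 1 ∷ []
cost (put i b)    = 2 ∷ []
cost (take i c f) = (1 ∷ []) ⊞ (cost c ⊞ (cost (f false) ⊞ cost (f true)))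
cost (c ▸ c′)     = cost c ⊞ cost c′
cost (rep c)      = 2 ∷ ((6 ∷ []) ⊞ cost c)

-- Two stacks for each level of loop nesting: the clock and the ticks
-- that it has spent.
withClocks : ℕ → ℕ → ℕ
withClocks zero    k = k
withClocks (suc D) k = suc (suc (withClocks D k))

ticks : ℕ → List Bool
ticks n = replicate n true

clocked : ∀ {k} D → ℕ → Stacks k → Stacks (withClocks D k)
clocked zero    n s = s
clocked (suc D) n s = ticks n ∷ [] ∷ clocked D n s

below : ∀ {k} D → Fin k → Fin (withClocks D k)
below zero    i = i
below (suc D) i = suc (suc (below D i))

lookup-below : ∀ {k} D n (s : Stacks k) i → lookup (clocked D n s) (below D i) ≡ lookup s i
lookup-below zero    n s i = refl
lookup-below (suc D) n s i = lookup-below D n s i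

update-below : ∀ {k} D n (s : Stacks k) i bs → clocked D n s [ below D i ]≔ bs ≡ clocked D n (s [ i ]≔ bs)
update-below zero    n s i bs = refl
update-below (suc D) n s i bs = cong (λ u → ticks n ∷ [] ∷ u) (update-below D n s i bs)

lift : ∀ {k} → Cmd k → Cmd (suc k)
lift skip        = skip
lift (push i b)  = push (suc i) b
lift (pop i c f) = pop (suc i) (lift c) (λ b → lift (f b))
lift (c ⨟ c′)    = lift c ⨟ lift c′
lift (while i f) = while (suc i) (λ b → lift (f b))

lift-runs : ∀ {k} {c : Cmd k} {s s′ n x} → Runs c s s′ n → Runs (lift c) (x ∷ s) (x ∷ s′) n
lift-runs skip                = skip
lift-runs push                = push
lift-runs (pop-empty eq r)    = pop-empty eq (lift-runs r)
lift-runs (pop-bit eq r)      = pop-bit eq (lift-runs r)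
lift-runs (seq r r′)          = seq (lift-runs r) (lift-runs r′)
lift-runs (while-stop eq)     = while-stop eq
lift-runs (while-bit eq r r′) = while-bit eq (lift-runs r) (lift-runs r′)

compile : ∀ {k} D → Clocked k → Cmd (withClocks D k)
compile D       nop          = skip
compile D       (put i b)    = push (below D i) b
compile D       (take i c f) = pop (below D i) (compile D c) (λ b → compile D (f b))
compile D       (c ▸ c′)     = compile D c ⨟ compile D c′
-- A default value: the hypothesis `depth c ≤ D` of `compile-runs` rules this case out.
compile zero    (rep c)      = skip
compile (suc D) (rep c)      =
  -- The spent ticks are moved back by the second loop, since an enclosing loop may start this one
  -- again and must find the clock full.
  while zero (λ _ → push (suc zero) true ⨟ lift (lift (compile D c))) ⨟
  while (suc zero) (λ _ → push zero true)

eval-⊞≥ˡ : ∀ p q n → eval p n ≤ eval (p ⊞ q) n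
eval-⊞≥ˡ p q n = ≤-trans (m≤m+n _ _) (≤-reflexive (sym (eval-⊞ p q n)))

eval-⊞≥ʳ : ∀ p q n → eval q n ≤ eval (p ⊞ q) n
eval-⊞≥ʳ p q n = ≤-trans (m≤n+m _ _) (≤-reflexive (sym (eval-⊞ p q n)))

eval-suc : ∀ p n → suc (eval p n) ≤ eval ((1 ∷ []) ⊞ p) n
eval-suc p n rewrite eval-⊞ (1 ∷ []) p n | *-zeroʳ n = ≤-refl

compile-runs : ∀ {k} D (c : Clocked k) → depth c ≤ D → ∀ n s →
  ∃[ t ] t ≤ eval (cost c) n × Runs (compile D c) (clocked D n s) (clocked D n (⟦ c ⟧ n s)) t
compile-runs D nop dc n s = 1 , s≤s z≤n , skip
compile-runs D (put i b) dc n s = 2 , s≤s (s≤s z≤n) , subst (λ u → Runs (push (below D i) b) (clocked D n s) u 2) eq push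
  where
  eq : clocked D n s [ below D i ]≔ (b ∷ lookup (clocked D n s) (below D i)) ≡ clocked D n (s [ i ]≔ (b ∷ lookup s i))
  eq rewrite lookup-below D n s i = update-below D n s i _
compile-runs D (take i c f) dc n s with lookup s i in eq
... | [] with compile-runs D c (m⊔n≤o⇒m≤o (depth c) _ dc) n s
... | t , t≤ , r = suc t , ≤-trans (s≤s (≤-trans t≤ (eval-⊞≥ˡ (cost c) _ n))) (eval-suc (cost c ⊞ (cost (f false) ⊞ cost (f true))) n) , pop-empty (trans (lookup-below D n s i) eq) r
compile-runs D (take i c f) dc n s | b ∷ bs
  with compile-runs D (f b) (branch-depth b) n (s [ i ]≔ bs)
  where
  branch-depth : ∀ b → depth (f b) ≤ D
  branch-depth false = m⊔n≤o⇒m≤o _ _ (m⊔n≤o⇒n≤o (depth c) _ dc)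
  branch-depth true  = m⊔n≤o⇒n≤o (depth (f false)) _ (m⊔n≤o⇒n≤o (depth c) _ dc)
... | t , t≤ , r = suc t , ≤-trans (s≤s (≤-trans t≤ (branch-cost b))) (eval-suc (cost c ⊞ (cost (f false) ⊞ cost (f true))) n) ,
  pop-bit (trans (lookup-below D n s i) eq) (subst (λ u → Runs (compile D (f b)) u (clocked D n (⟦ f b ⟧ n (s [ i ]≔ bs))) t) (sym (update-below D n s i bs)) r)
  where
  branch-cost : ∀ b → eval (cost (f b)) n ≤ eval (cost c ⊞ (cost (f false) ⊞ cost (f true))) n
  branch-cost false = ≤-trans (eval-⊞≥ˡ (cost (f false)) _ n) (eval-⊞≥ʳ (cost c) _ n)
  branch-cost true  = ≤-trans (eval-⊞≥ʳ (cost (f false)) _ n) (eval-⊞≥ʳ (cost c) _ n)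
compile-runs D (c ▸ c′) dc n s with compile-runs D c (m⊔n≤o⇒m≤o (depth c) _ dc) n s
... | t , t≤ , r with compile-runs D c′ (m⊔n≤o⇒n≤o (depth c) _ dc) n (⟦ c ⟧ n s)
... | t′ , t′≤ , r′ = t + t′ , ≤-trans (+-mono-≤ t≤ t′≤) (≤-reflexive (sym (eval-⊞ (cost c) (cost c′) n))) , seq r r′
compile-runs {k} (suc D) (rep c) (s≤s dc) n s with forth n 0 s
  where
  body : Bool → Cmd (withClocks (suc D) k)
  body _ = push (suc zero) true ⨟ lift (lift (compile D c))
  forth : ∀ j m s → ∃[ t ] t ≤ 1 + j * (3 + eval (cost c) n) ×
          Runs (while zero body) (ticks j ∷ ticks m ∷ clocked D n s) ([] ∷ ticks (j + m) ∷ clocked D n (iter j (⟦ c ⟧ n) s)) t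
  forth zero    m s = 1 , s≤s z≤n , while-stop refl
  forth (suc j) m s with compile-runs D c dc n s | forth j (suc m) (⟦ c ⟧ n s)
  ... | t , t≤ , r | t′ , t′≤ , r′ rewrite +-suc j m =
    suc (2 + t + t′) , bound , while-bit refl (seq push (lift-runs (lift-runs r))) r′
    where
    bound : suc (2 + t + t′) ≤ 1 + (3 + eval (cost c) n + j * (3 + eval (cost c) n))
    bound = s≤s (≤-trans (+-mono-≤ (s≤s (s≤s t≤)) t′≤) (≤-reflexive (lemma (eval (cost c) n) (j * (3 + eval (cost c) n)))))
      where
      lemma : ∀ e x → 2 + e + (1 + x) ≡ 3 + e + x
      lemma = solve-∀
... | t , t≤ , r = t + (1 + n * 3) , bound , seq r (subst₂ (λ m m′ → Runs rewind ([] ∷ ticks m ∷ u) (ticks m′ ∷ [] ∷ u) (1 + n * 3))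
                        (sym (+-identityʳ n)) (+-identityʳ n) (back n 0))
  where
  u : Stacks (withClocks D k)
  u = clocked D n (iter n (⟦ c ⟧ n) s)
  rewind : Cmd (withClocks (suc D) k)
  rewind = while (suc zero) (λ _ → push zero true)
  back : ∀ j m → Runs rewind (ticks m ∷ ticks j ∷ u) (ticks (j + m) ∷ [] ∷ u) (1 + j * 3)
  back zero    m = while-stop refl
  back (suc j) m = subst (λ m′ → Runs rewind (ticks m ∷ ticks (suc j) ∷ u) (ticks m′ ∷ [] ∷ u) (1 + suc j * 3)) (+-suc j m) (while-bit refl push (back j (suc m)))
  bound : t + (1 + n * 3) ≤ eval (cost (rep c)) n
  bound rewrite eval-⊞ (6 ∷ []) (cost c) n = ≤-trans (+-monoˡ-≤ _ t≤) (≤-reflexive (lemma n (eval (cost c) n)))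
    where
    lemma : ∀ n e → 1 + n * (3 + e) + (1 + n * 3) ≡ 2 + n * (6 + n * 0 + e)
    lemma = solve-∀

advance : ∀ {k} D → Cmd (withClocks D k)
advance zero    = skip
advance (suc D) = push zero true ⨟ lift (lift (advance D))

advance-runs : ∀ {k} D n (s : Stacks k) → Runs (advance D) (clocked D n s) (clocked D (suc n) s) (1 + 2 * D)
advance-runs zero    n s = skip
advance-runs (suc D) n s = subst (Runs (advance (suc D)) (clocked (suc D) n s) (clocked (suc D) (suc n) s)) (lemma D) (seq push (lift-runs (lift-runs (advance-runs D n s))))
  where
  lemma : ∀ D → 2 + (1 + 2 * D) ≡ 1 + 2 * suc D
  lemma = solve-∀

lifts : ∀ {k} m → Cmd k → Cmd (m + k)
lifts zero    c = c
lifts (suc m) c = lift (lifts m c)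

lifts-runs : ∀ {k m} {c : Cmd k} {s s′ n} (xs : Stacks m) → Runs c s s′ n → Runs (lifts m c) (xs Vec.++ s) (xs Vec.++ s′) n
lifts-runs []       r = r
lifts-runs (x ∷ xs) r = lift-runs (lifts-runs xs r)

-- Moves the input words to stacks (which reverses them) and sets all
-- clocks to the total input length.
load : ∀ {k} m D → (Fin m → Fin k) → Cmd (m + withClocks D k)
load zero    D ι = skip
load (suc m) D ι = while zero (λ b → lift (lifts m (push (below D (ι zero)) b ⨟ advance D))) ⨟ lift (load m D (ι ∘ suc))

loaded : ∀ {k m} → (Fin m → Fin k) → Vec (List Bool) m → Stacks k → Stacks k
loaded ι []       s = s
loaded ι (w ∷ ws) s = loaded (ι ∘ suc) ws (s [ ι zero ]≔ (w List.ʳ++ lookup s (ι zero)))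

totalLength : ∀ {m} → Vec (List Bool) m → ℕ
totalLength ws = Vec.sum (Vec.map length ws)

load-runs : ∀ {k} m D (ι : Fin m → Fin k) ws n s →
  Runs (load m D ι) (ws Vec.++ clocked D n s)
       (Vec.replicate m [] Vec.++ clocked D (totalLength ws + n) (loaded ι ws s)) (1 + m + totalLength ws * (4 + 2 * D))
load-runs zero    D ι [] n s = skip
load-runs {k} (suc m) D ι (w ∷ ws) n s =
  subst₂ (λ n′ t → Runs (load (suc m) D ι) ((w ∷ ws) Vec.++ clocked D n s) ([] ∷ (Vec.replicate m [] Vec.++ clocked D n′ (loaded ι (w ∷ ws) s))) t)
         (lemma₁ (length w) (totalLength ws) n) (lemma₂ (length w) (totalLength ws) m D)
         (seq (go w n s) (lift-runs (load-runs m D (ι ∘ suc) ws (length w + n) (s [ ι zero ]≔ (w List.ʳ++ lookup s (ι zero))))))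
  where
  lemma₁ : ∀ a b n → b + (a + n) ≡ a + b + n
  lemma₁ = solve-∀
  lemma₂ : ∀ a b m D → 1 + a * (4 + 2 * D) + (1 + m + b * (4 + 2 * D)) ≡ 1 + suc m + (a + b) * (4 + 2 * D)
  lemma₂ = solve-∀
  i : Fin k
  i = ι zero
  body : Bool → Cmd (suc m + withClocks D k)
  body b = lift (lifts m (push (below D i) b ⨟ advance D))
  once : ∀ b w n s → Runs (push (below D i) b ⨟ advance D) (clocked D n s) (clocked D (suc n) (s [ i ]≔ (b ∷ lookup s i))) (3 + 2 * D)
  once b w n s = seq (subst (λ u → Runs (push (below D i) b) (clocked D n s) u 2) eq push) (advance-runs D n _)
    where
    eq : clocked D n s [ below D i ]≔ (b ∷ lookup (clocked D n s) (below D i)) ≡ clocked D n (s [ i ]≔ (b ∷ lookup s i))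
    eq rewrite lookup-below D n s i = update-below D n s i _
  go : ∀ w n s → Runs (while zero body) (w ∷ (ws Vec.++ clocked D n s))
         ([] ∷ (ws Vec.++ clocked D (length w + n) (s [ i ]≔ (w List.ʳ++ lookup s i)))) (1 + length w * (4 + 2 * D))
  go []      n s = subst (λ s′ → Runs (while zero body) ([] ∷ (ws Vec.++ clocked D n s)) ([] ∷ (ws Vec.++ clocked D n s′)) 1) (sym (Vec.[]≔-lookup s i)) (while-stop refl)
  go (b ∷ w) n s = subst₂ (λ u t → Runs (while zero body) ((b ∷ w) ∷ (ws Vec.++ clocked D n s)) ([] ∷ (ws Vec.++ u)) t) eq₁ (eq₂ (length w) D)
                     (while-bit refl (lift-runs (lifts-runs ws (once b w n s))) (go w (suc n) (s [ i ]≔ (b ∷ lookup s i))))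
    where
    eq₁ : clocked D (length w + suc n) ((s [ i ]≔ (b ∷ lookup s i)) [ i ]≔ (w List.ʳ++ lookup (s [ i ]≔ (b ∷ lookup s i)) i))
          ≡ clocked D (suc (length w + n)) (s [ i ]≔ (w List.ʳ++ (b ∷ lookup s i)))
    eq₁ = cong₂ (clocked D) (+-suc (length w) n) (trans (Vec.[]≔-idempotent s i) (cong (λ bs → s [ i ]≔ (w List.ʳ++ bs)) (Vec.lookup∘update i s _)))
    eq₂ : ∀ l D → suc (3 + 2 * D + (1 + l * (4 + 2 * D))) ≡ 1 + suc l * (4 + 2 * D)
    eq₂ = solve-∀

update-shorter : ∀ {k} (s : Stacks k) j i {b bs} → lookup s j ≡ b ∷ bs → length (lookup (s [ j ]≔ bs) i) ≤ length (lookup s i)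
update-shorter s j i {b} {bs} eq with j Fin.≟ i
... | yes refl rewrite Vec.lookup∘update j s bs | eq = n≤1+n _
... | no j≢i   rewrite Vec.lookup∘update′ (j≢i ∘ sym) s bs = ≤-refl

-- Only `push` lengthens a stack. This bounds the time for unloading the output, about whose length
-- nothing else is known.
runs-length : ∀ {k} {c : Cmd k} {s s′ n} → Runs c s s′ n → ∀ i → length (lookup s′ i) ≤ length (lookup s i) + n
runs-length skip i = m≤m+n _ _
runs-length (push {j} {b} {s}) i with j Fin.≟ i
... | yes refl rewrite Vec.lookup∘update j s (b ∷ lookup s j) = ≤-trans (≤-reflexive (+-comm 1 _)) (+-monoʳ-≤ (length (lookup s j)) (s≤s z≤n))
... | no j≢i rewrite Vec.lookup∘update′ (j≢i ∘ sym) s (b ∷ lookup s j) = m≤m+n _ _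
runs-length (pop-empty eq r) i = ≤-trans (runs-length r i) (+-monoʳ-≤ _ (n≤1+n _))
runs-length (pop-bit {j} {s = s} eq r) i = ≤-trans (runs-length r i) (+-mono-≤ (update-shorter s j i eq) (n≤1+n _))
runs-length (seq {n = n} {n′} r r′) i = ≤-trans (runs-length r′ i) (≤-trans (+-monoˡ-≤ n′ (runs-length r i)) (≤-reflexive (+-assoc _ n n′)))
runs-length (while-stop eq) i = m≤m+n _ _
runs-length (while-bit {i = j} {f} {s} {n = n} {n′} eq r r′) i =
  ≤-trans (runs-length r′ i) (≤-trans (+-monoˡ-≤ n′ (≤-trans (runs-length r i) (+-monoˡ-≤ n (update-shorter s j i eq))))
    (≤-trans (≤-reflexive (+-assoc (length (lookup s i)) n n′)) (+-monoʳ-≤ _ (n≤1+n _))))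

unload-runs : ∀ {k} (i : Fin k) os s → Runs (while (suc i) (push zero)) (os ∷ s) ((lookup s i List.ʳ++ os) ∷ (s [ i ]≔ [])) (1 + length (lookup s i) * 3)
unload-runs i os s with lookup s i in eq
... | []     = subst (λ u → Runs _ (os ∷ s) (os ∷ u) 1) (trans (sym (Vec.[]≔-lookup s i)) (cong (s [ i ]≔_) eq)) (while-stop eq)
... | b ∷ bs = while-bit eq push
  (subst₂ (λ bs′ u → Runs (while (suc i) (push zero)) ((b ∷ os) ∷ (s [ i ]≔ bs)) ((bs′ List.ʳ++ (b ∷ os)) ∷ u) (1 + length bs′ * 3))
          (Vec.lookup∘update i s bs) (Vec.[]≔-idempotent s i) (rest bs (s [ i ]≔ bs) (b ∷ os) (Vec.lookup∘update i s bs)))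
  where
  rest : ∀ bs s os → lookup s i ≡ bs → Runs (while (suc i) (push zero)) (os ∷ s) ((lookup s i List.ʳ++ os) ∷ (s [ i ]≔ [])) (1 + length (lookup s i) * 3)
  rest []       s os eq rewrite eq = subst (λ u → Runs _ (os ∷ s) (os ∷ u) 1) (trans (sym (Vec.[]≔-lookup s i)) (cong (s [ i ]≔_) eq)) (while-stop eq)
  rest (b ∷ bs) s os eq rewrite eq = while-bit eq push
    (subst₂ (λ bs′ u → Runs (while (suc i) (push zero)) ((b ∷ os) ∷ (s [ i ]≔ bs)) ((bs′ List.ʳ++ (b ∷ os)) ∷ u) (1 + length bs′ * 3))
            (Vec.lookup∘update i s bs) (Vec.[]≔-idempotent s i) (rest bs (s [ i ]≔ bs) (b ∷ os) (Vec.lookup∘update i s bs)))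

-- The reversal stems from unloading, which pops the output stack onto the first tape. The inputs
-- arrive reversed for the same reason.
result : ∀ {k m} → Clocked k → (Fin m → Fin k) → Fin k → Vec (List Bool) m → List Bool
result {k} c ι o ws = reverse (lookup (⟦ c ⟧ (totalLength ws) (loaded ι ws (Vec.replicate k []))) o)

clocked-polyTime : ∀ {k m} (c : Clocked k) (ι : Fin (suc m) → Fin k) (o : Fin k) → PolyTime (result c ι o)
clocked-polyTime {k} {m} c ι o = machine {suc m} {withClocks D k} cmd , p , correct
  where
  D : ℕ
  D = depth c
  cmd : Cmd (suc m + withClocks D k)
  cmd = (load (suc m) D ι ⨟ lifts (suc m) (compile D c)) ⨟ while (suc (m ↑ʳ below D o)) (push zero)
  q : Polynomial
  q = (2 + m ∷ 4 + 2 * D ∷ []) ⊞ cost c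
  -- If loading and computing take x steps, the output has at most x letters and unloading takes at
  -- most 1 + 3 x steps; in total this is 1 + 4 x.
  p : Polynomial
  p = (1 ∷ []) ⊞ map (4 *_) q
  empty : ∀ D → Vec.replicate (withClocks D k) [] ≡ clocked D 0 (Vec.replicate k [])
  empty zero    = refl
  empty (suc D) = cong (λ u → [] ∷ [] ∷ u) (empty D)
  correct : ∀ ws → Maybe.map (output (machine {suc m} {withClocks D k} cmd))
              (TM.run (machine {suc m} {withClocks D k} cmd) (eval p (totalLength ws)) (TM.initial (machine {suc m} {withClocks D k} cmd) ws)) ≡ just (result c ι o ws)
  correct ws with compile-runs D c ≤-refl (totalLength ws) (loaded ι ws (Vec.replicate k []))
  ... | t , t≤ , r = subst (λ v → Maybe.map _ (TM.run (machine {suc m} {withClocks D k} cmd) (eval p n) (TM.initial (machine {suc m} {withClocks D k} cmd) ws)) ≡ just v) out-eq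
                       (machine-correct {m} cmd ws all-runs bound)
    where
    n : ℕ
    n = totalLength ws
    final : Stacks k
    final = ⟦ c ⟧ n (loaded ι ws (Vec.replicate k []))
    t₁ : ℕ
    t₁ = 2 + m + n * (4 + 2 * D)
    mid : Stacks (m + withClocks D k)
    mid = Vec.replicate m [] Vec.++ clocked D n final
    both : Runs (load (suc m) D ι ⨟ lifts (suc m) (compile D c)) (ws Vec.++ Vec.replicate (withClocks D k) []) ([] ∷ mid) (t₁ + t)
    both = seq (subst₂ (λ u n′ → Runs (load (suc m) D ι) (ws Vec.++ u) (Vec.replicate (suc m) [] Vec.++ clocked D n′ (loaded ι ws (Vec.replicate k []))) t₁)
                       (sym (empty D)) (+-identityʳ n) (load-runs (suc m) D ι ws 0 (Vec.replicate k [])))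
               (lifts-runs (Vec.replicate (suc m) []) r)
    lookup-mid : lookup mid (m ↑ʳ below D o) ≡ lookup final o
    lookup-mid = trans (Vec.lookup-++ʳ (Vec.replicate m []) (clocked D n final) (below D o)) (lookup-below D n final o)
    len : ℕ
    len = length (lookup mid (m ↑ʳ below D o))
    all-runs : Runs cmd (ws Vec.++ Vec.replicate (withClocks D k) [])
                 ((lookup mid (m ↑ʳ below D o) List.ʳ++ []) ∷ (mid [ m ↑ʳ below D o ]≔ [])) ((t₁ + t) + (1 + len * 3))
    all-runs = seq both (unload-runs (m ↑ʳ below D o) [] mid)
    out-eq : lookup mid (m ↑ʳ below D o) List.ʳ++ [] ≡ result c ι o ws
    out-eq = cong reverse lookup-mid
    len≤ : len ≤ t₁ + t
    len≤ = ≤-trans (runs-length both (suc m ↑ʳ below D o)) (≤-reflexive (cong (_+ (t₁ + t)) (cong length start-empty)))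
      where
      start-empty : lookup (ws Vec.++ Vec.replicate (withClocks D k) []) (suc m ↑ʳ below D o) ≡ []
      start-empty = trans (Vec.lookup-++ʳ ws _ (below D o)) (Vec.lookup-replicate (below D o) [])
    T≤ : t₁ + t ≤ eval q n
    T≤ = ≤-trans (+-mono-≤ (≤-reflexive (lemma m n D)) t≤) (≤-reflexive (sym (eval-⊞ (2 + m ∷ 4 + 2 * D ∷ []) (cost c) n)))
      where
      lemma : ∀ m n D → 2 + m + n * (4 + 2 * D) ≡ 2 + m + n * (4 + 2 * D + n * 0)
      lemma = solve-∀
    bound : (t₁ + t) + (1 + len * 3) ≤ eval p n
    bound rewrite eval-⊞ (1 ∷ []) (map (4 *_) q) n | eval-scale 4 q n =
      ≤-trans (+-mono-≤ T≤ (s≤s (*-monoˡ-≤ 3 (≤-trans len≤ T≤)))) (≤-reflexive (lemma (eval q n) n))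
      where
      lemma : ∀ x n → x + (1 + x * 3) ≡ 1 + n * 0 + 4 * x
      lemma = solve-∀

-- Arithmetic in polynomial time

-- Programs on natural number registers and stacks of bits.  A register
-- grows by at most one bit per addition, and the number of additions is
-- polynomial, so that registers of a fixed polynomial width suffice.
infixr 5 _››_
infix 4 _∣_
data Arith (m q : ℕ) : Set where
  nil   : Arith m q
  _››_  : Arith m q → Arith m q → Arith m q
  loop  : Arith m q → Arith m q
  clear : Fin m → Arith m q
  unit  : Fin m → Arith m q
  add   : Fin m → Fin m → Arith m q
  ifLe  : Fin m → Fin m → Arith m q → Arith m q → Arith m q
  popS  : Fin q → Arith m q → (Bool → Arith m q) → Arith m q
  pushS : Fin q → Bool → Arith m q
  emit  : Fin m → Fin q → Arith m q

record Store (m q : ℕ) : Set where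
  no-eta-equality
  pattern
  constructor _∣_
  field
    regs : Vec ℕ m
    stks : Stacks q
open Store

-- add i j adds register i to register j; emit i s writes one less than
-- register i.
⟪_⟫ : ∀ {m q} → Arith m q → ℕ → Store m q → Store m q
⟪ nil ⟫           n σ       = σ
⟪ c ›› c′ ⟫       n σ       = ⟪ c′ ⟫ n (⟪ c ⟫ n σ)
⟪ loop c ⟫        n σ       = iter n (⟪ c ⟫ n) σ
⟪ clear i ⟫       n (r ∣ s) = (r [ i ]≔ 0) ∣ s
⟪ unit i ⟫        n (r ∣ s) = (r [ i ]≔ 1) ∣ s
⟪ add i j ⟫       n (r ∣ s) = (r [ j ]≔ (lookup r j + lookup r i)) ∣ s
⟪ ifLe i j c c′ ⟫ n (r ∣ s) = if lookup r i ≤ᵇ lookup r j then ⟪ c ⟫ n (r ∣ s) else ⟪ c′ ⟫ n (r ∣ s)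
⟪ popS i c f ⟫    n (r ∣ s) = onTop (lookup s i) (⟪ c ⟫ n (r ∣ s)) (λ b bs → ⟪ f b ⟫ n (r ∣ (s [ i ]≔ bs)))
⟪ pushS i b ⟫     n (r ∣ s) = r ∣ (s [ i ]≔ (b ∷ lookup s i))
⟪ emit i j ⟫      n (r ∣ s) = r ∣ (s [ j ]≔ (encodeℕ (pred (lookup r i)) List.ʳ++ lookup s j))

-- Bounds how often `add` is executed, the only instruction that can push a register beyond its
-- current number of bits. The constant term 0 in front multiplies the count of a loop body by the
-- number of rounds.
additions : ∀ {m q} → Arith m q → Polynomial
additions (c ›› c′)       = additions c ⊞ additions c′
additions (loop c)        = 0 ∷ additions c
additions (add i j)       = 1 ∷ []
additions (ifLe i j c c′) = additions c ⊞ additions c′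
additions (popS i c f)    = additions c ⊞ (additions (f false) ⊞ additions (f true))
additions _               = []

iter-+ : ∀ {A : Set} m n (f : A → A) x → iter (m + n) f x ≡ iter n f (iter m f x)
iter-+ zero    n f x = refl
iter-+ (suc m) n f x = iter-+ m n f (f x)

iter-* : ∀ {A : Set} m n (f : A → A) x → iter (m * n) f x ≡ iter m (iter n f) x
iter-* zero    n f x = refl
iter-* (suc m) n f x = trans (iter-+ n (m * n) f x) (iter-* m n f (iter n f x))

iter-cong : ∀ {A : Set} n {f g : A → A} → (∀ x → f x ≡ g x) → ∀ x → iter n f x ≡ iter n g x
iter-cong zero    e x = refl
iter-cong (suc n) {f} {g} e x = trans (cong (iter n f) (e x)) (iter-cong n e (g x))

copies : ∀ {k} → ℕ → Clocked k → Clocked k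
copies zero    c = nop
copies (suc a) c = c ▸ copies a c

copies-sem : ∀ {k} a (c : Clocked k) n s → ⟦ copies a c ⟧ n s ≡ iter a (⟦ c ⟧ n) s
copies-sem zero    c n s = refl
copies-sem (suc a) c n s = copies-sem a c n (⟦ c ⟧ n s)

-- Horner's scheme: a + n p(n) rounds are a rounds followed by n blocks of p(n) rounds.
times : ∀ {k} → Polynomial → Clocked k → Clocked k
times []      c = nop
times (a ∷ p) c = copies a c ▸ rep (times p c)

times-sem : ∀ {k} p (c : Clocked k) n s → ⟦ times p c ⟧ n s ≡ iter (eval p n) (⟦ c ⟧ n) s
times-sem []      c n s = refl
times-sem (a ∷ p) c n s rewrite copies-sem a c n s =
  trans (iter-cong n (times-sem p c n) _)
 (trans (sym (iter-* n (eval p n) (⟦ c ⟧ n) _)) (sym (iter-+ a (n * eval p n) (⟦ c ⟧ n) s)))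

-- The common form of all loops that consume a stack. The number of rounds is only an upper bound
-- for the height of the stack, so the state with the empty stack has to be a fixed point.
drain : ∀ {S A : Set} (F : S → S) (st : List Bool → A → S) (g : A → Bool → A) →
        (∀ b xs a → F (st (b ∷ xs) a) ≡ st xs (g a b)) → (∀ a → F (st [] a) ≡ st [] a) →
        ∀ L xs a → length xs ≤ L → iter L F (st xs a) ≡ st [] (List.foldl g a xs)
drain F st g hc hn zero    []       a l       = refl
drain F st g hc hn (suc L) []       a l       = trans (cong (iter L F) (hn a)) (drain F st g hc hn L [] a z≤n)
drain F st g hc hn (suc L) (b ∷ xs) a (s≤s l) = trans (cong (iter L F) (hc b xs a)) (drain F st g hc hn L xs (g a b) l)

majority : Bool → Bool → Bool → Bool
majority false b c = b ∧ c
majority true  b c = b ∨ c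

addBits : Bool → List Bool → List Bool → List Bool
addBits c (a ∷ xs) (b ∷ ys) = (a xor (b xor c)) ∷ addBits (majority a b c) xs ys
addBits c _        _        = []

carryOut : Bool → List Bool → List Bool → Bool
carryOut c (a ∷ xs) (b ∷ ys) = carryOut (majority a b c) xs ys
carryOut c _        _        = c

leBit : Bool → Bool → Bool → Bool
leBit false true  f = true
leBit true  false f = false
leBit _     _     f = f

-- The least significant bits come first, so each later difference overrides the verdict `f` on the
-- earlier bits.
leBits : Bool → List Bool → List Bool → Bool
leBits f (a ∷ xs) (b ∷ ys) = leBits (leBit a b f) xs ys
leBits f _        _        = f

-- The bits below the leading one, nothing for zero.
cons-digit : Bool → Maybe (List Bool) → Maybe (List Bool)
cons-digit b     (just ds) = just (b ∷ ds)
cons-digit true  nothing   = just []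
cons-digit false nothing   = nothing

digits : List Bool → Maybe (List Bool)
digits = List.foldr cons-digit nothing

flag : Maybe (List Bool) → List Bool
flag (just _) = true ∷ []
flag nothing  = []

bits : Maybe (List Bool) → List Bool
bits (just ds) = ds
bits nothing   = []

written : List Bool → List Bool
written ds = concatMap (λ b → true ∷ not b ∷ []) ds List.++ false ∷ []

-- Three scratch stacks in front of the registers and stacks of the program, empty between its
-- instructions.
T₀ T₁ T₂ : ∀ {r} → Fin (3 + r)
T₀ = zero
T₁ = suc zero
T₂ = suc (suc zero)

slot : ∀ {r} → Fin r → Fin (3 + r)
slot j = suc (suc (suc j))

toT₀ : ∀ {r} → Polynomial → Fin r → Clocked (3 + r)
toT₀ p j = times p (take (slot j) nop (put T₀))

fromT₀ : ∀ {r} → Polynomial → Fin r → Clocked (3 + r)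
fromT₀ p j = times p (take T₀ nop (put (slot j)))

copyTo₁ copyTo₂ : ∀ {r} → Polynomial → Fin r → Clocked (3 + r)
copyTo₁ p j = toT₀ p j ▸ times p (take T₀ nop (λ b → put (slot j) b ▸ put T₁ b))
copyTo₂ p j = toT₀ p j ▸ times p (take T₀ nop (λ b → put (slot j) b ▸ put T₂ b))

-- The register is refilled with zeros because every register keeps its full width; equal widths
-- spare addition and comparison any treatment of leading zeros.
clearR : ∀ {r} → Polynomial → Fin r → Clocked (3 + r)
clearR p j = times p (take (slot j) nop (λ _ → nop)) ▸ times p (put (slot j) false)

addStep : ∀ {r} → Fin r → Clocked (3 + r)
addStep j = take T₂ nop λ c → take T₁ nop λ a → take (slot j) nop λ b → put T₀ (a xor (b xor c)) ▸ put T₂ (majority a b c)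

addR : ∀ {r} → Polynomial → Fin r → Fin r → Clocked (3 + r)
addR p i j = copyTo₁ p i ▸ put T₂ false ▸ times p (addStep j) ▸ take T₂ nop (λ _ → nop) ▸ fromT₀ p j

leStep : ∀ {r} → Clocked (3 + r)
leStep = take T₁ nop λ a → take T₂ nop λ b → take T₀ nop λ f → put T₀ (leBit a b f)

branchR : ∀ {r} → Polynomial → Fin r → Fin r → Clocked (3 + r) → Clocked (3 + r) → Clocked (3 + r)
branchR p i j c c′ = copyTo₁ p i ▸ copyTo₂ p j ▸ put T₀ true ▸ times p leStep ▸ take T₀ nop (λ f → if f then c else c′)

-- The bits arrive most significant first. `T₂` becomes nonempty when the leading one has gone by,
-- and only the bits after it are kept.
stripStep : ∀ {r} → Clocked (3 + r)
stripStep = take T₀ nop λ b → take T₂ (if b then put T₂ true else nop) (λ _ → put T₂ true ▸ put T₁ b)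

writeStep : ∀ {r} → Fin r → Clocked (3 + r)
writeStep s = take T₁ nop λ b → put (slot s) true ▸ put (slot s) (not b)

emitR : ∀ {r} → Polynomial → Fin r → Fin r → Clocked (3 + r)
emitR p i s = copyTo₁ p i ▸ times p (take T₁ nop (put T₀)) ▸ times p stripStep ▸ take T₂ nop (λ _ → nop) ▸ times p (writeStep s) ▸ put (slot s) false

module Registers {r : ℕ} (p : Polynomial) (n : ℕ) where

  L : ℕ
  L = eval p n

  loop-drain : ∀ {A : Set} (c : Clocked (3 + r)) (st : List Bool → A → Stacks (3 + r)) (g : A → Bool → A) →
               (∀ b xs a → ⟦ c ⟧ n (st (b ∷ xs) a) ≡ st xs (g a b)) → (∀ a → ⟦ c ⟧ n (st [] a) ≡ st [] a) →
               ∀ xs a → length xs ≤ L → ⟦ times p c ⟧ n (st xs a) ≡ st [] (List.foldl g a xs)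
  loop-drain c st g hc hn xs a l = trans (times-sem p c n (st xs a)) (drain (⟦ c ⟧ n) st g hc hn L xs a l)

  toT₀-sem : ∀ j xs {t₀ t₁ t₂} (ρ : Stacks r) → length xs ≤ L →
             ⟦ toT₀ p j ⟧ n (t₀ ∷ t₁ ∷ t₂ ∷ (ρ [ j ]≔ xs)) ≡ (xs List.ʳ++ t₀) ∷ t₁ ∷ t₂ ∷ (ρ [ j ]≔ [])
  toT₀-sem j xs {t₀} {t₁} {t₂} ρ l =
    loop-drain (take (slot j) nop (put T₀)) (λ xs a → a ∷ t₁ ∷ t₂ ∷ (ρ [ j ]≔ xs)) (λ a b → b ∷ a) hc hn xs t₀ l
    where
    hc : ∀ b xs a → ⟦ take (slot j) nop (put T₀) ⟧ n (a ∷ t₁ ∷ t₂ ∷ (ρ [ j ]≔ (b ∷ xs))) ≡ (b ∷ a) ∷ t₁ ∷ t₂ ∷ (ρ [ j ]≔ xs)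
    hc b xs a rewrite Vec.lookup∘update j ρ (b ∷ xs) | Vec.[]≔-idempotent {x = b ∷ xs} {y = xs} ρ j = refl
    hn : ∀ a → ⟦ take (slot j) nop (put T₀) ⟧ n (a ∷ t₁ ∷ t₂ ∷ (ρ [ j ]≔ [])) ≡ a ∷ t₁ ∷ t₂ ∷ (ρ [ j ]≔ [])
    hn a rewrite Vec.lookup∘update j ρ [] = refl

  fromT₀-sem : ∀ j xs {t₁ t₂} ys (ρ : Stacks r) → length xs ≤ L →
               ⟦ fromT₀ p j ⟧ n (xs ∷ t₁ ∷ t₂ ∷ (ρ [ j ]≔ ys)) ≡ [] ∷ t₁ ∷ t₂ ∷ (ρ [ j ]≔ (xs List.ʳ++ ys))
  fromT₀-sem j xs {t₁} {t₂} ys ρ l =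
    loop-drain (take T₀ nop (put (slot j))) (λ xs a → xs ∷ t₁ ∷ t₂ ∷ (ρ [ j ]≔ a)) (λ a b → b ∷ a) hc (λ a → refl) xs ys l
    where
    hc : ∀ b xs a → ⟦ take T₀ nop (put (slot j)) ⟧ n ((b ∷ xs) ∷ t₁ ∷ t₂ ∷ (ρ [ j ]≔ a)) ≡ xs ∷ t₁ ∷ t₂ ∷ (ρ [ j ]≔ (b ∷ a))
    hc b xs a rewrite Vec.lookup∘update j ρ a | Vec.[]≔-idempotent {x = a} {y = b ∷ a} ρ j = refl

  ʳ++-twice : ∀ (xs : List Bool) → (xs List.ʳ++ []) List.ʳ++ [] ≡ xs
  ʳ++-twice = List.reverse-involutive

  length-reverse≤ : ∀ (xs : List Bool) → length xs ≤ L → length (xs List.ʳ++ []) ≤ L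
  length-reverse≤ xs l = ≤-trans (≤-reflexive (List.length-reverse xs)) l

  pair-foldl : ∀ (xs as bs : List Bool) → List.foldl (λ (a , a′) b → (b ∷ a) , (b ∷ a′)) (as , bs) xs ≡ (xs List.ʳ++ as , xs List.ʳ++ bs)
  pair-foldl []       as bs = refl
  pair-foldl (x ∷ xs) as bs = pair-foldl xs (x ∷ as) (x ∷ bs)

  copyTo₁-sem : ∀ j {t₂} (ρ : Stacks r) → length (lookup ρ j) ≤ L →
                ⟦ copyTo₁ p j ⟧ n ([] ∷ [] ∷ t₂ ∷ ρ) ≡ [] ∷ lookup ρ j ∷ t₂ ∷ ρ
  copyTo₁-sem j {t₂} ρ l = begin
    ⟦ copyTo₁ p j ⟧ n ([] ∷ [] ∷ t₂ ∷ ρ) ≡⟨ cong (λ u → ⟦ copyTo₁ p j ⟧ n ([] ∷ [] ∷ t₂ ∷ u)) (sym (Vec.[]≔-lookup ρ j)) ⟩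
    ⟦ copyTo₁ p j ⟧ n ([] ∷ [] ∷ t₂ ∷ (ρ [ j ]≔ xs)) ≡⟨ cong (⟦ times p body ⟧ n) (toT₀-sem j xs ρ l) ⟩
    ⟦ times p body ⟧ n (st (xs List.ʳ++ []) ([] , [])) ≡⟨ loop-drain body st _ hc (λ a → refl) (xs List.ʳ++ []) ([] , []) (length-reverse≤ xs l) ⟩
    st [] (List.foldl _ ([] , []) (xs List.ʳ++ [])) ≡⟨ cong (st []) (pair-foldl (xs List.ʳ++ []) [] []) ⟩
    st [] ((xs List.ʳ++ []) List.ʳ++ [] , (xs List.ʳ++ []) List.ʳ++ []) ≡⟨ cong (λ ys → st [] (ys , ys)) (ʳ++-twice xs) ⟩
    [] ∷ xs ∷ t₂ ∷ (ρ [ j ]≔ xs) ≡⟨ cong (λ u → [] ∷ xs ∷ t₂ ∷ u) (Vec.[]≔-lookup ρ j) ⟩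
    [] ∷ xs ∷ t₂ ∷ ρ ∎
    where
    open ≡-Reasoning
    xs : List Bool
    xs = lookup ρ j
    body : Clocked (3 + r)
    body = take T₀ nop (λ b → put (slot j) b ▸ put T₁ b)
    st : List Bool → List Bool × List Bool → Stacks (3 + r)
    st zs (a , a′) = zs ∷ a′ ∷ t₂ ∷ (ρ [ j ]≔ a)
    hc : ∀ b zs a → ⟦ body ⟧ n (st (b ∷ zs) a) ≡ st zs (b ∷ proj₁ a , b ∷ proj₂ a)
    hc b zs (a , a′) rewrite Vec.lookup∘update j ρ a | Vec.[]≔-idempotent {x = a} {y = b ∷ a} ρ j = refl

  copyTo₂-sem : ∀ j {t₁} (ρ : Stacks r) → length (lookup ρ j) ≤ L →
                ⟦ copyTo₂ p j ⟧ n ([] ∷ t₁ ∷ [] ∷ ρ) ≡ [] ∷ t₁ ∷ lookup ρ j ∷ ρ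
  copyTo₂-sem j {t₁} ρ l = begin
    ⟦ copyTo₂ p j ⟧ n ([] ∷ t₁ ∷ [] ∷ ρ) ≡⟨ cong (λ u → ⟦ copyTo₂ p j ⟧ n ([] ∷ t₁ ∷ [] ∷ u)) (sym (Vec.[]≔-lookup ρ j)) ⟩
    ⟦ copyTo₂ p j ⟧ n ([] ∷ t₁ ∷ [] ∷ (ρ [ j ]≔ xs)) ≡⟨ cong (⟦ times p body ⟧ n) (toT₀-sem j xs ρ l) ⟩
    ⟦ times p body ⟧ n (st (xs List.ʳ++ []) ([] , [])) ≡⟨ loop-drain body st _ hc (λ a → refl) (xs List.ʳ++ []) ([] , []) (length-reverse≤ xs l) ⟩
    st [] (List.foldl _ ([] , []) (xs List.ʳ++ [])) ≡⟨ cong (st []) (pair-foldl (xs List.ʳ++ []) [] []) ⟩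
    st [] ((xs List.ʳ++ []) List.ʳ++ [] , (xs List.ʳ++ []) List.ʳ++ []) ≡⟨ cong (λ ys → st [] (ys , ys)) (ʳ++-twice xs) ⟩
    [] ∷ t₁ ∷ xs ∷ (ρ [ j ]≔ xs) ≡⟨ cong (λ u → [] ∷ t₁ ∷ xs ∷ u) (Vec.[]≔-lookup ρ j) ⟩
    [] ∷ t₁ ∷ xs ∷ ρ ∎
    where
    open ≡-Reasoning
    xs : List Bool
    xs = lookup ρ j
    body : Clocked (3 + r)
    body = take T₀ nop (λ b → put (slot j) b ▸ put T₂ b)
    st : List Bool → List Bool × List Bool → Stacks (3 + r)
    st zs (a , a′) = zs ∷ t₁ ∷ a′ ∷ (ρ [ j ]≔ a)
    hc : ∀ b zs a → ⟦ body ⟧ n (st (b ∷ zs) a) ≡ st zs (b ∷ proj₁ a , b ∷ proj₂ a)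
    hc b zs (a , a′) rewrite Vec.lookup∘update j ρ a | Vec.[]≔-idempotent {x = a} {y = b ∷ a} ρ j = refl

  clearR-sem : ∀ j (ρ : Stacks r) → length (lookup ρ j) ≤ L →
               ⟦ clearR p j ⟧ n ([] ∷ [] ∷ [] ∷ ρ) ≡ [] ∷ [] ∷ [] ∷ (ρ [ j ]≔ replicate L false)
  clearR-sem j ρ l = begin
    ⟦ clearR p j ⟧ n (st ρ) ≡⟨ cong (λ u → ⟦ clearR p j ⟧ n (st u)) (sym (Vec.[]≔-lookup ρ j)) ⟩
    ⟦ clearR p j ⟧ n (st (ρ [ j ]≔ lookup ρ j)) ≡⟨ cong (⟦ times p (put (slot j) false) ⟧ n)
      (loop-drain (take (slot j) nop (λ _ → nop)) (λ xs (_ : ⊤) → st (ρ [ j ]≔ xs)) (λ a _ → a) hc hn (lookup ρ j) tt l) ⟩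
    ⟦ times p (put (slot j) false) ⟧ n (st (ρ [ j ]≔ [])) ≡⟨ times-sem p (put (slot j) false) n (st (ρ [ j ]≔ [])) ⟩
    iter L (⟦ put (slot j) false ⟧ n) (st (ρ [ j ]≔ [])) ≡⟨ fill L 0 ⟩
    st (ρ [ j ]≔ replicate (L + 0) false) ≡⟨ cong (λ l → st (ρ [ j ]≔ replicate l false)) (+-identityʳ L) ⟩
    st (ρ [ j ]≔ replicate L false) ∎
    where
    open ≡-Reasoning
    st : Stacks r → Stacks (3 + r)
    st u = [] ∷ [] ∷ [] ∷ u
    hc : ∀ b xs a → ⟦ take (slot j) nop (λ _ → nop) ⟧ n (st (ρ [ j ]≔ (b ∷ xs))) ≡ st (ρ [ j ]≔ xs)
    hc b xs a rewrite Vec.lookup∘update j ρ (b ∷ xs) | Vec.[]≔-idempotent {x = b ∷ xs} {y = xs} ρ j = refl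
    hn : ∀ a → ⟦ take (slot j) nop (λ _ → nop) ⟧ n (st (ρ [ j ]≔ [])) ≡ st (ρ [ j ]≔ [])
    hn a rewrite Vec.lookup∘update j ρ [] = refl
    fill : ∀ l a → iter l (⟦ put (slot j) false ⟧ n) (st (ρ [ j ]≔ replicate a false)) ≡ st (ρ [ j ]≔ replicate (l + a) false)
    fill zero    a = refl
    fill (suc l) a rewrite Vec.lookup∘update j ρ (replicate a false) | Vec.[]≔-idempotent {x = replicate a false} {y = false ∷ replicate a false} ρ j =
      trans (fill l (suc a)) (cong (λ a → st (ρ [ j ]≔ replicate a false)) (+-suc l a))

  length-addBits : ∀ c xs ys → length xs ≡ length ys → length (addBits c xs ys) ≡ length xs
  length-addBits c []       []       eq = refl
  length-addBits c (a ∷ xs) (b ∷ ys) eq = cong suc (length-addBits _ xs ys (suc-injective eq))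

  addLoop : ∀ j (ρ : Stacks r) xs ys c zs → length xs ≡ length ys →
            iter (length xs) (⟦ addStep j ⟧ n) (zs ∷ xs ∷ (c ∷ []) ∷ (ρ [ j ]≔ ys))
            ≡ (addBits c xs ys List.ʳ++ zs) ∷ [] ∷ (carryOut c xs ys ∷ []) ∷ (ρ [ j ]≔ [])
  addLoop j ρ []       []       c zs eq = refl
  addLoop j ρ (a ∷ xs) (b ∷ ys) c zs eq rewrite Vec.lookup∘update j ρ (b ∷ ys) | Vec.[]≔-idempotent {x = b ∷ ys} {y = ys} ρ j =
    addLoop j ρ xs ys (majority a b c) ((a xor (b xor c)) ∷ zs) (suc-injective eq)

  addR-sem : ∀ i j (ρ : Stacks r) → length (lookup ρ i) ≡ L → length (lookup ρ j) ≡ L →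
             ⟦ addR p i j ⟧ n ([] ∷ [] ∷ [] ∷ ρ) ≡ [] ∷ [] ∷ [] ∷ (ρ [ j ]≔ addBits false (lookup ρ i) (lookup ρ j))
  addR-sem i j ρ li lj = begin
    ⟦ addR p i j ⟧ n ([] ∷ [] ∷ [] ∷ ρ) ≡⟨ cong (⟦ put T₂ false ▸ times p (addStep j) ▸ take T₂ nop (λ _ → nop) ▸ fromT₀ p j ⟧ n) (copyTo₁-sem i ρ (≤-reflexive li)) ⟩
    rest (⟦ times p (addStep j) ⟧ n ([] ∷ xs ∷ (false ∷ []) ∷ ρ)) ≡⟨ cong rest (times-sem p (addStep j) n _) ⟩
    rest (iter L (⟦ addStep j ⟧ n) ([] ∷ xs ∷ (false ∷ []) ∷ ρ)) ≡⟨ cong (λ u → rest (iter L (⟦ addStep j ⟧ n) ([] ∷ xs ∷ (false ∷ []) ∷ u))) (sym (Vec.[]≔-lookup ρ j)) ⟩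
    rest (iter L (⟦ addStep j ⟧ n) ([] ∷ xs ∷ (false ∷ []) ∷ (ρ [ j ]≔ ys))) ≡⟨ cong (λ l → rest (iter l (⟦ addStep j ⟧ n) ([] ∷ xs ∷ (false ∷ []) ∷ (ρ [ j ]≔ ys)))) (sym li) ⟩
    rest (iter (length xs) (⟦ addStep j ⟧ n) ([] ∷ xs ∷ (false ∷ []) ∷ (ρ [ j ]≔ ys))) ≡⟨ cong rest (addLoop j ρ xs ys false [] (trans li (sym lj))) ⟩
    ⟦ fromT₀ p j ⟧ n ((zs List.ʳ++ []) ∷ [] ∷ [] ∷ (ρ [ j ]≔ [])) ≡⟨ fromT₀-sem j (zs List.ʳ++ []) [] ρ (length-reverse≤ zs (≤-reflexive (trans (length-addBits false xs ys (trans li (sym lj))) li))) ⟩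
    [] ∷ [] ∷ [] ∷ (ρ [ j ]≔ ((zs List.ʳ++ []) List.ʳ++ [])) ≡⟨ cong (λ zs → [] ∷ [] ∷ [] ∷ (ρ [ j ]≔ zs)) (ʳ++-twice zs) ⟩
    [] ∷ [] ∷ [] ∷ (ρ [ j ]≔ zs) ∎
    where
    open ≡-Reasoning
    rest : Stacks (3 + r) → Stacks (3 + r)
    rest = ⟦ take T₂ nop (λ _ → nop) ▸ fromT₀ p j ⟧ n
    xs ys zs : List Bool
    xs = lookup ρ i
    ys = lookup ρ j
    zs = addBits false xs ys

  leLoop : ∀ (ρ : Stacks r) xs ys f → length xs ≡ length ys →
           iter (length xs) (⟦ leStep ⟧ n) ((f ∷ []) ∷ xs ∷ ys ∷ ρ) ≡ (leBits f xs ys ∷ []) ∷ [] ∷ [] ∷ ρ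
  leLoop ρ []       []       f eq = refl
  leLoop ρ (a ∷ xs) (b ∷ ys) f eq = leLoop ρ xs ys (leBit a b f) (suc-injective eq)

  branchR-sem : ∀ i j c c′ (ρ : Stacks r) → length (lookup ρ i) ≡ L → length (lookup ρ j) ≡ L →
                ⟦ branchR p i j c c′ ⟧ n ([] ∷ [] ∷ [] ∷ ρ)
                ≡ ⟦ if leBits true (lookup ρ i) (lookup ρ j) then c else c′ ⟧ n ([] ∷ [] ∷ [] ∷ ρ)
  branchR-sem i j c c′ ρ li lj = begin
    ⟦ branchR p i j c c′ ⟧ n ([] ∷ [] ∷ [] ∷ ρ) ≡⟨ cong (⟦ copyTo₂ p j ▸ put T₀ true ▸ times p leStep ▸ choose ⟧ n) (copyTo₁-sem i ρ (≤-reflexive li)) ⟩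
    ⟦ copyTo₂ p j ▸ put T₀ true ▸ times p leStep ▸ choose ⟧ n ([] ∷ xs ∷ [] ∷ ρ) ≡⟨ cong (⟦ put T₀ true ▸ times p leStep ▸ choose ⟧ n) (copyTo₂-sem j ρ (≤-reflexive lj)) ⟩
    ⟦ choose ⟧ n (⟦ times p leStep ⟧ n ((true ∷ []) ∷ xs ∷ ys ∷ ρ)) ≡⟨ cong (⟦ choose ⟧ n) (times-sem p leStep n _) ⟩
    ⟦ choose ⟧ n (iter L (⟦ leStep ⟧ n) ((true ∷ []) ∷ xs ∷ ys ∷ ρ)) ≡⟨ cong (λ l → ⟦ choose ⟧ n (iter l (⟦ leStep ⟧ n) ((true ∷ []) ∷ xs ∷ ys ∷ ρ))) (sym li) ⟩
    ⟦ choose ⟧ n (iter (length xs) (⟦ leStep ⟧ n) ((true ∷ []) ∷ xs ∷ ys ∷ ρ)) ≡⟨ cong (⟦ choose ⟧ n) (leLoop ρ xs ys true (trans li (sym lj))) ⟩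
    ⟦ if leBits true xs ys then c else c′ ⟧ n ([] ∷ [] ∷ [] ∷ ρ) ∎
    where
    open ≡-Reasoning
    choose : Clocked (3 + r)
    choose = take T₀ nop (λ f → if f then c else c′)
    xs ys : List Bool
    xs = lookup ρ i
    ys = lookup ρ j

  length-digits : ∀ xs → length (bits (digits xs)) ≤ length xs
  length-digits []           = z≤n
  length-digits (b ∷ xs)     with digits xs | length-digits xs
  length-digits (b ∷ xs)     | just ds | l = s≤s l
  length-digits (true ∷ xs)  | nothing | l = z≤n
  length-digits (false ∷ xs) | nothing | l = z≤n

  emitR-sem : ∀ i s (ρ : Stacks r) → length (lookup ρ i) ≤ L →
              ⟦ emitR p i s ⟧ n ([] ∷ [] ∷ [] ∷ ρ) ≡ [] ∷ [] ∷ [] ∷ (ρ [ s ]≔ (written (bits (digits (lookup ρ i))) List.ʳ++ lookup ρ s))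
  emitR-sem i s ρ l = begin
    ⟦ emitR p i s ⟧ n ([] ∷ [] ∷ [] ∷ ρ) ≡⟨ cong (λ u → c₄ (c₃ (c₂ (⟦ times p (take T₁ nop (put T₀)) ⟧ n u)))) (copyTo₁-sem i ρ l) ⟩
    c₄ (c₃ (c₂ (⟦ times p (take T₁ nop (put T₀)) ⟧ n ([] ∷ xs ∷ [] ∷ ρ)))) ≡⟨ cong (λ u → c₄ (c₃ (c₂ u)))
      (loop-drain (take T₁ nop (put T₀)) (λ xs a → a ∷ xs ∷ [] ∷ ρ) (λ a b → b ∷ a) (λ _ _ _ → refl) (λ _ → refl) xs [] l) ⟩
    c₄ (c₃ (c₂ (strip (xs List.ʳ++ []) nothing))) ≡⟨ cong (λ u → c₄ (c₃ u))
      (loop-drain stripStep strip (λ a b → cons-digit b a) strip-step (λ _ → refl) (xs List.ʳ++ []) nothing (length-reverse≤ xs l)) ⟩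
    c₄ (c₃ (strip [] (List.foldl (λ a b → cons-digit b a) nothing (xs List.ʳ++ [])))) ≡⟨ cong (λ a → c₄ (c₃ (strip [] a))) (List.reverse-foldl (λ a b → cons-digit b a) nothing xs) ⟩
    c₄ (c₃ (strip [] (digits xs))) ≡⟨ cong c₄ (unflag (digits xs)) ⟩
    c₄ ([] ∷ ds ∷ [] ∷ ρ) ≡⟨ cong (λ u → c₄ ([] ∷ ds ∷ [] ∷ u)) (sym (Vec.[]≔-lookup ρ s)) ⟩
    c₄ ([] ∷ ds ∷ [] ∷ (ρ [ s ]≔ lookup ρ s)) ≡⟨ cong (⟦ put (slot s) false ⟧ n)
      (loop-drain (writeStep s) (λ xs a → [] ∷ xs ∷ [] ∷ (ρ [ s ]≔ a)) (λ a b → not b ∷ true ∷ a) write-step (λ _ → refl) ds (lookup ρ s) (≤-trans (length-digits xs) l)) ⟩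
    ⟦ put (slot s) false ⟧ n ([] ∷ [] ∷ [] ∷ (ρ [ s ]≔ List.foldl (λ a b → not b ∷ true ∷ a) (lookup ρ s) ds)) ≡⟨ last-bit (List.foldl (λ a b → not b ∷ true ∷ a) (lookup ρ s) ds) ⟩
    [] ∷ [] ∷ [] ∷ (ρ [ s ]≔ (false ∷ List.foldl (λ a b → not b ∷ true ∷ a) (lookup ρ s) ds)) ≡⟨ cong (λ u → [] ∷ [] ∷ [] ∷ (ρ [ s ]≔ u)) (sym (fold-eq ds (lookup ρ s))) ⟩
    [] ∷ [] ∷ [] ∷ (ρ [ s ]≔ (written ds List.ʳ++ lookup ρ s)) ∎
    where
    open ≡-Reasoning
    xs ds : List Bool
    xs = lookup ρ i
    ds = bits (digits xs)
    c₂ c₃ c₄ : Stacks (3 + r) → Stacks (3 + r)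
    c₂ = ⟦ times p stripStep ⟧ n
    c₃ = ⟦ take T₂ nop (λ _ → nop) ⟧ n
    c₄ = ⟦ times p (writeStep s) ▸ put (slot s) false ⟧ n
    strip : List Bool → Maybe (List Bool) → Stacks (3 + r)
    strip xs a = xs ∷ bits a ∷ flag a ∷ ρ
    strip-step : ∀ b xs a → ⟦ stripStep ⟧ n (strip (b ∷ xs) a) ≡ strip xs (cons-digit b a)
    strip-step b     xs (just ds) = refl
    strip-step true  xs nothing   = refl
    strip-step false xs nothing   = refl
    unflag : ∀ a → c₃ (strip [] a) ≡ [] ∷ bits a ∷ [] ∷ ρ
    unflag (just ds) = refl
    unflag nothing   = refl
    write-step : ∀ b xs a → ⟦ writeStep s ⟧ n ([] ∷ (b ∷ xs) ∷ [] ∷ (ρ [ s ]≔ a)) ≡ [] ∷ xs ∷ [] ∷ (ρ [ s ]≔ (not b ∷ true ∷ a))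
    write-step b xs a rewrite Vec.lookup∘update s ρ a | Vec.[]≔-idempotent {x = a} {y = true ∷ a} ρ s
      | Vec.lookup∘update s ρ (true ∷ a) | Vec.[]≔-idempotent {x = true ∷ a} {y = not b ∷ true ∷ a} ρ s = refl
    last-bit : ∀ a → ⟦ put (slot s) false ⟧ n ([] ∷ [] ∷ [] ∷ (ρ [ s ]≔ a)) ≡ [] ∷ [] ∷ [] ∷ (ρ [ s ]≔ (false ∷ a))
    last-bit a rewrite Vec.lookup∘update s ρ a | Vec.[]≔-idempotent {x = a} {y = false ∷ a} ρ s = refl
    fold-eq : ∀ ds a → written ds List.ʳ++ a ≡ false ∷ List.foldl (λ a b → not b ∷ true ∷ a) a ds
    fold-eq []       a = refl
    fold-eq (d ∷ ds) a = fold-eq ds (not d ∷ true ∷ a)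

-- Bit lists as numbers.

bitValue : Bool → ℕ
bitValue false = 0
bitValue true  = 1

value : List Bool → ℕ
value []       = 0
value (b ∷ xs) = bitValue b + 2 * value xs

value-zeros : ∀ L → value (replicate L false) ≡ 0
value-zeros zero    = refl
value-zeros (suc L) rewrite value-zeros L = refl

-- The invariant of a ripple-carry adder; with the carry out on the left it holds without any bound
-- on the numbers, which is what the induction requires.
value-addBits : ∀ c xs ys → length xs ≡ length ys →
  value (addBits c xs ys) + bitValue (carryOut c xs ys) * 2 ^ length xs ≡ bitValue c + value xs + value ys
value-addBits c []       []       eq = trans (*-identityʳ _) (lemma (bitValue c))
  where
  lemma : ∀ c → c ≡ c + 0 + 0
  lemma = solve-∀
value-addBits c (a ∷ xs) (b ∷ ys) eq =
  trans (lemma₁ (bitValue (a xor (b xor c))) (value (addBits (majority a b c) xs ys)) (bitValue (carryOut (majority a b c) xs ys)) (2 ^ length xs))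
 (trans (cong (λ v → bitValue (a xor (b xor c)) + 2 * v) (value-addBits (majority a b c) xs ys (suc-injective eq)))
 (trans (lemma₂ (bitValue (a xor (b xor c))) (bitValue (majority a b c)) (value xs) (value ys))
 (trans (cong (λ v → v + 2 * value xs + 2 * value ys) (full-adder a b c))
        (lemma₃ (bitValue a) (bitValue b) (bitValue c) (value xs) (value ys)))))
  where
  lemma₁ : ∀ s v o e → s + 2 * v + o * (2 * e) ≡ s + 2 * (v + o * e)
  lemma₁ = solve-∀
  lemma₂ : ∀ s m x y → s + 2 * (m + x + y) ≡ s + 2 * m + 2 * x + 2 * y
  lemma₂ = solve-∀
  lemma₃ : ∀ a b c x y → c + a + b + 2 * x + 2 * y ≡ c + (a + 2 * x) + (b + 2 * y)
  lemma₃ = solve-∀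
  full-adder : ∀ a b c → bitValue (a xor (b xor c)) + 2 * bitValue (majority a b c) ≡ bitValue c + bitValue a + bitValue b
  full-adder false false false = refl
  full-adder false false true  = refl
  full-adder false true  false = refl
  full-adder false true  true  = refl
  full-adder true  false false = refl
  full-adder true  false true  = refl
  full-adder true  true  false = refl
  full-adder true  true  true  = refl

-- A carry out would contribute 2 ^ L to a sum that is assumed to be smaller.
value-addBits-exact : ∀ xs ys {L} → length xs ≡ L → length ys ≡ L → value xs + value ys < 2 ^ L →
                      value (addBits false xs ys) ≡ value xs + value ys
value-addBits-exact xs ys refl ly small with carryOut false xs ys | value-addBits false xs ys (sym ly)
... | false | eq = trans (sym (+-identityʳ _)) eq
... | true  | eq = contradiction (≤-trans (m≤n+m _ (value (addBits false xs ys))) (≤-reflexive (trans (cong (value (addBits false xs ys) +_) (sym (+-identityʳ _))) eq))) (<⇒≱ small)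

half-≤ : ∀ {x y} → 2 * x ≤ 1 + 2 * y → x ≤ y
half-≤ {x} {y} h with x ≤? y
... | yes x≤y = x≤y
... | no  x≰y = contradiction (≤-trans (*-monoʳ-≤ 2 (≰⇒> x≰y)) h) (<⇒≱ (≤-reflexive (lemma y)))
  where
  lemma : ∀ y → 2 + 2 * y ≡ 2 * suc y
  lemma = solve-∀

half-< : ∀ {x y} → 1 + 2 * x ≤ 2 * y → x < y
half-< {x} {y} h = half-≤ (≤-trans (≤-reflexive (*-suc 2 x)) (s≤s h))

double-< : ∀ {x y} → x < y → 2 + 2 * x ≤ 2 * y
double-< {x} h = ≤-trans (≤-reflexive (sym (*-suc 2 x))) (*-monoʳ-≤ 2 h)

-- A flag `true` stands for ≤ and `false` for <, written as an offset so that both comparisons have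
-- one form.
offset : Bool → ℕ
offset true  = 0
offset false = 1

leBits-reflects : ∀ f xs ys → length xs ≡ length ys → Reflects (offset f + value xs ≤ value ys) (leBits f xs ys)
leBits-reflects true  [] [] eq = ofʸ z≤n
leBits-reflects false [] [] eq = ofⁿ λ ()
leBits-reflects f (a ∷ xs) (b ∷ ys) eq = go a b f (leBits-reflects (leBit a b f) xs ys (suc-injective eq))
  where
  recast : ∀ {P Q : Set} {b} → (P → Q) → (Q → P) → Reflects P b → Reflects Q b
  recast f g (ofʸ p)  = ofʸ (f p)
  recast f g (ofⁿ ¬p) = ofⁿ (λ q → ¬p (g q))
  X Y : ℕ
  X = value xs
  Y = value ys
  go : ∀ a b f → Reflects (offset (leBit a b f) + X ≤ Y) (leBits (leBit a b f) xs ys) →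
       Reflects (offset f + (bitValue a + 2 * X) ≤ bitValue b + 2 * Y) (leBits (leBit a b f) xs ys)
  go false false true  = recast (*-monoʳ-≤ 2) (λ h → half-≤ (m≤n⇒m≤1+n h))
  go false false false = recast (λ h → ≤-trans (n≤1+n _) (double-< h)) half-<
  go false true  true  = recast (λ h → m≤n⇒m≤1+n (*-monoʳ-≤ 2 h)) half-≤
  go false true  false = recast (λ h → s≤s (*-monoʳ-≤ 2 h)) (λ h → half-≤ (m≤n⇒m≤1+n (≤-pred h)))
  go true  false true  = recast (λ h → ≤-trans (n≤1+n _) (double-< h)) half-<
  go true  false false = recast double-< (λ h → half-< (≤-trans (n≤1+n _) h))
  go true  true  true  = recast (λ h → s≤s (*-monoʳ-≤ 2 h)) (λ h → half-≤ (m≤n⇒m≤1+n (≤-pred h)))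
  go true  true  false = recast (λ h → s≤s (≤-trans (n≤1+n _) (double-< h))) (λ h → half-< (≤-pred h))

leBits-≤ᵇ : ∀ xs ys → length xs ≡ length ys → leBits true xs ys ≡ (value xs ≤ᵇ value ys)
leBits-≤ᵇ xs ys eq = det (leBits-reflects true xs ys eq) (≤ᵇ-reflects-≤ (value xs) (value ys))

digitsᵇ : List Bool → ℕᵇ
digitsᵇ []           = ℕᵇ.zero
digitsᵇ (false ∷ ds) = 1+[2 digitsᵇ ds ]
digitsᵇ (true ∷ ds)  = 2[1+ digitsᵇ ds ]

written-digitsᵇ : ∀ ds → written ds ≡ encodeℕᵇ (digitsᵇ ds)
written-digitsᵇ []           = refl
written-digitsᵇ (false ∷ ds) = cong (λ w → true ∷ true ∷ w) (written-digitsᵇ ds)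
written-digitsᵇ (true ∷ ds)  = cong (λ w → true ∷ false ∷ w) (written-digitsᵇ ds)

value-digits : ∀ xs → pred (value xs) ≡ ℕᵇ.toℕ (digitsᵇ (bits (digits xs))) × (digits xs ≡ nothing → value xs ≡ 0) × (∀ ds → digits xs ≡ just ds → value xs ≡ suc (ℕᵇ.toℕ (digitsᵇ ds)))
value-digits [] = refl , (λ _ → refl) , λ _ ()
value-digits (b ∷ xs) with digits xs | value-digits xs
value-digits (false ∷ xs) | just ds | _ , _ , h rewrite h ds refl = +-suc _ _ , (λ ()) , λ { _ refl → cong suc (+-suc _ _) }
value-digits (true ∷ xs)  | just ds | _ , _ , h rewrite h ds refl = refl , (λ ()) , λ { _ refl → refl }
value-digits (false ∷ xs) | nothing | _ , h , _ rewrite h refl = refl , (λ _ → refl) , λ _ ()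
value-digits (true ∷ xs)  | nothing | _ , h , _ rewrite h refl = refl , (λ ()) , λ { _ refl → refl }

-- Write v + 1 in binary: the bits below the leading one, each increased by one, are the digits of v
-- in bijective base 2. Dropping the leading one is therefore the whole conversion, at the price of
-- the predecessor.
written-value : ∀ xs → written (bits (digits xs)) ≡ encodeℕ (pred (value xs))
written-value xs = trans (written-digitsᵇ (bits (digits xs)))
  (cong encodeℕᵇ (sym (trans (cong ℕᵇ.fromℕ (proj₁ (value-digits xs))) (ℕᵇ.fromℕ-toℕ _))))

-- Simulation of register programs by clocked programs.

compileArith : ∀ {m q} → Polynomial → Arith m q → Clocked (3 + (m + q))
compileArith         p nil             = nop
compileArith         p (c ›› c′)       = compileArith p c ▸ compileArith p c′
compileArith         p (loop c)        = rep (compileArith p c)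
compileArith {q = q} p (clear i)       = clearR p (i ↑ˡ q)
-- The lowest of the zeros just written is exchanged for a one, for which the width must be at least
-- 1.
compileArith {q = q} p (unit i)        = clearR p (i ↑ˡ q) ▸ take (slot (i ↑ˡ q)) nop (λ _ → put (slot (i ↑ˡ q)) true)
compileArith {q = q} p (add i j)       = addR p (i ↑ˡ q) (j ↑ˡ q)
compileArith {q = q} p (ifLe i j c c′) = branchR p (i ↑ˡ q) (j ↑ˡ q) (compileArith p c) (compileArith p c′)
compileArith {m}     p (popS s c f)    = take (slot (m ↑ʳ s)) (compileArith p c) (λ b → compileArith p (f b))
compileArith {m}     p (pushS s b)     = put (slot (m ↑ʳ s)) b
compileArith {m} {q} p (emit i s)      = emitR p (i ↑ˡ q) (m ↑ʳ s)

record Represents (L : ℕ) (xs : List Bool) (v : ℕ) : Set where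
  constructor represents
  field
    width   : length xs ≡ L
    correct : value xs ≡ v

Representsᵛ : ∀ {m} → ℕ → Stacks m → Vec ℕ m → Set
Representsᵛ L = Pointwise (Represents L)

represents-update : ∀ {m L} {xss : Stacks m} {r} i {xs v} → Representsᵛ L xss r → Represents L xs v → Representsᵛ L (xss [ i ]≔ xs) (r [ i ]≔ v)
represents-update zero    (h ∷ hs) h′ = h′ ∷ hs
represents-update (suc i) (h ∷ hs) h′ = h ∷ represents-update i hs h′

record Bounded {m : ℕ} (e : ℕ) (r : Vec ℕ m) : Set where
  constructor bounded
  field
    bound-at : ∀ i → lookup r i < 2 ^ e

open Bounded

bounded-update : ∀ {m e} {r : Vec ℕ m} j {v} → Bounded e r → v < 2 ^ e → Bounded e (r [ j ]≔ v)
bounded-update {e = e} {r} j {v} h hv = bounded go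
  where
  go : ∀ i → lookup (r [ j ]≔ v) i < 2 ^ e
  go i with i Fin.≟ j
  ... | yes refl rewrite Vec.lookup∘update i r v = hv
  ... | no i≢j   rewrite Vec.lookup∘update′ i≢j r v = bound-at h i

bounded-mono : ∀ {m e e′} {r : Vec ℕ m} → e ≤ e′ → Bounded e r → Bounded e′ r
bounded-mono le h = bounded λ i → <-≤-trans (bound-at h i) (^-monoʳ-≤ 2 le)

sum-bounded : ∀ {a b} e → a < 2 ^ e → b < 2 ^ e → a + b < 2 ^ suc e
sum-bounded e ha hb = <-≤-trans (+-mono-< ha hb) (≤-reflexive (cong (2 ^ e +_) (sym (+-identityʳ _))))

growth : ∀ {m q} (c : Arith m q) n {e} σ → 1 ≤ e → Bounded e (regs σ) → Bounded (e + eval (additions c) n) (regs (⟪ c ⟫ n σ))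
growth-iter : ∀ {m q} (c : Arith m q) n k {e} σ → 1 ≤ e → Bounded e (regs σ) → Bounded (e + k * eval (additions c) n) (regs (iter k (⟪ c ⟫ n) σ))
growth nil             n {e} σ       1≤e h = bounded-mono (m≤m+n e _) h
growth (c ›› c′)       n {e} σ       1≤e h = bounded-mono (≤-reflexive (trans (+-assoc e _ _) (cong (e +_) (sym (eval-⊞ (additions c) (additions c′) n)))))
                                             (growth c′ n (⟪ c ⟫ n σ) (≤-trans 1≤e (m≤m+n _ _)) (growth c n σ 1≤e h))
growth (loop c)        n     σ       1≤e h = growth-iter c n n σ 1≤e h
growth (clear i)       n {e} (r ∣ s) 1≤e h = bounded-mono (m≤m+n e _) (bounded-update {e = e} i h (m^n>0 2 e))
growth (unit i)        n {e} (r ∣ s) 1≤e h = bounded-mono (m≤m+n e _) (bounded-update {e = e} i h (^-monoʳ-≤ 2 1≤e))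
growth (add i j)       n {e} (r ∣ s) 1≤e h = bounded-mono (≤-trans (≤-reflexive (+-comm 1 e)) (+-monoʳ-≤ e (s≤s z≤n)))
                                             (bounded-update {e = suc e} j (bounded-mono (n≤1+n e) h) (sum-bounded e (bound-at h j) (bound-at h i)))
growth (ifLe i j c c′) n {e} (r ∣ s) 1≤e h with lookup r i ≤ᵇ lookup r j
... | true  = bounded-mono (+-monoʳ-≤ e (eval-⊞≥ˡ (additions c) _ n)) (growth c n (r ∣ s) 1≤e h)
... | false = bounded-mono (+-monoʳ-≤ e (eval-⊞≥ʳ (additions c) _ n)) (growth c′ n (r ∣ s) 1≤e h)
growth (popS i c f)    n {e} (r ∣ s) 1≤e h with lookup s i
... | []         = bounded-mono (+-monoʳ-≤ e (eval-⊞≥ˡ (additions c) _ n)) (growth c n (r ∣ s) 1≤e h)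
... | false ∷ bs = bounded-mono (+-monoʳ-≤ e (≤-trans (eval-⊞≥ˡ (additions (f false)) _ n) (eval-⊞≥ʳ (additions c) _ n))) (growth (f false) n (r ∣ (s [ i ]≔ bs)) 1≤e h)
... | true ∷ bs  = bounded-mono (+-monoʳ-≤ e (≤-trans (eval-⊞≥ʳ (additions (f false)) _ n) (eval-⊞≥ʳ (additions c) _ n))) (growth (f true) n (r ∣ (s [ i ]≔ bs)) 1≤e h)
growth (pushS i b)     n {e} (r ∣ s) 1≤e h = bounded-mono (m≤m+n e _) h
growth (emit i j)      n {e} (r ∣ s) 1≤e h = bounded-mono (m≤m+n e _) h
growth-iter c n zero    {e} σ 1≤e h = bounded-mono (m≤m+n e 0) h
growth-iter c n (suc k) {e} σ 1≤e h = bounded-mono (≤-reflexive (+-assoc e _ _)) (growth-iter c n k (⟪ c ⟫ n σ) (≤-trans 1≤e (m≤m+n _ _)) (growth c n σ 1≤e h))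

layout : ∀ {m q} → Stacks m → Stacks q → Stacks (3 + (m + q))
layout xss s = [] ∷ [] ∷ [] ∷ (xss Vec.++ s)

module Simulation {m q : ℕ} (p : Polynomial) (n : ℕ) (1≤L : 1 ≤ eval p n) where

  open Registers {m + q} p n

  Simulates : Clocked (3 + (m + q)) → Arith m q → Stacks m → Store m q → Set
  Simulates h c xss σ = ∃[ xss′ ] ⟦ h ⟧ n (layout xss (stks σ)) ≡ layout xss′ (stks (⟪ c ⟫ n σ)) × Representsᵛ L xss′ (regs (⟪ c ⟫ n σ))

  width-at : ∀ {xss : Stacks m} {r} (s : Stacks q) i → Representsᵛ L xss r → length (lookup (xss Vec.++ s) (i ↑ˡ q)) ≡ L
  width-at {xss} s i reps = trans (cong length (Vec.lookup-++ˡ xss s i)) (Represents.width (Pointwise.lookup reps i))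

  -- `e` bounds the bits in use now and grows by one with each addition. As long as `e` plus the
  -- additions still to come stays within the width, no addition overflows.
  simulation : ∀ (c : Arith m q) {e xss} σ → 1 ≤ e → e + eval (additions c) n ≤ L → Bounded e (regs σ) → Representsᵛ L xss (regs σ) →
               Simulates (compileArith p c) c xss σ
  simulation-iter : ∀ (c : Arith m q) k {e xss} σ → 1 ≤ e → e + k * eval (additions c) n ≤ L → Bounded e (regs σ) → Representsᵛ L xss (regs σ) →
    ∃[ xss′ ] iter k (⟦ compileArith p c ⟧ n) (layout xss (stks σ)) ≡ layout xss′ (stks (iter k (⟪ c ⟫ n) σ)) × Representsᵛ L xss′ (regs (iter k (⟪ c ⟫ n) σ))

  simulation nil σ 1≤e le b reps = _ , refl , reps
  simulation (c ›› c′) {e} σ 1≤e le b reps rewrite eval-⊞ (additions c) (additions c′) n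
    with simulation c σ 1≤e (≤-trans (+-monoʳ-≤ e (m≤m+n _ _)) le) b reps
  ... | xss₁ , eq₁ , reps₁
    with simulation c′ {e = e + eval (additions c) n} (⟪ c ⟫ n σ) (≤-trans 1≤e (m≤m+n _ _)) (≤-trans (≤-reflexive (+-assoc e _ _)) le) (growth c n σ 1≤e b) reps₁
  ... | xss₂ , eq₂ , reps₂ = xss₂ , trans (cong (⟦ compileArith p c′ ⟧ n) eq₁) eq₂ , reps₂
  simulation (loop c) σ 1≤e le b reps = simulation-iter c n σ 1≤e le b reps
  simulation (clear i) {xss = xss} (r ∣ s) 1≤e le b reps =
    xss [ i ]≔ replicate L false ,
    trans (clearR-sem (i ↑ˡ q) (xss Vec.++ s) (≤-reflexive (width-at s i reps))) (cong (λ u → [] ∷ [] ∷ [] ∷ u) (Vec.[]≔-++-↑ˡ xss s i)) ,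
    represents-update i reps (represents (List.length-replicate L) (value-zeros L))
  simulation (unit i) {xss = xss} (r ∣ s) 1≤e le b reps = xss [ i ]≔ (true ∷ replicate l false) ,
    trans (cong (⟦ take (slot (i ↑ˡ q)) nop (λ _ → put (slot (i ↑ˡ q)) true) ⟧ n)
            (trans (clearR-sem j (xss Vec.++ s) (≤-reflexive (width-at s i reps))) (cong (λ k → [] ∷ [] ∷ [] ∷ ((xss Vec.++ s) [ j ]≔ replicate k false)) L≡)))
   (trans (top (xss Vec.++ s)) (cong (λ u → [] ∷ [] ∷ [] ∷ u) (Vec.[]≔-++-↑ˡ xss s i))) ,
    represents-update i reps (represents (trans (cong suc (List.length-replicate l)) (sym L≡)) (cong (λ v → suc (2 * v)) (value-zeros l)))
    where
    j : Fin (m + q)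
    j = i ↑ˡ q
    l : ℕ
    l = pred L
    L≡ : L ≡ suc l
    L≡ = sym (suc-pred L ⦃ >-nonZero 1≤L ⦄)
    top : ∀ (ρ : Stacks (m + q)) → ⟦ take (slot j) nop (λ _ → put (slot j) true) ⟧ n ([] ∷ [] ∷ [] ∷ (ρ [ j ]≔ (false ∷ replicate l false)))
                  ≡ [] ∷ [] ∷ [] ∷ (ρ [ j ]≔ (true ∷ replicate l false))
    top ρ rewrite Vec.lookup∘update j ρ (false ∷ replicate l false) | Vec.[]≔-idempotent {x = false ∷ replicate l false} {y = replicate l false} ρ j
      | Vec.lookup∘update j ρ (replicate l false) | Vec.[]≔-idempotent {x = replicate l false} {y = true ∷ replicate l false} ρ j = refl
  simulation (add i j) {e} {xss} (r ∣ s) 1≤e le b reps =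
    xss [ j ]≔ addBits false (lookup xss i) (lookup xss j) ,
    trans (addR-sem (i ↑ˡ q) (j ↑ˡ q) (xss Vec.++ s) (width-at s i reps) (width-at s j reps))
          (cong (λ u → [] ∷ [] ∷ [] ∷ u) (trans (Vec.[]≔-++-↑ˡ xss s j)
             (cong₂ (λ a b → (xss [ j ]≔ addBits false a b) Vec.++ s) (Vec.lookup-++ˡ xss s i) (Vec.lookup-++ˡ xss s j)))) ,
    represents-update j reps (represents
      (trans (length-addBits false (lookup xss i) (lookup xss j) (trans wi (sym wj))) wi)
      (trans (value-addBits-exact (lookup xss i) (lookup xss j) wi wj small) (trans (cong₂ _+_ vi vj) (+-comm (lookup r i) (lookup r j)))))
    where
    wi : length (lookup xss i) ≡ L
    wi = Represents.width (Pointwise.lookup reps i)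
    wj : length (lookup xss j) ≡ L
    wj = Represents.width (Pointwise.lookup reps j)
    vi : value (lookup xss i) ≡ lookup r i
    vi = Represents.correct (Pointwise.lookup reps i)
    vj : value (lookup xss j) ≡ lookup r j
    vj = Represents.correct (Pointwise.lookup reps j)
    small : value (lookup xss i) + value (lookup xss j) < 2 ^ L
    small rewrite vi | vj = <-≤-trans (sum-bounded e (bound-at b i) (bound-at b j)) (^-monoʳ-≤ 2 (≤-trans (≤-trans (≤-reflexive (+-comm 1 e)) (+-monoʳ-≤ e (s≤s z≤n))) le))
  simulation (ifLe i j c c′) {e} {xss} (r ∣ s) 1≤e le b reps
    rewrite branchR-sem (i ↑ˡ q) (j ↑ˡ q) (compileArith p c) (compileArith p c′) (xss Vec.++ s) (width-at s i reps) (width-at s j reps)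
          | Vec.lookup-++ˡ xss s i | Vec.lookup-++ˡ xss s j
          | leBits-≤ᵇ (lookup xss i) (lookup xss j) (trans (Represents.width (Pointwise.lookup reps i)) (sym (Represents.width (Pointwise.lookup reps j))))
          | Represents.correct (Pointwise.lookup reps i) | Represents.correct (Pointwise.lookup reps j)
    with lookup r i ≤ᵇ lookup r j
  ... | true  = simulation c (r ∣ s) 1≤e (≤-trans (+-monoʳ-≤ e (eval-⊞≥ˡ (additions c) _ n)) le) b reps
  ... | false = simulation c′ (r ∣ s) 1≤e (≤-trans (+-monoʳ-≤ e (eval-⊞≥ʳ (additions c) _ n)) le) b reps
  simulation (popS i c f) {e} {xss} (r ∣ s) 1≤e le b reps rewrite Vec.lookup-++ʳ xss s i with lookup s i
  ... | []     = simulation c (r ∣ s) 1≤e (≤-trans (+-monoʳ-≤ e (eval-⊞≥ˡ (additions c) _ n)) le) b reps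
  ... | false ∷ bs rewrite Vec.[]≔-++-↑ʳ {y = bs} xss s i = simulation (f false) (r ∣ (s [ i ]≔ bs)) 1≤e (≤-trans (+-monoʳ-≤ e (≤-trans (eval-⊞≥ˡ (additions (f false)) _ n) (eval-⊞≥ʳ (additions c) _ n))) le) b reps
  ... | true ∷ bs  rewrite Vec.[]≔-++-↑ʳ {y = bs} xss s i = simulation (f true) (r ∣ (s [ i ]≔ bs)) 1≤e (≤-trans (+-monoʳ-≤ e (≤-trans (eval-⊞≥ʳ (additions (f false)) _ n) (eval-⊞≥ʳ (additions c) _ n))) le) b reps
  simulation (pushS i b) {xss = xss} (r ∣ s) 1≤e le bd reps = xss ,
    cong (λ u → [] ∷ [] ∷ [] ∷ u) (trans (Vec.[]≔-++-↑ʳ xss s i) (cong (λ bs → xss Vec.++ (s [ i ]≔ (b ∷ bs))) (Vec.lookup-++ʳ xss s i))) , reps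
  simulation (emit i j) {xss = xss} (r ∣ s) 1≤e le b reps = xss ,
    trans (emitR-sem (i ↑ˡ q) (m ↑ʳ j) (xss Vec.++ s) (≤-reflexive (width-at s i reps)))
          (cong (λ u → [] ∷ [] ∷ [] ∷ u) (trans (Vec.[]≔-++-↑ʳ xss s j)
             (cong₂ (λ a b → xss Vec.++ (s [ j ]≔ (a List.ʳ++ b))) out (Vec.lookup-++ʳ xss s j)))) , reps
    where
    out : written (bits (digits (lookup (xss Vec.++ s) (i ↑ˡ q)))) ≡ encodeℕ (pred (lookup r i))
    out = trans (cong (λ xs → written (bits (digits xs))) (Vec.lookup-++ˡ xss s i))
                (trans (written-value (lookup xss i)) (cong (λ v → encodeℕ (pred v)) (Represents.correct (Pointwise.lookup reps i))))

  simulation-iter c zero    σ 1≤e le b reps = _ , refl , reps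
  simulation-iter c (suc k) {e} σ 1≤e le b reps
    with simulation c σ 1≤e (≤-trans (+-monoʳ-≤ e (m≤m+n _ _)) le) b reps
  ... | xss₁ , eq₁ , reps₁
    with simulation-iter c k {e = e + eval (additions c) n} (⟪ c ⟫ n σ) (≤-trans 1≤e (m≤m+n _ _)) (≤-trans (≤-reflexive (+-assoc e _ _)) le) (growth c n σ 1≤e b) reps₁
  ... | xss₂ , eq₂ , reps₂ = xss₂ , trans (cong (iter k (⟦ compileArith p c ⟧ n)) eq₁) eq₂ , reps₂

polyTime-cong : ∀ {m} {f g : Vec (List Bool) (suc m) → List Bool} → (∀ ws → f ws ≡ g ws) → PolyTime f → PolyTime g
polyTime-cong e (M , p , correct) = M , p , λ ws → trans (correct ws) (cong just (e ws))

arithResult : ∀ {m q i} → Arith m q → (Fin i → Fin q) → Fin q → Vec (List Bool) i → List Bool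
arithResult {m} {q} c ι o ws =
  reverse (lookup (stks (⟪ c ⟫ (totalLength ws) (Vec.replicate m 0 ∣ loaded ι ws (Vec.replicate q [])))) o)

arith-polyTime : ∀ {m q i} (c : Arith m q) (ι : Fin (suc i) → Fin q) (o : Fin q) → PolyTime (arithResult c ι o)
arith-polyTime {m} {q} {i} c ι o = polyTime-cong result-eq (clocked-polyTime prog (λ j → slot (m ↑ʳ ι j)) (slot (m ↑ʳ o)))
  where
  -- The registers start at 0, which is below 2 ^ 1; hence one bit and one more for each addition.
  p : Polynomial
  p = (1 ∷ []) ⊞ additions c
  clearAll : (k : ℕ) → (Fin k → Fin (m + q)) → Clocked (3 + (m + q))
  clearAll zero    f = nop
  clearAll (suc k) f = clearR p (f zero) ▸ clearAll k (f ∘ suc)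
  -- The stacks that represent registers are empty at the start and must first be brought to full
  -- width.
  prog : Clocked (3 + (m + q))
  prog = clearAll m (_↑ˡ q) ▸ compileArith p c
  load-eq : ∀ {i} (ι : Fin i → Fin q) ws s → loaded (λ j → slot (m ↑ʳ ι j)) ws (layout (Vec.replicate m []) s) ≡ layout (Vec.replicate m []) (loaded ι ws s)
  load-eq ι []       s = refl
  load-eq ι (w ∷ ws) s = trans
    (cong (loaded (λ j → slot (m ↑ʳ ι (suc j))) ws)
      (cong (λ u → [] ∷ [] ∷ [] ∷ u) (trans (Vec.[]≔-++-↑ʳ (Vec.replicate m []) s (ι zero))
        (cong (λ bs → Vec.replicate m [] Vec.++ (s [ ι zero ]≔ (w List.ʳ++ bs))) (Vec.lookup-++ʳ (Vec.replicate m []) s (ι zero))))))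
    (load-eq (ι ∘ suc) ws _)
  clear-sem : ∀ n k (f : Fin k → Fin (m + q)) ρ → (∀ i → length (lookup ρ (f i)) ≤ eval p n) → (∀ {i j} → f i ≡ f j → i ≡ j) →
    ∃[ ρ′ ] ⟦ clearAll k f ⟧ n ([] ∷ [] ∷ [] ∷ ρ) ≡ [] ∷ [] ∷ [] ∷ ρ′ × (∀ i → lookup ρ′ (f i) ≡ replicate (eval p n) false) × (∀ j → (∀ i → f i ≢ j) → lookup ρ′ j ≡ lookup ρ j)
  clear-sem n zero    f ρ short inj = ρ , refl , (λ ()) , λ _ _ → refl
  clear-sem n (suc k) f ρ short inj
    with clear-sem n k (f ∘ suc) (ρ [ f zero ]≔ replicate (eval p n) false)
           (λ i → ≤-trans (≤-reflexive (cong length (Vec.lookup∘update′ (λ e → case inj e of λ ()) ρ _))) (short (suc i))) (λ e → Fin.suc-injective (inj e))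
  ... | ρ′ , eq , cleared , kept = ρ′ , trans (cong (⟦ clearAll k (f ∘ suc) ⟧ n) (Registers.clearR-sem p n (f zero) ρ (short zero))) eq ,
    (λ { zero → trans (kept (f zero) (λ i e → case inj e of λ ())) (Vec.lookup∘update (f zero) ρ _) ; (suc i) → cleared i }) ,
    λ j ne → trans (kept j (ne ∘ suc)) (Vec.lookup∘update′ (λ e → ne zero (sym e)) ρ _)
  cleared-eq : ∀ n s → ⟦ clearAll m (_↑ˡ q) ⟧ n (layout (Vec.replicate m []) s) ≡ layout (Vec.replicate m (replicate (eval p n) false)) s
  cleared-eq n s with clear-sem n m (_↑ˡ q) (Vec.replicate m [] Vec.++ s)
    (λ i → ≤-trans (≤-reflexive (cong length (trans (Vec.lookup-++ˡ (Vec.replicate m []) s i) (Vec.lookup-replicate i [])))) z≤n) (λ {i} {j} → Fin.↑ˡ-injective q i j)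
  ... | ρ′ , eq , cleared , kept = trans eq (cong (λ u → [] ∷ [] ∷ [] ∷ u) (trans (sym (Vec.tabulate∘lookup ρ′)) (trans (Vec.tabulate-cong pointwise) (Vec.tabulate∘lookup _))))
    where
    pointwise : ∀ j → lookup ρ′ j ≡ lookup (Vec.replicate m (replicate (eval p n) false) Vec.++ s) j
    pointwise j with Fin.splitAt m j in spl
    ... | inj₁ i = trans (cong (lookup ρ′) (sym (Fin.splitAt⁻¹-↑ˡ spl))) (trans (cleared i) (sym (trans (cong (lookup (Vec.replicate m _ Vec.++ s)) (sym (Fin.splitAt⁻¹-↑ˡ spl))) (trans (Vec.lookup-++ˡ (Vec.replicate m _) s i) (Vec.lookup-replicate i _)))))
    ... | inj₂ i = trans (cong (lookup ρ′) (sym j≡)) (trans (kept (m ↑ʳ i) (λ k e → case trans (sym (Fin.splitAt-↑ˡ m k q)) (trans (cong (Fin.splitAt m) e) (Fin.splitAt-↑ʳ m q i)) of λ ()))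
                     (trans (Vec.lookup-++ʳ (Vec.replicate m []) s i) (sym (trans (cong (lookup (Vec.replicate m _ Vec.++ s)) (sym j≡)) (Vec.lookup-++ʳ (Vec.replicate m _) s i)))))
      where
      j≡ : m ↑ʳ i ≡ j
      j≡ = Fin.splitAt⁻¹-↑ʳ spl
  result-eq : ∀ ws → result prog (λ j → slot (m ↑ʳ ι j)) (slot (m ↑ʳ o)) ws ≡ arithResult c ι o ws
  result-eq ws with Simulation.simulation p n 1≤L c {e = 1} (Vec.replicate m 0 ∣ s₀) (s≤s z≤n) width-ok (bounded λ i → subst (_< 2) (sym (Vec.lookup-replicate i 0)) (s≤s z≤n)) (zeros m)
    where
    n : ℕ
    n = totalLength ws
    s₀ : Stacks q
    s₀ = loaded ι ws (Vec.replicate q [])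
    1≤L : 1 ≤ eval p n
    1≤L = ≤-trans (s≤s z≤n) (eval-suc (additions c) n)
    width-ok : 1 + eval (additions c) n ≤ eval p n
    width-ok = eval-suc (additions c) n
    zeros : ∀ m → Representsᵛ (eval p n) (Vec.replicate m (replicate (eval p n) false)) (Vec.replicate m 0)
    zeros zero    = []
    zeros (suc m) = represents (List.length-replicate (eval p n)) (value-zeros (eval p n)) ∷ zeros m
  ... | xss′ , eq , _ = cong reverse (trans (cong (λ u → lookup u (slot (m ↑ʳ o))) (trans start eq)) (Vec.lookup-++ʳ xss′ _ o))
    where
    n : ℕ
    n = totalLength ws
    replicate-layout : ∀ m → Vec.replicate (m + q) [] ≡ Vec.replicate m [] Vec.++ Vec.replicate q []
    replicate-layout zero    = refl
    replicate-layout (suc m) = cong ([] ∷_) (replicate-layout m)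
    start : ⟦ prog ⟧ n (loaded (λ j → slot (m ↑ʳ ι j)) ws (Vec.replicate (3 + (m + q)) [])) ≡ ⟦ compileArith p c ⟧ n (layout (Vec.replicate m (replicate (eval p n) false)) (loaded ι ws (Vec.replicate q [])))
    start = cong (⟦ compileArith p c ⟧ n) (trans (cong (λ u → ⟦ clearAll m (_↑ˡ q) ⟧ n u)
              (trans (cong (λ u → loaded (λ j → slot (m ↑ʳ ι j)) ws ([] ∷ [] ∷ [] ∷ u)) (replicate-layout m)) (load-eq ι ws (Vec.replicate q []))))
              (cleared-eq n (loaded ι ws (Vec.replicate q []))))

-- Feasible schedules in integral units

data Kind : Set where
  mine idle other : Kind

kind : ∀ {n} → Fin n → Maybe (Fin n) → Kind
kind k nothing  = idle
kind k (just i) = if does (i Fin.≟ k) then mine else other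

-- The conditions on a single job with processing time T, arrival A and
-- deadline D, segment by segment: τ is the time and y the amount processed
-- so far.  The job is never executable again in the state Dead.
module Check {C : Set} (_⊕_ : C → C → C) (_≼_ _≺_ : C → C → Set) where

  Dead : (T A D τ y : C) → Set
  Dead T A D τ y = T ≼ y ⊎ (D ⊕ y) ≺ (τ ⊕ T) ⊎ (D ⊕ y) ≺ (A ⊕ T)

  Allowed : Kind → (T A D τ y x : C) → Set
  Allowed mine  T A D τ y x = A ≼ τ × (y ⊕ x) ≼ T × (τ ⊕ T) ≼ (D ⊕ y)
  Allowed idle  T A D τ y x = (τ ⊕ x) ≼ A ⊎ Dead T A D τ y
  Allowed other T A D τ y x = ⊤

  credit : Kind → C → C → C
  credit mine y x = y ⊕ x
  credit _    y x = y

  Ok : (T A D τ y : C) → List (Kind × C) → Set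
  Ok T A D τ y []            = Dead T A D τ y
  Ok T A D τ y ((κ , x) ∷ σ) = Allowed κ T A D τ y x × Ok T A D (τ ⊕ x) (credit κ y x) σ

open Check {ℕ} _+_ _≤_ _<_

module Qᶜ = Check {ℚ} ℚ._+_ ℚ._≤_ ℚ._<_

-- The reason for keeping `Check` abstract. It is applied to the passage from integral units to
-- rationals and to the evaluation of linear forms.
module Transfer {C E : Set} (_⊕_ : C → C → C) (_≼_ _≺_ : C → C → Set) (_⊕′_ : E → E → E) (_≼′_ _≺′_ : E → E → Set)
                (ι : C → E) (ι-⊕ : ∀ x y → ι (x ⊕ y) ≡ (ι x ⊕′ ι y))
                (ι-≼ : ∀ {x y} → (x ≼ y) ⇔ (ι x ≼′ ι y)) (ι-≺ : ∀ {x y} → (x ≺ y) ⇔ (ι x ≺′ ι y)) where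

  open Equivalence using (to; from)
  module S = Check _⊕_ _≼_ _≺_
  module S′ = Check _⊕′_ _≼′_ _≺′_

  dead→ : ∀ {T A D τ y} → S.Dead T A D τ y → S′.Dead (ι T) (ι A) (ι D) (ι τ) (ι y)
  dead→ (inj₁ h) = inj₁ (to ι-≼ h)
  dead→ {T} {A} {D} {τ} {y} (inj₂ (inj₁ h)) = inj₂ (inj₁ (subst₂ _≺′_ (ι-⊕ D y) (ι-⊕ τ T) (to ι-≺ h)))
  dead→ {T} {A} {D} {τ} {y} (inj₂ (inj₂ h)) = inj₂ (inj₂ (subst₂ _≺′_ (ι-⊕ D y) (ι-⊕ A T) (to ι-≺ h)))

  dead← : ∀ {T A D τ y} → S′.Dead (ι T) (ι A) (ι D) (ι τ) (ι y) → S.Dead T A D τ y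
  dead← (inj₁ h) = inj₁ (from ι-≼ h)
  dead← {T} {A} {D} {τ} {y} (inj₂ (inj₁ h)) = inj₂ (inj₁ (from ι-≺ (subst₂ _≺′_ (sym (ι-⊕ D y)) (sym (ι-⊕ τ T)) h)))
  dead← {T} {A} {D} {τ} {y} (inj₂ (inj₂ h)) = inj₂ (inj₂ (from ι-≺ (subst₂ _≺′_ (sym (ι-⊕ D y)) (sym (ι-⊕ A T)) h)))

  allowed→ : ∀ κ {T A D τ y x} → S.Allowed κ T A D τ y x → S′.Allowed κ (ι T) (ι A) (ι D) (ι τ) (ι y) (ι x)
  allowed→ mine {T} {A} {D} {τ} {y} {x} (h₁ , h₂ , h₃) =
    to ι-≼ h₁ , subst (_≼′ ι T) (ι-⊕ y x) (to ι-≼ h₂) , subst₂ _≼′_ (ι-⊕ τ T) (ι-⊕ D y) (to ι-≼ h₃)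
  allowed→ idle {A = A} {τ = τ} {x = x} (inj₁ h) = inj₁ (subst (_≼′ ι A) (ι-⊕ τ x) (to ι-≼ h))
  allowed→ idle (inj₂ h) = inj₂ (dead→ h)
  allowed→ other _ = tt

  allowed← : ∀ κ {T A D τ y x} → S′.Allowed κ (ι T) (ι A) (ι D) (ι τ) (ι y) (ι x) → S.Allowed κ T A D τ y x
  allowed← mine {T} {A} {D} {τ} {y} {x} (h₁ , h₂ , h₃) =
    from ι-≼ h₁ , from ι-≼ (subst (_≼′ ι T) (sym (ι-⊕ y x)) h₂) , from ι-≼ (subst₂ _≼′_ (sym (ι-⊕ τ T)) (sym (ι-⊕ D y)) h₃)
  allowed← idle {A = A} {τ = τ} {x = x} (inj₁ h) = inj₁ (from ι-≼ (subst (_≼′ ι A) (sym (ι-⊕ τ x)) h))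
  allowed← idle (inj₂ h) = inj₂ (dead← h)
  allowed← other _ = tt

  credit-ι : ∀ κ y x → ι (S.credit κ y x) ≡ S′.credit κ (ι y) (ι x)
  credit-ι mine  y x = ι-⊕ y x
  credit-ι idle  y x = refl
  credit-ι other y x = refl

  scaled : List (Kind × C) → List (Kind × E)
  scaled = map (λ (κ , x) → κ , ι x)

  ok→ : ∀ {T A D τ y} σ → S.Ok T A D τ y σ → S′.Ok (ι T) (ι A) (ι D) (ι τ) (ι y) (scaled σ)
  ok→ []            h = dead→ h
  ok→ {T} {A} {D} {τ} {y} ((κ , x) ∷ σ) (h , hs) = allowed→ κ h ,
    subst₂ (λ τ y → S′.Ok (ι T) (ι A) (ι D) τ y (scaled σ)) (ι-⊕ τ x) (credit-ι κ y x) (ok→ σ hs)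

  ok← : ∀ {T A D τ y} σ → S′.Ok (ι T) (ι A) (ι D) (ι τ) (ι y) (scaled σ) → S.Ok T A D τ y σ
  ok← []            h = dead← h
  ok← {T} {A} {D} {τ} {y} ((κ , x) ∷ σ) (h , hs) = allowed← κ h ,
    ok← σ (subst₂ (λ τ y → S′.Ok (ι T) (ι A) (ι D) τ y (scaled σ)) (sym (ι-⊕ τ x)) (sym (credit-ι κ y x)) hs)

ℚ-<⇒≱ : ∀ {p q} → p ℚ.< q → ¬ q ℚ.≤ p
ℚ-<⇒≱ p<q q≤p = ℚ.<-irrefl refl (ℚ.<-≤-trans p<q q≤p)

abstract

  frac : ℕ → ℕ → ℚ
  frac k m = ℤ.+ m ℚ./ suc k

  toℚᵘ-frac : ∀ k m → ℚ.toℚᵘ (frac k m) ℚᵘ.≃ ℚᵘ.mkℚᵘ (ℤ.+ m) k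
  toℚᵘ-frac k m = ℚ.toℚᵘ-fromℚᵘ (ℚᵘ.mkℚᵘ (ℤ.+ m) k)

  frac-+ : ∀ k m n → frac k (m + n) ≡ frac k m ℚ.+ frac k n
  frac-+ k m n = ℚ.toℚᵘ-injective (begin
    ℚ.toℚᵘ (frac k (m + n)) ≈⟨ toℚᵘ-frac k (m + n) ⟩
    ℚᵘ.mkℚᵘ (ℤ.+ (m + n)) k ≈⟨ ℚᵘ.*≡* (trans (sym (ℤ.pos-* (m + n) (suc k * suc k))) (trans (cong ℤ.+_ (lemma m n (suc k)))
        (trans (ℤ.pos-* (m * suc k + n * suc k) (suc k)) (cong (ℤ._* (ℤ.+ suc k)) (cong₂ ℤ._+_ (ℤ.pos-* m (suc k)) (ℤ.pos-* n (suc k))))))) ⟩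
    ℚᵘ.mkℚᵘ (ℤ.+ m) k ℚᵘ.+ ℚᵘ.mkℚᵘ (ℤ.+ n) k ≈⟨ ℚᵘ.+-cong (ℚᵘ.≃-sym (toℚᵘ-frac k m)) (ℚᵘ.≃-sym (toℚᵘ-frac k n)) ⟩
    ℚ.toℚᵘ (frac k m) ℚᵘ.+ ℚ.toℚᵘ (frac k n) ≈⟨ ℚᵘ.≃-sym (ℚ.toℚᵘ-homo-+ (frac k m) (frac k n)) ⟩
    ℚ.toℚᵘ (frac k m ℚ.+ frac k n) ∎)
    where
    open ℚᵘ.≃-Reasoning
    lemma : ∀ m n k → (m + n) * (k * k) ≡ (m * k + n * k) * k
    lemma = solve-∀

  frac-≤ : ∀ k {m n} → m ≤ n ⇔ frac k m ℚ.≤ frac k n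
  frac-≤ k {m} {n} = mk⇔
    (λ h → ℚ.toℚᵘ-cancel-≤ (ℚᵘ.≤-respʳ-≃ (ℚᵘ.≃-sym (toℚᵘ-frac k n)) (ℚᵘ.≤-respˡ-≃ (ℚᵘ.≃-sym (toℚᵘ-frac k m)) (ℚᵘ.*≤* (ℤ.*-monoʳ-≤-nonNeg (ℤ.+ suc k) (ℤ.+≤+ h))))))
    (λ h → case ℚᵘ.≤-respʳ-≃ (toℚᵘ-frac k n) (ℚᵘ.≤-respˡ-≃ (toℚᵘ-frac k m) (ℚ.toℚᵘ-mono-≤ h)) of λ
      { (ℚᵘ.*≤* h) → ℤ.drop‿+≤+ (ℤ.*-cancelʳ-≤-pos (ℤ.+ m) (ℤ.+ n) (ℤ.+ suc k) h) })

  frac-< : ∀ k {m n} → m < n ⇔ frac k m ℚ.< frac k n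
  frac-< k {m} {n} = mk⇔
    (λ h → ℚ.≰⇒> (λ h′ → <⇒≱ h (Equivalence.from (frac-≤ k) h′)))
    (λ h → ≰⇒> (λ h′ → ℚ-<⇒≱ h (Equivalence.to (frac-≤ k) h′)))

  -- The index `k + c * suc k` is one less than the denominator (k + 1) (c + 1).
  frac-rescale : ∀ k c m → frac k m ≡ frac (k + c * suc k) (suc c * m)
  frac-rescale k c m = ℚ.fromℚᵘ-cong {ℚᵘ.mkℚᵘ (ℤ.+ m) k} {ℚᵘ.mkℚᵘ (ℤ.+ (suc c * m)) (k + c * suc k)} (ℚᵘ.*≡* (trans (sym (ℤ.pos-* m (suc c * suc k))) (trans (cong ℤ.+_ (lemma m (suc c) (suc k))) (ℤ.pos-* (suc c * m) (suc k)))))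
    where
    lemma : ∀ m c k → m * (c * k) ≡ c * m * k
    lemma = solve-∀

  fromℕ-frac : ∀ k m → fromℕ m ≡ frac k (suc k * m)
  fromℕ-frac k m = trans (frac-rescale 0 k m) (cong (λ j → frac j (suc k * m)) (*-identityʳ k))

  positive-frac : ∀ p → 0ℚ ℚ.< p → ∃[ k ] ∃[ m ] p ≡ frac k m
  positive-frac p@(ℚ.mkℚ (ℤ.+ m) k _)      h = k , m , sym (ℚ.fromℚᵘ-toℚᵘ p)
  positive-frac p@(ℚ.mkℚ (ℤ.-[1+ m ]) k _) h = contradiction (ℚ.*≤* ℤ.-≤+) (ℚ-<⇒≱ h)

-- Feasibility at all times against the check at the ends of segments.

module Feasibility (tᵢ aᵢ dᵢ : ℚ) {n : ℕ} (k : Fin n) where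

  Exec : ℚ → ℚ → Set
  Exec τ y = aᵢ ℚ.≤ τ × y ℚ.< tᵢ × τ ℚ.≤ dᵢ ℚ.- tᵢ ℚ.+ y

  view : Schedule n → List (Kind × ℚ)
  view = map (λ s → kind k (Segment.activity s) , Segment.duration s)

  -- The feasibility conditions on job `k` for a schedule that starts at time `τ₀` with `y₀` units
  -- already processed; this generality makes induction on the segments possible.
  record Admissible (σ : Schedule n) (τ₀ y₀ : ℚ) : Set where
    field
      notExceeded : y₀ ℚ.+ y∞ σ k ℚ.≤ tᵢ
      executable  : ∀ τ → 0ℚ ℚ.≤ τ → activityAt σ τ ≡ just k → Exec (τ₀ ℚ.+ τ) (y₀ ℚ.+ Defs.y σ k τ)
      busy        : ∀ τ → 0ℚ ℚ.≤ τ → activityAt σ τ ≡ nothing → ¬ Exec (τ₀ ℚ.+ τ) (y₀ ℚ.+ Defs.y σ k τ)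
  open Admissible

  slack→ : ∀ {x z} → x ℚ.≤ dᵢ ℚ.- tᵢ ℚ.+ z → x ℚ.+ tᵢ ℚ.≤ dᵢ ℚ.+ z
  slack→ {x} {z} h = subst (x ℚ.+ tᵢ ℚ.≤_) (solve 3 (λ d t z → ((d :- t) :+ z) :+ t := d :+ z) refl dᵢ tᵢ z) (ℚ.+-monoˡ-≤ tᵢ h)
    where open ℚ-Solver

  slack← : ∀ {x z} → x ℚ.+ tᵢ ℚ.≤ dᵢ ℚ.+ z → x ℚ.≤ dᵢ ℚ.- tᵢ ℚ.+ z
  slack← {x} {z} h = subst₂ ℚ._≤_ (solve 2 (λ x t → (x :+ t) :- t := x) refl x tᵢ) (solve 3 (λ d t z → (d :+ z) :- t := (d :- t) :+ z) refl dᵢ tᵢ z) (ℚ.+-monoˡ-≤ (ℚ.- tᵢ) h)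
    where open ℚ-Solver

  dead-¬exec : ∀ {τ y τ₀} → Qᶜ.Dead tᵢ aᵢ dᵢ τ₀ y → τ₀ ℚ.≤ τ → ¬ Exec τ y
  dead-¬exec (inj₁ h)        le (_ , y<t , _) = ℚ-<⇒≱ y<t h
  dead-¬exec (inj₂ (inj₁ h)) le (_ , _ , τ≤)  = ℚ-<⇒≱ h (ℚ.≤-trans (ℚ.+-monoˡ-≤ tᵢ le) (slack→ τ≤))
  dead-¬exec (inj₂ (inj₂ h)) le (a≤ , _ , τ≤) = ℚ-<⇒≱ h (ℚ.≤-trans (ℚ.+-monoˡ-≤ tᵢ a≤) (slack→ τ≤))

  ¬exec-dead : ∀ {τ y} → aᵢ ℚ.≤ τ → ¬ Exec τ y → tᵢ ℚ.≤ y ⊎ dᵢ ℚ.+ y ℚ.< τ ℚ.+ tᵢ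
  ¬exec-dead {τ} {y} a≤ ¬e with tᵢ ℚ.≤? y
  ... | yes t≤y = inj₁ t≤y
  ... | no  t≰y = inj₂ (ℚ.≰⇒> (λ h → ¬e (a≤ , ℚ.≰⇒> t≰y , slack← h)))

  0≤diff : ∀ {x z} → x ℚ.≤ z → 0ℚ ℚ.≤ z ℚ.- x
  0≤diff {x} {z} h = subst (ℚ._≤ z ℚ.- x) (ℚ.+-inverseʳ x) (ℚ.+-monoˡ-≤ (ℚ.- x) h)

  plus-diff : ∀ x z → x ℚ.+ (z ℚ.- x) ≡ z
  plus-diff = solve 2 (λ x z → x :+ (z :- x) := z) refl
    where open ℚ-Solver

  ≤-+ : ∀ x {z} → 0ℚ ℚ.≤ z → x ℚ.≤ x ℚ.+ z
  ≤-+ x {z} h = subst (ℚ._≤ x ℚ.+ z) (ℚ.+-identityʳ x) (ℚ.+-monoʳ-≤ x h)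

  diff-nonpos : ∀ {τ x} → τ ℚ.≤ 0ℚ → 0ℚ ℚ.< x → τ ℚ.- x ℚ.≤ 0ℚ
  diff-nonpos {τ} {x} h p = subst (τ ℚ.- x ℚ.≤_) (ℚ.+-inverseʳ x) (ℚ.+-monoˡ-≤ (ℚ.- x) (ℚ.≤-trans h (ℚ.<⇒≤ p)))

  y-before : ∀ σ {τ} → τ ℚ.≤ 0ℚ → Defs.y σ k τ ≡ 0ℚ
  y-before []      h = refl
  y-before (s ∷ σ) {τ} h rewrite y-before σ (diff-nonpos h (Segment.positive s)) with processes s k
  ... | false = refl
  ... | true  = trans (ℚ.+-identityʳ _) (ℚ.p≥q⇒p⊔q≡p (ℚ.≤-trans (ℚ.p⊓q≤q (Segment.duration s) τ) h))

  share : Kind → ℚ → ℚ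
  share mine x = x
  share _    x = 0ℚ

  processes-kind : ∀ s x → (if processes s k then x else 0ℚ) ≡ share (kind k (Segment.activity s)) x
  processes-kind s x with Segment.activity s
  ... | nothing = refl
  ... | just i with does (i Fin.≟ k)
  ... | true  = refl
  ... | false = refl

  y-during : ∀ s σ {τ} → 0ℚ ℚ.≤ τ → τ ℚ.< Segment.duration s → Defs.y (s ∷ σ) k τ ≡ share (kind k (Segment.activity s)) τ
  y-during s σ {τ} 0≤τ τ<x = trans (cong₂ ℚ._+_ (trans (cong (λ z → if processes s k then z else 0ℚ)
      (trans (cong (0ℚ ℚ.⊔_) (ℚ.p≥q⇒p⊓q≡q (ℚ.<⇒≤ τ<x))) (ℚ.p≤q⇒p⊔q≡q 0≤τ))) (processes-kind s τ))
      (y-before σ (subst (τ ℚ.- Segment.duration s ℚ.≤_) (ℚ.+-inverseʳ (Segment.duration s)) (ℚ.+-monoˡ-≤ (ℚ.- Segment.duration s) (ℚ.<⇒≤ τ<x)))))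
    (ℚ.+-identityʳ _)

  y-after : ∀ s σ {τ} → Segment.duration s ℚ.≤ τ → Defs.y (s ∷ σ) k τ ≡ share (kind k (Segment.activity s)) (Segment.duration s) ℚ.+ Defs.y σ k (τ ℚ.- Segment.duration s)
  y-after s σ {τ} x≤τ = cong (ℚ._+ _) (trans (cong (λ z → if processes s k then z else 0ℚ)
      (trans (cong (0ℚ ℚ.⊔_) (ℚ.p≤q⇒p⊓q≡p x≤τ)) (ℚ.p≤q⇒p⊔q≡q (ℚ.<⇒≤ (Segment.positive s))))) (processes-kind s (Segment.duration s)))

  at-during : ∀ (s : Segment n) σ {τ} → τ ℚ.< Segment.duration s → activityAt (s ∷ σ) τ ≡ Segment.activity s
  at-during s σ {τ} h = cong (λ b → if b then Segment.activity s else activityAt σ (τ ℚ.- Segment.duration s)) (dec-true (τ ℚ.<? Segment.duration s) h)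

  at-after : ∀ (s : Segment n) σ {τ} → Segment.duration s ℚ.≤ τ → activityAt (s ∷ σ) τ ≡ activityAt σ (τ ℚ.- Segment.duration s)
  at-after s σ {τ} h = cong (λ b → if b then Segment.activity s else activityAt σ (τ ℚ.- Segment.duration s)) (dec-false (τ ℚ.<? Segment.duration s) (λ h′ → ℚ-<⇒≱ h′ h))

  credit-share : ∀ κ y x → Qᶜ.credit κ y x ≡ y ℚ.+ share κ x
  credit-share mine  y x = refl
  credit-share idle  y x = sym (ℚ.+-identityʳ y)
  credit-share other y x = sym (ℚ.+-identityʳ y)

  shift-y : ∀ s σ τ y₀ → 0ℚ ℚ.≤ τ → y₀ ℚ.+ Defs.y (s ∷ σ) k (Segment.duration s ℚ.+ τ) ≡ Qᶜ.credit (kind k (Segment.activity s)) y₀ (Segment.duration s) ℚ.+ Defs.y σ k τ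
  shift-y s σ τ y₀ 0≤τ = begin
    y₀ ℚ.+ Defs.y (s ∷ σ) k (x ℚ.+ τ) ≡⟨ cong (y₀ ℚ.+_) (y-after s σ (≤-+ x 0≤τ)) ⟩
    y₀ ℚ.+ (share κ x ℚ.+ Defs.y σ k (x ℚ.+ τ ℚ.- x)) ≡⟨ sym (ℚ.+-assoc y₀ _ _) ⟩
    y₀ ℚ.+ share κ x ℚ.+ Defs.y σ k (x ℚ.+ τ ℚ.- x) ≡⟨ cong₂ ℚ._+_ (sym (credit-share κ y₀ x)) (cong (Defs.y σ k) (solve 2 (λ x z → (x :+ z) :- x := z) refl x τ)) ⟩
    Qᶜ.credit κ y₀ x ℚ.+ Defs.y σ k τ ∎
    where
    open ≡-Reasoning
    open ℚ-Solver
    x : ℚ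
    x = Segment.duration s
    κ : Kind
    κ = kind k (Segment.activity s)

  shift-at : ∀ (s : Segment n) σ τ → 0ℚ ℚ.≤ τ → activityAt (s ∷ σ) (Segment.duration s ℚ.+ τ) ≡ activityAt σ τ
  shift-at s σ τ 0≤τ = trans (at-after s σ (≤-+ _ 0≤τ)) (cong (activityAt σ) (solve 2 (λ x z → (x :+ z) :- x := z) refl (Segment.duration s) τ))
    where open ℚ-Solver

  y∞-nonneg : ∀ σ → 0ℚ ℚ.≤ y∞ σ k
  y∞-nonneg []      = ℚ.≤-refl
  y∞-nonneg (s ∷ σ) = ℚ.+-mono-≤ nonneg (y∞-nonneg σ)
    where
    nonneg : 0ℚ ℚ.≤ (if processes s k then Segment.duration s else 0ℚ)
    nonneg with processes s k
    ... | true  = ℚ.<⇒≤ (Segment.positive s)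
    ... | false = ℚ.≤-refl

  y∞-cons : ∀ s σ y₀ → y₀ ℚ.+ y∞ (s ∷ σ) k ≡ Qᶜ.credit (kind k (Segment.activity s)) y₀ (Segment.duration s) ℚ.+ y∞ σ k
  y∞-cons s σ y₀ = trans (cong (λ z → y₀ ℚ.+ (z ℚ.+ y∞ σ k)) (processes-kind s (Segment.duration s)))
    (trans (sym (ℚ.+-assoc y₀ _ _)) (cong (ℚ._+ y∞ σ k) (sym (credit-share (kind k (Segment.activity s)) y₀ (Segment.duration s)))))

  admissible-tail : ∀ {s σ τ₀ y₀} → Admissible (s ∷ σ) τ₀ y₀ →
    Admissible σ (τ₀ ℚ.+ Segment.duration s) (Qᶜ.credit (kind k (Segment.activity s)) y₀ (Segment.duration s))
  admissible-tail {s} {σ} {τ₀} {y₀} F = record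
    { notExceeded = subst (ℚ._≤ tᵢ) (y∞-cons s σ y₀) (notExceeded F)
    ; executable  = λ τ 0≤τ e → subst₂ Exec (sym (ℚ.+-assoc τ₀ x τ)) (shift-y s σ τ y₀ 0≤τ) (executable F (x ℚ.+ τ) (0≤x+ 0≤τ) (trans (shift-at s σ τ 0≤τ) e))
    ; busy        = λ τ 0≤τ e → subst₂ (λ u v → ¬ Exec u v) (sym (ℚ.+-assoc τ₀ x τ)) (shift-y s σ τ y₀ 0≤τ) (busy F (x ℚ.+ τ) (0≤x+ 0≤τ) (trans (shift-at s σ τ 0≤τ) e))
    }
    where
    x : ℚ
    x = Segment.duration s
    0≤x+ : ∀ {τ} → 0ℚ ℚ.≤ τ → 0ℚ ℚ.≤ x ℚ.+ τ
    0≤x+ h = ℚ.≤-trans (ℚ.<⇒≤ (Segment.positive s)) (≤-+ x h)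

  -- The busy requirement is used at a single moment, the first one not before the arrival: without
  -- progress a job that has missed its latest start has missed it for good. `inside` holds of
  -- relative times at which the processor is known to idle and `y` to be 0.
  idle-dead : ∀ σ {τ₀ y₀} → Admissible σ τ₀ y₀ → (inside : ℚ → Set) →
    (∀ τ → 0ℚ ℚ.≤ τ → inside τ → activityAt σ τ ≡ nothing × Defs.y σ k τ ≡ 0ℚ) →
    inside 0ℚ → (τ₀ ℚ.< aᵢ → inside (aᵢ ℚ.- τ₀)) → Qᶜ.Dead tᵢ aᵢ dᵢ τ₀ y₀
  idle-dead σ {τ₀} {y₀} F inside h h₀ hₐ with aᵢ ℚ.≤? τ₀
  ... | yes a≤τ₀ = case ¬exec-dead a≤τ₀ (subst₂ (λ u v → ¬ Exec u v) (ℚ.+-identityʳ τ₀) (trans (cong (y₀ ℚ.+_) (proj₂ (h 0ℚ ℚ.≤-refl h₀))) (ℚ.+-identityʳ y₀))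
                     (busy F 0ℚ ℚ.≤-refl (proj₁ (h 0ℚ ℚ.≤-refl h₀)))) of λ { (inj₁ e) → inj₁ e ; (inj₂ e) → inj₂ (inj₁ e) }
  ... | no a≰τ₀ = case ¬exec-dead ℚ.≤-refl (subst₂ (λ u v → ¬ Exec u v) (plus-diff τ₀ aᵢ) (trans (cong (y₀ ℚ.+_) (proj₂ (h _ 0≤ (hₐ lt)))) (ℚ.+-identityʳ y₀))
                     (busy F (aᵢ ℚ.- τ₀) 0≤ (proj₁ (h _ 0≤ (hₐ lt))))) of λ { (inj₁ e) → inj₁ e ; (inj₂ e) → inj₂ (inj₂ e) }
    where
    lt : τ₀ ℚ.< aᵢ
    lt = ℚ.≰⇒> a≰τ₀
    0≤ : 0ℚ ℚ.≤ aᵢ ℚ.- τ₀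
    0≤ = 0≤diff (ℚ.<⇒≤ lt)

  admissible→ok : ∀ σ {τ₀ y₀} → Admissible σ τ₀ y₀ → Qᶜ.Ok tᵢ aᵢ dᵢ τ₀ y₀ (view σ)
  admissible→ok [] F = idle-dead [] F (λ _ → ⊤) (λ _ _ _ → refl , refl) tt (λ _ → tt)
  admissible→ok (s ∷ σ) {τ₀} {y₀} F = head , admissible→ok σ (admissible-tail F)
    where
    x : ℚ
    x = Segment.duration s
    head : Qᶜ.Allowed (kind k (Segment.activity s)) tᵢ aᵢ dᵢ τ₀ y₀ x
    head with Segment.activity s in act
    ... | nothing with τ₀ ℚ.+ x ℚ.≤? aᵢ
    ... | yes h = inj₁ h
    ... | no ¬h = inj₂ (idle-dead (s ∷ σ) F (ℚ._< x)
                    (λ τ 0≤τ τ<x → trans (at-during s σ τ<x) act , trans (y-during s σ 0≤τ τ<x) (cong (λ z → share (kind k z) τ) act))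
                    (Segment.positive s)
                    (λ _ → subst (aᵢ ℚ.- τ₀ ℚ.<_) (solve 2 (λ a b → (a :+ b) :- a := b) refl τ₀ x) (ℚ.+-monoˡ-< (ℚ.- τ₀) (ℚ.≰⇒> ¬h))))
      where open ℚ-Solver
    head | just i with i Fin.≟ k
    ... | no _     = tt
    ... | yes refl with executable F 0ℚ ℚ.≤-refl (trans (at-during s σ (Segment.positive s)) act)
    ... | a≤ , _ , τ≤ = subst (aᵢ ℚ.≤_) (ℚ.+-identityʳ τ₀) a≤ ,
      ℚ.≤-trans (≤-+ (y₀ ℚ.+ x) (y∞-nonneg σ)) (subst (ℚ._≤ tᵢ) (trans (y∞-cons s σ y₀) (cong (ℚ._+ y∞ σ k) is-mine)) (notExceeded F)) ,
      slack→ (subst₂ (λ u v → u ℚ.≤ dᵢ ℚ.- tᵢ ℚ.+ v) (ℚ.+-identityʳ τ₀) (trans (cong (y₀ ℚ.+_) y≡0) (ℚ.+-identityʳ y₀)) τ≤)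
      where
      share-0 : ∀ κ → share κ 0ℚ ≡ 0ℚ
      share-0 mine  = refl
      share-0 idle  = refl
      share-0 other = refl
      y≡0 : Defs.y (s ∷ σ) k 0ℚ ≡ 0ℚ
      y≡0 = trans (y-during s σ ℚ.≤-refl (Segment.positive s)) (share-0 (kind k (Segment.activity s)))
      is-mine : Qᶜ.credit (kind k (Segment.activity s)) y₀ x ≡ y₀ ℚ.+ x
      is-mine rewrite act with k Fin.≟ k
      ... | yes _ = refl
      ... | no ¬e = contradiction refl ¬e

  -- Checking the start of a segment suffices. While the job runs, time and amount processed grow at
  -- the same rate and the slack is constant; while the processor idles, a dead job remains dead.
  ok→admissible : ∀ σ {τ₀ y₀} → y₀ ℚ.≤ tᵢ → Qᶜ.Ok tᵢ aᵢ dᵢ τ₀ y₀ (view σ) → Admissible σ τ₀ y₀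
  ok→admissible [] {τ₀} {y₀} y₀≤t h = record
    { notExceeded = subst (ℚ._≤ tᵢ) (sym (ℚ.+-identityʳ y₀)) y₀≤t
    ; executable  = λ _ _ ()
    ; busy        = λ τ 0≤τ _ → subst (λ v → ¬ Exec (τ₀ ℚ.+ τ) v) (sym (ℚ.+-identityʳ y₀)) (dead-¬exec h (≤-+ τ₀ 0≤τ))
    }
  ok→admissible (s ∷ σ) {τ₀} {y₀} y₀≤t (h , hs) = record
    { notExceeded = subst (ℚ._≤ tᵢ) (sym (y∞-cons s σ y₀)) (notExceeded F)
    ; executable  = λ τ 0≤τ e → case-time τ 0≤τ e (λ τ<x e → during-executable τ 0≤τ τ<x e)
                      (λ x≤τ e → subst₂ Exec (shift-τ τ) (sym (shift-y′ τ x≤τ)) (executable F (τ ℚ.- x) (0≤diff x≤τ) e))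
    ; busy        = λ τ 0≤τ e → case-time τ 0≤τ e (λ τ<x e → during-busy τ 0≤τ τ<x e)
                      (λ x≤τ e → subst₂ (λ u v → ¬ Exec u v) (shift-τ τ) (sym (shift-y′ τ x≤τ)) (busy F (τ ℚ.- x) (0≤diff x≤τ) e))
    }
    where
    x : ℚ
    x = Segment.duration s
    κ : Kind
    κ = kind k (Segment.activity s)
    credit≤ : ∀ κ → Qᶜ.Allowed κ tᵢ aᵢ dᵢ τ₀ y₀ x → Qᶜ.credit κ y₀ x ℚ.≤ tᵢ
    credit≤ mine  (_ , h , _) = h
    credit≤ idle  _           = y₀≤t
    credit≤ other _           = y₀≤t
    F : Admissible σ (τ₀ ℚ.+ x) (Qᶜ.credit κ y₀ x)
    F = ok→admissible σ (credit≤ κ h) hs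
    shift-τ : ∀ τ → τ₀ ℚ.+ x ℚ.+ (τ ℚ.- x) ≡ τ₀ ℚ.+ τ
    shift-τ τ = solve 3 (λ a x z → (a :+ x) :+ (z :- x) := a :+ z) refl τ₀ x τ
      where open ℚ-Solver
    shift-y′ : ∀ τ → x ℚ.≤ τ → y₀ ℚ.+ Defs.y (s ∷ σ) k τ ≡ Qᶜ.credit κ y₀ x ℚ.+ Defs.y σ k (τ ℚ.- x)
    shift-y′ τ x≤τ = trans (cong (λ z → y₀ ℚ.+ Defs.y (s ∷ σ) k z) (sym (plus-diff x τ))) (shift-y s σ (τ ℚ.- x) y₀ (0≤diff x≤τ))
    case-time : ∀ {P : Set} {v} τ → 0ℚ ℚ.≤ τ → activityAt (s ∷ σ) τ ≡ v →
                (τ ℚ.< x → Segment.activity s ≡ v → P) → (x ℚ.≤ τ → activityAt σ (τ ℚ.- x) ≡ v → P) → P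
    case-time τ 0≤τ e f g with τ ℚ.<? x
    ... | yes h = f h (trans (sym (at-during s σ h)) e)
    ... | no ¬h = g (ℚ.≮⇒≥ ¬h) (trans (sym (at-after s σ (ℚ.≮⇒≥ ¬h))) e)
    during-executable : ∀ τ → 0ℚ ℚ.≤ τ → τ ℚ.< x → Segment.activity s ≡ just k → Exec (τ₀ ℚ.+ τ) (y₀ ℚ.+ Defs.y (s ∷ σ) k τ)
    during-executable τ 0≤τ τ<x act = subst (Exec (τ₀ ℚ.+ τ)) (cong (y₀ ℚ.+_) (sym (trans (y-during s σ 0≤τ τ<x) (cong (λ κ → share κ τ) κ≡)))) exec
      where
      κ≡ : κ ≡ mine
      κ≡ rewrite act with k Fin.≟ k
      ... | yes _ = refl
      ... | no ¬e = contradiction refl ¬e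
      exec : Exec (τ₀ ℚ.+ τ) (y₀ ℚ.+ τ)
      exec with subst (λ κ → Qᶜ.Allowed κ tᵢ aᵢ dᵢ τ₀ y₀ x) κ≡ h
      ... | a≤ , y≤ , τ≤ = ℚ.≤-trans a≤ (≤-+ τ₀ 0≤τ) , ℚ.<-≤-trans (ℚ.+-monoʳ-< y₀ τ<x) y≤ ,
        slack← (subst₂ ℚ._≤_ (solve 3 (λ a t z → (a :+ t) :+ z := (a :+ z) :+ t) refl τ₀ tᵢ τ) (ℚ.+-assoc dᵢ y₀ τ) (ℚ.+-monoˡ-≤ τ τ≤))
        where open ℚ-Solver
    during-busy : ∀ τ → 0ℚ ℚ.≤ τ → τ ℚ.< x → Segment.activity s ≡ nothing → ¬ Exec (τ₀ ℚ.+ τ) (y₀ ℚ.+ Defs.y (s ∷ σ) k τ)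
    during-busy τ 0≤τ τ<x act = subst (λ v → ¬ Exec (τ₀ ℚ.+ τ) v) (sym (trans (cong (y₀ ℚ.+_) (trans (y-during s σ 0≤τ τ<x) (cong (λ z → share (kind k z) τ) act))) (ℚ.+-identityʳ y₀)))
      (no-exec (subst (λ z → Qᶜ.Allowed (kind k z) tᵢ aᵢ dᵢ τ₀ y₀ x) act h))
      where
      no-exec : Qᶜ.Allowed idle tᵢ aᵢ dᵢ τ₀ y₀ x → ¬ Exec (τ₀ ℚ.+ τ) y₀
      no-exec (inj₁ τ+x≤a) (a≤ , _) = ℚ-<⇒≱ (ℚ.<-≤-trans (ℚ.+-monoʳ-< τ₀ τ<x) τ+x≤a) a≤
      no-exec (inj₂ dead)  e        = dead-¬exec dead (≤-+ τ₀ 0≤τ) e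

-- Schedules with integral durations.

Segs : ℕ → Set
Segs n = List (Maybe (Fin n) × ℕ)

viewFor : ∀ {n} → Fin n → Segs n → List (Kind × ℕ)
viewFor k = map (λ (i , x) → kind k i , x)

worked : ∀ {n} → Segs n → Fin n → ℕ
worked []            k = 0
worked ((i , x) ∷ σ) k = credit (kind k i) 0 x + worked σ k

workload : ∀ {n} → Segs n → ℕ
workload {n} σ = sum (map (worked σ) (List.allFin n))

OkJob : ∀ {n} → Vec Job n → ℕ → Segs n → Fin n → Set
OkJob jobs K σ k = Ok (K * Job.processing jb) (K * Job.arrival jb) (K * Job.deadline jb) 0 0 (viewFor k σ)
  where
  jb : Job
  jb = lookup jobs k

-- A feasible schedule of sufficiently small work in units of 1 / K.
record Plan (I : Instance) (K : ℕ) (σ : Segs (Instance.size I)) : Set where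
  open Instance I
  field
    unit-positive : 0 < K
    positive      : All (λ s → 0 < proj₂ s) σ
    ok            : ∀ k → OkJob jobs K σ k
    work          : workload σ ≤ K * bound

data Scaled {n} (k : ℕ) : Schedule n → Segs n → Set where
  []  : Scaled k [] []
  _∷_ : ∀ {s i x σ σ′} → Segment.activity s ≡ i × Segment.duration s ≡ frac k x → Scaled k σ σ′ → Scaled k (s ∷ σ) ((i , x) ∷ σ′)

common-denominator : ∀ {n} (σ : Schedule n) → ∃[ k ] ∃[ σ′ ] Scaled k σ σ′
common-denominator []      = 0 , [] , []
common-denominator (s ∷ σ) with positive-frac (Segment.duration s) (Segment.positive s) | common-denominator σ
... | k₁ , x , eq | k₂ , σ′ , sc = k₂ + k₁ * suc k₂ , (Segment.activity s , suc k₂ * x) ∷ map (λ (i , x) → i , suc k₁ * x) σ′ ,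
  (refl , trans eq (trans (frac-rescale k₁ k₂ x) (cong (λ k → frac k (suc k₂ * x)) (suc-injective (*-comm (suc k₂) (suc k₁)))))) ∷ rescale sc
  where
  rescale : ∀ {σ σ′} → Scaled k₂ σ σ′ → Scaled (k₂ + k₁ * suc k₂) σ (map (λ (i , x) → i , suc k₁ * x) σ′)
  rescale []                     = []
  rescale (_∷_ {x = x} (e , e′) sc) = (e , trans e′ (frac-rescale k₂ k₁ x)) ∷ rescale sc

module FracTransfer (k : ℕ) = Transfer _+_ _≤_ _<_ ℚ._+_ ℚ._≤_ ℚ._<_ (frac k) (frac-+ k) (frac-≤ k) (frac-< k)

frac-0 : ∀ k → frac k 0 ≡ 0ℚ
frac-0 k = trans (cong (frac k) (sym (*-zeroʳ (suc k)))) (sym (fromℕ-frac k 0))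

module _ {n : ℕ} (k : ℕ) where

  open FracTransfer k

  scaled-view : ∀ {σ σ′} (j : Fin n) → Scaled k σ σ′ → map (λ s → kind j (Segment.activity s) , Segment.duration s) σ ≡ scaled (viewFor j σ′)
  scaled-view j []                    = refl
  scaled-view j ((refl , e) ∷ sc) = cong₂ (λ x xs → (_ , x) ∷ xs) e (scaled-view j sc)

  scaled-y∞ : ∀ {σ σ′} (j : Fin n) → Scaled k σ σ′ → y∞ σ j ≡ frac k (worked σ′ j)
  scaled-y∞ j [] = sym (frac-0 k)
  scaled-y∞ j (_∷_ {s} {x = x} {σ′ = σ′} (refl , e) sc) =
    trans (cong₂ ℚ._+_ head (scaled-y∞ j sc)) (sym (frac-+ k (credit (kind j (Segment.activity s)) 0 x) (worked σ′ j)))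
    where
    head : (if processes s j then Segment.duration s else 0ℚ) ≡ frac k (credit (kind j (Segment.activity s)) 0 x)
    head with Segment.activity s
    ... | nothing = sym (frac-0 k)
    ... | just i with does (i Fin.≟ j)
    ... | true  = e
    ... | false = sym (frac-0 k)

  scaled-total : ∀ {σ σ′} → Scaled k σ σ′ → totalWork σ ≡ frac k (workload σ′)
  scaled-total {σ} {σ′} sc = go (List.allFin n)
    where
    go : ∀ js → sumℚ (map (y∞ σ) js) ≡ frac k (sum (map (worked σ′) js))
    go []       = sym (frac-0 k)
    go (j ∷ js) = trans (cong₂ ℚ._+_ (scaled-y∞ j sc) (go js)) (sym (frac-+ k (worked σ′ j) _))

  scaled-positive : ∀ {σ σ′} → Scaled {n} k σ σ′ → All (λ s → 0 < proj₂ s) σ′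
  scaled-positive []                       = []
  scaled-positive (_∷_ {s} (_ , e) sc) = Equivalence.from (frac-< k) (subst₂ ℚ._<_ (sym (frac-0 k)) e (Segment.positive s)) ∷ scaled-positive sc

yes→plan : ∀ I → YesInstance I → ∃[ K ] ∃[ σ ] Plan I K σ
yes→plan I (σ , feas , work) with common-denominator σ
... | k , σ′ , sc = suc k , σ′ , record
  { unit-positive = s≤s z≤n
  ; positive      = scaled-positive k sc
  ; ok            = λ j → rescale (lookup jobs j) (viewFor j σ′)
                      (subst (Qᶜ.Ok (Defs.t jobs j) (Defs.a jobs j) (Defs.d jobs j) 0ℚ 0ℚ) (scaled-view k j sc) (F.admissible→ok j σ (admissible j)))
  ; work          = Equivalence.from (frac-≤ k) (subst₂ ℚ._≤_ (scaled-total k sc) (fromℕ-frac k bound) work)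
  }
  where
  open Instance I
  rescale : ∀ jb xs → Qᶜ.Ok (fromℕ (Job.processing jb)) (fromℕ (Job.arrival jb)) (fromℕ (Job.deadline jb)) 0ℚ 0ℚ (FracTransfer.scaled k xs) →
            Ok (suc k * Job.processing jb) (suc k * Job.arrival jb) (suc k * Job.deadline jb) 0 0 xs
  rescale jb xs h rewrite fromℕ-frac k (Job.processing jb) | fromℕ-frac k (Job.arrival jb) | fromℕ-frac k (Job.deadline jb) | sym (frac-0 k) = FracTransfer.ok← k xs h
  module F (j : Fin size) = Feasibility (Defs.t jobs j) (Defs.a jobs j) (Defs.d jobs j) j
  admissible : ∀ j → F.Admissible j σ 0ℚ 0ℚ
  admissible j = record
    { notExceeded = subst (ℚ._≤ Defs.t jobs j) (sym (ℚ.+-identityˡ _)) (Feasible.notExceeded feas j)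
    ; executable  = λ τ 0≤τ e → subst₂ (F.Exec j) (sym (ℚ.+-identityˡ τ)) (sym (ℚ.+-identityˡ _)) (Feasible.onlyExecutable feas τ 0≤τ j e)
    ; busy        = λ τ 0≤τ e → subst₂ (λ u v → ¬ F.Exec j u v) (sym (ℚ.+-identityˡ τ)) (sym (ℚ.+-identityˡ _)) (Feasible.busy feas τ 0≤τ e j)
    }

plan→yes : ∀ I K σ → Plan I K σ → YesInstance I
plan→yes I (suc k) σ′ P = σ , feasible , subst₂ ℚ._≤_ (sym (scaled-total k sc)) (sym (fromℕ-frac k bound)) (Equivalence.to (frac-≤ k) work)
  where
  open Instance I
  open Plan P
  schedule : ∀ σ′ → All (λ s → 0 < proj₂ s) σ′ → Schedule size
  schedule []             []       = []
  schedule ((i , x) ∷ σ′) (p ∷ ps) =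
    record { activity = i ; duration = frac k x ; positive = subst (ℚ._< frac k x) (frac-0 k) (Equivalence.to (frac-< k) p) } ∷ schedule σ′ ps
  schedule-scaled : ∀ σ′ ps → Scaled k (schedule σ′ ps) σ′
  schedule-scaled []       []       = []
  schedule-scaled (_ ∷ σ′) (p ∷ ps) = (refl , refl) ∷ schedule-scaled σ′ ps
  σ : Schedule size
  σ = schedule σ′ positive
  sc : Scaled k σ σ′
  sc = schedule-scaled σ′ positive
  okQ : ∀ j → Qᶜ.Ok (Defs.t jobs j) (Defs.a jobs j) (Defs.d jobs j) 0ℚ 0ℚ (map (λ s → kind j (Segment.activity s) , Segment.duration s) σ)
  okQ j = subst (Qᶜ.Ok (Defs.t jobs j) (Defs.a jobs j) (Defs.d jobs j) 0ℚ 0ℚ) (sym (scaled-view k j sc)) (unscale (lookup jobs j) (viewFor j σ′) (ok j))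
    where
    unscale : ∀ jb xs → Ok (suc k * Job.processing jb) (suc k * Job.arrival jb) (suc k * Job.deadline jb) 0 0 xs →
              Qᶜ.Ok (fromℕ (Job.processing jb)) (fromℕ (Job.arrival jb)) (fromℕ (Job.deadline jb)) 0ℚ 0ℚ (FracTransfer.scaled k xs)
    unscale jb xs h rewrite fromℕ-frac k (Job.processing jb) | fromℕ-frac k (Job.arrival jb) | fromℕ-frac k (Job.deadline jb) | sym (frac-0 k) = FracTransfer.ok→ k xs h
  0≤t : ∀ j → 0ℚ ℚ.≤ Defs.t jobs j
  0≤t j = subst₂ ℚ._≤_ (frac-0 0) (sym (fromℕ-frac 0 (Job.processing (lookup jobs j)))) (Equivalence.to (frac-≤ 0) z≤n)
  module F (j : Fin size) = Feasibility (Defs.t jobs j) (Defs.a jobs j) (Defs.d jobs j) j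
  admissible : ∀ j → F.Admissible j σ 0ℚ 0ℚ
  admissible j = F.ok→admissible j σ (0≤t j) (okQ j)
  feasible : Feasible jobs σ
  feasible = record
    { notExceeded    = λ j → subst (ℚ._≤ Defs.t jobs j) (ℚ.+-identityˡ _) (F.Admissible.notExceeded (admissible j))
    ; onlyExecutable = λ τ 0≤τ j e → subst₂ (F.Exec j) (ℚ.+-identityˡ τ) (ℚ.+-identityˡ _) (F.Admissible.executable (admissible j) τ 0≤τ e)
    ; busy           = λ τ 0≤τ e j → subst₂ (λ u v → ¬ F.Exec j u v) (ℚ.+-identityˡ τ) (ℚ.+-identityˡ _) (F.Admissible.busy (admissible j) τ 0≤τ e)
    }

-- Schedules with few segments

-- From the equation, b - a = d - c; this leaves an identity for the ring solver.
by≤ : ∀ {a b c d} → c ≤ d → a + d ≡ b + c → a ≤ b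
by≤ {a} {b} {c} {d} h e = +-cancelʳ-≤ d a b (≤-trans (≤-reflexive e) (+-monoʳ-≤ b h))

All-lookup : ∀ {A : Set} {P : A → Set} {xs} → All P xs → ∀ q → P (List.lookup xs q)
All-lookup (p ∷ ps) zero    = p
All-lookup (p ∷ ps) (suc q) = All-lookup ps q

distinct-length : ∀ {A : Set} {N} (f : A → Fin N) {xs} → AllPairs (λ x y → f x ≢ f y) xs → length xs ≤ N
distinct-length f {xs} ps = Fin.injective⇒≤ {f = λ p → f (List.lookup xs p)} (injective ps)
  where
  injective : ∀ {xs} → AllPairs (λ x y → f x ≢ f y) xs → ∀ {p q} → f (List.lookup xs p) ≡ f (List.lookup xs q) → p ≡ q
  injective (h ∷ hs) {zero}  {zero}  e = refl
  injective (h ∷ hs) {zero}  {suc q} e = contradiction e (All-lookup h q)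
  injective (h ∷ hs) {suc p} {zero}  e = contradiction (sym e) (All-lookup h p)
  injective (h ∷ hs) {suc p} {suc q} e = cong suc (injective hs e)

kind-self : ∀ {n} (k : Fin n) → kind k (just k) ≡ mine
kind-self k rewrite dec-true (k Fin.≟ k) refl = refl

kind-other : ∀ {n} {k i : Fin n} → i ≢ k → kind k (just i) ≡ other
kind-other {k = k} {i} ne rewrite dec-false (i Fin.≟ k) ne = refl

-- Two pieces of the same job are joined, at the place of the second one,
-- if every job processed in between had arrived when the first piece
-- began.  Then two remaining pieces of a job differ in the number of jobs
-- that arrived before them, so that at most (n + 1)² pieces remain.
module Normalise {n : ℕ} (jobs : Vec Job n) (K : ℕ) where

  T A D : Fin n → ℕ
  T k = K * Job.processing (lookup jobs k)
  A k = K * Job.arrival (lookup jobs k)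
  D k = K * Job.deadline (lookup jobs k)

  OkAt : Fin n → ℕ → ℕ → Segs n → Set
  OkAt k τ y σ = Ok (T k) (A k) (D k) τ y (viewFor k σ)

  absorb : ℕ → Maybe (Fin n) → ℕ → Segs n → Maybe (Segs n)
  absorb τ i        x []                  = nothing
  absorb τ nothing  x ((nothing , z) ∷ σ) = just ((nothing , x + z) ∷ σ)
  absorb τ nothing  x ((just j , z) ∷ σ)  = nothing
  absorb τ (just i) x ((nothing , z) ∷ σ) = nothing
  absorb τ (just i) x ((just j , z) ∷ σ) with j Fin.≟ i | A j ≤? τ
  ... | yes _ | _     = just ((just i , x + z) ∷ σ)
  ... | no _  | yes _ = Maybe.map ((just j , z) ∷_) (absorb τ (just i) x σ)
  -- This piece would be moved forward in time, possibly to before the arrival of `j`, and therefore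
  -- blocks the joining.
  ... | no _  | no _  = nothing

  normalise : ℕ → Segs n → Segs n
  normalise τ []            = []
  normalise τ ((i , x) ∷ σ) = Maybe.fromMaybe ((i , x) ∷ normalise (τ + x) σ) (absorb τ i x (normalise (τ + x) σ))

  shift₁ : ∀ a b c → a + b + c ≡ a + (b + c)
  shift₁ = +-assoc

  shift₂ : ∀ a b c → a + b + c ≡ a + c + b
  shift₂ = solve-∀

  -- The pieces in between start earlier by `x`. Their jobs had arrived by `τ₀`, the start of the
  -- moved piece, so this is allowed and only widens their slack. For `i` itself, both the start of
  -- the later piece and the amount processed before it drop by `x`, which leaves the slack as it
  -- was.
  absorb-ok : ∀ k i τ τ₀ x σ {σ′ y} → τ₀ ≤ τ → (k ≡ i → A k ≤ τ) → OkAt k (τ + x) (credit (kind k (just i)) y x) σ →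
              absorb τ₀ (just i) x σ ≡ just σ′ → OkAt k τ y σ′
  absorb-ok k i τ τ₀ x ((just j , z) ∷ σ) {y = y} τ₀≤ arrived (h , hs) eq with j Fin.≟ i | A j ≤? τ₀
  absorb-ok k i τ τ₀ x ((just j , z) ∷ σ) {y = y} τ₀≤ arrived (h , hs) refl | yes refl | _ with k Fin.≟ j
  ... | yes refl rewrite kind-self k = (arrived refl , ≤-trans (≤-reflexive (sym (+-assoc y x z))) (proj₁ (proj₂ h)) ,
          by≤ (proj₂ (proj₂ h)) (lemma τ x (T k) (D k) y)) , subst₂ (λ τ y → OkAt k τ y σ) (shift₁ τ x z) (shift₁ y x z) hs
    where
    lemma : ∀ τ x T D y → τ + T + (D + (y + x)) ≡ D + y + (τ + x + T)
    lemma = solve-∀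
  ... | no k≢j rewrite kind-other (k≢j ∘ sym) = tt , subst (λ τ → OkAt k τ y σ) (shift₁ τ x z) hs
  absorb-ok k i τ τ₀ x ((just j , z) ∷ σ) {y = y} τ₀≤ arrived (h , hs) eq | no j≢i | yes a≤
    with absorb τ₀ (just i) x σ in eq′
  absorb-ok k i τ τ₀ x ((just j , z) ∷ σ) {y = y} τ₀≤ arrived (h , hs) refl | no j≢i | yes a≤ | just σ″
    with k Fin.≟ j
  ... | yes refl rewrite kind-self k | kind-other {k = k} (j≢i ∘ sym) =
    (≤-trans a≤ τ₀≤ , proj₁ (proj₂ h) , ≤-trans (+-monoˡ-≤ (T k) (m≤m+n τ x)) (proj₂ (proj₂ h))) ,
    absorb-ok k i (τ + z) τ₀ x σ (≤-trans τ₀≤ (m≤m+n τ z)) (λ e → contradiction e j≢i)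
      (subst₂ (λ τ κ → OkAt k τ (credit κ (y + z) x) σ) (shift₂ τ x z) (sym (kind-other (j≢i ∘ sym))) hs) eq′
  ... | no k≢j rewrite kind-other {k = k} (k≢j ∘ sym) = tt ,
    absorb-ok k i (τ + z) τ₀ x σ (≤-trans τ₀≤ (m≤m+n τ z)) (λ e → ≤-trans (arrived e) (m≤m+n τ z))
      (subst (λ τ → OkAt k τ (credit (kind k (just i)) y x) σ) (shift₂ τ x z) hs) eq′

  -- In the only mixed case that takes an argument, the job has not arrived by the end of the first
  -- part and is too late from then on; hence it is too late on arrival.
  merge-idle : ∀ k τ x z y → Allowed idle (T k) (A k) (D k) τ y x → Allowed idle (T k) (A k) (D k) (τ + x) y z → Allowed idle (T k) (A k) (D k) τ y (x + z)
  merge-idle k τ x z y (inj₂ dead) _ = inj₂ dead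
  merge-idle k τ x z y (inj₁ h) (inj₁ h′) = inj₁ (≤-trans (≤-reflexive (sym (+-assoc τ x z))) h′)
  merge-idle k τ x z y (inj₁ h) (inj₂ (inj₁ h′)) = inj₂ (inj₁ h′)
  merge-idle k τ x z y (inj₁ h) (inj₂ (inj₂ (inj₁ h′))) = inj₂ (inj₂ (inj₂ (≤-trans h′ (+-monoˡ-≤ (T k) h))))
  merge-idle k τ x z y (inj₁ h) (inj₂ (inj₂ (inj₂ h′))) = inj₂ (inj₂ (inj₂ h′))

  absorb-ok′ : ∀ k i τ x σ {σ′ y} → OkAt k τ y ((i , x) ∷ σ) → absorb τ i x σ ≡ just σ′ → OkAt k τ y σ′
  absorb-ok′ k nothing  τ x ((nothing , z) ∷ σ) {y = y} (h , h′ , hs) refl = merge-idle k τ x z y h h′ , subst (λ τ → OkAt k τ y σ) (+-assoc τ x z) hs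
  absorb-ok′ k (just i) τ x σ {y = y} (h , hs) eq = absorb-ok k i τ τ x σ ≤-refl arrived hs eq
    where
    arrived : k ≡ i → A k ≤ τ
    arrived refl rewrite kind-self k = proj₁ h

  normalise-ok : ∀ k τ σ {y} → OkAt k τ y σ → OkAt k τ y (normalise τ σ)
  normalise-ok k τ []            h = h
  normalise-ok k τ ((i , x) ∷ σ) {y} (h , hs) with absorb τ i x (normalise (τ + x) σ) in eq
  ... | nothing = h , normalise-ok k (τ + x) σ hs
  ... | just σ′ = absorb-ok′ k i τ x (normalise (τ + x) σ) (h , normalise-ok k (τ + x) σ hs) eq

  credit-+ : ∀ κ x z → credit κ 0 (x + z) ≡ credit κ 0 x + credit κ 0 z
  credit-+ mine  x z = refl
  credit-+ idle  x z = refl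
  credit-+ other x z = refl

  absorb-worked : ∀ k τ i x σ {σ′} → absorb τ i x σ ≡ just σ′ → worked σ′ k ≡ credit (kind k i) 0 x + worked σ k
  absorb-worked k τ nothing  x ((nothing , z) ∷ σ) refl = refl
  absorb-worked k τ (just i) x ((just j , z) ∷ σ) eq with j Fin.≟ i | A j ≤? τ
  absorb-worked k τ (just i) x ((just j , z) ∷ σ) refl | yes refl | _ =
    trans (cong (_+ worked σ k) (credit-+ (kind k (just i)) x z)) (+-assoc (credit (kind k (just i)) 0 x) (credit (kind k (just i)) 0 z) (worked σ k))
  absorb-worked k τ (just i) x ((just j , z) ∷ σ) eq | no _ | yes _ with absorb τ (just i) x σ in eq′
  absorb-worked k τ (just i) x ((just j , z) ∷ σ) refl | no _ | yes _ | just σ″ =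
    trans (cong (credit (kind k (just j)) 0 z +_) (absorb-worked k τ (just i) x σ eq′))
          (lemma (credit (kind k (just j)) 0 z) (credit (kind k (just i)) 0 x) (worked σ k))
    where
    lemma : ∀ a b c → a + (b + c) ≡ b + (a + c)
    lemma = solve-∀

  normalise-worked : ∀ k τ σ → worked (normalise τ σ) k ≡ worked σ k
  normalise-worked k τ []            = refl
  normalise-worked k τ ((i , x) ∷ σ) with absorb τ i x (normalise (τ + x) σ) in eq
  ... | nothing = cong (credit (kind k i) 0 x +_) (normalise-worked k (τ + x) σ)
  ... | just σ′ = trans (absorb-worked k τ i x (normalise (τ + x) σ) eq) (cong (credit (kind k i) 0 x +_) (normalise-worked k (τ + x) σ))

  Positive : Segs n → Set
  Positive = All (λ s → 0 < proj₂ s)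

  absorb-positive : ∀ τ i x σ {σ′} → 0 < x → Positive σ → absorb τ i x σ ≡ just σ′ → Positive σ′
  absorb-positive τ nothing  x ((nothing , z) ∷ σ) p (q ∷ qs) refl = ≤-trans q (m≤n+m z x) ∷ qs
  absorb-positive τ (just i) x ((just j , z) ∷ σ) p (q ∷ qs) eq with j Fin.≟ i | A j ≤? τ
  absorb-positive τ (just i) x ((just j , z) ∷ σ) p (q ∷ qs) refl | yes _ | _ = ≤-trans q (m≤n+m z x) ∷ qs
  absorb-positive τ (just i) x ((just j , z) ∷ σ) p (q ∷ qs) eq | no _ | yes _ with absorb τ (just i) x σ in eq′
  absorb-positive τ (just i) x ((just j , z) ∷ σ) p (q ∷ qs) refl | no _ | yes _ | just σ″ = q ∷ absorb-positive τ (just i) x σ p qs eq′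

  normalise-positive : ∀ τ σ → Positive σ → Positive (normalise τ σ)
  normalise-positive τ []            []       = []
  normalise-positive τ ((i , x) ∷ σ) (p ∷ ps) with absorb τ i x (normalise (τ + x) σ) in eq
  ... | nothing = p ∷ normalise-positive (τ + x) σ ps
  ... | just σ′ = absorb-positive τ i x (normalise (τ + x) σ) p (normalise-positive (τ + x) σ ps) eq

  indicator : ∀ {P : Set} → Dec P → ℕ
  indicator (yes _) = 1
  indicator (no _)  = 0

  arrivals : List (Fin n) → ℕ → ℕ
  arrivals []       τ = 0
  arrivals (k ∷ ks) τ = indicator (A k ≤? τ) + arrivals ks τ

  indicator-mono : ∀ k {τ τ′} → τ ≤ τ′ → indicator (A k ≤? τ) ≤ indicator (A k ≤? τ′)
  indicator-mono k {τ} {τ′} τ≤ with A k ≤? τ | A k ≤? τ′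
  ... | no _   | _      = z≤n
  ... | yes _  | yes _  = ≤-refl
  ... | yes a≤ | no a≰ = contradiction (≤-trans a≤ τ≤) a≰

  arrivals-mono : ∀ ks {τ τ′} → τ ≤ τ′ → arrivals ks τ ≤ arrivals ks τ′
  arrivals-mono []       τ≤ = z≤n
  arrivals-mono (k ∷ ks) τ≤ = +-mono-≤ (indicator-mono k τ≤) (arrivals-mono ks τ≤)

  arrivals-strict : ∀ {j ks τ τ′} → j ∈ ks → τ < A j → A j ≤ τ′ → arrivals ks τ < arrivals ks τ′
  arrivals-strict {j} {_ ∷ ks} {τ} {τ′} (here refl) τ< ≤τ′ with A j ≤? τ | A j ≤? τ′
  ... | yes a≤ | _      = contradiction a≤ (<⇒≱ τ<)
  ... | no _   | no a≰  = contradiction ≤τ′ a≰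
  ... | no _   | yes _  = s≤s (arrivals-mono ks (≤-trans (<⇒≤ τ<) ≤τ′))
  arrivals-strict {j} {k ∷ ks} (there j∈) τ< ≤τ′ = +-mono-≤-< (indicator-mono k (≤-trans (<⇒≤ τ<) ≤τ′)) (arrivals-strict j∈ τ< ≤τ′)

  arrivals≤ : ∀ ks τ → arrivals ks τ ≤ length ks
  arrivals≤ []       τ = z≤n
  arrivals≤ (k ∷ ks) τ with A k ≤? τ
  ... | yes _ = s≤s (arrivals≤ ks τ)
  ... | no _  = m≤n⇒m≤1+n (arrivals≤ ks τ)

  epoch : ℕ → ℕ
  epoch = arrivals (List.allFin n)

  labels : ℕ → Segs n → List (Maybe (Fin n) × ℕ)
  labels τ []            = []
  labels τ ((i , x) ∷ σ) = (i , epoch τ) ∷ labels (τ + x) σ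

  later : ∀ {τ τ′ i} σ → epoch τ < epoch τ′ → All (λ (i′ , c) → i ≡ i′ → epoch τ < c) (labels τ′ σ)
  later []            h = []
  later {τ′ = τ′} ((i , x) ∷ σ) h = (λ _ → h) ∷ later σ (≤-trans h (arrivals-mono (List.allFin n) (m≤m+n τ′ x)))

  -- A job that is completed or late gets no further piece, so the claim about its later labels is
  -- vacuous, whatever `c` is.
  never-again : ∀ k τ σ {y} → T k ≤ y ⊎ D k + y < τ + T k → Positive σ → OkAt k τ y σ → ∀ c → All (λ (i′ , c′) → just k ≡ i′ → c < c′) (labels τ σ)
  never-again k τ [] dead ps h c = []
  never-again k τ ((nothing , x) ∷ σ) dead (p ∷ ps) (h , hs) c = (λ ()) ∷ never-again k (τ + x) σ (still dead) ps hs c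
    where
    still : ∀ {y} → T k ≤ y ⊎ D k + y < τ + T k → T k ≤ y ⊎ D k + y < τ + x + T k
    still (inj₁ h) = inj₁ h
    still (inj₂ h) = inj₂ (≤-trans h (+-monoˡ-≤ (T k) (m≤m+n τ x)))
  never-again k τ ((just j , x) ∷ σ) {y} dead (p ∷ ps) (h , hs) c with j Fin.≟ k
  ... | no j≢k = (λ { refl → contradiction refl j≢k }) ∷ never-again k (τ + x) σ (still dead) ps hs c
    where
    still : ∀ {y} → T k ≤ y ⊎ D k + y < τ + T k → T k ≤ y ⊎ D k + y < τ + x + T k
    still (inj₁ h) = inj₁ h
    still (inj₂ h) = inj₂ (≤-trans h (+-monoˡ-≤ (T k) (m≤m+n τ x)))
  never-again k τ ((just j , x) ∷ σ) {y} (inj₁ t≤y) (p ∷ ps) (h , hs) c | yes refl =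
    contradiction (≤-trans (proj₁ (proj₂ h)) t≤y) (<⇒≱ (m<m+n y p))
  never-again k τ ((just j , x) ∷ σ) {y} (inj₂ late) (p ∷ ps) (h , hs) c | yes refl = contradiction (proj₂ (proj₂ h)) (<⇒≱ late)

  -- A piece of `i` stays alone for one of three reasons: nothing of `i` follows; an idle period
  -- intervenes, during which `i`, having arrived, must be dead; or a job runs that arrived after
  -- `τ₀`, so that the epoch has grown.
  blocked-busy : ∀ i τ₀ τ x σ (ys : Fin n → ℕ) → τ₀ ≤ τ → A i ≤ τ₀ → absorb τ₀ (just i) x σ ≡ nothing → Positive σ →
                 (∀ k → OkAt k τ (ys k) σ) → All (λ (i′ , c) → just i ≡ i′ → epoch τ₀ < c) (labels τ σ)
  blocked-busy i τ₀ τ x [] ys τ₀≤ a≤ eq ps oks = []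
  blocked-busy i τ₀ τ x ((nothing , z) ∷ σ) ys τ₀≤ a≤ eq (p ∷ ps) oks = (λ ()) ∷ never-again i (τ + z) σ (dead (proj₁ (oks i))) ps (proj₂ (oks i)) (epoch τ₀)
    where
    dead : Allowed idle (T i) (A i) (D i) τ (ys i) z → T i ≤ ys i ⊎ D i + ys i < τ + z + T i
    dead (inj₁ h) = contradiction (≤-trans h (≤-trans a≤ τ₀≤)) (<⇒≱ (m<m+n τ p))
    dead (inj₂ (inj₁ h)) = inj₁ h
    dead (inj₂ (inj₂ (inj₁ h))) = inj₂ (≤-trans h (+-monoˡ-≤ (T i) (m≤m+n τ z)))
    dead (inj₂ (inj₂ (inj₂ h))) = inj₂ (≤-trans h (+-monoˡ-≤ (T i) (≤-trans (≤-trans a≤ τ₀≤) (m≤m+n τ z))))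
  blocked-busy i τ₀ τ x ((just j , z) ∷ σ) ys τ₀≤ a≤ eq (p ∷ ps) oks with j Fin.≟ i | A j ≤? τ₀
  blocked-busy i τ₀ τ x ((just j , z) ∷ σ) ys τ₀≤ a≤ eq (p ∷ ps) oks | no j≢i | yes _ with absorb τ₀ (just i) x σ in eq′
  ... | nothing = (λ { refl → contradiction refl j≢i }) ∷
    blocked-busy i τ₀ (τ + z) x σ (λ k → credit (kind k (just j)) (ys k) z) (≤-trans τ₀≤ (m≤m+n τ z)) a≤ eq′ ps (λ k → proj₂ (oks k))
  blocked-busy i τ₀ τ x ((just j , z) ∷ σ) ys τ₀≤ a≤ eq (p ∷ ps) oks | no j≢i | no a≰ = later ((just j , z) ∷ σ) increases
    where
    arrived : A j ≤ τ
    arrived with oks j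
    ... | h , _ rewrite kind-self j = proj₁ h
    increases : epoch τ₀ < epoch τ
    increases = arrivals-strict (∈-allFin j) (≰⇒> a≰) arrived

  -- The job that runs after the idle period was not dead, so it was kept from running by its
  -- arrival, which falls within that period and raises the epoch.
  blocked-idle : ∀ τ x σ (ys : Fin n → ℕ) → 0 < x → absorb τ nothing x σ ≡ nothing → Positive σ →
                 (∀ k → OkAt k τ (ys k) ((nothing , x) ∷ σ)) → All (λ (i′ , c) → nothing ≡ i′ → epoch τ < c) (labels (τ + x) σ)
  blocked-idle τ x [] ys 0<x eq ps oks = []
  blocked-idle τ x ((just j , z) ∷ σ) ys 0<x eq (p ∷ ps) oks = later ((just j , z) ∷ σ) (increases (oks j))
    where
    increases : OkAt j τ (ys j) ((nothing , x) ∷ (just j , z) ∷ σ) → epoch τ < epoch (τ + x)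
    increases (h , h′ , _) rewrite kind-self j = go h
      where
      go : Allowed idle (T j) (A j) (D j) τ (ys j) x → epoch τ < epoch (τ + x)
      go (inj₁ ≤a) = arrivals-strict (∈-allFin j) (≤-trans (m<m+n τ 0<x) ≤a) (proj₁ h′)
      go (inj₂ (inj₁ t≤)) = contradiction (≤-trans (proj₁ (proj₂ h′)) t≤) (<⇒≱ (m<m+n (ys j) p))
      go (inj₂ (inj₂ (inj₁ late))) = contradiction (proj₂ (proj₂ h′)) (<⇒≱ (≤-trans late (+-monoˡ-≤ (T j) (m≤m+n τ x))))
      go (inj₂ (inj₂ (inj₂ late))) = contradiction (proj₂ (proj₂ h′)) (<⇒≱ (≤-trans late (+-monoˡ-≤ (T j) (proj₁ h′))))

  blocked : ∀ τ i x σ (ys : Fin n → ℕ) → 0 < x → absorb τ i x σ ≡ nothing → Positive σ →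
            (∀ k → OkAt k τ (ys k) ((i , x) ∷ σ)) → All (λ (i′ , c) → i ≡ i′ → epoch τ < c) (labels (τ + x) σ)
  blocked τ nothing  x σ ys 0<x eq ps oks = blocked-idle τ x σ ys 0<x eq ps oks
  blocked τ (just i) x σ ys 0<x eq ps oks = blocked-busy i τ (τ + x) x σ (λ k → credit (kind k (just i)) (ys k) x) (m≤m+n τ x) arrived eq ps (λ k → proj₂ (oks k))
    where
    arrived : A i ≤ τ
    arrived with oks i
    ... | h , _ rewrite kind-self i = proj₁ h

  Separated : List (Maybe (Fin n) × ℕ) → Set
  Separated = AllPairs (λ (i , c) (i′ , c′) → i ≡ i′ → c < c′)

  Irreducible : ℕ → Segs n → Set
  Irreducible τ []            = ⊤
  Irreducible τ ((i , x) ∷ σ) = absorb τ i x σ ≡ nothing × Irreducible (τ + x) σ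

  -- Absorbing a piece moves the following ones forward. An earlier start makes absorption harder,
  -- since fewer jobs have arrived, so a tail that is already irreducible stays so.
  data Earlier : ℕ → Segs n → ℕ → Segs n → Set where
    []  : ∀ {τ τ′} → Earlier τ [] τ′ []
    _∷_ : ∀ {τ τ′ i x x′ σ σ′} → τ ≤ τ′ → Earlier (τ + x) σ (τ′ + x′) σ′ → Earlier τ ((i , x) ∷ σ) τ′ ((i , x′) ∷ σ′)

  earlier-refl : ∀ τ σ → Earlier τ σ τ σ
  earlier-refl τ []            = []
  earlier-refl τ ((i , x) ∷ σ) = ≤-refl ∷ earlier-refl (τ + x) σ

  absorb-earlier : ∀ τ τ₀ i x σ {σ′} → absorb τ₀ i x σ ≡ just σ′ → Earlier τ σ′ (τ + x) σ
  absorb-earlier τ τ₀ nothing  x ((nothing , z) ∷ σ) refl = m≤m+n τ x ∷ subst (λ τ′ → Earlier (τ + (x + z)) σ τ′ σ) (sym (+-assoc τ x z)) (earlier-refl _ σ)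
  absorb-earlier τ τ₀ (just i) x ((just j , z) ∷ σ) eq with j Fin.≟ i | A j ≤? τ₀
  absorb-earlier τ τ₀ (just i) x ((just j , z) ∷ σ) refl | yes refl | _ = m≤m+n τ x ∷ subst (λ τ′ → Earlier (τ + (x + z)) σ τ′ σ) (sym (+-assoc τ x z)) (earlier-refl _ σ)
  absorb-earlier τ τ₀ (just i) x ((just j , z) ∷ σ) eq | no _ | yes _ with absorb τ₀ (just i) x σ in eq′
  absorb-earlier τ τ₀ (just i) x ((just j , z) ∷ σ) refl | no _ | yes _ | just σ″ =
    m≤m+n τ x ∷ subst (λ τ′ → Earlier (τ + z) σ″ τ′ σ) (shift₂ τ z x) (absorb-earlier (τ + z) τ₀ (just i) x σ eq′)

  nothing-mono : ∀ {τ₁ τ₁′ τ τ′ i x x′ σ σ′} → Earlier τ₁ σ τ₁′ σ′ → τ ≤ τ′ → absorb τ′ i x′ σ′ ≡ nothing → absorb τ i x σ ≡ nothing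
  nothing-mono [] τ≤ eq = refl
  nothing-mono {i = nothing} (_∷_ {i = just j} h e)  τ≤ eq = refl
  nothing-mono {i = just i}  (_∷_ {i = nothing} h e) τ≤ eq = refl
  nothing-mono {τ = τ} {τ′} {just i} {x′ = x′} (_∷_ {i = just j} {σ′ = σ′} h e) τ≤ eq with j Fin.≟ i | A j ≤? τ | A j ≤? τ′
  ... | no _ | no _   | _      = refl
  ... | no _ | yes a≤ | no a≰  = contradiction (≤-trans a≤ τ≤) a≰
  ... | no _ | yes _  | yes _  with absorb τ′ (just i) x′ σ′ in eq′
  ... | nothing = cong (Maybe.map _) (nothing-mono e τ≤ eq′)

  irreducible-mono : ∀ {τ τ′ σ σ′} → Earlier τ σ τ′ σ′ → Irreducible τ′ σ′ → Irreducible τ σ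
  irreducible-mono []      _        = tt
  irreducible-mono (h ∷ e) (eq , r) = nothing-mono e h eq , irreducible-mono e r

  normalise-irreducible : ∀ τ σ → Irreducible τ (normalise τ σ)
  normalise-irreducible τ []            = tt
  normalise-irreducible τ ((i , x) ∷ σ) with absorb τ i x (normalise (τ + x) σ) in eq
  ... | nothing = eq , normalise-irreducible (τ + x) σ
  ... | just σ′ = irreducible-mono (absorb-earlier τ τ i x (normalise (τ + x) σ) eq) (normalise-irreducible (τ + x) σ)

  irreducible-separated : ∀ τ σ (ys : Fin n → ℕ) → Positive σ → (∀ k → OkAt k τ (ys k) σ) → Irreducible τ σ → Separated (labels τ σ)
  irreducible-separated τ []            ys []       oks _        = []
  irreducible-separated τ ((i , x) ∷ σ) ys (p ∷ ps) oks (eq , r) =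
    blocked τ i x σ ys p eq ps oks ∷ irreducible-separated (τ + x) σ (λ k → credit (kind k i) (ys k) x) ps (λ k → proj₂ (oks k)) r

  labels-length : ∀ τ σ → length (labels τ σ) ≡ length σ
  labels-length τ []      = refl
  labels-length τ (s ∷ σ) = cong suc (labels-length _ σ)

  position : Maybe (Fin n) → Fin (suc n)
  position nothing  = zero
  position (just i) = suc i

  position-injective : ∀ {i j} → position i ≡ position j → i ≡ j
  position-injective {nothing} {nothing} _ = refl
  position-injective {just i}  {just .i} refl = refl

  clamp : ℕ → Fin (suc n)
  clamp c with c <? suc n
  ... | yes h = fromℕ< h
  -- An arbitrary value: epochs are at most `n`.
  ... | no _  = zero

  clamp-toℕ : ∀ {c} → c ≤ n → toℕ (clamp c) ≡ c
  clamp-toℕ {c} h with c <? suc n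
  ... | yes h′ = Fin.toℕ-fromℕ< h′
  ... | no ¬h  = contradiction (s≤s h) ¬h

  labels-bounded : ∀ τ σ → All (λ (i , c) → c ≤ n) (labels τ σ)
  labels-bounded τ []            = []
  labels-bounded τ ((i , x) ∷ σ) = ≤-trans (arrivals≤ (List.allFin n) τ) (≤-reflexive (List.length-tabulate id)) ∷ labels-bounded (τ + x) σ

  separated-length : ∀ ls → All (λ (i , c) → c ≤ n) ls → Separated ls → length ls ≤ suc n * suc n
  separated-length ls bd sep = distinct-length (λ (i , c) → Fin.combine (position i) (clamp c)) (distinct ls bd sep)
    where
    distinct : ∀ ls → All (λ (i , c) → c ≤ n) ls → Separated ls →
               AllPairs (λ (i , c) (i′ , c′) → Fin.combine (position i) (clamp c) ≢ Fin.combine (position i′) (clamp c′)) ls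
    distinct []             _        _         = []
    distinct ((i , c) ∷ ls) (b ∷ bs) (h ∷ sep) = go ls bs h ∷ distinct ls bs sep
      where
      go : ∀ ls → All (λ (i , c) → c ≤ n) ls → All (λ (i′ , c′) → i ≡ i′ → c < c′) ls →
           All (λ (i′ , c′) → Fin.combine (position i) (clamp c) ≢ Fin.combine (position i′) (clamp c′)) ls
      go []               _        _        = []
      go ((i′ , c′) ∷ ls) (b′ ∷ bs) (h ∷ hs) = (λ e → differ (Fin.combine-injective (position i) (clamp c) (position i′) (clamp c′) e)) ∷ go ls bs hs
        where
        differ : position i ≡ position i′ × clamp c ≡ clamp c′ → ⊥
        differ (e₁ , e₂) = <⇒≢ (h (position-injective e₁)) (trans (sym (clamp-toℕ b)) (trans (cong toℕ e₂) (clamp-toℕ b′)))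

  normalise-length : ∀ σ → Positive σ → (∀ k → OkAt k 0 0 σ) → length (normalise 0 σ) ≤ suc n * suc n
  normalise-length σ ps oks = subst (_≤ suc n * suc n) (labels-length 0 (normalise 0 σ))
    (separated-length _ (labels-bounded 0 (normalise 0 σ))
      (irreducible-separated 0 (normalise 0 σ) (λ _ → 0) (normalise-positive 0 σ ps) (λ k → normalise-ok k 0 σ (oks k)) (normalise-irreducible 0 σ)))

short-plan : ∀ I {K σ} → Plan I K σ → ∃[ σ′ ] Plan I K σ′ × length σ′ ≤ suc (Instance.size I) * suc (Instance.size I)
short-plan I {K} {σ} P = normalise 0 σ , record
  { unit-positive = unit-positive
  ; positive      = normalise-positive 0 σ positive
  ; ok            = λ k → normalise-ok k 0 σ (ok k)
  ; work          = ≤-trans (≤-reflexive (cong sum (List.map-cong (λ k → normalise-worked k 0 σ) (List.allFin size)))) work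
  } , normalise-length σ positive ok
  where
  open Instance I
  open Plan P
  open Normalise jobs K

-- Vectors of small integers with a given sign pattern

dot : ∀ {N} → (Fin N → ℤ) → (Fin N → ℤ) → ℤ
dot {zero}  α w = 0ℤ
dot {suc N} α w = α zero ℤ.* w zero ℤ.+ dot (α ∘ suc) (w ∘ suc)

Small : ∀ {N} → ℕ → (Fin N → ℤ) → Set
Small H α = ∀ j → ℤ.∣ α j ∣ ≤ H

dot-combine : ∀ {N} (a : ℤ) (α p r u : Fin N → ℤ) → (∀ j → u j ≡ a ℤ.* p j ℤ.+ r j) → dot α u ≡ a ℤ.* dot α p ℤ.+ dot α r
dot-combine {zero}  a α p r u e = sym (trans (cong (ℤ._+ 0ℤ) (ℤ.*-zeroʳ a)) refl)
dot-combine {suc N} a α p r u e rewrite e zero | dot-combine a (α ∘ suc) (p ∘ suc) (r ∘ suc) (u ∘ suc) (e ∘ suc) =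
  lemma a (α zero) (p zero) (r zero) (dot (α ∘ suc) (p ∘ suc)) (dot (α ∘ suc) (r ∘ suc))
  where
  lemma : ∀ a x p r P R → x ℤ.* (a ℤ.* p ℤ.+ r) ℤ.+ (a ℤ.* P ℤ.+ R) ≡ a ℤ.* (x ℤ.* p ℤ.+ P) ℤ.+ (x ℤ.* r ℤ.+ R)
  lemma = ℤ-Ring.solve-∀

dot-scale : ∀ {N} (a : ℤ) (α w : Fin N → ℤ) → dot α (λ j → a ℤ.* w j) ≡ a ℤ.* dot α w
dot-scale {zero}  a α w = sym (ℤ.*-zeroʳ a)
dot-scale {suc N} a α w rewrite dot-scale a (α ∘ suc) (w ∘ suc) = lemma a (α zero) (w zero) (dot (α ∘ suc) (w ∘ suc))
  where
  lemma : ∀ a x p P → x ℤ.* (a ℤ.* p) ℤ.+ a ℤ.* P ≡ a ℤ.* (x ℤ.* p ℤ.+ P)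
  lemma = ℤ-Ring.solve-∀

-- The factor `M` stands in for a division in the bound B / M on the entries of `r`.
dot-bound : ∀ {N} M H B (α r : Fin N → ℤ) → Small H α → (∀ j → M * ℤ.∣ r j ∣ ≤ B) → M * ℤ.∣ dot α r ∣ ≤ N * (H * B)
dot-bound {zero}  M H B α r hα hr = ≤-reflexive (*-zeroʳ M)
dot-bound {suc N} M H B α r hα hr = begin
  M * ℤ.∣ α zero ℤ.* r zero ℤ.+ dot (α ∘ suc) (r ∘ suc) ∣ ≤⟨ *-monoʳ-≤ M (ℤ.∣i+j∣≤∣i∣+∣j∣ (α zero ℤ.* r zero) (dot (α ∘ suc) (r ∘ suc))) ⟩
  M * (ℤ.∣ α zero ℤ.* r zero ∣ + ℤ.∣ dot (α ∘ suc) (r ∘ suc) ∣) ≡⟨ cong (λ x → M * (x + ℤ.∣ dot (α ∘ suc) (r ∘ suc) ∣)) (ℤ.abs-* (α zero) (r zero)) ⟩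
  M * (ℤ.∣ α zero ∣ * ℤ.∣ r zero ∣ + ℤ.∣ dot (α ∘ suc) (r ∘ suc) ∣) ≡⟨ lemma M ℤ.∣ α zero ∣ ℤ.∣ r zero ∣ ℤ.∣ dot (α ∘ suc) (r ∘ suc) ∣ ⟩
  ℤ.∣ α zero ∣ * (M * ℤ.∣ r zero ∣) + M * ℤ.∣ dot (α ∘ suc) (r ∘ suc) ∣ ≤⟨ +-mono-≤ (*-mono-≤ (hα zero) (hr zero)) (dot-bound M H B (α ∘ suc) (r ∘ suc) (hα ∘ suc) (hr ∘ suc)) ⟩
  H * B + N * (H * B) ∎
  where
  open ≤-Reasoning
  lemma : ∀ M x r d → M * (x * r + d) ≡ x * (M * r) + M * d
  lemma = solve-∀

i≤∣i∣ : ∀ i → i ℤ.≤ ℤ.+ ℤ.∣ i ∣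
i≤∣i∣ (ℤ.+ n)    = ℤ.≤-refl
i≤∣i∣ ℤ.-[1+ n ] = ℤ.-≤+

abs-⊖ : ∀ x y → ℤ.∣ x ℤ.⊖ y ∣ ≡ ∣ x - y ∣
abs-⊖ zero    zero    = refl
abs-⊖ zero    (suc y) = refl
abs-⊖ (suc x) zero    = refl
abs-⊖ (suc x) (suc y) = trans (cong ℤ.∣_∣ (ℤ.[1+m]⊖[1+n]≡m⊖n x y)) (abs-⊖ x y)

mod-multiple : ∀ z k m .{{_ : NonZero m}} → ℤ.∣ z ∣ ≡ k * m → z ℤ.%ℕ m ≡ 0
mod-multiple (ℤ.+ n)    k m e = trans (cong (_% m) e) (m*n%n≡0 k m)
mod-multiple ℤ.-[1+ n ] k m e with suc n % m | trans (cong (_% m) e) (m*n%n≡0 k m)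
... | zero | _ = refl

-- The sign of m a + r is that of a, unless a is zero.
leading-nonneg : ∀ m (x r : ℤ) → ℤ.∣ r ∣ < m → 0ℤ ℤ.≤ ℤ.+ m ℤ.* x ℤ.+ r → 0ℤ ℤ.≤ x
leading-nonneg m (ℤ.+ n)    r h le = ℤ.+≤+ z≤n
leading-nonneg m ℤ.-[1+ n ] r h le = contradiction le (ℤ.<⇒≱ (begin-strict
  ℤ.+ m ℤ.* ℤ.-[1+ n ] ℤ.+ r ≡⟨ cong (ℤ._+ r) (trans (sym (ℤ.neg-distribʳ-* (ℤ.+ m) (ℤ.+ suc n))) (cong (λ z → ℤ.- z) (sym (ℤ.pos-* m (suc n))))) ⟩
  ℤ.- (ℤ.+ (m * suc n)) ℤ.+ r ≤⟨ ℤ.+-monoʳ-≤ (ℤ.- (ℤ.+ (m * suc n))) (i≤∣i∣ r) ⟩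
  ℤ.- (ℤ.+ (m * suc n)) ℤ.+ (ℤ.+ ℤ.∣ r ∣) <⟨ ℤ.+-monoʳ-< (ℤ.- (ℤ.+ (m * suc n))) (ℤ.+<+ (<-≤-trans h (m≤m*n m (suc n)))) ⟩
  ℤ.- (ℤ.+ (m * suc n)) ℤ.+ ℤ.+ (m * suc n) ≡⟨ ℤ.+-inverseˡ (ℤ.+ (m * suc n)) ⟩
  0ℤ ∎))
  where open ℤ.≤-Reasoning

leading-pos : ∀ m (x r : ℤ) → ℤ.∣ r ∣ < m → 0ℤ ℤ.< x → 0ℤ ℤ.< ℤ.+ m ℤ.* x ℤ.+ r
leading-pos m (ℤ.+ zero)  r h (ℤ.+<+ ())
leading-pos m (ℤ.+ suc n) r h lt = begin-strict
  0ℤ ≡⟨ sym (ℤ.+-inverseʳ (ℤ.+ ℤ.∣ r ∣)) ⟩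
  ℤ.+ ℤ.∣ r ∣ ℤ.+ ℤ.- (ℤ.+ ℤ.∣ r ∣) <⟨ ℤ.+-monoˡ-< (ℤ.- (ℤ.+ ℤ.∣ r ∣)) (ℤ.+<+ (<-≤-trans h (m≤m*n m (suc n)))) ⟩
  ℤ.+ (m * suc n) ℤ.+ ℤ.- (ℤ.+ ℤ.∣ r ∣) ≤⟨ ℤ.+-monoʳ-≤ (ℤ.+ (m * suc n)) (ℤ.≤-trans (ℤ.neg-mono-≤ (ℤ.≤-trans (i≤∣i∣ (ℤ.- r)) (ℤ.≤-reflexive (cong ℤ.+_ (ℤ.∣-i∣≡∣i∣ r))))) (ℤ.≤-reflexive (ℤ.neg-involutive r))) ⟩
  ℤ.+ (m * suc n) ℤ.+ r ≡⟨ cong (ℤ._+ r) (ℤ.pos-* m (suc n)) ⟩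
  ℤ.+ m ℤ.* (ℤ.+ suc n) ℤ.+ r ∎
  where open ℤ.≤-Reasoning

-- Two implications determine all three signs, since the negative of a small vector is small as
-- well.
record SameSigns {N} (H : ℕ) (w w′ : Fin N → ℤ) : Set where
  field
    nonneg : ∀ α → Small H α → 0ℤ ℤ.≤ dot α w → 0ℤ ℤ.≤ dot α w′
    pos    : ∀ α → Small H α → 0ℤ ℤ.< dot α w → 0ℤ ℤ.< dot α w′
open SameSigns

data Sign³ (x : ℤ) : Set where
  is-neg  : x ℤ.< 0ℤ → Sign³ x
  is-zero : x ≡ 0ℤ → Sign³ x
  is-pos  : 0ℤ ℤ.< x → Sign³ x

sign³ : ∀ x → Sign³ x
sign³ (ℤ.+ zero)  = is-zero refl
sign³ (ℤ.+ suc n) = is-pos (ℤ.+<+ (s≤s z≤n))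
sign³ ℤ.-[1+ n ]  = is-neg ℤ.-<+

-- Rounding w to p, with signs lost by the rounding recovered from r′.
round-signs : ∀ {N} H q m R (w p r r′ w′ : Fin N → ℤ) → 0 < q →
  (∀ j → ℤ.+ q ℤ.* w j ≡ ℤ.+ m ℤ.* p j ℤ.+ r j) → (∀ α → Small H α → ℤ.∣ dot α r ∣ < m) →
  (∀ j → w′ j ≡ ℤ.+ R ℤ.* p j ℤ.+ r′ j) → (∀ α → Small H α → ℤ.∣ dot α r′ ∣ < R) →
  SameSigns H r r′ → SameSigns H w w′
round-signs {N} H q@(suc q′) m R w p r r′ w′ 0<q e small e′ small′ S = record
  { nonneg = λ α hα h → nonneg-case α hα (subst (0ℤ ℤ.≤_) (expand α) (ℤ.≤-trans (ℤ.≤-reflexive (sym (ℤ.*-zeroʳ (ℤ.+ q)))) (ℤ.*-monoˡ-≤-nonNeg (ℤ.+ q) h))) (sign³ (dot α p))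
  ; pos    = λ α hα h → pos-case α hα (subst (0ℤ ℤ.<_) (expand α) (subst (ℤ._< ℤ.+ q ℤ.* dot α w) (ℤ.*-zeroʳ (ℤ.+ q)) (ℤ.*-monoˡ-<-pos (ℤ.+ q) h))) (sign³ (dot α p))
  }
  where
  expand : ∀ α → ℤ.+ q ℤ.* dot α w ≡ ℤ.+ m ℤ.* dot α p ℤ.+ dot α r
  expand α = trans (sym (dot-scale (ℤ.+ q) α w)) (dot-combine (ℤ.+ m) α p r (λ j → ℤ.+ q ℤ.* w j) e)
  expand′ : ∀ α → dot α w′ ≡ ℤ.+ R ℤ.* dot α p ℤ.+ dot α r′
  expand′ α = dot-combine (ℤ.+ R) α p r′ w′ e′
  drop-zero : ∀ a x r → x ≡ 0ℤ → ℤ.+ a ℤ.* x ℤ.+ r ≡ r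
  drop-zero a x r refl = trans (cong (ℤ._+ r) (ℤ.*-zeroʳ (ℤ.+ a))) (ℤ.+-identityˡ r)
  nonneg-case : ∀ α → Small H α → 0ℤ ℤ.≤ ℤ.+ m ℤ.* dot α p ℤ.+ dot α r → Sign³ (dot α p) → 0ℤ ℤ.≤ dot α w′
  nonneg-case α hα h (is-neg n)  = contradiction (leading-nonneg m (dot α p) (dot α r) (small α hα) h) (ℤ.<⇒≱ n)
  nonneg-case α hα h (is-zero z) = subst (0ℤ ℤ.≤_) (sym (trans (expand′ α) (drop-zero R _ _ z))) (nonneg S α hα (subst (0ℤ ℤ.≤_) (drop-zero m _ _ z) h))
  nonneg-case α hα h (is-pos p)  = subst (0ℤ ℤ.≤_) (sym (expand′ α)) (ℤ.<⇒≤ (leading-pos R _ _ (small′ α hα) p))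
  pos-case : ∀ α → Small H α → 0ℤ ℤ.< ℤ.+ m ℤ.* dot α p ℤ.+ dot α r → Sign³ (dot α p) → 0ℤ ℤ.< dot α w′
  pos-case α hα h (is-neg n)  = contradiction (leading-nonneg m (dot α p) (dot α r) (small α hα) (ℤ.<⇒≤ h)) (ℤ.<⇒≱ n)
  pos-case α hα h (is-zero z) = subst (0ℤ ℤ.<_) (sym (trans (expand′ α) (drop-zero R _ _ z))) (pos S α hα (subst (0ℤ ℤ.<_) (drop-zero m _ _ z) h))
  pos-case α hα h (is-pos p)  = subst (0ℤ ℤ.<_) (sym (expand′ α)) (leading-pos R _ _ (small′ α hα) p)

-- Dirichlet: the fractional parts of the multiples of w / m fall into
-- M ^ N boxes.
module Dirichlet {N : ℕ} (w : Fin N → ℤ) (m M : ℕ) .{{_ : NonZero m}} .{{_ : NonZero M}} where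

  φ : ℕ → Fin N → ℤ
  φ q j = (ℤ.+ q ℤ.* w j) ℤ./ℕ m

  ρ : ℕ → Fin N → ℕ
  ρ q j = (ℤ.+ q ℤ.* w j) ℤ.%ℕ m

  split : ∀ q j → ℤ.+ q ℤ.* w j ≡ ℤ.+ ρ q j ℤ.+ φ q j ℤ.* ℤ.+ m
  split q j = ℤ.a≡a%ℕn+[a/ℕn]*n (ℤ.+ q ℤ.* w j) m

  box : ℕ → Fin N → Fin M
  box q j = fromℕ< {M * ρ q j / m} (m<n*o⇒m/o<n (*-monoʳ-< M (ℤ.n%ℕd<d (ℤ.+ q ℤ.* w j) m)))

  collision : ∃[ q₁ ] ∃[ q₂ ] q₁ < q₂ × q₂ ≤ M ^ N × (∀ j → M * ρ q₁ j / m ≡ M * ρ q₂ j / m)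
  collision with Fin.pigeonhole (n<1+n (M ^ N)) (λ q → Fin.funToFin (box (toℕ q)))
  ... | i , j , i<j , eq = toℕ i , toℕ j , i<j , ≤-pred (Fin.toℕ<n j) , λ k →
    trans (sym (Fin.toℕ-fromℕ< _)) (trans (cong toℕ (trans (sym (Fin.finToFun-funToFin (box (toℕ i)) k)) (trans (cong (λ f → Fin.finToFun f k) eq) (Fin.finToFun-funToFin (box (toℕ j)) k)))) (Fin.toℕ-fromℕ< _))

  close : ∀ x y → M * x / m ≡ M * y / m → M * ∣ x - y ∣ < m
  close x y eq = subst (_< m) (sym (trans (*-distribˡ-∣-∣ M x y) (sub-quotient (M * x) (M * y) eq))) (∣-∣<  (m%n<n (M * x) m) (m%n<n (M * y) m))
    where
    ∣-∣< : ∀ {a b} → a < m → b < m → ∣ a - b ∣ < m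
    ∣-∣< {a} {b} a< b< = ≤-<-trans (∣m-n∣≤m⊔n a b) (⊔-lub a< b<)
    sub-quotient : ∀ a b → a / m ≡ b / m → ∣ a - b ∣ ≡ ∣ a % m - b % m ∣
    sub-quotient a b e = trans (cong₂ ∣_-_∣ (trans (m≡m%n+[m/n]*n a m) (+-comm (a % m) _)) (trans (m≡m%n+[m/n]*n b m) (trans (cong (λ k → b % m + k * m) (sym e)) (+-comm (b % m) _)))) (∣m+n-m+o∣≡∣n-o∣ (a / m * m) (a % m) (b % m))

  abstract
    -- The last component makes the recursion in `small-signs` progress: entries 0 and ± m are
    -- divisible by m and leave no remainder. With m the largest absolute value, zeros stay zeros
    -- and at least one more appears.
    approximation : ∃[ q ] Σ[ p ∈ (Fin N → ℤ) ] Σ[ r ∈ (Fin N → ℤ) ] 0 < q × q ≤ M ^ N × (∀ j → ℤ.+ q ℤ.* w j ≡ ℤ.+ m ℤ.* p j ℤ.+ r j) ×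
                    (∀ j → M * ℤ.∣ r j ∣ < m) × (∀ j → ℤ.∣ w j ∣ ≡ 0 ⊎ ℤ.∣ w j ∣ ≡ m → r j ≡ 0ℤ)
    approximation with collision
    ... | q₁ , q₂ , q₁<q₂ , q₂≤ , same = q₂ ∸ q₁ , (λ j → φ q₂ j ℤ.- φ q₁ j) , (λ j → ℤ.+ ρ q₂ j ℤ.- ℤ.+ ρ q₁ j) ,
      m<n⇒0<n∸m q₁<q₂ , ≤-trans (m∸n≤m q₂ q₁) q₂≤ , split′ , small , vanishes
      where
      split′ : ∀ j → ℤ.+ (q₂ ∸ q₁) ℤ.* w j ≡ ℤ.+ m ℤ.* (φ q₂ j ℤ.- φ q₁ j) ℤ.+ (ℤ.+ ρ q₂ j ℤ.- ℤ.+ ρ q₁ j)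
      split′ j = begin
        ℤ.+ (q₂ ∸ q₁) ℤ.* w j ≡⟨ cong (ℤ._* w j) (trans (sym (ℤ.⊖-≥ (<⇒≤ q₁<q₂))) (sym (ℤ.m-n≡m⊖n q₂ q₁))) ⟩
        (ℤ.+ q₂ ℤ.- ℤ.+ q₁) ℤ.* w j ≡⟨ lemma₁ (ℤ.+ q₂) (ℤ.+ q₁) (w j) ⟩
        ℤ.+ q₂ ℤ.* w j ℤ.- ℤ.+ q₁ ℤ.* w j ≡⟨ cong₂ ℤ._-_ (split q₂ j) (split q₁ j) ⟩
        (ℤ.+ ρ q₂ j ℤ.+ φ q₂ j ℤ.* ℤ.+ m) ℤ.- (ℤ.+ ρ q₁ j ℤ.+ φ q₁ j ℤ.* ℤ.+ m) ≡⟨ lemma₂ (ℤ.+ ρ q₂ j) (φ q₂ j) (ℤ.+ ρ q₁ j) (φ q₁ j) (ℤ.+ m) ⟩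
        ℤ.+ m ℤ.* (φ q₂ j ℤ.- φ q₁ j) ℤ.+ (ℤ.+ ρ q₂ j ℤ.- ℤ.+ ρ q₁ j) ∎
        where
        open ≡-Reasoning
        lemma₁ : ∀ a b w → (a ℤ.- b) ℤ.* w ≡ a ℤ.* w ℤ.- b ℤ.* w
        lemma₁ = ℤ-Ring.solve-∀
        lemma₂ : ∀ a b c d m → (a ℤ.+ b ℤ.* m) ℤ.- (c ℤ.+ d ℤ.* m) ≡ m ℤ.* (b ℤ.- d) ℤ.+ (a ℤ.- c)
        lemma₂ = ℤ-Ring.solve-∀
      abs-diff : ∀ a b → ℤ.∣ ℤ.+ a ℤ.- ℤ.+ b ∣ ≡ ∣ a - b ∣
      abs-diff a b = trans (cong ℤ.∣_∣ (ℤ.m-n≡m⊖n a b)) (abs-⊖ a b)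
      small : ∀ j → M * ℤ.∣ ℤ.+ ρ q₂ j ℤ.- ℤ.+ ρ q₁ j ∣ < m
      small j = subst (λ d → M * d < m) (sym (abs-diff (ρ q₂ j) (ρ q₁ j))) (close (ρ q₂ j) (ρ q₁ j) (sym (same j)))
      ρ-zero : ∀ q j → ℤ.∣ w j ∣ ≡ 0 ⊎ ℤ.∣ w j ∣ ≡ m → ρ q j ≡ 0
      ρ-zero q j h = multiple h
        where
        abs : ℤ.∣ ℤ.+ q ℤ.* w j ∣ ≡ q * ℤ.∣ w j ∣
        abs = ℤ.abs-* (ℤ.+ q) (w j)
        multiple : ℤ.∣ w j ∣ ≡ 0 ⊎ ℤ.∣ w j ∣ ≡ m → ρ q j ≡ 0
        multiple (inj₁ e) = mod-multiple (ℤ.+ q ℤ.* w j) 0 m (trans abs (trans (cong (q *_) e) (*-zeroʳ q)))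
        multiple (inj₂ e) = mod-multiple (ℤ.+ q ℤ.* w j) q m (trans abs (cong (q *_) e))
      vanishes : ∀ j → ℤ.∣ w j ∣ ≡ 0 ⊎ ℤ.∣ w j ∣ ≡ m → ℤ.+ ρ q₂ j ℤ.- ℤ.+ ρ q₁ j ≡ 0ℤ
      vanishes j h rewrite ρ-zero q₂ j h | ρ-zero q₁ j h = refl

argmax : ∀ {N} (w : Fin (suc N) → ℤ) → ∃[ J ] ∀ j → ℤ.∣ w j ∣ ≤ ℤ.∣ w J ∣
argmax {zero}  w = zero , λ { zero → ≤-refl }
argmax {suc N} w with argmax (w ∘ suc)
... | J , h with ℤ.∣ w zero ∣ ≤? ℤ.∣ w (suc J) ∣
... | yes le = suc J , λ { zero → le ; (suc j) → h j }
... | no ¬le = zero , λ { zero → ≤-refl ; (suc j) → ≤-trans (h j) (<⇒≤ (≰⇒> ¬le)) }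

nonzero : ℤ → ℕ
nonzero (ℤ.+ zero) = 0
nonzero _          = 1

nonzeros : ∀ {N} → (Fin N → ℤ) → ℕ
nonzeros {zero}  w = 0
nonzeros {suc N} w = nonzero (w zero) + nonzeros (w ∘ suc)

nonzero-mono : ∀ x y → (ℤ.∣ x ∣ ≡ 0 → y ≡ 0ℤ) → nonzero y ≤ nonzero x
nonzero-mono (ℤ.+ zero)  y h rewrite h refl = z≤n
nonzero-mono (ℤ.+ suc n) y h = nonzero≤1 y
  where
  nonzero≤1 : ∀ y → nonzero y ≤ 1
  nonzero≤1 (ℤ.+ zero)  = z≤n
  nonzero≤1 (ℤ.+ suc _) = ≤-refl
  nonzero≤1 ℤ.-[1+ _ ]  = ≤-refl
nonzero-mono ℤ.-[1+ n ]  (ℤ.+ zero)  h = z≤n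
nonzero-mono ℤ.-[1+ n ]  (ℤ.+ suc _) h = ≤-refl
nonzero-mono ℤ.-[1+ n ]  ℤ.-[1+ _ ]  h = ≤-refl

nonzeros-mono : ∀ {N} (w r : Fin N → ℤ) → (∀ j → ℤ.∣ w j ∣ ≡ 0 → r j ≡ 0ℤ) → nonzeros r ≤ nonzeros w
nonzeros-mono {zero}  w r h = z≤n
nonzeros-mono {suc N} w r h = +-mono-≤ (nonzero-mono (w zero) (r zero) (h zero)) (nonzeros-mono (w ∘ suc) (r ∘ suc) (h ∘ suc))

nonzeros-strict : ∀ {N} (w r : Fin N → ℤ) J → (∀ j → ℤ.∣ w j ∣ ≡ 0 → r j ≡ 0ℤ) → r J ≡ 0ℤ → 0 < ℤ.∣ w J ∣ → nonzeros r < nonzeros w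
nonzeros-strict w r zero    h r≡0 w>0 rewrite r≡0 with w zero
... | ℤ.+ suc _  = s≤s (nonzeros-mono (w ∘ suc) (r ∘ suc) (h ∘ suc))
... | ℤ.-[1+ _ ] = s≤s (nonzeros-mono (w ∘ suc) (r ∘ suc) (h ∘ suc))
nonzeros-strict w r (suc J) h r≡0 w>0 = +-mono-≤-< (nonzero-mono (w zero) (r zero) (h zero)) (nonzeros-strict (w ∘ suc) (r ∘ suc) J (h ∘ suc) r≡0 w>0)

nonzeros≤ : ∀ {N} (w : Fin N → ℤ) → nonzeros w ≤ N
nonzeros≤ {zero}  w = z≤n
nonzeros≤ {suc N} w with w zero
... | ℤ.+ zero   = m≤n⇒m≤1+n (nonzeros≤ (w ∘ suc))
... | ℤ.+ suc _  = s≤s (nonzeros≤ (w ∘ suc))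
... | ℤ.-[1+ _ ] = s≤s (nonzeros≤ (w ∘ suc))

-- One round yields R p + r′. Here r′ is bounded by the previous value β, the entries of p are at
-- most M ^ N with M = N H + 1, and R = N H β + 1 exceeds every small combination of r′.
coefficientBound : ℕ → ℕ → ℕ → ℕ
coefficientBound N H zero    = 0
coefficientBound N H (suc s) = suc (N * (H * coefficientBound N H s)) * suc (N * H) ^ N + coefficientBound N H s

-- Frank and Tardos: every vector has the same sign pattern as one with
-- small entries.  Each round makes a largest entry vanish.
small-signs : ∀ s {N} H (w : Fin N → ℤ) → nonzeros w ≤ s →
              Σ[ w′ ∈ (Fin N → ℤ) ] (∀ j → ℤ.∣ w′ j ∣ ≤ coefficientBound N H s) × SameSigns H w w′
small-signs s {zero} H w _ = w , (λ ()) , record { nonneg = λ _ _ h → h ; pos = λ _ _ h → h }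
small-signs s {suc N′} H w nz with argmax w
... | J , max with ℤ.∣ w J ∣ in wJ
... | zero = w , (λ j → ≤-trans (max j) z≤n) , record { nonneg = λ _ _ h → h ; pos = λ _ _ h → h }
small-signs zero {suc N′} H w nz | J , max | suc m′ =
  contradiction (≤-trans (nonzeros-strict w (λ _ → 0ℤ) J (λ _ _ → refl) refl (subst (0 <_) (sym wJ) (s≤s z≤n))) nz) λ ()
-- With N H + 1 boxes in each direction, a small combination of the remainders is at most N H m / (N
-- H + 1), which is below m and so cannot override the leading part.
small-signs (suc s) {suc N′} H w nz | J , max | m@(suc m′) with Dirichlet.approximation w m (suc (suc N′ * H))
... | q , p , r , 0<q , q≤ , split , small , vanish
  with small-signs s H r (≤-pred (≤-trans (nonzeros-strict w r J (λ j e → vanish j (inj₁ e)) (vanish J (inj₂ wJ)) (subst (0 <_) (sym wJ) (s≤s z≤n))) nz))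
... | r′ , bound′ , signs = w′ , bound , round-signs H q m R w p r r′ w′ 0<q split small-r (λ _ → refl) small-r′ signs
  where
  N M β R : ℕ
  N = suc N′
  M = suc (N * H)
  β = coefficientBound N H s
  R = suc (N * (H * β))
  w′ : Fin N → ℤ
  w′ j = ℤ.+ R ℤ.* p j ℤ.+ r′ j
  small-r : ∀ α → Small H α → ℤ.∣ dot α r ∣ < m
  small-r α hα = *-cancelˡ-< M _ _ (≤-<-trans (dot-bound M H m α r hα (λ j → <⇒≤ (small j))) (≤-trans (s≤s (≤-reflexive (sym (*-assoc N H m)))) (m<n+m (N * H * m) (s≤s z≤n))))
  small-r′ : ∀ α → Small H α → ℤ.∣ dot α r′ ∣ < R
  small-r′ α hα = s≤s (≤-trans (≤-reflexive (sym (*-identityˡ _))) (dot-bound 1 H β α r′ hα (λ j → ≤-trans (≤-reflexive (*-identityˡ _)) (bound′ j))))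
  p≤q : ∀ j → ℤ.∣ p j ∣ ≤ q
  p≤q j = ≤-pred (*-cancelˡ-< m _ _ (begin-strict
    m * ℤ.∣ p j ∣ ≡⟨ sym (ℤ.abs-* (ℤ.+ m) (p j)) ⟩
    ℤ.∣ ℤ.+ m ℤ.* p j ∣ ≡⟨ cong ℤ.∣_∣ (trans (lemma (ℤ.+ m ℤ.* p j) (r j)) (cong (ℤ._- r j) (sym (split j)))) ⟩
    ℤ.∣ ℤ.+ q ℤ.* w j ℤ.- r j ∣ ≤⟨ ℤ.∣i-j∣≤∣i∣+∣j∣ (ℤ.+ q ℤ.* w j) (r j) ⟩
    ℤ.∣ ℤ.+ q ℤ.* w j ∣ + ℤ.∣ r j ∣ ≡⟨ cong (_+ ℤ.∣ r j ∣) (ℤ.abs-* (ℤ.+ q) (w j)) ⟩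
    q * ℤ.∣ w j ∣ + ℤ.∣ r j ∣ ≤⟨ +-monoˡ-≤ _ (*-monoʳ-≤ q (max j)) ⟩
    q * m + ℤ.∣ r j ∣ <⟨ +-monoʳ-< (q * m) (≤-<-trans (m≤m+n ℤ.∣ r j ∣ _) (small j)) ⟩
    q * m + m ≡⟨ lemma₂ q m ⟩
    m * suc q ∎))
    where
    open ≤-Reasoning
    lemma : ∀ x r → x ≡ x ℤ.+ r ℤ.- r
    lemma = ℤ-Ring.solve-∀
    lemma₂ : ∀ q m → q * m + m ≡ m * suc q
    lemma₂ = solve-∀
  bound : ∀ j → ℤ.∣ w′ j ∣ ≤ R * M ^ N + β
  bound j = begin
    ℤ.∣ ℤ.+ R ℤ.* p j ℤ.+ r′ j ∣ ≤⟨ ℤ.∣i+j∣≤∣i∣+∣j∣ (ℤ.+ R ℤ.* p j) (r′ j) ⟩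
    ℤ.∣ ℤ.+ R ℤ.* p j ∣ + ℤ.∣ r′ j ∣ ≡⟨ cong (_+ ℤ.∣ r′ j ∣) (ℤ.abs-* (ℤ.+ R) (p j)) ⟩
    R * ℤ.∣ p j ∣ + ℤ.∣ r′ j ∣ ≤⟨ +-mono-≤ (*-monoʳ-≤ R (≤-trans (p≤q j) q≤)) (bound′ j) ⟩
    R * M ^ N + β ∎
    where open ≤-Reasoning

-- A round multiplies β + 1 by at most M ^ (N + 1) + 1, and this is at most 2 to the power 1 + (N +
-- 1) μ.
coefficientBound< : ∀ N H s μ → suc (N * H) ≤ 2 ^ μ → coefficientBound N H s < 2 ^ (s * suc (suc N * μ))
coefficientBound< N H zero    μ h = s≤s z≤n
coefficientBound< N H (suc s) μ h = begin
  suc (suc (N * (H * β)) * M ^ N + β) ≤⟨ s≤s (+-monoˡ-≤ β (*-monoˡ-≤ (M ^ N) (s≤s (≤-reflexive (sym (*-assoc N H β)))))) ⟩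
  suc (suc (N * H * β) * M ^ N + β) ≤⟨ by≤ {c = 0} z≤n (trans (lemma (N * H) β (M ^ N)) refl) ⟩
  suc β * suc (M * M ^ N) ≤⟨ *-mono-≤ (coefficientBound< N H s μ h) one+ ⟩
  2 ^ (s * e) * 2 ^ e ≡⟨ sym (^-distribˡ-+-* 2 (s * e) e) ⟩
  2 ^ (s * e + e) ≡⟨ cong (2 ^_) (+-comm (s * e) e) ⟩
  2 ^ (suc s * e) ∎
  where
  open ≤-Reasoning
  M β e : ℕ
  M = suc (N * H)
  β = coefficientBound N H s
  e = suc (suc N * μ)
  lemma : ∀ x β P → suc (suc (x * β) * P + β) + (β * P + x * P) ≡ suc β * suc (suc x * P) + 0
  lemma = solve-∀
  one+ : suc (M * M ^ N) ≤ 2 ^ e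
  one+ = begin
    suc (M ^ suc N) ≤⟨ +-mono-≤ (m^n>0 M (suc N)) (m≤m+n (M ^ suc N) 0) ⟩
    2 * M ^ suc N ≤⟨ *-monoʳ-≤ 2 (^-monoˡ-≤ (suc N) h) ⟩
    2 * (2 ^ μ) ^ suc N ≡⟨ cong (2 *_) (trans (^-*-assoc 2 μ (suc N)) (cong (2 ^_) (*-comm μ (suc N)))) ⟩
    2 ^ e ∎

-- Schedules with small numbers

busy : ∀ {n} → Segs n → ℕ
busy []                  = 0
busy ((nothing , x) ∷ σ) = busy σ
busy ((just i , x) ∷ σ)  = x + busy σ

sum-map-+ : ∀ {A : Set} (f g : A → ℕ) xs → sum (map (λ x → f x + g x) xs) ≡ sum (map f xs) + sum (map g xs)
sum-map-+ f g []       = refl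
sum-map-+ f g (x ∷ xs) rewrite sum-map-+ f g xs = lemma (f x) (g x) (sum (map f xs)) (sum (map g xs))
  where
  lemma : ∀ a b c d → a + b + (c + d) ≡ a + c + (b + d)
  lemma = solve-∀

sum-map-0 : ∀ {A : Set} (xs : List A) → sum (map (λ _ → 0) xs) ≡ 0
sum-map-0 []       = refl
sum-map-0 (x ∷ xs) = sum-map-0 xs

sum-indicator : ∀ {n} (i : Fin n) x → sum (map (λ k → credit (kind k (just i)) 0 x) (List.allFin n)) ≡ x
sum-indicator {suc n} zero    x = trans (cong (x +_) (trans (cong sum (trans (List.map-tabulate {n = n} suc (λ k → credit (kind k (just zero)) 0 x)) (sym (List.map-tabulate {n = n} id (λ _ → 0))))) (sum-map-0 (List.allFin n)))) (+-identityʳ x)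
sum-indicator {suc n} (suc i) x = trans (cong sum (trans (List.map-tabulate suc (λ k → credit (kind k (just (suc i))) 0 x)) (trans (List.tabulate-cong same) (sym (List.map-tabulate id (λ k → credit (kind k (just i)) 0 x)))))) (sum-indicator i x)
  where
  same : ∀ k → credit (kind (suc k) (just (suc i))) 0 x ≡ credit (kind k (just i)) 0 x
  same k with i Fin.≟ k
  ... | yes _ = refl
  ... | no _  = refl

-- Turns the sum over all jobs into a linear form in the durations with coefficients 0 and 1.
workload-busy : ∀ {n} (σ : Segs n) → workload σ ≡ busy σ
workload-busy {n} []                  = sum-map-0 (List.allFin n)
workload-busy {n} ((nothing , x) ∷ σ) = workload-busy σ
workload-busy {n} ((just i , x) ∷ σ)  = trans (sum-map-+ (λ k → credit (kind k (just i)) 0 x) (worked σ) (List.allFin n)) (cong₂ _+_ (sum-indicator i x) (workload-busy σ))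

-- Every condition compares two sums, so natural coefficients suffice; the difference of the two
-- sides is the integer vector whose sign has to be kept.
Form : ℕ → Set
Form N = Fin N → ℕ

evaluate : ∀ {N} → Form N → (Fin N → ℕ) → ℕ
evaluate {zero}  f v = 0
evaluate {suc N} f v = f zero * v zero + evaluate (f ∘ suc) (v ∘ suc)

_⊕_ : ∀ {N} → Form N → Form N → Form N
(f ⊕ g) j = f j + g j

evaluate-⊕ : ∀ {N} (f g : Form N) v → evaluate (f ⊕ g) v ≡ evaluate f v + evaluate g v
evaluate-⊕ {zero}  f g v = refl
evaluate-⊕ {suc N} f g v rewrite evaluate-⊕ (f ∘ suc) (g ∘ suc) (v ∘ suc) = lemma (f zero) (g zero) (v zero) (evaluate (f ∘ suc) (v ∘ suc)) (evaluate (g ∘ suc) (v ∘ suc))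
  where
  lemma : ∀ a b v x y → (a + b) * v + (x + y) ≡ a * v + x + (b * v + y)
  lemma = solve-∀

single : ∀ {N} → Fin N → ℕ → Form N
single zero    c zero    = c
single zero    c (suc j) = 0
single (suc i) c zero    = 0
single (suc i) c (suc j) = single i c j

evaluate-0 : ∀ {N} (v : Fin N → ℕ) → evaluate (λ _ → 0) v ≡ 0
evaluate-0 {zero}  v = refl
evaluate-0 {suc N} v = evaluate-0 (v ∘ suc)

evaluate-single : ∀ {N} (i : Fin N) c v → evaluate (single i c) v ≡ c * v i
evaluate-single zero    c v = trans (cong (c * v zero +_) (evaluate-0 (v ∘ suc))) (+-identityʳ _)
evaluate-single (suc i) c v = evaluate-single i c (v ∘ suc)

single≤ : ∀ {N} (i : Fin N) c j → single i c j ≤ c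
single≤ zero    c zero    = ≤-refl
single≤ zero    c (suc j) = z≤n
single≤ (suc i) c zero    = z≤n
single≤ (suc i) c (suc j) = single≤ i c j

Coefs≤ : ∀ {N} → ℕ → Form N → Set
Coefs≤ c f = ∀ j → f j ≤ c

dot-forms : ∀ {N} (P Q : Form N) v → dot (λ j → ℤ.+ Q j ℤ.- ℤ.+ P j) (λ j → ℤ.+ v j) ≡ ℤ.+ evaluate Q v ℤ.- ℤ.+ evaluate P v
dot-forms {zero}  P Q v = refl
dot-forms {suc N} P Q v rewrite dot-forms (P ∘ suc) (Q ∘ suc) (v ∘ suc) =
  trans (lemma (ℤ.+ Q zero) (ℤ.+ P zero) (ℤ.+ v zero) X Y)
        (cong₂ (λ a b → a ℤ.+ X ℤ.- (b ℤ.+ Y)) (sym (ℤ.pos-* (Q zero) (v zero))) (sym (ℤ.pos-* (P zero) (v zero))))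
  where
  X Y : ℤ
  X = ℤ.+ evaluate (Q ∘ suc) (v ∘ suc)
  Y = ℤ.+ evaluate (P ∘ suc) (v ∘ suc)
  lemma : ∀ q p v x y → (q ℤ.- p) ℤ.* v ℤ.+ (x ℤ.- y) ≡ q ℤ.* v ℤ.+ x ℤ.- (p ℤ.* v ℤ.+ y)
  lemma = ℤ-Ring.solve-∀

record Agree {N} (H : ℕ) (v v′ : Fin N → ℕ) : Set where
  field
    agree-≤ : ∀ {P Q} → Coefs≤ H P → Coefs≤ H Q → evaluate P v ≤ evaluate Q v → evaluate P v′ ≤ evaluate Q v′
    agree-< : ∀ {P Q} → Coefs≤ H P → Coefs≤ H Q → evaluate P v < evaluate Q v → evaluate P v′ < evaluate Q v′
open Agree

-- As 1 ≤ H, the unit vectors are among the small ones. Hence the new entries are nonnegative and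
-- may be read as natural numbers.
small-solution : ∀ {N} H (v : Fin N → ℕ) → 1 ≤ H → Σ[ v′ ∈ (Fin N → ℕ) ] (∀ j → v′ j ≤ coefficientBound N H N) × Agree H v v′
small-solution {N} H v 1≤H with small-signs N H (λ j → ℤ.+ v j) (nonzeros≤ (λ j → ℤ.+ v j))
... | w′ , bound , S = v′ , bound , record
  { agree-≤ = λ {P} {Q} hP hQ h → ℤ.drop‿+≤+ (ℤ.0≤i-j⇒j≤i (subst (0ℤ ℤ.≤_) (to-v′ P Q)
                (nonneg S _ (small P Q hP hQ) (subst (0ℤ ℤ.≤_) (sym (dot-forms P Q v)) (ℤ.i≤j⇒0≤j-i (ℤ.+≤+ h))))))
  ; agree-< = λ {P} {Q} hP hQ h → ℤ.drop‿+<+ (ℤ-0<⇒< (subst (0ℤ ℤ.<_) (to-v′ P Q)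
                (pos S _ (small P Q hP hQ) (subst (0ℤ ℤ.<_) (sym (dot-forms P Q v)) (ℤ-<⇒0< (ℤ.+<+ h))))))
  }
  where
  ℤ-<⇒0< : ∀ {x y} → x ℤ.< y → 0ℤ ℤ.< y ℤ.- x
  ℤ-<⇒0< {x} {y} h = subst (ℤ._< y ℤ.- x) (ℤ.+-inverseʳ x) (ℤ.+-monoˡ-< (ℤ.- x) h)
  ℤ-0<⇒< : ∀ {x y} → 0ℤ ℤ.< y ℤ.- x → x ℤ.< y
  ℤ-0<⇒< {x} {y} h = subst₂ ℤ._<_ (ℤ.+-identityˡ x) (lemma x y) (ℤ.+-monoˡ-< x h)
    where
    lemma : ∀ x y → y ℤ.- x ℤ.+ x ≡ y
    lemma = ℤ-Ring.solve-∀
  v′ : Fin N → ℕ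
  v′ j = ℤ.∣ w′ j ∣
  nonneg-w′ : ∀ j → 0ℤ ℤ.≤ w′ j
  nonneg-w′ j = subst (0ℤ ℤ.≤_) (dot-unit j w′) (nonneg S (unitℤ j) (small-unit j) (subst (0ℤ ℤ.≤_) (sym (dot-unit j (λ j → ℤ.+ v j))) (ℤ.+≤+ z≤n)))
    where
    unitℤ : ∀ {N} → Fin N → Fin N → ℤ
    unitℤ i j = ℤ.+ single i 1 j
    small-unit : ∀ j → Small H (unitℤ j)
    small-unit j k = ≤-trans (single≤ j 1 k) 1≤H
    dot-zero : ∀ {N} (w : Fin N → ℤ) → dot (λ _ → 0ℤ) w ≡ 0ℤ
    dot-zero {zero}  w = refl
    dot-zero {suc N} w rewrite dot-zero (w ∘ suc) = refl
    dot-unit : ∀ {N} (j : Fin N) w → dot (unitℤ j) w ≡ w j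
    dot-unit zero    w = trans (cong₂ ℤ._+_ (ℤ.*-identityˡ (w zero)) (dot-zero (w ∘ suc))) (ℤ.+-identityʳ (w zero))
    dot-unit (suc j) w = trans (ℤ.+-identityˡ (dot (unitℤ j) (w ∘ suc))) (dot-unit j (w ∘ suc))
  dot-cong : ∀ {N} (α : Fin N → ℤ) {w u} → (∀ j → w j ≡ u j) → dot α w ≡ dot α u
  dot-cong {zero}  α e = refl
  dot-cong {suc N} α e = cong₂ ℤ._+_ (cong (α zero ℤ.*_) (e zero)) (dot-cong (α ∘ suc) (e ∘ suc))
  to-v′ : ∀ P Q → dot (λ j → ℤ.+ Q j ℤ.- ℤ.+ P j) w′ ≡ ℤ.+ evaluate Q v′ ℤ.- ℤ.+ evaluate P v′
  to-v′ P Q = trans (dot-cong _ (λ j → sym (ℤ.0≤i⇒+∣i∣≡i (nonneg-w′ j)))) (dot-forms P Q v′)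
  small : ∀ P Q → Coefs≤ H P → Coefs≤ H Q → Small H (λ j → ℤ.+ Q j ℤ.- ℤ.+ P j)
  small P Q hP hQ j = ≤-trans (≤-reflexive (trans (cong ℤ.∣_∣ (ℤ.m-n≡m⊖n (Q j) (P j))) (abs-⊖ (Q j) (P j)))) (≤-trans (∣m-n∣≤m⊔n (Q j) (P j)) (⊔-lub (hQ j) (hP j)))

-- Forms are compared through their values at `v`. The conditions can thus be carried from one `v`
-- to another while the forms themselves stay put.
module FormCheck {N : ℕ} (v : Fin N → ℕ) where
  open Check {Form N} _⊕_ (λ f g → evaluate f v ≤ evaluate g v) (λ f g → evaluate f v < evaluate g v) public
  module T = Transfer {Form N} _⊕_ (λ f g → evaluate f v ≤ evaluate g v) (λ f g → evaluate f v < evaluate g v) _+_ _≤_ _<_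
                      (λ f → evaluate f v) (λ f g → evaluate-⊕ f g v) (mk⇔ id id) (mk⇔ id id)

module _ {N H h : ℕ} {v v′ : Fin N → ℕ} (agr : Agree H v v′) where

  module F = FormCheck v
  module F′ = FormCheck v′

  -- `c` bounds the coefficients of the time and of the amount processed and grows by one with each
  -- segment; `h` bounds those of the job. Every form that is compared then has coefficients of at
  -- most c + h + h + 1.
  agree-ok : ∀ {T A D τ y : Form N} c fs → c + length fs + (h + h + 1) ≤ H → Coefs≤ h T → Coefs≤ h A → Coefs≤ h D → Coefs≤ c τ → Coefs≤ c y →
             All (λ s → Coefs≤ 1 (proj₂ s)) fs → F.Ok T A D τ y fs → F′.Ok T A D τ y fs
  agree-ok {T} {A} {D} {τ} {y} c fs le hT hA hD hτ hy = go fs le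
    where
    module _ (cap : c + (h + h + 1) ≤ H) where
      to-H : ∀ {f e} → e ≤ c + (h + h + 1) → Coefs≤ {N} e f → Coefs≤ H f
      to-H e≤ hf j = ≤-trans (hf j) (≤-trans e≤ cap)
      plus : ∀ {f g e e′} → Coefs≤ {N} e f → Coefs≤ e′ g → Coefs≤ (e + e′) (f ⊕ g)
      plus hf hg j = +-mono-≤ (hf j) (hg j)
      h≤ : h ≤ c + (h + h + 1)
      h≤ = by≤ {c = 0} z≤n (trans (+-comm h (c + h + 1)) (trans (lemma c h) (sym (+-identityʳ _))))
        where
        lemma : ∀ c h → c + h + 1 + h ≡ c + (h + h + 1)
        lemma = solve-∀
      ch≤ : c + h ≤ c + (h + h + 1)
      ch≤ = +-monoʳ-≤ c (≤-trans (m≤m+n h h) (m≤m+n _ 1))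
      hT′ : Coefs≤ H T
      hT′ = to-H h≤ hT
      hDy : Coefs≤ H (D ⊕ y)
      hDy = to-H (≤-trans (≤-reflexive (+-comm h c)) ch≤) (plus hD hy)
      hτT : Coefs≤ H (τ ⊕ T)
      hτT = to-H ch≤ (plus hτ hT)
      dead : F.Dead T A D τ y → F′.Dead T A D τ y
      dead (inj₁ e)        = inj₁ (agree-≤ agr hT′ (to-H (m≤m+n c _) hy) e)
      dead (inj₂ (inj₁ e)) = inj₂ (inj₁ (agree-< agr hDy hτT e))
      dead (inj₂ (inj₂ e)) = inj₂ (inj₂ (agree-< agr hDy (to-H (≤-trans (m≤m+n (h + h) 1) (m≤n+m _ c)) (plus hA hT)) e))
      allowed : ∀ κ {f} → Coefs≤ 1 f → F.Allowed κ T A D τ y f → F′.Allowed κ T A D τ y f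
      allowed mine  hf (e₁ , e₂ , e₃) = agree-≤ agr (to-H h≤ hA) (to-H (m≤m+n c _) hτ) e₁ , agree-≤ agr (to-H c+1≤ (plus hy hf)) hT′ e₂ , agree-≤ agr hτT hDy e₃
        where
        c+1≤ : c + 1 ≤ c + (h + h + 1)
        c+1≤ = +-monoʳ-≤ c (m≤n+m 1 (h + h))
      allowed idle  hf (inj₁ e) = inj₁ (agree-≤ agr (to-H (+-monoʳ-≤ c (m≤n+m 1 (h + h))) (plus hτ hf)) (to-H h≤ hA) e)
      allowed idle  hf (inj₂ e) = inj₂ (dead e)
      allowed other hf _        = tt
    c≤c+ : ∀ l → c + (h + h + 1) ≤ c + l + (h + h + 1)
    c≤c+ l = +-monoˡ-≤ (h + h + 1) (m≤m+n c l)
    credit≤ : ∀ κ {f} → Coefs≤ 1 f → Coefs≤ (c + 1) (F.credit κ y f)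
    credit≤ mine  hf j = +-mono-≤ (hy j) (hf j)
    credit≤ idle  hf j = ≤-trans (hy j) (m≤m+n c 1)
    credit≤ other hf j = ≤-trans (hy j) (m≤m+n c 1)
    credit-same : ∀ κ f → F′.credit κ y f ≡ F.credit κ y f
    credit-same mine  f = refl
    credit-same idle  f = refl
    credit-same other f = refl
    go : ∀ fs → c + length fs + (h + h + 1) ≤ H → All (λ s → Coefs≤ 1 (proj₂ s)) fs → F.Ok T A D τ y fs → F′.Ok T A D τ y fs
    go []             le []         ok        = dead (≤-trans (c≤c+ 0) le) ok
    go ((κ , f) ∷ fs) le (hf ∷ hfs) (ok , oks) = allowed (≤-trans (c≤c+ (suc (length fs))) le) κ hf ok ,
      subst (λ z → F′.Ok T A D (τ ⊕ f) z fs) (sym (credit-same κ f))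
        (agree-ok (c + 1) fs (≤-trans (≤-reflexive (cong (_+ (h + h + 1)) (+-assoc c 1 (length fs)))) le) hT hA hD (λ j → +-mono-≤ (hτ j) (hf j)) (credit≤ κ hf) hfs oks)

Bounds : ∀ {n} → ℕ → ℕ → Vec Job n → Set
Bounds h bound jobs = bound ≤ h × (∀ k → Job.processing (lookup jobs k) ≤ h × Job.arrival (lookup jobs k) ≤ h × Job.deadline (lookup jobs k) ≤ h)

-- The unknowns are the unit K and the durations. A number T of the instance occurs only in the
-- product K T and so becomes a coefficient of the unknown K, which is why `h` enters the bound on
-- the coefficients.
small-plan : ∀ I {K σ} h → Plan I K σ → Bounds h (Instance.bound I) (Instance.jobs I) →
  let N = suc (length σ) ; β = coefficientBound N (length σ + (h + h + 1)) N in
  ∃[ K′ ] ∃[ σ′ ] Plan I K′ σ′ × length σ′ ≡ length σ × K′ ≤ β × All (λ s → proj₂ s ≤ β) σ′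
small-plan I {K} {σ} h P (hb , hjobs) with small-solution {suc (length σ)} (length σ + (h + h + 1)) v (≤-trans (m≤n+m 1 (h + h)) (m≤n+m _ (length σ)))
  where
  v : Fin (suc (length σ)) → ℕ
  v zero    = K
  v (suc s) = proj₂ (List.lookup σ s)
... | v′ , bound′ , agr = v′ zero , at v′ , record
  { unit-positive = subst₂ _<_ (evaluate-0 v′) (trans (evaluate-single zero 1 v′) (*-identityˡ _))
                      (agree-< agr (λ _ → z≤n) (unit≤ zero) (subst₂ _<_ (sym (evaluate-0 v)) (sym (trans (evaluate-single zero 1 v) (*-identityˡ _))) unit-positive))
  ; positive      = All.map⁺ (All.tabulate⁺ (λ s → subst₂ _<_ (evaluate-0 v′) refl
                      (agree-< agr (λ _ → z≤n) (unit≤ (suc s)) (subst₂ _<_ (sym (evaluate-0 v)) (sym (trans (evaluate-single (suc s) 1 v) (*-identityˡ _))) (All-lookup positive s)))))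
  ; ok            = λ k → ok′ k
  ; work          = subst₂ _≤_ (trans (busy-form v′ fs) (sym (workload-busy (at v′)))) (trans (evaluate-single zero (Instance.bound I) v′) (*-comm (Instance.bound I) (v′ zero)))
                      (agree-≤ agr {busyForm fs} {single zero (Instance.bound I)} (λ j → ≤-trans (busyForm≤ fs forms≤1 j) (≤-trans (≤-reflexive fs-length) (m≤m+n (length σ) _))) (λ j → ≤-trans (single≤ zero _ j) (≤-trans hb h≤H))
                        (subst₂ _≤_ (sym (trans (busy-form v fs) (trans (cong busy at-v) (sym (workload-busy σ))))) (sym (trans (evaluate-single zero (Instance.bound I) v) (*-comm (Instance.bound I) K))) work))
  } , trans (List.length-map _ fs) fs-length , bound′ zero , All.map⁺ (All.tabulate⁺ (λ s → ≤-trans (≤-reflexive (trans (evaluate-single (suc s) 1 v′) (*-identityˡ _))) (bound′ (suc s))))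
  where
  open Instance I using (size; jobs)
  open Plan P
  v : Fin (suc (length σ)) → ℕ
  v zero    = K
  v (suc s) = proj₂ (List.lookup σ s)
  H : ℕ
  H = length σ + (h + h + 1)
  fs : List (Maybe (Fin size) × Form (suc (length σ)))
  fs = List.tabulate (λ s → proj₁ (List.lookup σ s) , single (suc s) 1)
  at : (Fin (suc (length σ)) → ℕ) → Segs size
  at u = map (λ (i , f) → i , evaluate f u) fs
  at-v : at v ≡ σ
  at-v = trans (List.map-tabulate _ _) (trans (List.tabulate-cong (λ s → cong (proj₁ (List.lookup σ s) ,_) (trans (evaluate-single (suc s) 1 v) (*-identityˡ _)))) (List.tabulate-lookup σ))
  fs-length : length fs ≡ length σ
  fs-length = List.length-tabulate _
  h≤H : h ≤ H
  h≤H = ≤-trans (≤-trans (m≤m+n h h) (m≤m+n _ 1)) (m≤n+m _ (length σ))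
  unit≤ : ∀ j → Coefs≤ H (single j 1)
  unit≤ j k = ≤-trans (single≤ j 1 k) (≤-trans (m≤n+m 1 (h + h)) (m≤n+m _ (length σ)))
  forms≤1 : All (λ s → Coefs≤ 1 (proj₂ s)) fs
  forms≤1 = All.tabulate⁺ (λ s → single≤ (suc s) 1)
  busyForm : List (Maybe (Fin size) × Form (suc (length σ))) → Form (suc (length σ))
  busyForm []                  = λ _ → 0
  busyForm ((nothing , f) ∷ fs) = busyForm fs
  busyForm ((just i , f) ∷ fs)  = f ⊕ busyForm fs
  busy-form : ∀ u fs → evaluate (busyForm fs) u ≡ busy (map (λ (i , f) → i , evaluate f u) fs)
  busy-form u []                   = evaluate-0 u
  busy-form u ((nothing , f) ∷ fs) = busy-form u fs
  busy-form u ((just i , f) ∷ fs)  = trans (evaluate-⊕ f (busyForm fs) u) (cong (evaluate f u +_) (busy-form u fs))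
  busyForm≤ : ∀ fs → All (λ s → Coefs≤ 1 (proj₂ s)) fs → Coefs≤ (length fs) (busyForm fs)
  busyForm≤ []                   []         j = z≤n
  busyForm≤ ((nothing , f) ∷ fs) (hf ∷ hfs) j = m≤n⇒m≤1+n (busyForm≤ fs hfs j)
  busyForm≤ ((just i , f) ∷ fs)  (hf ∷ hfs) j = +-mono-≤ (hf j) (busyForm≤ fs hfs j)
  views : ∀ k → List (Kind × Form (suc (length σ)))
  views k = map (λ (i , f) → kind k i , f) fs
  views-at : ∀ u k → FormCheck.T.scaled u (views k) ≡ viewFor k (at u)
  views-at u k = trans (sym (List.map-∘ fs)) (List.map-∘ fs)
  numbers : ∀ u c → evaluate (single zero c) u ≡ u zero * c
  numbers u c = trans (evaluate-single zero c u) (*-comm c (u zero))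
  forms≤1′ : ∀ k → All (λ s → Coefs≤ 1 (proj₂ s)) (views k)
  forms≤1′ k = All.map⁺ forms≤1
  module _ (k : Fin size) where
    jb : Job
    jb = lookup jobs k
    Tf Af Df 0f : Form (suc (length σ))
    Tf = single zero (Job.processing jb)
    Af = single zero (Job.arrival jb)
    Df = single zero (Job.deadline jb)
    0f = λ _ → 0
    length-views : length (views k) ≡ length σ
    length-views = trans (List.length-map _ fs) fs-length
    into : FormCheck.Ok v Tf Af Df 0f 0f (views k)
    into = FormCheck.T.ok← v {Tf} {Af} {Df} {0f} {0f} (views k) (lemma (numbers v (Job.processing jb)) (numbers v (Job.arrival jb)) (numbers v (Job.deadline jb)) (evaluate-0 v) (trans (views-at v k) (cong (viewFor k) at-v)) (ok k))
      where
      lemma : ∀ {T T′ A A′ D D′ z xs xs′} → T′ ≡ T → A′ ≡ A → D′ ≡ D → z ≡ 0 → xs′ ≡ xs → Ok T A D 0 0 xs → Ok T′ A′ D′ z z xs′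
      lemma refl refl refl refl refl h = h
    ok′ : OkJob jobs (v′ zero) (at v′) k
    ok′ = lemma (numbers v′ (Job.processing jb)) (numbers v′ (Job.arrival jb)) (numbers v′ (Job.deadline jb)) (evaluate-0 v′) (views-at v′ k)
      (FormCheck.T.ok→ v′ {Tf} {Af} {Df} {0f} {0f} (views k)
        (agree-ok agr {Tf} {Af} {Df} {0f} {0f} 0 (views k) (≤-reflexive (cong (_+ (h + h + 1)) length-views))
          (λ j → ≤-trans (single≤ zero _ j) (proj₁ (hjobs k))) (λ j → ≤-trans (single≤ zero _ j) (proj₁ (proj₂ (hjobs k)))) (λ j → ≤-trans (single≤ zero _ j) (proj₂ (proj₂ (hjobs k))))
          (λ _ → z≤n) (λ _ → z≤n) (forms≤1′ k) into))
      where
      lemma : ∀ {T T′ A A′ D D′ z xs xs′} → T′ ≡ T → A′ ≡ A → D′ ≡ D → z ≡ 0 → xs′ ≡ xs → Ok T′ A′ D′ z z xs′ → Ok T A D 0 0 xs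
      lemma refl refl refl refl refl h = h

-- Certificates

IsPolynomial : (ℕ → ℕ) → Set
IsPolynomial f = Σ[ p ∈ Polynomial ] ∀ n → eval p n ≡ f n

constᴾ : ∀ k → IsPolynomial (λ _ → k)
constᴾ k = k ∷ [] , λ n → trans (cong (k +_) (*-zeroʳ n)) (+-identityʳ k)

varᴾ : IsPolynomial (λ n → n)
varᴾ = 0 ∷ 1 ∷ [] , λ n → trans (cong (λ z → n * (1 + z)) (*-zeroʳ n)) (*-identityʳ n)

_+ᴾ_ : ∀ {f g} → IsPolynomial f → IsPolynomial g → IsPolynomial (λ n → f n + g n)
(p , e) +ᴾ (q , e′) = p ⊞ q , λ n → trans (eval-⊞ p q n) (cong₂ _+_ (e n) (e′ n))

_*ᴾ_ : ∀ {f g} → IsPolynomial f → IsPolynomial g → IsPolynomial (λ n → f n * g n)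
(p , e) *ᴾ (q , e′) = p ⊠ q , λ n → trans (eval-⊠ p q n) (cong₂ _*_ (e n) (e′ n))

encode-upper : ∀ e m → m < 2 ^ e → length (encodeℕ m) ≤ 2 * e + 1
encode-upper e m h = go e (ℕᵇ.fromℕ m) (subst (_< 2 ^ e) (sym (ℕᵇ.toℕ-fromℕ m)) h)
  where
  go : ∀ e x → ℕᵇ.toℕ x < 2 ^ e → length (encodeℕᵇ x) ≤ 2 * e + 1
  go e       ℕᵇ.zero  h = m≤n+m 1 (2 * e)
  go zero    2[1+ x ] (s≤s h) = contradiction h λ ()
  go zero    1+[2 x ] (s≤s h) = contradiction h λ ()
  go (suc e) 2[1+ x ] h = ≤-trans (s≤s (s≤s (go e x (*-cancelˡ-< 2 _ _ (<-trans (*-monoʳ-< 2 (n<1+n (ℕᵇ.toℕ x))) h))))) (≤-reflexive (lemma e))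
    where
    lemma : ∀ e → 2 + (2 * e + 1) ≡ 2 * suc e + 1
    lemma = solve-∀
  go (suc e) 1+[2 x ] h = ≤-trans (s≤s (s≤s (go e x (*-cancelˡ-< 2 _ _ (<-trans (n<1+n _) h))))) (≤-reflexive (lemma e))
    where
    lemma : ∀ e → 2 + (2 * e + 1) ≡ 2 * suc e + 1
    lemma = solve-∀

encode-lower : ∀ m → m < 2 ^ length (encodeℕ m)
encode-lower m = subst (_< 2 ^ length (encodeℕ m)) (ℕᵇ.toℕ-fromℕ m) (go (ℕᵇ.fromℕ m))
  where
  step : ∀ v l → v < 2 ^ l → 2 * suc v < 2 ^ (2 + l)
  step v l h = ≤-<-trans (*-monoʳ-≤ 2 h) (*-monoʳ-< 2 (^-monoʳ-< 2 (s≤s (s≤s z≤n)) (n<1+n l)))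
  go : ∀ x → ℕᵇ.toℕ x < 2 ^ length (encodeℕᵇ x)
  go ℕᵇ.zero  = s≤s z≤n
  go 2[1+ x ] = step (ℕᵇ.toℕ x) (length (encodeℕᵇ x)) (go x)
  go 1+[2 x ] = <-trans (≤-reflexive (sym (*-suc 2 (ℕᵇ.toℕ x)))) (step (ℕᵇ.toℕ x) (length (encodeℕᵇ x)) (go x))

Triple : Set
Triple = ℕ × ℕ × ℕ

encodeTriple : Triple → List Bool
encodeTriple (x , y , z) = encodeℕ x ++ encodeℕ y ++ encodeℕ z

encodeNumbers : ℕ → List Triple → List Bool
encodeNumbers b ts = encodeℕ b ++ concatMap encodeTriple ts

jobTriple : Job → Triple
jobTriple (job t a d) = t , a , d

encode-numbers : ∀ I → encode I ≡ encodeNumbers (Instance.bound I) (map jobTriple (Vec.toList (Instance.jobs I)))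
encode-numbers I = cong (encodeℕ (Instance.bound I) ++_) (go (Vec.toList (Instance.jobs I)))
  where
  go : ∀ js → concatMap encodeJob js ≡ concatMap encodeTriple (map jobTriple js)
  go []       = refl
  go (j ∷ js) = cong (encodeJob j ++_) (go js)

segIndex : ∀ {n} → Maybe (Fin n) → ℕ
segIndex nothing  = 0
segIndex (just i) = suc (toℕ i)

-- The 0 pads a segment to a triple. A certificate thereby has the format of an instance, and one
-- recogniser and one way of reading serve both.
segTriple : ∀ {n} → Maybe (Fin n) × ℕ → Triple
segTriple (i , x) = segIndex i , x , 0

certificate : ∀ {n} → ℕ → Segs n → List Bool
certificate K σ = encodeNumbers K (map segTriple σ)

length-part₁ : ∀ (xs ys : List Bool) → length xs ≤ length (xs ++ ys)
length-part₁ xs ys = ≤-trans (m≤m+n _ _) (≤-reflexive (sym (List.length-++ xs)))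

length-part₂ : ∀ (xs ys : List Bool) → length ys ≤ length (xs ++ ys)
length-part₂ xs ys = ≤-trans (m≤n+m _ (length xs)) (≤-reflexive (sym (List.length-++ xs)))

jobs-in-code : ∀ {n} (jobs : Vec Job n) → n ≤ length (concatMap encodeJob (Vec.toList jobs)) ×
               (∀ k → length (encodeJob (lookup jobs k)) ≤ length (concatMap encodeJob (Vec.toList jobs)))
jobs-in-code []       = z≤n , λ ()
jobs-in-code (j ∷ js) with jobs-in-code js
... | n≤ , each = ≤-trans (+-mono-≤ (nonempty j) n≤) (≤-reflexive (sym (List.length-++ (encodeJob j)))) ,
  λ { zero → length-part₁ (encodeJob j) _ ; (suc k) → ≤-trans (each k) (length-part₂ (encodeJob j) _) }
  where
  nonempty : ∀ j → 1 ≤ length (encodeJob j)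
  nonempty (job t a d) = ≤-trans (go (ℕᵇ.fromℕ t)) (length-part₁ (encodeℕ t) _)
    where
    go : ∀ x → 1 ≤ length (encodeℕᵇ x)
    go ℕᵇ.zero  = s≤s z≤n
    go 2[1+ x ] = s≤s z≤n
    go 1+[2 x ] = s≤s z≤n

bounds-in-code : ∀ I → Bounds (2 ^ length (encode I)) (Instance.bound I) (Instance.jobs I)
bounds-in-code I = small bound (length-part₁ (encodeℕ bound) rest) , λ k → parts (lookup jobs k) (≤-trans (proj₂ (jobs-in-code jobs) k) (length-part₂ (encodeℕ bound) rest))
  where
  open Instance I
  rest : List Bool
  rest = concatMap encodeJob (Vec.toList jobs)
  small : ∀ m {l} → length (encodeℕ m) ≤ l → m ≤ 2 ^ l
  small m h = ≤-trans (<⇒≤ (encode-lower m)) (^-monoʳ-≤ 2 h)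
  parts : ∀ j {l} → length (encodeJob j) ≤ l → Job.processing j ≤ 2 ^ l × Job.arrival j ≤ 2 ^ l × Job.deadline j ≤ 2 ^ l
  parts (job t a d) h = small t (≤-trans (length-part₁ (encodeℕ t) _) h) ,
    small a (≤-trans (≤-trans (length-part₁ (encodeℕ a) _) (length-part₂ (encodeℕ t) _)) h) ,
    small d (≤-trans (≤-trans (length-part₂ (encodeℕ a) _) (length-part₂ (encodeℕ t) _)) h)

pow-sum : ∀ x y → 2 ^ suc x + 2 ^ suc y ≤ 2 ^ (suc x + suc y)
pow-sum x y = ≤-trans (lemma (2 ^ suc x) (2 ^ suc y) (^-monoʳ-≤ 2 {1} {suc x} (s≤s z≤n)) (^-monoʳ-≤ 2 {1} {suc y} (s≤s z≤n))) (≤-reflexive (sym (^-distribˡ-+-* 2 (suc x) (suc y))))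
  where
  lemma : ∀ a b → 2 ≤ a → 2 ≤ b → a + b ≤ a * b
  lemma (suc (suc a)) (suc (suc b)) (s≤s (s≤s _)) (s≤s (s≤s _)) = by≤ {c = 0} {d = a + b + a * b} z≤n (identity a b)
    where
    identity : ∀ a b → suc (suc a) + suc (suc b) + (a + b + a * b) ≡ suc (suc a) * suc (suc b) + 0
    identity = solve-∀

n<2^n : ∀ n → n < 2 ^ n
n<2^n zero    = s≤s z≤n
n<2^n (suc n) = ≤-trans (+-mono-≤ (m^n>0 2 n) (n<2^n n)) (≤-reflexive (cong (2 ^ n +_) (sym (+-identityʳ _))))

-- For a code of length W: `segments` bounds the number of unknowns, the unit included, as there are
-- at most W jobs; `numberBits` is the exponent from `coefficientBound<` with μ = 2 `segments W` + W
-- + 2.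
segments numberBits : ℕ → ℕ
segments W = 1 + suc W * suc W
numberBits W = segments W * suc (suc (segments W) * (segments W + (segments W + suc W) + 1))

certificateBound : ℕ → ℕ
certificateBound W = (2 * numberBits W + 1) + segments W * ((2 * suc W + 1) + ((2 * numberBits W + 1) + 1))

abstract
  certificateBound-polynomial : IsPolynomial certificateBound
  certificateBound-polynomial = ((constᴾ 2 *ᴾ bitsᴾ) +ᴾ constᴾ 1) +ᴾ (segmentsᴾ *ᴾ (((constᴾ 2 *ᴾ (constᴾ 1 +ᴾ varᴾ)) +ᴾ constᴾ 1) +ᴾ (((constᴾ 2 *ᴾ bitsᴾ) +ᴾ constᴾ 1) +ᴾ constᴾ 1)))
    where
    segmentsᴾ : IsPolynomial segments
    segmentsᴾ = constᴾ 1 +ᴾ ((constᴾ 1 +ᴾ varᴾ) *ᴾ (constᴾ 1 +ᴾ varᴾ))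
    bitsᴾ : IsPolynomial numberBits
    bitsᴾ = segmentsᴾ *ᴾ (constᴾ 1 +ᴾ ((constᴾ 1 +ᴾ segmentsᴾ) *ᴾ ((segmentsᴾ +ᴾ (segmentsᴾ +ᴾ (constᴾ 1 +ᴾ varᴾ))) +ᴾ constᴾ 1)))

certificate-length : ∀ {n} W e K (σ : Segs n) → n ≤ W → K < 2 ^ e → All (λ s → proj₂ s < 2 ^ e) σ →
                     length (certificate K σ) ≤ (2 * e + 1) + length σ * ((2 * suc W + 1) + ((2 * e + 1) + 1))
certificate-length {n} W e K σ n≤W hK hσ = ≤-trans (≤-reflexive (List.length-++ (encodeℕ K))) (+-mono-≤ (encode-upper e K hK) (go σ hσ))
  where
  index< : ∀ (i : Maybe (Fin n)) → segIndex i < 2 ^ suc W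
  index< nothing  = m^n>0 2 (suc W)
  index< (just i) = <-trans (s≤s (≤-trans (Fin.toℕ<n i) n≤W)) (n<2^n (suc W))
  go : ∀ σ → All (λ s → proj₂ s < 2 ^ e) σ → length (concatMap encodeTriple (map segTriple σ)) ≤ length σ * ((2 * suc W + 1) + ((2 * e + 1) + 1))
  go []            []       = z≤n
  go ((i , x) ∷ σ) (h ∷ hs) = ≤-trans (≤-reflexive (List.length-++ (encodeTriple (segTriple (i , x))))) (+-mono-≤
    (≤-trans (≤-reflexive (trans (List.length-++ (encodeℕ (segIndex i))) (cong (length (encodeℕ (segIndex i)) +_) (List.length-++ (encodeℕ x)))))
             (+-mono-≤ (encode-upper (suc W) (segIndex i) (index< i)) (+-monoˡ-≤ 1 (encode-upper e x h)))) (go σ hs))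

-- The pieces are joined before the numbers are reduced, because the number of unknowns enters the
-- exponent of the bound on the numbers.
short-certificate : ∀ I → YesInstance I → ∃[ K ] ∃[ σ ] Plan I K σ × length (certificate K σ) ≤ certificateBound (length (encode I))
short-certificate I feasible = finish (short-plan I (proj₂ (proj₂ (yes→plan I feasible))))
  where
  open Instance I
  W : ℕ
  W = length (encode I)
  size≤W : size ≤ W
  size≤W = ≤-trans (proj₁ (jobs-in-code jobs)) (length-part₂ (encodeℕ bound) _)
  h μ : ℕ
  h = 2 ^ W
  μ = segments W + (segments W + suc W) + 1
  module _ {l : ℕ} (len : l ≤ suc size * suc size) where
    N≤ : suc l ≤ segments W
    N≤ = s≤s (≤-trans len (*-mono-≤ (s≤s size≤W) (s≤s size≤W)))
    factor : l + (h + h + 1) ≤ 2 ^ (segments W + suc W)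
    factor = begin
      l + (h + h + 1) ≡⟨ lemma l h ⟩
      suc l + 2 * h ≤⟨ +-monoˡ-≤ (2 * h) (≤-trans N≤ (<⇒≤ (n<2^n (segments W)))) ⟩
      2 ^ segments W + 2 ^ suc W ≤⟨ pow-sum (suc W * suc W) W ⟩
      2 ^ (segments W + suc W) ∎
      where
      open ≤-Reasoning
      lemma : ∀ l h → l + (h + h + 1) ≡ suc l + 2 * h
      lemma = solve-∀
    product : suc (suc l * (l + (h + h + 1))) ≤ 2 ^ μ
    product = begin
      suc (suc l * (l + (h + h + 1))) ≤⟨ s≤s (*-mono-≤ (≤-trans N≤ (<⇒≤ (n<2^n (segments W)))) factor) ⟩
      suc (2 ^ segments W * 2 ^ (segments W + suc W)) ≡⟨ cong suc (sym (^-distribˡ-+-* 2 (segments W) (segments W + suc W))) ⟩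
      suc (2 ^ (segments W + (segments W + suc W))) ≤⟨ +-mono-≤ (m^n>0 2 (segments W + (segments W + suc W))) (m≤m+n _ 0) ⟩
      2 ^ suc (segments W + (segments W + suc W)) ≡⟨ cong (2 ^_) (+-comm 1 (segments W + (segments W + suc W))) ⟩
      2 ^ μ ∎
      where open ≤-Reasoning
    β< : coefficientBound (suc l) (l + (h + h + 1)) (suc l) < 2 ^ numberBits W
    β< = <-≤-trans (coefficientBound< (suc l) (l + (h + h + 1)) (suc l) μ product) (^-monoʳ-≤ 2 (*-mono-≤ N≤ (s≤s (*-monoˡ-≤ μ (s≤s N≤)))))
  finish : ∀ {K₁} → ∃[ σ₁ ] Plan I K₁ σ₁ × length σ₁ ≤ suc size * suc size → ∃[ K ] ∃[ σ ] Plan I K σ × length (certificate K σ) ≤ certificateBound W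
  finish (σ₁ , P₁ , len₁) = done (small-plan I h P₁ (bounds-in-code I))
    where
    β : ℕ
    β = coefficientBound (suc (length σ₁)) (length σ₁ + (h + h + 1)) (suc (length σ₁))
    done : ∃[ K′ ] ∃[ σ′ ] Plan I K′ σ′ × length σ′ ≡ length σ₁ × K′ ≤ β × All (λ s → proj₂ s ≤ β) σ′ → ∃[ K ] ∃[ σ ] Plan I K σ × length (certificate K σ) ≤ certificateBound W
    done (K , σ , P , len , hK , hσ) = K , σ , P ,
      ≤-trans (certificate-length W (numberBits W) K σ size≤W (≤-<-trans hK (β< len₁)) (All.map (λ h → ≤-<-trans h (β< len₁)) hσ))
              (+-monoʳ-≤ (2 * numberBits W + 1) (*-monoˡ-≤ ((2 * suc W + 1) + ((2 * numberBits W + 1) + 1)) (≤-trans (≤-trans (≤-reflexive len) (n≤1+n _)) (N≤ len₁))))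

-- The verifier

-- Words of the form of an encoding, recognised by a finite automaton.
-- The first component of its state is [] at the end of a number, true ∷ []
-- before a digit and false ∷ [] before a marker; the second one counts
-- the numbers modulo 3.
next : List Bool → List Bool
next []          = true ∷ []
next (_ ∷ [])    = true ∷ true ∷ []
next (_ ∷ _ ∷ c) = c

scanStep : List Bool × List Bool → Bool → List Bool × List Bool
scanStep ([]        , c) true  = true ∷ [] , c
scanStep ([]        , c) false = [] , next c
scanStep (true ∷ f  , c) b     = false ∷ f , c
scanStep (false ∷ f , c) true  = true ∷ f , c
scanStep (false ∷ f , c) false = f , next c

scanAll : List Bool × List Bool → List Bool → List Bool × List Bool
scanAll = List.foldl scanStep

accepting : List Bool × List Bool
accepting = [] , true ∷ []

scan-number : ∀ x f c l → f ≡ [] ⊎ f ≡ false ∷ [] → scanAll (f , c) (encodeℕᵇ x ++ l) ≡ scanAll ([] , next c) l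
scan-number ℕᵇ.zero  f c l (inj₁ refl) = refl
scan-number ℕᵇ.zero  f c l (inj₂ refl) = refl
scan-number 2[1+ x ] f c l (inj₁ refl) = scan-number x _ c l (inj₂ refl)
scan-number 2[1+ x ] f c l (inj₂ refl) = scan-number x _ c l (inj₂ refl)
scan-number 1+[2 x ] f c l (inj₁ refl) = scan-number x _ c l (inj₂ refl)
scan-number 1+[2 x ] f c l (inj₂ refl) = scan-number x _ c l (inj₂ refl)

scan-triples : ∀ ts → scanAll accepting (concatMap encodeTriple ts) ≡ accepting
scan-triples []                 = refl
scan-triples ((x , y , z) ∷ ts) = begin
  scanAll accepting ((encodeℕ x ++ encodeℕ y ++ encodeℕ z) ++ concatMap encodeTriple ts) ≡⟨ cong (scanAll accepting) (List.++-assoc (encodeℕ x) _ _) ⟩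
  scanAll accepting (encodeℕ x ++ (encodeℕ y ++ encodeℕ z) ++ concatMap encodeTriple ts) ≡⟨ scan-number (ℕᵇ.fromℕ x) [] _ _ (inj₁ refl) ⟩
  scanAll ([] , true ∷ true ∷ []) ((encodeℕ y ++ encodeℕ z) ++ concatMap encodeTriple ts) ≡⟨ cong (scanAll _) (List.++-assoc (encodeℕ y) _ _) ⟩
  scanAll ([] , true ∷ true ∷ []) (encodeℕ y ++ encodeℕ z ++ concatMap encodeTriple ts) ≡⟨ scan-number (ℕᵇ.fromℕ y) [] _ _ (inj₁ refl) ⟩
  scanAll ([] , []) (encodeℕ z ++ concatMap encodeTriple ts) ≡⟨ scan-number (ℕᵇ.fromℕ z) [] _ _ (inj₁ refl) ⟩
  scanAll accepting (concatMap encodeTriple ts) ≡⟨ scan-triples ts ⟩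
  accepting ∎
  where open ≡-Reasoning

scan-encoding : ∀ b ts → scanAll ([] , []) (encodeNumbers b ts) ≡ accepting
scan-encoding b ts = trans (scan-number (ℕᵇ.fromℕ b) [] [] _ (inj₁ refl)) (scan-triples ts)

nextAll : List Bool → List ℕᵇ → List Bool
nextAll = List.foldl (λ c _ → next c)

-- Together with `accepted-end`, this inverts the automaton: the numbers are read off an accepting
-- run, two letters for each digit.
accepted-inside : ∀ l c → scanAll (false ∷ [] , c) l ≡ accepting → ∃[ x ] ∃[ ns ] l ≡ encodeℕᵇ x ++ concatMap encodeℕᵇ ns × nextAll (next c) ns ≡ true ∷ []
accepted-end : ∀ l c → scanAll ([] , c) l ≡ accepting → ∃[ ns ] l ≡ concatMap encodeℕᵇ ns × nextAll c ns ≡ true ∷ []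
accepted-end []          c e = [] , refl , cong proj₂ e
accepted-end (true ∷ []) c ()
accepted-end (false ∷ l) c e with accepted-end l (next c) e
... | ns , e₁ , e₂ = ℕᵇ.zero ∷ ns , cong (false ∷_) e₁ , e₂
accepted-end (true ∷ d ∷ l) c e with accepted-inside l c e
accepted-end (true ∷ true ∷ l)  c e | x , ns , e₁ , e₂ = 1+[2 x ] ∷ ns , cong (λ l → true ∷ true ∷ l) e₁ , e₂
accepted-end (true ∷ false ∷ l) c e | x , ns , e₁ , e₂ = 2[1+ x ] ∷ ns , cong (λ l → true ∷ false ∷ l) e₁ , e₂
accepted-inside []          c ()
accepted-inside (true ∷ []) c ()
accepted-inside (false ∷ l) c e with accepted-end l (next c) e
... | ns , e₁ , e₂ = ℕᵇ.zero , ns , cong (false ∷_) e₁ , e₂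
accepted-inside (true ∷ d ∷ l) c e with accepted-inside l c e
accepted-inside (true ∷ true ∷ l)  c e | x , ns , e₁ , e₂ = 1+[2 x ] , ns , cong (λ l → true ∷ true ∷ l) e₁ , e₂
accepted-inside (true ∷ false ∷ l) c e | x , ns , e₁ , e₂ = 2[1+ x ] , ns , cong (λ l → true ∷ false ∷ l) e₁ , e₂

encodeᵇ : ∀ x → encodeℕᵇ x ≡ encodeℕ (ℕᵇ.toℕ x)
encodeᵇ x = cong encodeℕᵇ (sym (ℕᵇ.fromℕ-toℕ x))

group : ∀ ns → nextAll (true ∷ []) ns ≡ true ∷ [] → ∃[ ts ] concatMap encodeℕᵇ ns ≡ concatMap encodeTriple ts
group []               e = [] , refl
group (x ∷ y ∷ z ∷ ns) e with group ns e
... | ts , e′ = (ℕᵇ.toℕ x , ℕᵇ.toℕ y , ℕᵇ.toℕ z) ∷ ts , (begin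
  encodeℕᵇ x ++ encodeℕᵇ y ++ encodeℕᵇ z ++ concatMap encodeℕᵇ ns ≡⟨ cong₂ _++_ (encodeᵇ x) (cong₂ _++_ (encodeᵇ y) (cong₂ _++_ (encodeᵇ z) e′)) ⟩
  X ++ Y ++ Z ++ concatMap encodeTriple ts ≡⟨ cong (X ++_) (sym (List.++-assoc Y Z _)) ⟩
  X ++ (Y ++ Z) ++ concatMap encodeTriple ts ≡⟨ sym (List.++-assoc X (Y ++ Z) _) ⟩
  (X ++ Y ++ Z) ++ concatMap encodeTriple ts ∎)
  where
  open ≡-Reasoning
  X Y Z : List Bool
  X = encodeℕ (ℕᵇ.toℕ x)
  Y = encodeℕ (ℕᵇ.toℕ y)
  Z = encodeℕ (ℕᵇ.toℕ z)

accepted-encoding : ∀ l → scanAll ([] , []) l ≡ accepting → ∃[ b ] ∃[ ts ] l ≡ encodeNumbers b ts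
accepted-encoding l e with accepted-end l [] e
... | b ∷ ns , refl , e₂ with group ns e₂
... | ts , e₃ = ℕᵇ.toℕ b , ts , cong₂ _++_ (encodeᵇ b) e₃

-- Follows the nested comparisons of `judge` branch by branch. Jobs are numbered from 1, and 0
-- stands for idling.
kindOf : ℕ → ℕ → Kind
kindOf J i = if i ≤ᵇ J then (if J ≤ᵇ i then mine else (if i ≤ᵇ 0 then idle else other)) else (if i ≤ᵇ 0 then idle else other)

-- Failures are recorded in unary on a stack, so a conjunction of checks is the emptiness of that
-- stack at the end.
penalty : Bool → List Bool → List Bool
penalty true  bs = bs
penalty false bs = true ∷ bs

isDead : (T A D τ y : ℕ) → Bool
isDead T A D τ y = (T ≤ᵇ y) ∨ (not (τ + T ≤ᵇ D + y) ∨ not (A + T ≤ᵇ D + y))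

judged : Kind → (T A D τ y x : ℕ) → List Bool → List Bool
judged mine  T A D τ y x bs = penalty (τ + T ≤ᵇ D + y) (penalty (y + x ≤ᵇ T) (penalty (A ≤ᵇ τ) bs))
judged idle  T A D τ y x bs = penalty ((τ + x ≤ᵇ A) ∨ isDead T A D τ y) bs
judged other T A D τ y x bs = bs

-- Registers and stacks of the verifier.  P to U′ are scratch registers,
-- which are zero between the parts of the program.
module Verifier where

  K one nul Bd Wk J T A D τ y I X P V U U′ : Fin 17
  K   = # 0
  one = # 1
  nul = # 2
  Bd  = # 3
  Wk  = # 4
  J   = # 5
  T   = # 6
  A   = # 7
  D   = # 8
  τ   = # 9
  y   = # 10
  I   = # 11
  X   = # 12
  P   = # 13
  V   = # 14
  U   = # 15
  U′  = # 16

  W C C′ FL BAD OUT WR CR : Fin 8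
  W   = # 0
  C   = # 1
  C′  = # 2
  FL  = # 3
  BAD = # 4
  OUT = # 5
  WR  = # 6
  CR  = # 7

  Program : Set
  Program = Arith 17 8

  bad : Program
  bad = pushS BAD true

  transfer : Fin 8 → Fin 8 → Program
  transfer s s′ = loop (popS s nil (pushS s′))

  marker : Bool → Program
  marker true  = pushS FL true
  marker false = popS C′ (pushS C′ true) (λ _ → popS C′ (pushS C′ true ›› pushS C′ true) (λ _ → nil))

  scanBody : Fin 8 → Fin 8 → Program
  scanBody s s′ = popS s nil λ b → pushS s′ b ›› popS FL (marker b) (λ m → if m then pushS FL false else marker b)

  scanEnd : Program
  scanEnd = popS FL (popS C′ bad (λ b → if b then popS C′ nil (λ _ → bad) else bad)) (λ _ → bad)

  format : Fin 8 → Fin 8 → Program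
  format s s′ = loop (scanBody s s′) ›› scanEnd ›› transfer s′ s

  -- `P` is the weight of the next digit and doubles each time; a digit bit `true` means the digit
  -- 1, `false` the digit 2. `FL` is nonempty while the number goes on, so further rounds change
  -- nothing.
  readBody : Fin 8 → Program
  readBody s = popS FL nil λ _ → popS s nil λ m →
    if m then popS s nil (λ d → (if d then add P V else (add P V ›› add P V)) ›› add P P ›› pushS FL true) else nil

  -- The weight starts from register `b` instead of 1, so what is added to `t` is the number read
  -- times `b`. With `b = K` this is the multiplication that brings the instance to the unit of the
  -- certificate.
  readTo : Fin 8 → Fin 17 → Fin 17 → Program
  readTo s b t = add b P ›› pushS FL true ›› loop (readBody s) ›› add V t ›› clear P ›› clear V

  copyC : Program
  copyC = transfer C CR ›› loop (popS CR nil (λ b → pushS C b ›› pushS C′ b))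

  deadCheck : Program
  deadCheck = ifLe T y nil (add D U ›› add y U ›› add τ U′ ›› add T U′ ››
    ifLe U′ U (clear U′ ›› add A U′ ›› add T U′ ›› ifLe U′ U bad nil) nil) ›› clear U ›› clear U′

  mineCheck : Program
  mineCheck = ifLe A τ nil bad ›› (add y U ›› add X U ›› ifLe U T nil bad ›› clear U) ››
    (add τ U ›› add T U ›› add D U′ ›› add y U′ ›› ifLe U U′ nil bad ›› clear U ›› clear U′) ›› add X y

  idleCheck : Program
  idleCheck = add τ U ›› add X U ›› ifLe U A nil (clear U ›› deadCheck) ›› clear U

  judge : Program
  judge = ifLe I J (ifLe J I mineCheck (ifLe I nul idleCheck nil)) (ifLe I nul idleCheck nil)

  readSegment : Program
  readSegment = readTo C′ one I ›› readTo C′ one X ›› readTo C′ one U ›› clear U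

  whenMore : Fin 8 → Program → Program
  whenMore s c = popS s nil λ b → pushS s b ›› c

  segmentStep : Program
  segmentStep = whenMore C′ (readSegment ›› judge ›› add X τ ›› clear I ›› clear X)

  startPass : Program
  startPass = copyC ›› readTo C′ one U ›› clear U

  -- The certificate is read anew for each job, as time and amount processed are kept for a single
  -- job only.
  jobStep : Program
  jobStep = whenMore W (readTo W K T ›› readTo W K A ›› readTo W K D ›› add one J ›› startPass ›› loop segmentStep ››
    deadCheck ›› add y Wk ›› clear T ›› clear A ›› clear D ›› clear τ ›› clear y)

  -- Runs after the last job, when `J` is the number of jobs; an index beyond it or an empty segment
  -- makes the certificate invalid.
  indexStep : Program
  indexStep = whenMore C′ (readSegment ›› ifLe I J nil bad ›› ifLe one X nil bad ›› clear I ›› clear X)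

  main : Program
  -- This first copy provides the unit, by which the bound and the jobs are multiplied when they are
  -- read; its remainder is thrown away.
  main = copyC ›› readTo C′ one K ›› loop (popS C′ nil (λ _ → nil)) ››
    ifLe one K nil bad ›› readTo W K Bd ›› loop jobStep ›› startPass ›› loop indexStep ›› ifLe Wk Bd nil bad

  verifier : Program
  verifier = unit one ›› transfer WR W ›› transfer CR C ›› format W WR ››
    popS BAD (format C CR) (λ _ → bad) ›› popS BAD main (λ _ → bad) ›› popS BAD (pushS OUT true) (λ _ → pushS OUT false)

-- What the verifier computes.

digitCount : ℕᵇ → ℕ
digitCount ℕᵇ.zero  = 0
digitCount 2[1+ x ] = suc (digitCount x)
digitCount 1+[2 x ] = suc (digitCount x)

digitCount< : ∀ x → digitCount x < length (encodeℕᵇ x)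
digitCount< ℕᵇ.zero  = s≤s z≤n
digitCount< 2[1+ x ] = s≤s (m≤n⇒m≤1+n (digitCount< x))
digitCount< 1+[2 x ] = s≤s (m≤n⇒m≤1+n (digitCount< x))

iter-fixed : ∀ {A : Set} k (f : A → A) {x} → f x ≡ x → iter k f x ≡ x
iter-fixed zero    f e = refl
iter-fixed (suc k) f e = trans (cong (iter k f) e) (iter-fixed k f e)

module VerifierSemantics (n : ℕ) where

  open Verifier

  rg : (K Bd Wk J T A D τ y I X P V U U′ : ℕ) → Vec ℕ 17
  rg K Bd Wk J T A D τ y I X P V U U′ = K ∷ 1 ∷ 0 ∷ Bd ∷ Wk ∷ J ∷ T ∷ A ∷ D ∷ τ ∷ y ∷ I ∷ X ∷ P ∷ V ∷ U ∷ U′ ∷ []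

  st : (K Bd Wk J T A D τ y I X P V U U′ : ℕ) (W C C′ FL BAD CR : List Bool) → Store 17 8
  st K Bd Wk J T A D τ y I X P V U U′ W C C′ FL BAD CR =
    rg K Bd Wk J T A D τ y I X P V U U′ ∣ (W ∷ C ∷ C′ ∷ FL ∷ BAD ∷ [] ∷ [] ∷ CR ∷ [])

  -- Reading a number, for any way of embedding the four changing
  -- components in a store.
  read-loop : (F : Store 17 8 → Store 17 8) (mk : ℕ → ℕ → List Bool → List Bool → Store 17 8) →
    (∀ P V l → F (mk P V (true ∷ true ∷ l) (true ∷ [])) ≡ mk (P + P) (V + P) l (true ∷ [])) →
    (∀ P V l → F (mk P V (true ∷ false ∷ l) (true ∷ [])) ≡ mk (P + P) (V + P + P) l (true ∷ [])) →
    (∀ P V l → F (mk P V (false ∷ l) (true ∷ [])) ≡ mk P V l []) →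
    (∀ P V l → F (mk P V l []) ≡ mk P V l []) →
    ∀ k x P V l → digitCount x < k → ∃[ P′ ] iter k F (mk P V (encodeℕᵇ x ++ l) (true ∷ [])) ≡ mk P′ (V + P * ℕᵇ.toℕ x) l []
  read-loop F mk h₁ h₂ h₃ h₄ (suc k) ℕᵇ.zero P V l lt = P , trans (cong (iter k F) (h₃ P V l)) (trans (iter-fixed k F (h₄ P V l)) (cong (λ v → mk P v l []) (sym (trans (cong (V +_) (*-zeroʳ P)) (+-identityʳ V)))))
  read-loop F mk h₁ h₂ h₃ h₄ (suc k) 2[1+ x ] P V l (s≤s lt) with read-loop F mk h₁ h₂ h₃ h₄ k x (P + P) (V + P + P) l lt
  ... | P′ , e = P′ , trans (cong (iter k F) (h₂ P V _)) (trans e (cong (λ v → mk P′ v l []) (lemma P V (ℕᵇ.toℕ x))))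
    where
    lemma : ∀ P V x → V + P + P + (P + P) * x ≡ V + P * (2 * suc x)
    lemma = solve-∀
  read-loop F mk h₁ h₂ h₃ h₄ (suc k) 1+[2 x ] P V l (s≤s lt) with read-loop F mk h₁ h₂ h₃ h₄ k x (P + P) (V + P) l lt
  ... | P′ , e = P′ , trans (cong (iter k F) (h₁ P V _)) (trans e (cong (λ v → mk P′ v l []) (lemma P V (ℕᵇ.toℕ x))))
    where
    lemma : ∀ P V x → V + P + (P + P) * x ≡ V + P * suc (2 * x)
    lemma = solve-∀

  fits : ∀ m → length (encodeℕ m) ≤ n → digitCount (ℕᵇ.fromℕ m) < n
  fits m h = <-≤-trans (digitCount< (ℕᵇ.fromℕ m)) h

  read-W : ∀ {K Bd Wk J T A D τ y I X U U′ W C C′ BAD CR} P m → length (encodeℕ m) ≤ n →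
    ∃[ P′ ] ⟪ loop (readBody Verifier.W) ⟫ n (st K Bd Wk J T A D τ y I X P 0 U U′ (encodeℕ m ++ W) C C′ (true ∷ []) BAD CR)
         ≡ st K Bd Wk J T A D τ y I X P′ (P * m) U U′ W C C′ [] BAD CR
  read-W {K} {Bd} {Wk} {J} {T} {A} {D} {τ} {y} {I} {X} {U} {U′} {W} {C} {C′} {BAD} {CR} P m h
    with read-loop (⟪ readBody Verifier.W ⟫ n) (λ P V l f → st K Bd Wk J T A D τ y I X P V U U′ l C C′ f BAD CR)
           (λ _ _ _ → refl) (λ _ _ _ → refl) (λ _ _ _ → refl) (λ _ _ _ → refl) n (ℕᵇ.fromℕ m) P 0 W (fits m h)
  ... | P′ , e = P′ , trans e (cong (λ v → st K Bd Wk J T A D τ y I X P′ (P * v) U U′ W C C′ [] BAD CR) (ℕᵇ.toℕ-fromℕ m))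

  read-C′ : ∀ {K Bd Wk J T A D τ y I X U U′ W C C′ BAD CR} m → length (encodeℕ m) ≤ n →
    ∃[ P′ ] ⟪ loop (readBody Verifier.C′) ⟫ n (st K Bd Wk J T A D τ y I X 1 0 U U′ W C (encodeℕ m ++ C′) (true ∷ []) BAD CR)
         ≡ st K Bd Wk J T A D τ y I X P′ m U U′ W C C′ [] BAD CR
  read-C′ {K} {Bd} {Wk} {J} {T} {A} {D} {τ} {y} {I} {X} {U} {U′} {W} {C} {C′} {BAD} {CR} m h
    with read-loop (⟪ readBody Verifier.C′ ⟫ n) (λ P V l f → st K Bd Wk J T A D τ y I X P V U U′ W C l f BAD CR)
           (λ _ _ _ → refl) (λ _ _ _ → refl) (λ _ _ _ → refl) (λ _ _ _ → refl) n (ℕᵇ.fromℕ m) 1 0 C′ (fits m h)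
  ... | P′ , e = P′ , trans e (cong (λ v → st K Bd Wk J T A D τ y I X P′ v U U′ W C C′ [] BAD CR) (trans (*-identityˡ _) (ℕᵇ.toℕ-fromℕ m)))

  -- The stores between parts of the program, with scratch registers and flag stack cleared. The
  -- effect of each part is stated as an equation between such stores, so that the parts compose by
  -- rewriting.
  at : (K Bd Wk J T A D τ y I X : ℕ) (W C C′ BAD : List Bool) → Store 17 8
  at K Bd Wk J T A D τ y I X W C C′ BAD = st K Bd Wk J T A D τ y I X 0 0 0 0 W C C′ [] BAD []

  after-W : ∀ {K Bd Wk J T A D τ y I X U U′ W C C′ BAD CR} m t → length (encodeℕ m) ≤ n →
    ∃[ P′ ] ⟪ readTo Verifier.W Verifier.K t ⟫ n (st K Bd Wk J T A D τ y I X 0 0 U U′ (encodeℕ m ++ W) C C′ [] BAD CR)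
         ≡ ⟪ add V t ›› clear P ›› clear V ⟫ n (st K Bd Wk J T A D τ y I X P′ (K * m) U U′ W C C′ [] BAD CR)
  after-W {K} m t h = proj₁ (read-W K m h) , cong (⟪ add V t ›› clear P ›› clear V ⟫ n) (proj₂ (read-W K m h))

  after-C′ : ∀ {K Bd Wk J T A D τ y I X U U′ W C C′ BAD CR} m t → length (encodeℕ m) ≤ n →
    ∃[ P′ ] ⟪ readTo Verifier.C′ one t ⟫ n (st K Bd Wk J T A D τ y I X 0 0 U U′ W C (encodeℕ m ++ C′) [] BAD CR)
         ≡ ⟪ add V t ›› clear P ›› clear V ⟫ n (st K Bd Wk J T A D τ y I X P′ m U U′ W C C′ [] BAD CR)
  after-C′ m t h = proj₁ (read-C′ m h) , cong (⟪ add V t ›› clear P ›› clear V ⟫ n) (proj₂ (read-C′ m h))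

  readSegment-sem : ∀ {K Bd Wk J T A D τ y W C C′ BAD} i x z → length (encodeTriple (i , x , z)) ≤ n →
    ⟪ readSegment ⟫ n (at K Bd Wk J T A D τ y 0 0 W C (encodeTriple (i , x , z) ++ C′) BAD) ≡ at K Bd Wk J T A D τ y i x W C C′ BAD
  readSegment-sem {K} {Bd} {Wk} {J} {T} {A} {D} {τ} {y} {W} {C} {C′} {BAD} i x z h = begin
    rest₃ (rest₂ (⟪ readTo Verifier.C′ one Verifier.I ⟫ n (at K Bd Wk J T A D τ y 0 0 W C (encodeTriple (i , x , z) ++ C′) BAD)))
      ≡⟨ cong (λ l → rest₃ (rest₂ (⟪ readTo Verifier.C′ one Verifier.I ⟫ n (at K Bd Wk J T A D τ y 0 0 W C l BAD)))) (trans (List.++-assoc (encodeℕ i) _ C′) (cong (encodeℕ i ++_) (List.++-assoc (encodeℕ x) (encodeℕ z) C′))) ⟩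
    rest₃ (rest₂ (⟪ readTo Verifier.C′ one Verifier.I ⟫ n (at K Bd Wk J T A D τ y 0 0 W C (encodeℕ i ++ encodeℕ x ++ encodeℕ z ++ C′) BAD)))
      ≡⟨ cong (λ u → rest₃ (rest₂ u)) (proj₂ (after-C′ i Verifier.I hi)) ⟩
    rest₃ (rest₂ (at K Bd Wk J T A D τ y i 0 W C (encodeℕ x ++ encodeℕ z ++ C′) BAD))
      ≡⟨ cong rest₃ (proj₂ (after-C′ x Verifier.X hx)) ⟩
    rest₃ (at K Bd Wk J T A D τ y i x W C (encodeℕ z ++ C′) BAD)
      ≡⟨ cong (⟪ clear U ⟫ n) (proj₂ (after-C′ z Verifier.U hz)) ⟩
    at K Bd Wk J T A D τ y i x W C C′ BAD ∎
    where
    open ≡-Reasoning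
    rest₂ rest₃ : Store 17 8 → Store 17 8
    rest₂ = ⟪ readTo Verifier.C′ one Verifier.X ⟫ n
    rest₃ = ⟪ readTo Verifier.C′ one Verifier.U ›› clear U ⟫ n
    hi : length (encodeℕ i) ≤ n
    hi = ≤-trans (length-part₁ (encodeℕ i) _) h
    hx : length (encodeℕ x) ≤ n
    hx = ≤-trans (≤-trans (length-part₁ (encodeℕ x) _) (length-part₂ (encodeℕ i) _)) h
    hz : length (encodeℕ z) ≤ n
    hz = ≤-trans (≤-trans (length-part₂ (encodeℕ x) _) (length-part₂ (encodeℕ i) _)) h

  deadCheck-sem : ∀ {K Bd Wk J T A D τ y I X U U′ W C C′ BAD} → U ≡ 0 → U′ ≡ 0 →
    ⟪ deadCheck ⟫ n (st K Bd Wk J T A D τ y I X 0 0 U U′ W C C′ [] BAD []) ≡ at K Bd Wk J T A D τ y I X W C C′ (penalty (isDead T A D τ y) BAD)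
  deadCheck-sem {T = T} {A} {D} {τ} {y} refl refl with T ≤ᵇ y
  ... | true = refl
  ... | false with τ + T ≤ᵇ D + y
  ... | false = refl
  ... | true with A + T ≤ᵇ D + y
  ... | false = refl
  ... | true  = refl

  test-sem : ∀ i j r {W C C′ FL BAD OUT WR CR} →
    ⟪ ifLe i j nil bad ⟫ n (r ∣ (W ∷ C ∷ C′ ∷ FL ∷ BAD ∷ OUT ∷ WR ∷ CR ∷ [])) ≡ (r ∣ (W ∷ C ∷ C′ ∷ FL ∷ penalty (lookup r i ≤ᵇ lookup r j) BAD ∷ OUT ∷ WR ∷ CR ∷ []))
  test-sem i j r with lookup r i ≤ᵇ lookup r j
  ... | true  = refl
  ... | false = refl

  mineCheck-sem : ∀ {K Bd Wk J T A D τ y I X W C C′ BAD} →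
    ⟪ mineCheck ⟫ n (at K Bd Wk J T A D τ y I X W C C′ BAD) ≡ at K Bd Wk J T A D τ (y + X) I X W C C′ (judged mine T A D τ y X BAD)
  mineCheck-sem {K} {Bd} {Wk} {J} {T} {A} {D} {τ} {y} {I} {X} {W} {C} {C′} {BAD} = begin
    c₄ (c₃ (c₂ (⟪ ifLe Verifier.A Verifier.τ nil bad ⟫ n (at K Bd Wk J T A D τ y I X W C C′ BAD)))) ≡⟨ cong (λ u → c₄ (c₃ (c₂ u))) (test-sem Verifier.A Verifier.τ (rg K Bd Wk J T A D τ y I X 0 0 0 0)) ⟩
    c₄ (c₃ (c₂ (at K Bd Wk J T A D τ y I X W C C′ b₁))) ≡⟨ cong (λ u → c₄ (c₃ (⟪ clear U ⟫ n u))) (test-sem U Verifier.T (rg K Bd Wk J T A D τ y I X 0 0 (y + X) 0)) ⟩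
    c₄ (c₃ (at K Bd Wk J T A D τ y I X W C C′ b₂)) ≡⟨ cong (λ u → c₄ (⟪ clear U ›› clear U′ ⟫ n u)) (test-sem U U′ (rg K Bd Wk J T A D τ y I X 0 0 (τ + T) (D + y))) ⟩
    at K Bd Wk J T A D τ (y + X) I X W C C′ (judged mine T A D τ y X BAD) ∎
    where
    open ≡-Reasoning
    b₁ b₂ : List Bool
    b₁ = penalty (A ≤ᵇ τ) BAD
    b₂ = penalty (y + X ≤ᵇ T) b₁
    c₂ c₃ c₄ : Store 17 8 → Store 17 8
    c₂ = ⟪ add Verifier.y U ›› add Verifier.X U ›› ifLe U Verifier.T nil bad ›› clear U ⟫ n
    c₃ = ⟪ add Verifier.τ U ›› add Verifier.T U ›› add Verifier.D U′ ›› add Verifier.y U′ ›› ifLe U U′ nil bad ›› clear U ›› clear U′ ⟫ n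
    c₄ = ⟪ add Verifier.X Verifier.y ⟫ n

  idleCheck-sem : ∀ {K Bd Wk J T A D τ y I X W C C′ BAD} →
    ⟪ idleCheck ⟫ n (at K Bd Wk J T A D τ y I X W C C′ BAD) ≡ at K Bd Wk J T A D τ y I X W C C′ (judged idle T A D τ y X BAD)
  idleCheck-sem {T = T} {A} {D} {τ} {y} {X = X} with τ + X ≤ᵇ A
  ... | true  = refl
  ... | false = cong (⟪ clear U ⟫ n) (deadCheck-sem refl refl)

  judge-sem : ∀ {K Bd Wk J T A D τ y I X W C C′ BAD} →
    ⟪ judge ⟫ n (at K Bd Wk J T A D τ y I X W C C′ BAD) ≡ at K Bd Wk J T A D τ (credit (kindOf J I) y X) I X W C C′ (judged (kindOf J I) T A D τ y X BAD)
  judge-sem {K} {Bd} {Wk} {J} {T} {A} {D} {τ} {y} {I} {X} {W} {C} {C′} {BAD} with I ≤ᵇ J | J ≤ᵇ I | I ≤ᵇ 0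
  ... | true  | true  | _     = mineCheck-sem
  ... | true  | false | true  = idleCheck-sem
  ... | true  | false | false = refl
  ... | false | _     | true  = idleCheck-sem
  ... | false | _     | false = refl

  nonempty-code : ∀ i l → ∃[ b ] ∃[ bs ] encodeℕ i ++ l ≡ b ∷ bs
  nonempty-code i l = go (ℕᵇ.fromℕ i)
    where
    go : ∀ x → ∃[ b ] ∃[ bs ] encodeℕᵇ x ++ l ≡ b ∷ bs
    go ℕᵇ.zero  = _ , _ , refl
    go 2[1+ x ] = _ , _ , refl
    go 1+[2 x ] = _ , _ , refl

  whenMore-C′ : ∀ {K Bd Wk J T A D τ y I X W C BAD} c t l →
    ⟪ whenMore Verifier.C′ c ⟫ n (at K Bd Wk J T A D τ y I X W C (encodeTriple t ++ l) BAD) ≡ ⟪ c ⟫ n (at K Bd Wk J T A D τ y I X W C (encodeTriple t ++ l) BAD)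
  whenMore-C′ {K} {Bd} {Wk} {J} {T} {A} {D} {τ} {y} {I} {X} {W} {C} {BAD} c (i , x , z) l
    rewrite List.++-assoc (encodeℕ i) (encodeℕ x ++ encodeℕ z) l with encodeℕ i ++ (encodeℕ x ++ encodeℕ z) ++ l | nonempty-code i ((encodeℕ x ++ encodeℕ z) ++ l)
  ... | _ | _ , _ , refl = refl

  whenMore-W : ∀ {K Bd Wk J T A D τ y I X C C′ BAD} c t l →
    ⟪ whenMore Verifier.W c ⟫ n (at K Bd Wk J T A D τ y I X (encodeTriple t ++ l) C C′ BAD) ≡ ⟪ c ⟫ n (at K Bd Wk J T A D τ y I X (encodeTriple t ++ l) C C′ BAD)
  whenMore-W {K} {Bd} {Wk} {J} {T} {A} {D} {τ} {y} {I} {X} {C} {C′} {BAD} c (i , x , z) l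
    rewrite List.++-assoc (encodeℕ i) (encodeℕ x ++ encodeℕ z) l with encodeℕ i ++ (encodeℕ x ++ encodeℕ z) ++ l | nonempty-code i ((encodeℕ x ++ encodeℕ z) ++ l)
  ... | _ | _ , _ , refl = refl

  views : ℕ → List Triple → List (Kind × ℕ)
  views J = map (λ (i , x , _) → kindOf J i , x)

  passτ : ℕ → List (Kind × ℕ) → ℕ
  passτ τ []            = τ
  passτ τ ((κ , x) ∷ σ) = passτ (τ + x) σ

  passy : ℕ → List (Kind × ℕ) → ℕ
  passy y []            = y
  passy y ((κ , x) ∷ σ) = passy (credit κ y x) σ

  passBad : (T A D τ y : ℕ) → List (Kind × ℕ) → List Bool → List Bool
  passBad T A D τ y []            bs = bs
  passBad T A D τ y ((κ , x) ∷ σ) bs = passBad T A D (τ + x) (credit κ y x) σ (judged κ T A D τ y x bs)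

  length-triple : ∀ t ts → length (concatMap encodeTriple (t ∷ ts)) ≡ length (encodeTriple t) + length (concatMap encodeTriple ts)
  length-triple t ts = List.length-++ (encodeTriple t)

  fits-head : ∀ t ts → length (concatMap encodeTriple (t ∷ ts)) ≤ n → length (encodeTriple t) ≤ n
  fits-head t ts h = ≤-trans (length-part₁ (encodeTriple t) _) h

  fits-tail : ∀ t ts → length (concatMap encodeTriple (t ∷ ts)) ≤ n → length (concatMap encodeTriple ts) ≤ n
  fits-tail t ts h = ≤-trans (length-part₂ (encodeTriple t) _) h

  count-triples : ∀ ts → length ts ≤ length (concatMap encodeTriple ts)
  count-triples [] = z≤n
  count-triples (t@(i , x , z) ∷ ts) = ≤-trans (+-mono-≤ nonempty (count-triples ts)) (≤-reflexive (sym (length-triple t ts)))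
    where
    nonempty : 1 ≤ length (encodeTriple t)
    nonempty with encodeTriple t | nonempty-code i (encodeℕ x ++ encodeℕ z)
    ... | _ | _ , _ , refl = s≤s z≤n

  segmentStep-sem : ∀ {K Bd Wk J T A D τ y W C BAD} i x z l → length (encodeTriple (i , x , z)) ≤ n →
    ⟪ segmentStep ⟫ n (at K Bd Wk J T A D τ y 0 0 W C (encodeTriple (i , x , z) ++ l) BAD)
    ≡ at K Bd Wk J T A D (τ + x) (credit (kindOf J i) y x) 0 0 W C l (judged (kindOf J i) T A D τ y x BAD)
  segmentStep-sem {K} {Bd} {Wk} {J} {T} {A} {D} {τ} {y} {W} {C} {BAD} i x z l h =
    trans (whenMore-C′ (readSegment ›› judge ›› add X Verifier.τ ›› clear I ›› clear X) (i , x , z) l)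
   (trans (cong (⟪ judge ›› add X Verifier.τ ›› clear I ›› clear X ⟫ n) (readSegment-sem i x z h))
          (cong (⟪ add X Verifier.τ ›› clear I ›› clear X ⟫ n) (judge-sem {K} {Bd} {Wk} {J} {T} {A} {D} {τ} {y} {i} {x} {W} {C} {l} {BAD})))

  segments-sem : ∀ k {K Bd Wk J T A D τ y W C BAD} ts → length (concatMap encodeTriple ts) ≤ n → length ts ≤ k →
    iter k (⟪ segmentStep ⟫ n) (at K Bd Wk J T A D τ y 0 0 W C (concatMap encodeTriple ts) BAD)
    ≡ at K Bd Wk J T A D (passτ τ (views J ts)) (passy y (views J ts)) 0 0 W C [] (passBad T A D τ y (views J ts) BAD)
  segments-sem k       []                 h l = iter-fixed k (⟪ segmentStep ⟫ n) refl
  segments-sem (suc k) ((i , x , z) ∷ ts) h (s≤s l) =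
    trans (cong (iter k (⟪ segmentStep ⟫ n)) (segmentStep-sem i x z (concatMap encodeTriple ts) (fits-head (i , x , z) ts h)))
          (segments-sem k ts (fits-tail (i , x , z) ts h) l)

  copyC-sem : ∀ {K Bd Wk J T A D τ y I X W C BAD} → length C ≤ n →
    ⟪ copyC ⟫ n (at K Bd Wk J T A D τ y I X W C [] BAD) ≡ at K Bd Wk J T A D τ y I X W C C BAD
  copyC-sem {K} {Bd} {Wk} {J} {T} {A} {D} {τ} {y} {I} {X} {W} {C} {BAD} h = begin
    ⟪ copyC ⟫ n (at K Bd Wk J T A D τ y I X W C [] BAD)
      ≡⟨ cong (⟪ loop (popS Verifier.CR nil (λ b → pushS Verifier.C b ›› pushS Verifier.C′ b)) ⟫ n)
          (drain (⟪ popS Verifier.C nil (pushS Verifier.CR) ⟫ n) (λ xs a → st K Bd Wk J T A D τ y I X 0 0 0 0 W xs [] [] BAD a) (λ a b → b ∷ a) (λ _ _ _ → refl) (λ _ → refl) n C [] h) ⟩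
    iter n (⟪ popS Verifier.CR nil (λ b → pushS Verifier.C b ›› pushS Verifier.C′ b) ⟫ n) (st K Bd Wk J T A D τ y I X 0 0 0 0 W [] [] [] BAD (C List.ʳ++ []))
      ≡⟨ drain (⟪ popS Verifier.CR nil (λ b → pushS Verifier.C b ›› pushS Verifier.C′ b) ⟫ n) (λ xs (a , a′) → st K Bd Wk J T A D τ y I X 0 0 0 0 W a a′ [] BAD xs) (λ (a , a′) b → b ∷ a , b ∷ a′)
          (λ _ _ _ → refl) (λ _ → refl) n (C List.ʳ++ []) ([] , []) (≤-trans (≤-reflexive (List.length-reverse C)) h) ⟩
    fin (List.foldl (λ (a , a′) b → b ∷ a , b ∷ a′) ([] , []) (C List.ʳ++ [])) ≡⟨ cong fin (pairs (C List.ʳ++ []) [] []) ⟩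
    fin ((C List.ʳ++ []) List.ʳ++ [] , (C List.ʳ++ []) List.ʳ++ []) ≡⟨ cong (λ c → fin (c , c)) (List.reverse-involutive C) ⟩
    at K Bd Wk J T A D τ y I X W C C BAD ∎
    where
    open ≡-Reasoning
    fin : List Bool × List Bool → Store 17 8
    fin (a , a′) = st K Bd Wk J T A D τ y I X 0 0 0 0 W a a′ [] BAD []
    pairs : ∀ (xs as bs : List Bool) → List.foldl (λ (a , a′) b → (b ∷ a) , (b ∷ a′)) (as , bs) xs ≡ (xs List.ʳ++ as , xs List.ʳ++ bs)
    pairs []       as bs = refl
    pairs (x ∷ xs) as bs = pairs xs (x ∷ as) (x ∷ bs)

  startPass-sem : ∀ {K Bd Wk J T A D τ y W BAD} k l → length (encodeℕ k ++ l) ≤ n →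
    ⟪ startPass ⟫ n (at K Bd Wk J T A D τ y 0 0 W (encodeℕ k ++ l) [] BAD) ≡ at K Bd Wk J T A D τ y 0 0 W (encodeℕ k ++ l) l BAD
  startPass-sem k l h = trans (cong (⟪ readTo Verifier.C′ one U ›› clear U ⟫ n) (copyC-sem h))
    (cong (⟪ clear U ⟫ n) (proj₂ (after-C′ k U (≤-trans (length-part₁ (encodeℕ k) l) h))))

  jobBad : (K J t a d : ℕ) → List Triple → List Bool → List Bool
  jobBad K J t a d ts bs = penalty (isDead (K * t) (K * a) (K * d) (passτ 0 σ) (passy 0 σ)) (passBad (K * t) (K * a) (K * d) 0 0 σ bs)
    where
    σ : List (Kind × ℕ)
    σ = views J ts

  module _ (k : ℕ) (ts : List Triple) (hC : length (encodeNumbers k ts) ≤ n) where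

    code : List Bool
    code = encodeNumbers k ts

    hts : length (concatMap encodeTriple ts) ≤ n
    hts = ≤-trans (length-part₂ (encodeℕ k) _) hC

    jobStep-sem : ∀ {K Bd Wk J BAD} t a d W → length (encodeTriple (t , a , d)) ≤ n →
      ⟪ jobStep ⟫ n (at K Bd Wk J 0 0 0 0 0 0 0 (encodeTriple (t , a , d) ++ W) code [] BAD)
      ≡ at K Bd (Wk + passy 0 (views (J + 1) ts)) (J + 1) 0 0 0 0 0 0 0 W code [] (jobBad K (J + 1) t a d ts BAD)
    jobStep-sem {K} {Bd} {Wk} {J} {BAD} t a d W h = begin
      ⟪ jobStep ⟫ n (at K Bd Wk J 0 0 0 0 0 0 0 (encodeTriple (t , a , d) ++ W) code [] BAD)
        ≡⟨ whenMore-W (readTo Verifier.W Verifier.K T ›› readTo Verifier.W Verifier.K A ›› readTo Verifier.W Verifier.K D ›› add one Verifier.J ›› startPass ›› loop segmentStep ››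
             deadCheck ›› add y Verifier.Wk ›› clear T ›› clear A ›› clear D ›› clear τ ›› clear y) (t , a , d) W ⟩
      c₃ (c₂ (c₁ (at K Bd Wk J 0 0 0 0 0 0 0 (encodeTriple (t , a , d) ++ W) code [] BAD)))
        ≡⟨ cong (λ l → c₃ (c₂ (c₁ (at K Bd Wk J 0 0 0 0 0 0 0 l code [] BAD)))) (trans (List.++-assoc (encodeℕ t) _ W) (cong (encodeℕ t ++_) (List.++-assoc (encodeℕ a) (encodeℕ d) W))) ⟩
      c₃ (c₂ (c₁ (at K Bd Wk J 0 0 0 0 0 0 0 (encodeℕ t ++ encodeℕ a ++ encodeℕ d ++ W) code [] BAD)))
        ≡⟨ cong (λ u → c₃ (c₂ u)) (proj₂ (after-W t T ht)) ⟩
      c₃ (c₂ (at K Bd Wk J (K * t) 0 0 0 0 0 0 (encodeℕ a ++ encodeℕ d ++ W) code [] BAD))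
        ≡⟨ cong c₃ (proj₂ (after-W a A ha)) ⟩
      c₃ (at K Bd Wk J (K * t) (K * a) 0 0 0 0 0 (encodeℕ d ++ W) code [] BAD)
        ≡⟨ cong c₄ (cong (⟪ add one Verifier.J ⟫ n) (proj₂ (after-W d D hd))) ⟩
      c₄ (at K Bd Wk (J + 1) (K * t) (K * a) (K * d) 0 0 0 0 W code [] BAD)
        ≡⟨ cong c₅ (startPass-sem k (concatMap encodeTriple ts) hC) ⟩
      c₅ (at K Bd Wk (J + 1) (K * t) (K * a) (K * d) 0 0 0 0 W code (concatMap encodeTriple ts) BAD)
        ≡⟨ cong c₆ (segments-sem n ts hts (≤-trans (count-triples ts) hts)) ⟩
      c₆ (at K Bd Wk (J + 1) (K * t) (K * a) (K * d) (passτ 0 (views (J + 1) ts)) (passy 0 (views (J + 1) ts)) 0 0 W code [] (passBad (K * t) (K * a) (K * d) 0 0 (views (J + 1) ts) BAD))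
        ≡⟨ cong c₇ (deadCheck-sem {K} {Bd} {Wk} {J + 1} {K * t} {K * a} {K * d} {passτ 0 (views (J + 1) ts)} {passy 0 (views (J + 1) ts)} refl refl) ⟩
      at K Bd (Wk + passy 0 (views (J + 1) ts)) (J + 1) 0 0 0 0 0 0 0 W code [] (jobBad K (J + 1) t a d ts BAD) ∎
      where
      open ≡-Reasoning
      c₁ c₂ c₃ c₄ c₅ c₆ c₇ : Store 17 8 → Store 17 8
      c₁ = ⟪ readTo Verifier.W Verifier.K T ⟫ n
      c₂ = ⟪ readTo Verifier.W Verifier.K A ⟫ n
      c₇ = ⟪ add y Verifier.Wk ›› clear T ›› clear A ›› clear D ›› clear τ ›› clear y ⟫ n
      c₆ u = c₇ (⟪ deadCheck ⟫ n u)
      c₅ u = c₆ (⟪ loop segmentStep ⟫ n u)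
      c₄ u = c₅ (⟪ startPass ⟫ n u)
      c₃ u = c₄ (⟪ readTo Verifier.W Verifier.K D ›› add one Verifier.J ⟫ n u)
      ht : length (encodeℕ t) ≤ n
      ht = ≤-trans (length-part₁ (encodeℕ t) _) h
      ha : length (encodeℕ a) ≤ n
      ha = ≤-trans (≤-trans (length-part₁ (encodeℕ a) _) (length-part₂ (encodeℕ t) _)) h
      hd : length (encodeℕ d) ≤ n
      hd = ≤-trans (≤-trans (length-part₂ (encodeℕ a) _) (length-part₂ (encodeℕ t) _)) h

    jobsBad : (K J : ℕ) → List Triple → List Bool → List Bool
    jobsBad K J []                 bs = bs
    jobsBad K J ((t , a , d) ∷ js) bs = jobsBad K (J + 1) js (jobBad K (J + 1) t a d ts bs)

    jobsWork : (J : ℕ) → List Triple → ℕ → ℕ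
    jobsWork J []       w = w
    jobsWork J (_ ∷ js) w = jobsWork (J + 1) js (w + passy 0 (views (J + 1) ts))

    jobs-sem : ∀ m {K Bd Wk J BAD} js → length (concatMap encodeTriple js) ≤ n → length js ≤ m →
      iter m (⟪ jobStep ⟫ n) (at K Bd Wk J 0 0 0 0 0 0 0 (concatMap encodeTriple js) code [] BAD)
      ≡ at K Bd (jobsWork J js Wk) (J + length js) 0 0 0 0 0 0 0 [] code [] (jobsBad K J js BAD)
    jobs-sem m {K} {Bd} {Wk} {J} {BAD} [] h l = trans (iter-fixed m (⟪ jobStep ⟫ n) refl) (cong (λ J → at K Bd Wk J 0 0 0 0 0 0 0 [] code [] BAD) (sym (+-identityʳ J)))
    jobs-sem (suc m) {K} {Bd} {Wk} {J} {BAD} ((t , a , d) ∷ js) h (s≤s l) =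
      trans (cong (iter m (⟪ jobStep ⟫ n)) (jobStep-sem t a d (concatMap encodeTriple js) (fits-head (t , a , d) js h)))
     (trans (jobs-sem m js (fits-tail (t , a , d) js h) l)
            (cong (λ J′ → at K Bd (jobsWork (J + 1) js (Wk + passy 0 (views (J + 1) ts))) J′ 0 0 0 0 0 0 0 [] code [] (jobsBad K (J + 1) js (jobBad K (J + 1) t a d ts BAD))) (+-assoc J 1 (length js))))

  indexBad : ℕ → List Triple → List Bool → List Bool
  indexBad J []                 bs = bs
  indexBad J ((i , x , _) ∷ ts) bs = indexBad J ts (penalty (1 ≤ᵇ x) (penalty (i ≤ᵇ J) bs))

  index-sem : ∀ k {K Bd Wk J W C BAD} ts → length (concatMap encodeTriple ts) ≤ n → length ts ≤ k →
    iter k (⟪ indexStep ⟫ n) (at K Bd Wk J 0 0 0 0 0 0 0 W C (concatMap encodeTriple ts) BAD)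
    ≡ at K Bd Wk J 0 0 0 0 0 0 0 W C [] (indexBad J ts BAD)
  index-sem k       []                 h l = iter-fixed k (⟪ indexStep ⟫ n) refl
  index-sem (suc k) {K} {Bd} {Wk} {J} {W} {C} {BAD} ((i , x , z) ∷ ts) h (s≤s l) =
    trans (cong (iter k (⟪ indexStep ⟫ n))
      (trans (whenMore-C′ (readSegment ›› tests) (i , x , z) (concatMap encodeTriple ts))
      (trans (cong (⟪ tests ⟫ n) (readSegment-sem i x z (fits-head (i , x , z) ts h))) checked)))
      (index-sem k ts (fits-tail (i , x , z) ts h) l)
    where
    tests : Program
    tests = ifLe I Verifier.J nil bad ›› ifLe one X nil bad ›› clear I ›› clear X
    checked : ⟪ tests ⟫ n (at K Bd Wk J 0 0 0 0 0 i x W C (concatMap encodeTriple ts) BAD)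
            ≡ at K Bd Wk J 0 0 0 0 0 0 0 W C (concatMap encodeTriple ts) (penalty (1 ≤ᵇ x) (penalty (i ≤ᵇ J) BAD))
    checked = trans (cong (⟪ ifLe one X nil bad ›› clear I ›› clear X ⟫ n) (test-sem I Verifier.J (rg K Bd Wk J 0 0 0 0 0 i x 0 0 0 0))) (cong (⟪ clear I ›› clear X ⟫ n) (test-sem one X (rg K Bd Wk J 0 0 0 0 0 i x 0 0 0 0)))

  failures : (b : ℕ) (js : List Triple) (k : ℕ) (ts : List Triple) → length (encodeNumbers k ts) ≤ n → List Bool
  failures b js k ts hC = penalty (jobsWork k ts hC 0 js 0 ≤ᵇ k * b) (indexBad (length js) ts (jobsBad k ts hC k 0 js (penalty (1 ≤ᵇ k) [])))

  main-sem : ∀ b js k ts (hW : length (encodeNumbers b js) ≤ n) (hC : length (encodeNumbers k ts) ≤ n) →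
    ∃[ σ ] ⟪ main ⟫ n (at 0 0 0 0 0 0 0 0 0 0 0 (encodeNumbers b js) (encodeNumbers k ts) [] []) ≡ σ × lookup (stks σ) Verifier.BAD ≡ failures b js k ts hC × lookup (stks σ) OUT ≡ []
  main-sem b js k ts hW hC = _ , final , refl , refl
    where
    open ≡-Reasoning
    cs : List Bool
    cs = encodeNumbers k ts
    hjs : length (concatMap encodeTriple js) ≤ n
    hjs = ≤-trans (length-part₂ (encodeℕ b) _) hW
    e₁ e₂ e₃ e₄ e₅ e₆ e₇ : Store 17 8 → Store 17 8
    e₇ = ⟪ ifLe Wk Bd nil bad ⟫ n
    e₆ u = e₇ (⟪ loop indexStep ⟫ n u)
    e₅ u = e₆ (⟪ startPass ⟫ n u)
    e₄ u = e₅ (⟪ loop jobStep ⟫ n u)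
    e₃ u = e₄ (⟪ readTo Verifier.W Verifier.K Bd ⟫ n u)
    e₂ u = e₃ (⟪ ifLe one Verifier.K nil bad ⟫ n u)
    e₁ u = e₂ (⟪ loop (popS Verifier.C′ nil (λ _ → nil)) ⟫ n u)
    rest : List Bool
    rest = concatMap encodeTriple ts
    pen : List Bool
    pen = penalty (1 ≤ᵇ k) []
    K≥1 : ⟪ ifLe one Verifier.K nil bad ⟫ n (at k 0 0 0 0 0 0 0 0 0 0 (encodeNumbers b js) cs [] []) ≡ at k 0 0 0 0 0 0 0 0 0 0 (encodeNumbers b js) cs [] pen
    K≥1 = test-sem one Verifier.K (rg k 0 0 0 0 0 0 0 0 0 0 0 0 0 0)
    last-test : ∀ w j bs → e₇ (at k (k * b) w j 0 0 0 0 0 0 0 [] cs [] bs) ≡ at k (k * b) w j 0 0 0 0 0 0 0 [] cs [] (penalty (w ≤ᵇ k * b) bs)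
    last-test w j bs = test-sem Wk Bd (rg k (k * b) w j 0 0 0 0 0 0 0 0 0 0 0)
    final : ⟪ main ⟫ n (at 0 0 0 0 0 0 0 0 0 0 0 (encodeNumbers b js) cs [] []) ≡ at k (k * b) (jobsWork k ts hC 0 js 0) (length js) 0 0 0 0 0 0 0 [] cs [] (failures b js k ts hC)
    final = begin
      ⟪ main ⟫ n (at 0 0 0 0 0 0 0 0 0 0 0 (encodeNumbers b js) cs [] []) ≡⟨ cong (λ u → e₁ (⟪ readTo Verifier.C′ one Verifier.K ⟫ n u)) (copyC-sem hC) ⟩
      e₁ (⟪ readTo Verifier.C′ one Verifier.K ⟫ n (at 0 0 0 0 0 0 0 0 0 0 0 (encodeNumbers b js) cs cs [])) ≡⟨ cong e₁ (proj₂ (after-C′ k Verifier.K (≤-trans (length-part₁ (encodeℕ k) rest) hC))) ⟩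
      e₁ (at k 0 0 0 0 0 0 0 0 0 0 (encodeNumbers b js) cs rest []) ≡⟨ cong e₂ (drain (⟪ popS Verifier.C′ nil (λ _ → nil) ⟫ n) (λ xs (_ : ⊤) → at k 0 0 0 0 0 0 0 0 0 0 (encodeNumbers b js) cs xs []) (λ a _ → a) (λ _ _ _ → refl) (λ _ → refl) n rest tt (≤-trans (length-part₂ (encodeℕ k) rest) hC)) ⟩
      e₂ (at k 0 0 0 0 0 0 0 0 0 0 (encodeNumbers b js) cs [] []) ≡⟨ cong e₃ K≥1 ⟩
      e₃ (at k 0 0 0 0 0 0 0 0 0 0 (encodeNumbers b js) cs [] pen) ≡⟨ cong e₄ (proj₂ (after-W b Verifier.Bd (≤-trans (length-part₁ (encodeℕ b) _) hW))) ⟩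
      e₄ (at k (k * b) 0 0 0 0 0 0 0 0 0 (concatMap encodeTriple js) cs [] pen) ≡⟨ cong e₅ (jobs-sem k ts hC n js hjs (≤-trans (count-triples js) hjs)) ⟩
      e₅ (at k (k * b) (jobsWork k ts hC 0 js 0) (length js) 0 0 0 0 0 0 0 [] cs [] (jobsBad k ts hC k 0 js pen)) ≡⟨ cong e₆ (startPass-sem k rest hC) ⟩
      e₆ (at k (k * b) (jobsWork k ts hC 0 js 0) (length js) 0 0 0 0 0 0 0 [] cs rest (jobsBad k ts hC k 0 js pen)) ≡⟨ cong e₇ (index-sem n ts (hts k ts hC) (≤-trans (count-triples ts) (hts k ts hC))) ⟩
      e₇ (at k (k * b) (jobsWork k ts hC 0 js 0) (length js) 0 0 0 0 0 0 0 [] cs [] (indexBad (length js) ts (jobsBad k ts hC k 0 js pen))) ≡⟨ last-test _ _ _ ⟩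
      at k (k * b) (jobsWork k ts hC 0 js 0) (length js) 0 0 0 0 0 0 0 [] cs [] (failures b js k ts hC) ∎

-- Acceptance and plans.

penalty-[] : ∀ b {bs} → penalty b bs ≡ [] ⇔ (b ≡ true × bs ≡ [])
penalty-[] true  = mk⇔ (λ e → refl , e) proj₂
penalty-[] false = mk⇔ (λ ()) (λ { (() , _) })

≤ᵇ-true : ∀ {m n} → (m ≤ᵇ n) ≡ true ⇔ m ≤ n
≤ᵇ-true {m} {n} with m ≤ᵇ n | ≤ᵇ-reflects-≤ m n
... | true  | ofʸ h  = mk⇔ (λ _ → h) (λ _ → refl)
... | false | ofⁿ ¬h = mk⇔ (λ ()) (λ h → contradiction h ¬h)

not-≤ᵇ-true : ∀ {m n} → not (m ≤ᵇ n) ≡ true ⇔ n < m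
not-≤ᵇ-true {m} {n} with m ≤ᵇ n | ≤ᵇ-reflects-≤ m n
... | true  | ofʸ h  = mk⇔ (λ ()) (λ h′ → contradiction h (<⇒≱ h′))
... | false | ofⁿ ¬h = mk⇔ (λ _ → ≰⇒> ¬h) (λ _ → refl)

∨-true : ∀ {a b} {P Q : Set} → a ≡ true ⇔ P → b ≡ true ⇔ Q → (a ∨ b) ≡ true ⇔ (P ⊎ Q)
∨-true {true}  p q = mk⇔ (λ _ → inj₁ (Equivalence.to p refl)) (λ _ → refl)
∨-true {false} p q = mk⇔ (λ e → inj₂ (Equivalence.to q e)) (λ { (inj₁ x) → case Equivalence.from p x of λ () ; (inj₂ y) → Equivalence.from q y })

isDead-true : ∀ {T A D τ y} → isDead T A D τ y ≡ true ⇔ Dead T A D τ y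
isDead-true = ∨-true ≤ᵇ-true (∨-true not-≤ᵇ-true not-≤ᵇ-true)

judged-[] : ∀ κ {T A D τ y x bs} → judged κ T A D τ y x bs ≡ [] ⇔ (Allowed κ T A D τ y x × bs ≡ [])
judged-[] mine {T} {A} {D} {τ} {y} {x} {bs} = mk⇔
  (λ e → case to (penalty-[] (τ + T ≤ᵇ D + y)) e of λ (e₁ , r₁) → case to (penalty-[] (y + x ≤ᵇ T)) r₁ of λ (e₂ , r₂) → case to (penalty-[] (A ≤ᵇ τ)) r₂ of λ (e₃ , r₃) →
    (to ≤ᵇ-true e₃ , to ≤ᵇ-true e₂ , to ≤ᵇ-true e₁) , r₃)
  (λ ((h₁ , h₂ , h₃) , e) → from (penalty-[] _) (from ≤ᵇ-true h₃ , from (penalty-[] _) (from ≤ᵇ-true h₂ , from (penalty-[] _) (from ≤ᵇ-true h₁ , e))))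
  where open Equivalence
judged-[] idle {T} {A} {D} {τ} {y} {x} {bs} = mk⇔
  (λ e → case to (penalty-[] _) e of λ (e₁ , r) → to (∨-true ≤ᵇ-true isDead-true) e₁ , r)
  (λ (h , e) → from (penalty-[] _) (from (∨-true ≤ᵇ-true isDead-true) h , e))
  where open Equivalence
judged-[] other = mk⇔ (λ e → tt , e) proj₂

kindOf-index : ∀ {n} (k : Fin n) i → kindOf (suc (toℕ k)) (segIndex i) ≡ kind k i
kindOf-index k nothing  = refl
kindOf-index k (just i) with i Fin.≟ k
... | yes refl rewrite Equivalence.from (≤ᵇ-true {suc (toℕ k)} {suc (toℕ k)}) ≤-refl = refl
... | no i≢k with suc (toℕ i) ≤ᵇ suc (toℕ k) | ≤ᵇ-reflects-≤ (suc (toℕ i)) (suc (toℕ k)) | suc (toℕ k) ≤ᵇ suc (toℕ i) | ≤ᵇ-reflects-≤ (suc (toℕ k)) (suc (toℕ i))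
... | true  | ofʸ h | true  | ofʸ h′ = contradiction (Fin.toℕ-injective (suc-injective (≤-antisym h h′))) i≢k
... | true  | _     | false | _ = refl
... | false | _     | _     | _ = refl

-- Numbers are self-delimiting, as each digit is announced by `true` and the end by `false`.
encodeᵇ-prefix : ∀ x x′ {l l′} → encodeℕᵇ x ++ l ≡ encodeℕᵇ x′ ++ l′ → x ≡ x′ × l ≡ l′
encodeᵇ-prefix ℕᵇ.zero  ℕᵇ.zero   e = refl , List.∷-injectiveʳ e
encodeᵇ-prefix 2[1+ x ] 2[1+ x′ ] e with encodeᵇ-prefix x x′ (List.∷-injectiveʳ (List.∷-injectiveʳ e))
... | e₁ , e₂ = cong 2[1+_] e₁ , e₂
encodeᵇ-prefix 1+[2 x ] 1+[2 x′ ] e with encodeᵇ-prefix x x′ (List.∷-injectiveʳ (List.∷-injectiveʳ e))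
... | e₁ , e₂ = cong 1+[2_] e₁ , e₂

encodeℕ-prefix : ∀ x x′ {l l′} → encodeℕ x ++ l ≡ encodeℕ x′ ++ l′ → x ≡ x′ × l ≡ l′
encodeℕ-prefix x x′ e with encodeᵇ-prefix (ℕᵇ.fromℕ x) (ℕᵇ.fromℕ x′) e
... | e₁ , e₂ = trans (sym (ℕᵇ.toℕ-fromℕ x)) (trans (cong ℕᵇ.toℕ e₁) (ℕᵇ.toℕ-fromℕ x′)) , e₂

encodeTriple-prefix : ∀ t t′ {l l′} → encodeTriple t ++ l ≡ encodeTriple t′ ++ l′ → t ≡ t′ × l ≡ l′
encodeTriple-prefix (x , y , z) (x′ , y′ , z′) {l} {l′} e
  with encodeℕ-prefix x x′ (trans (sym (List.++-assoc (encodeℕ x) _ l)) (trans e (List.++-assoc (encodeℕ x′) _ l′)))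
... | refl , e₁ with encodeℕ-prefix y y′ (trans (sym (List.++-assoc (encodeℕ y) _ l)) (trans e₁ (List.++-assoc (encodeℕ y′) _ l′)))
... | refl , e₂ with encodeℕ-prefix z z′ e₂
... | refl , e₃ = refl , e₃

triples-injective : ∀ ts ts′ → concatMap encodeTriple ts ≡ concatMap encodeTriple ts′ → ts ≡ ts′
triples-injective []       []         e = refl
triples-injective []       ((x , y , z) ∷ ts′) e with ℕᵇ.fromℕ x
triples-injective [] ((x , y , z) ∷ ts′) () | ℕᵇ.zero
triples-injective [] ((x , y , z) ∷ ts′) () | 2[1+ _ ]
triples-injective [] ((x , y , z) ∷ ts′) () | 1+[2 _ ]
triples-injective ((x , y , z) ∷ ts) [] e with ℕᵇ.fromℕ x
triples-injective ((x , y , z) ∷ ts) [] () | ℕᵇ.zero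
triples-injective ((x , y , z) ∷ ts) [] () | 2[1+ _ ]
triples-injective ((x , y , z) ∷ ts) [] () | 1+[2 _ ]
triples-injective (t ∷ ts) (t′ ∷ ts′) e with encodeTriple-prefix t t′ e
... | refl , e′ = cong (t ∷_) (triples-injective ts ts′ e′)

encodeNumbers-injective : ∀ b b′ ts ts′ → encodeNumbers b ts ≡ encodeNumbers b′ ts′ → b ≡ b′ × ts ≡ ts′
encodeNumbers-injective b b′ ts ts′ e with encodeℕ-prefix b b′ e
... | e₁ , e₂ = e₁ , triples-injective ts ts′ e₂

module Acceptance (n : ℕ) where

  open VerifierSemantics n
  open Verifier using (verifier; format; scanBody; scanEnd; transfer; main; OUT; WR; CR)
  open Equivalence

  -- The stack of failures never shrinks during a pass, so it ends empty exactly if it began empty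
  -- and every check succeeded.
  pass-[] : ∀ {T A D} τ y σ bs → penalty (isDead T A D (passτ τ σ) (passy y σ)) (passBad T A D τ y σ bs) ≡ [] ⇔ (Ok T A D τ y σ × bs ≡ [])
  pass-[] τ y [] bs = mk⇔ (λ e → case to (penalty-[] _) e of λ (e₁ , r) → to isDead-true e₁ , r) (λ (h , e) → from (penalty-[] _) (from isDead-true h , e))
  pass-[] τ y ((κ , x) ∷ σ) bs = mk⇔
    (λ e → case to (pass-[] (τ + x) (credit κ y x) σ _) e of λ (h , r) → case to (judged-[] κ) r of λ (h′ , r′) → (h′ , h) , r′)
    (λ ((h′ , h) , r) → from (pass-[] (τ + x) (credit κ y x) σ _) (h , from (judged-[] κ) (h′ , r)))

  indexBad-[] : ∀ J ts bs → indexBad J ts bs ≡ [] ⇔ (All (λ (i , x , _) → i ≤ J × 1 ≤ x) ts × bs ≡ [])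
  indexBad-[] J [] bs = mk⇔ (λ e → [] , e) proj₂
  indexBad-[] J ((i , x , z) ∷ ts) bs = mk⇔
    (λ e → case to (indexBad-[] J ts _) e of λ (hs , r) → case to (penalty-[] _) r of λ (e₁ , r₁) → case to (penalty-[] _) r₁ of λ (e₂ , r₂) → ((to ≤ᵇ-true e₂ , to ≤ᵇ-true e₁) ∷ hs) , r₂)
    (λ { ((h₁ , h₂) ∷ hs , r) → from (indexBad-[] J ts _) (hs , from (penalty-[] _) (from ≤ᵇ-true h₂ , from (penalty-[] _) (from ≤ᵇ-true h₁ , r))) })

  passy-worked : ∀ {m} (k : Fin m) σ y → passy y (viewFor k σ) ≡ y + worked σ k
  passy-worked k []            y = sym (+-identityʳ y)
  passy-worked k ((i , x) ∷ σ) y = trans (passy-worked k σ _) (trans (cong (_+ worked σ k) (split (kind k i))) (+-assoc y _ _))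
    where
    split : ∀ κ → credit κ y x ≡ y + credit κ 0 x
    split mine  = refl
    split idle  = sym (+-identityʳ y)
    split other = sym (+-identityʳ y)

  jobTriples : ∀ {m} → Vec Job m → List Triple
  jobTriples jobs = map jobTriple (Vec.toList jobs)

  module _ (K : ℕ) (ts : List Triple) (hC : length (encodeNumbers K ts) ≤ n) where

    OkTriple : Job → ℕ → Set
    OkTriple jb J = Ok (K * Job.processing jb) (K * Job.arrival jb) (K * Job.deadline jb) 0 0 (views J ts)

    jobsBad-[] : ∀ {m} (jobs : Vec Job m) J bs → jobsBad K ts hC K J (jobTriples jobs) bs ≡ [] ⇔ ((∀ k → OkTriple (lookup jobs k) (J + suc (toℕ k))) × bs ≡ [])
    jobsBad-[] [] J bs = mk⇔ (λ e → (λ ()) , e) proj₂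
    jobsBad-[] (jb@(job t a d) ∷ jobs) J bs = mk⇔
      (λ e → case to (jobsBad-[] jobs (J + 1) _) e of λ (hs , r) → case to (pass-[] 0 0 (views (J + 1) ts) bs) r of λ (h , r′) →
         (λ { zero → h ; (suc k) → subst (OkTriple (lookup jobs k)) (+-assoc J 1 (suc (toℕ k))) (hs k) }) , r′)
      (λ (hs , r) → from (jobsBad-[] jobs (J + 1) _) ((λ k → subst (OkTriple (lookup jobs k)) (sym (+-assoc J 1 (suc (toℕ k)))) (hs (suc k))) , from (pass-[] 0 0 (views (J + 1) ts) bs) (hs zero , r)))

    jobsWork-sum : ∀ {m} (jobs : Vec Job m) J w → jobsWork K ts hC J (jobTriples jobs) w ≡ w + sum (List.tabulate {n = m} (λ k → passy 0 (views (J + suc (toℕ k)) ts)))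
    jobsWork-sum [] J w = sym (+-identityʳ w)
    jobsWork-sum {suc m} (jb ∷ jobs) J w = trans (jobsWork-sum jobs (J + 1) _) (trans (+-assoc w _ _)
      (cong (λ s → w + (passy 0 (views (J + 1) ts) + s)) (cong sum (List.tabulate-cong {n = m} (λ k → cong (λ j → passy 0 (views j ts)) (+-assoc J 1 (suc (toℕ k))))))))

  length-jobTriples : ∀ {m} (jobs : Vec Job m) → length (jobTriples jobs) ≡ m
  length-jobTriples jobs = trans (List.length-map jobTriple (Vec.toList jobs)) (Vec.length-toList jobs)

  module _ {m : ℕ} (σ : Segs m) where

    views-view : ∀ ts (k : Fin m) → map (λ (i , x , _) → i , x) ts ≡ map (λ (i , x) → segIndex i , x) σ → views (suc (toℕ k)) ts ≡ viewFor k σ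
    views-view ts k e = trans (List.map-∘ ts) (trans (cong (map (λ (i , x) → kindOf (suc (toℕ k)) i , x)) e)
                       (trans (sym (List.map-∘ σ)) (List.map-cong (λ (i , x) → cong (_, x) (kindOf-index k i)) σ)))

  module _ (I : Instance) (K : ℕ) (ts : List Triple) (hC : length (encodeNumbers K ts) ≤ n) (σ : Segs (Instance.size I))
           (same : map (λ (i , x , _) → i , x) ts ≡ map (λ (i , x) → segIndex i , x) σ) where

    open Instance I

    work-eq : jobsWork K ts hC 0 (jobTriples jobs) 0 ≡ workload σ
    work-eq = trans (jobsWork-sum K ts hC jobs 0 0) (cong sum (trans (List.tabulate-cong {n = size} (λ k → trans (cong (passy 0) (views-view σ ts k same)) (passy-worked k σ 0))) (sym (List.map-tabulate {n = size} id (worked σ)))))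

    failures→plan : failures bound (jobTriples jobs) K ts hC ≡ [] → Plan I K σ
    failures→plan e with to (penalty-[] _) e
    ... | e₁ , r₁ with to (indexBad-[] _ ts _) r₁
    ... | hs , r₂ with to (jobsBad-[] K ts hC jobs 0 _) r₂
    ... | oks , r₃ = record
      { unit-positive = to ≤ᵇ-true (proj₁ (to (penalty-[] _) r₃))
      ; positive      = All.map⁻ (subst (All (λ s → 0 < proj₂ s)) same (All.map⁺ (All.map proj₂ hs)))
      ; ok            = λ k → subst (Ok _ _ _ 0 0) (views-view σ ts k same) (oks k)
      ; work          = subst (_≤ K * bound) work-eq (to ≤ᵇ-true e₁)
      }

    plan→failures : All (λ (i , x , _) → i ≤ size) ts → Plan I K σ → failures bound (jobTriples jobs) K ts hC ≡ []
    plan→failures idx P = from (penalty-[] _) (from ≤ᵇ-true (subst (_≤ K * bound) (sym work-eq) work) ,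
      from (indexBad-[] _ ts _) (both idx (All.map⁻ (subst (All (λ s → 0 < proj₂ s)) (sym same) (All.map⁺ positive))) ,
      from (jobsBad-[] K ts hC jobs 0 _) ((λ k → subst (Ok _ _ _ 0 0) (sym (views-view σ ts k same)) (ok k)) ,
      from (penalty-[] _) (from ≤ᵇ-true unit-positive , refl))))
      where
      open Plan P
      both : ∀ {ts} → All (λ (i , x , _) → i ≤ size) ts → All (λ (i , x , _) → 0 < x) ts → All (λ (i , x , _) → i ≤ length (jobTriples jobs) × 1 ≤ x) ts
      both []       []       = []
      both (p ∷ ps) (q ∷ qs) = (≤-trans p (≤-reflexive (sym (length-jobTriples jobs))) , q) ∷ both ps qs

  Accepted : List Bool → List Bool → Set
  Accepted w c = ∃[ b ] ∃[ js ] ∃[ k ] ∃[ ts ] Σ[ hC ∈ length (encodeNumbers k ts) ≤ n ] w ≡ encodeNumbers b js × c ≡ encodeNumbers k ts × failures b js k ts hC ≡ []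

  store : (W C C′ FL BAD WR CR : List Bool) → Store 17 8
  store W C C′ FL BAD WR CR = rg 0 0 0 0 0 0 0 0 0 0 0 0 0 0 0 ∣ (W ∷ C ∷ C′ ∷ FL ∷ BAD ∷ [] ∷ WR ∷ CR ∷ [])

  accepting? : ∀ a → Dec (a ≡ accepting)
  accepting? ([]    , [])            = no λ ()
  accepting? ([]    , true ∷ [])     = yes refl
  accepting? ([]    , false ∷ [])    = no λ ()
  accepting? ([]    , _ ∷ _ ∷ _)     = no λ ()
  accepting? (_ ∷ _ , _)             = no λ ()

  scanEnd-bad : ∀ {W C BAD WR CR} a → a ≢ accepting → ∃[ C′ ] ∃[ FL ]
    ⟪ scanEnd ⟫ n (store W C (proj₂ a) (proj₁ a) BAD WR CR) ≡ store W C C′ FL (true ∷ BAD) WR CR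
  scanEnd-bad ([]    , [])                 ne = _ , _ , refl
  scanEnd-bad ([]    , true ∷ [])          ne = contradiction refl ne
  scanEnd-bad ([]    , false ∷ [])         ne = _ , _ , refl
  scanEnd-bad ([]    , true ∷ _ ∷ _)       ne = _ , _ , refl
  scanEnd-bad ([]    , false ∷ _ ∷ _)      ne = _ , _ , refl
  scanEnd-bad (_ ∷ _ , _)                  ne = _ , _ , refl

  scanBody-W : ∀ {C BAD CR} b xs (a : (List Bool × List Bool) × List Bool) →
    ⟪ scanBody Verifier.W WR ⟫ n (store (b ∷ xs) C (proj₂ (proj₁ a)) (proj₁ (proj₁ a)) BAD (proj₂ a) CR)
    ≡ store xs C (proj₂ (scanStep (proj₁ a) b)) (proj₁ (scanStep (proj₁ a) b)) BAD (b ∷ proj₂ a) CR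
  scanBody-W true  xs (([] , c) , z)             = refl
  scanBody-W false xs (([] , []) , z)            = refl
  scanBody-W false xs (([] , _ ∷ []) , z)        = refl
  scanBody-W false xs (([] , _ ∷ _ ∷ _) , z)     = refl
  scanBody-W b     xs ((true ∷ f , c) , z)       = refl
  scanBody-W true  xs ((false ∷ f , c) , z)      = refl
  scanBody-W false xs ((false ∷ f , []) , z)     = refl
  scanBody-W false xs ((false ∷ f , _ ∷ []) , z) = refl
  scanBody-W false xs ((false ∷ f , _ ∷ _ ∷ _) , z) = refl

  scanBody-C : ∀ {W BAD WR} b xs (a : (List Bool × List Bool) × List Bool) →
    ⟪ scanBody Verifier.C CR ⟫ n (store W (b ∷ xs) (proj₂ (proj₁ a)) (proj₁ (proj₁ a)) BAD WR (proj₂ a))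
    ≡ store W xs (proj₂ (scanStep (proj₁ a) b)) (proj₁ (scanStep (proj₁ a) b)) BAD WR (b ∷ proj₂ a)
  scanBody-C true  xs (([] , c) , z)             = refl
  scanBody-C false xs (([] , []) , z)            = refl
  scanBody-C false xs (([] , _ ∷ []) , z)        = refl
  scanBody-C false xs (([] , _ ∷ _ ∷ _) , z)     = refl
  scanBody-C b     xs ((true ∷ f , c) , z)       = refl
  scanBody-C true  xs ((false ∷ f , c) , z)      = refl
  scanBody-C false xs ((false ∷ f , []) , z)     = refl
  scanBody-C false xs ((false ∷ f , _ ∷ []) , z) = refl
  scanBody-C false xs ((false ∷ f , _ ∷ _ ∷ _) , z) = refl

  scan-foldl : ∀ xs a z → List.foldl (λ a b → scanStep (proj₁ a) b , b ∷ proj₂ a) (a , z) xs ≡ (scanAll a xs , xs List.ʳ++ z)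
  scan-foldl []       a z = refl
  scan-foldl (x ∷ xs) a z = scan-foldl xs (scanStep a x) (x ∷ z)

  reverse≤ : ∀ (w : List Bool) → length w ≤ n → length (reverse w) ≤ n
  reverse≤ w h = ≤-trans (≤-reflexive (List.length-reverse w)) h

  format-W : ∀ {C BAD CR} w → length w ≤ n → ⟪ format Verifier.W WR ⟫ n (store w C [] [] BAD [] CR)
    ≡ ⟪ transfer WR Verifier.W ⟫ n (⟪ scanEnd ⟫ n (store [] C (proj₂ (scanAll ([] , []) w)) (proj₁ (scanAll ([] , []) w)) BAD (reverse w) CR))
  format-W {C} {BAD} {CR} w h = cong (⟪ scanEnd ›› transfer WR Verifier.W ⟫ n)
    (trans (drain (⟪ scanBody Verifier.W WR ⟫ n) (λ xs a → store xs C (proj₂ (proj₁ a)) (proj₁ (proj₁ a)) BAD (proj₂ a) CR) (λ a b → scanStep (proj₁ a) b , b ∷ proj₂ a) scanBody-W (λ _ → refl) n w (([] , []) , []) h)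
           (cong (λ a → store [] C (proj₂ (proj₁ a)) (proj₁ (proj₁ a)) BAD (proj₂ a) CR) (scan-foldl w ([] , []) [])))

  format-C : ∀ {W BAD WR} c → length c ≤ n → ⟪ format Verifier.C CR ⟫ n (store W c [] [] BAD WR [])
    ≡ ⟪ transfer CR Verifier.C ⟫ n (⟪ scanEnd ⟫ n (store W [] (proj₂ (scanAll ([] , []) c)) (proj₁ (scanAll ([] , []) c)) BAD WR (reverse c)))
  format-C {W} {BAD} {WR} c h = cong (⟪ scanEnd ›› transfer CR Verifier.C ⟫ n)
    (trans (drain (⟪ scanBody Verifier.C CR ⟫ n) (λ xs a → store W xs (proj₂ (proj₁ a)) (proj₁ (proj₁ a)) BAD WR (proj₂ a)) (λ a b → scanStep (proj₁ a) b , b ∷ proj₂ a) scanBody-C (λ _ → refl) n c (([] , []) , []) h)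
           (cong (λ a → store W [] (proj₂ (proj₁ a)) (proj₁ (proj₁ a)) BAD WR (proj₂ a)) (scan-foldl c ([] , []) [])))

  transfer-WR : ∀ {C C′ FL BAD CR} w → length w ≤ n → ⟪ transfer WR Verifier.W ⟫ n (store [] C C′ FL BAD (reverse w) CR) ≡ store w C C′ FL BAD [] CR
  transfer-WR {C} {C′} {FL} {BAD} {CR} w h = trans
    (drain (⟪ popS WR nil (pushS Verifier.W) ⟫ n) (λ xs a → store a C C′ FL BAD xs CR) (λ a b → b ∷ a) (λ _ _ _ → refl) (λ _ → refl) n (reverse w) [] (reverse≤ w h))
    (cong (λ w → store w C C′ FL BAD [] CR) (List.reverse-involutive w))

  transfer-CR : ∀ {W C′ FL BAD WR} c → length c ≤ n → ⟪ transfer CR Verifier.C ⟫ n (store W [] C′ FL BAD WR (reverse c)) ≡ store W c C′ FL BAD WR []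
  transfer-CR {W} {C′} {FL} {BAD} {WR} c h = trans
    (drain (⟪ popS CR nil (pushS Verifier.C) ⟫ n) (λ xs a → store W a C′ FL BAD WR xs) (λ a b → b ∷ a) (λ _ _ _ → refl) (λ _ → refl) n (reverse c) [] (reverse≤ c h))
    (cong (λ c → store W c C′ FL BAD WR []) (List.reverse-involutive c))

  stage₁ stage₂ stage₃ : Store 17 8 → Store 17 8
  stage₃ = ⟪ popS Verifier.BAD (pushS OUT true) (λ _ → pushS OUT false) ⟫ n
  stage₂ u = stage₃ (⟪ popS Verifier.BAD main (λ _ → Verifier.bad) ⟫ n u)
  stage₁ u = stage₂ (⟪ popS Verifier.BAD (format Verifier.C CR) (λ _ → Verifier.bad) ⟫ n u)

  start : ∀ w c → length w ≤ n → length c ≤ n →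
    ⟪ verifier ⟫ n (Vec.replicate 17 0 ∣ ([] ∷ [] ∷ [] ∷ [] ∷ [] ∷ [] ∷ reverse w ∷ reverse c ∷ [])) ≡ stage₁ (⟪ format Verifier.W WR ⟫ n (store w c [] [] [] [] []))
  start w c hw hc = cong (λ u → stage₁ (⟪ format Verifier.W WR ⟫ n u)) (trans (cong (⟪ transfer CR Verifier.C ⟫ n) (transfer-WR w hw)) (transfer-CR c hc))

  initialStore : List Bool → List Bool → Store 17 8
  initialStore w c = Vec.replicate 17 0 ∣ ([] ∷ [] ∷ [] ∷ [] ∷ [] ∷ [] ∷ reverse w ∷ reverse c ∷ [])

  record Verdict (w c : List Bool) : Set where
    field
      answer  : Bool
      output≡ : lookup (stks (⟪ verifier ⟫ n (initialStore w c))) OUT ≡ answer ∷ []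
      correct : answer ≡ true ⇔ Accepted w c

  restored-W : ∀ w c → length w ≤ n → scanAll ([] , []) w ≡ accepting → ⟪ format Verifier.W WR ⟫ n (store w c [] [] [] [] []) ≡ store w c [] [] [] [] []
  restored-W w c hw a = trans (format-W w hw) (trans (cong (λ a → ⟪ transfer WR Verifier.W ⟫ n (⟪ scanEnd ⟫ n (store [] c (proj₂ a) (proj₁ a) [] (reverse w) []))) a) (transfer-WR w hw))

  restored-C : ∀ w c → length c ≤ n → scanAll ([] , []) c ≡ accepting → ⟪ format Verifier.C CR ⟫ n (store w c [] [] [] [] []) ≡ store w c [] [] [] [] []
  restored-C w c hc a = trans (format-C c hc) (trans (cong (λ a → ⟪ transfer CR Verifier.C ⟫ n (⟪ scanEnd ⟫ n (store w [] (proj₂ a) (proj₁ a) [] [] (reverse c)))) a) (transfer-CR c hc))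

  out-of : Store 17 8 → List Bool
  out-of u = lookup (stks u) OUT

  bad-W : ∀ w c → length w ≤ n → length c ≤ n → scanAll ([] , []) w ≢ accepting → Verdict w c
  bad-W w c hw hc ¬a = record
    { answer  = false
    ; output≡ = cong out-of (trans (start w c hw hc) (cong stage₁ (trans (format-W w hw) (trans (cong (⟪ transfer WR Verifier.W ⟫ n) (proj₂ (proj₂ end))) (transfer-WR w hw)))))
    ; correct = mk⇔ (λ ()) (λ (b , js , _ , _ , _ , e , _) → contradiction (trans (cong (scanAll ([] , [])) e) (scan-encoding b js)) ¬a)
    }
    where
    end : ∃[ C′ ] ∃[ FL ] ⟪ scanEnd ⟫ n (store [] c (proj₂ (scanAll ([] , []) w)) (proj₁ (scanAll ([] , []) w)) [] (reverse w) []) ≡ store [] c C′ FL (true ∷ []) (reverse w) []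
    end = scanEnd-bad (scanAll ([] , []) w) ¬a

  bad-C : ∀ w c → length w ≤ n → length c ≤ n → scanAll ([] , []) w ≡ accepting → scanAll ([] , []) c ≢ accepting → Verdict w c
  bad-C w c hw hc a ¬a = record
    { answer  = false
    ; output≡ = cong out-of (trans (start w c hw hc) (trans (cong stage₁ (restored-W w c hw a))
                  (cong stage₂ (trans (format-C c hc) (trans (cong (⟪ transfer CR Verifier.C ⟫ n) (proj₂ (proj₂ end))) (transfer-CR c hc))))))
    ; correct = mk⇔ (λ ()) (λ (_ , _ , k , ts , _ , _ , e , _) → contradiction (trans (cong (scanAll ([] , [])) e) (scan-encoding k ts)) ¬a)
    }
    where
    end : ∃[ C′ ] ∃[ FL ] ⟪ scanEnd ⟫ n (store w [] (proj₂ (scanAll ([] , []) c)) (proj₁ (scanAll ([] , []) c)) [] [] (reverse c)) ≡ store w [] C′ FL (true ∷ []) [] (reverse c)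
    end = scanEnd-bad (scanAll ([] , []) c) ¬a

  isEmpty : List Bool → Bool
  isEmpty []      = true
  isEmpty (_ ∷ _) = false

  stage₃-out : ∀ σ → lookup (stks σ) OUT ≡ [] → out-of (stage₃ σ) ≡ isEmpty (lookup (stks σ) Verifier.BAD) ∷ []
  stage₃-out (r ∣ (s₀ ∷ s₁ ∷ s₂ ∷ s₃ ∷ []      ∷ s₅ ∷ s₆ ∷ s₇ ∷ [])) e = cong (true ∷_) e
  stage₃-out (r ∣ (s₀ ∷ s₁ ∷ s₂ ∷ s₃ ∷ (_ ∷ _) ∷ s₅ ∷ s₆ ∷ s₇ ∷ [])) e = cong (false ∷_) e

  well-formed : ∀ b js k ts → length (encodeNumbers b js) ≤ n → (hc : length (encodeNumbers k ts) ≤ n) → Verdict (encodeNumbers b js) (encodeNumbers k ts)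
  well-formed b js k ts hw hc = record
    { answer  = isEmpty (failures b js k ts hc)
    ; output≡ = trans (cong out-of (trans (start w c hw hc) (trans (cong stage₁ (restored-W w c hw (scan-encoding b js)))
                  (trans (cong stage₂ (restored-C w c hc (scan-encoding k ts))) (cong stage₃ (proj₁ (proj₂ ms)))))))
                  (trans (stage₃-out (proj₁ ms) (proj₂ (proj₂ (proj₂ ms)))) (cong (λ bs → isEmpty bs ∷ []) (proj₁ (proj₂ (proj₂ ms)))))
    ; correct = mk⇔ (λ v → b , js , k , ts , hc , refl , refl , empty _ v) (λ acc → filled _ (unique acc))
    }
    where
    w c : List Bool
    w = encodeNumbers b js
    c = encodeNumbers k ts
    ms : ∃[ σ ] ⟪ main ⟫ n (at 0 0 0 0 0 0 0 0 0 0 0 w c [] []) ≡ σ × lookup (stks σ) Verifier.BAD ≡ failures b js k ts hc × lookup (stks σ) OUT ≡ []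
    ms = main-sem b js k ts hw hc
    empty : ∀ bad → isEmpty bad ≡ true → bad ≡ []
    empty [] _ = refl
    filled : ∀ bad → bad ≡ [] → isEmpty bad ≡ true
    filled [] _ = refl
    unique : Accepted w c → failures b js k ts hc ≡ []
    unique (b′ , js′ , k′ , ts′ , hC′ , e₁ , e₂ , e₃) = same (encodeNumbers-injective b b′ js js′ e₁) (encodeNumbers-injective k k′ ts ts′ e₂) hC′ e₃
      where
      same : ∀ {b′ js′ k′ ts′} → b ≡ b′ × js ≡ js′ → k ≡ k′ × ts ≡ ts′ → ∀ hC′ → failures b′ js′ k′ ts′ hC′ ≡ [] → failures b js k ts hc ≡ []
      same (refl , refl) (refl , refl) hC′ e = subst (λ h → failures b js k ts h ≡ []) (≤-irrelevant hC′ hc) e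

  verdict : ∀ w c → length w ≤ n → length c ≤ n → Verdict w c
  verdict w c hw hc = decide (accepting? (scanAll ([] , []) w)) (accepting? (scanAll ([] , []) c))
    where
    parsed : ∀ {w c} → length w ≤ n → length c ≤ n → ∃[ b ] ∃[ js ] w ≡ encodeNumbers b js → ∃[ k ] ∃[ ts ] c ≡ encodeNumbers k ts → Verdict w c
    parsed hw hc (b , js , refl) (k , ts , refl) = well-formed b js k ts hw hc
    decide : Dec (scanAll ([] , []) w ≡ accepting) → Dec (scanAll ([] , []) c ≡ accepting) → Verdict w c
    decide (no ¬a) _       = bad-W w c hw hc ¬a
    decide (yes a) (no ¬a) = bad-C w c hw hc a ¬a
    decide (yes a) (yes a′) = parsed hw hc (accepted-encoding w a) (accepted-encoding c a′)

decodeSegs : ∀ {m} (ts : List Triple) → All (λ (i , x , _) → i ≤ m) ts → Σ[ σ ∈ Segs m ] map (λ (i , x , _) → i , x) ts ≡ map (λ (i , x) → segIndex i , x) σ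
decodeSegs []                     []       = [] , refl
decodeSegs ((zero , x , z) ∷ ts)  (h ∷ hs) with decodeSegs ts hs
... | σ , e = (nothing , x) ∷ σ , cong (_ ∷_) e
decodeSegs ((suc i , x , z) ∷ ts) (h ∷ hs) with decodeSegs ts hs
... | σ , e = (just (fromℕ< h) , x) ∷ σ , cong₂ (λ i σ → (suc i , x) ∷ σ) (sym (Fin.toℕ-fromℕ< h)) e

decodeJobs : ∀ js → Σ[ m ∈ ℕ ] Σ[ jobs ∈ Vec Job m ] map jobTriple (Vec.toList jobs) ≡ js
decodeJobs []                 = 0 , [] , refl
decodeJobs ((t , a , d) ∷ js) with decodeJobs js
... | m , jobs , e = suc m , job t a d ∷ jobs , cong (_ ∷_) e

plan-from-acceptance : ∀ n b {m} (jobs : Vec Job m) k ts hC → VerifierSemantics.failures n b (Acceptance.jobTriples n jobs) k ts hC ≡ [] →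
                       PreemptiveLazyBureaucratII (encodeNumbers b (Acceptance.jobTriples n jobs))
plan-from-acceptance n b {m} jobs k ts hC ok = I , encode-numbers I , plan→yes I k (proj₁ segs) (Acceptance.failures→plan n I k ts hC (proj₁ segs) (proj₂ segs) ok)
  where
  I : Instance
  I = record { jobs = jobs ; bound = b }
  idx : All (λ (i , x , _) → i ≤ length (Acceptance.jobTriples n jobs) × 1 ≤ x) ts
  idx = proj₁ (Equivalence.to (Acceptance.indexBad-[] n _ ts _) (proj₂ (Equivalence.to (penalty-[] _) ok)))
  segs : Σ[ σ ∈ Segs m ] map (λ (i , x , _) → i , x) ts ≡ map (λ (i , x) → segIndex i , x) σ
  segs = decodeSegs {m} ts (All.map (λ {t} h → ≤-trans (proj₁ h) (≤-reflexive (Acceptance.length-jobTriples n jobs))) idx)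

accepted-sound : ∀ n {w c} → Acceptance.Accepted n w c → PreemptiveLazyBureaucratII w
accepted-sound n (b , js , k , ts , hC , refl , _ , ok) =
  subst (λ js → VerifierSemantics.failures n b js k ts hC ≡ [] → PreemptiveLazyBureaucratII (encodeNumbers b js)) (proj₂ (proj₂ (decodeJobs js)))
        (plan-from-acceptance n b (proj₁ (proj₂ (decodeJobs js))) k ts hC) ok

module _ (w c : List Bool) where

  private
    size₂ : ℕ
    size₂ = length w + (length c + 0)

    w≤ : length w ≤ size₂
    w≤ = m≤m+n (length w) _

    c≤ : length c ≤ size₂
    c≤ = ≤-trans (m≤m+n (length c) 0) (m≤n+m _ (length w))

  -- The relation is defined as the answer of the program itself, so that its computability is
  -- immediate and soundness and completeness carry the content.
  accepts : Bool
  accepts = Acceptance.Verdict.answer (Acceptance.verdict size₂ w c w≤ c≤)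

  accepts-output : lookup (stks (⟪ Verifier.verifier ⟫ size₂ (Acceptance.initialStore size₂ w c))) Verifier.OUT ≡ accepts ∷ []
  accepts-output = Acceptance.Verdict.output≡ (Acceptance.verdict size₂ w c w≤ c≤)

  accepts-sound : accepts ≡ true → PreemptiveLazyBureaucratII w
  accepts-sound e = accepted-sound size₂ (Equivalence.to (Acceptance.Verdict.correct (Acceptance.verdict size₂ w c w≤ c≤)) e)

  accepts-complete : ∀ I K σ → encode I ≡ w → certificate K σ ≡ c → Plan I K σ → accepts ≡ true
  accepts-complete I K σ refl refl P = Equivalence.from (Acceptance.Verdict.correct (Acceptance.verdict size₂ w c w≤ c≤))
    (Instance.bound I , map jobTriple (Vec.toList (Instance.jobs I)) , K , map segTriple σ , c≤ , encode-numbers I , refl ,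
     Acceptance.plan→failures size₂ I K (map segTriple σ) c≤ σ (sym (List.map-∘ σ)) (indices σ) P)
    where
    indices : ∀ σ → All (λ (i , x , _) → i ≤ Instance.size I) (map segTriple σ)
    indices []                  = []
    indices ((nothing , x) ∷ σ) = z≤n ∷ indices σ
    indices ((just i , x) ∷ σ)  = Fin.toℕ<n i ∷ indices σ

in-NP : NP PreemptiveLazyBureaucratII
in-NP = accepts , proj₁ certificateBound-polynomial ,
  polyTime-cong (λ { (w ∷ c ∷ []) → cong reverse (accepts-output w c) }) (arith-polyTime Verifier.verifier inputs Verifier.OUT) ,
  λ w → mk⇔ (complete w) (λ (c , _ , e) → accepts-sound w c e)
  where
  inputs : Fin 2 → Fin 8
  inputs zero       = Verifier.WR
  inputs (suc zero) = Verifier.CR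
  complete : ∀ w → PreemptiveLazyBureaucratII w → ∃[ c ] length c ≤ eval (proj₁ certificateBound-polynomial) (length w) × accepts w c ≡ true
  complete w (I , refl , feasible) = finish (short-certificate I feasible)
    where
    finish : ∃[ K ] ∃[ σ ] Plan I K σ × length (certificate K σ) ≤ certificateBound (length (encode I)) →
             ∃[ c ] length c ≤ eval (proj₁ certificateBound-polynomial) (length (encode I)) × accepts (encode I) c ≡ true
    finish (K , σ , P , len) = certificate K σ , subst (length (certificate K σ) ≤_) (sym (proj₂ certificateBound-polynomial (length (encode I)))) len ,
      accepts-complete (encode I) (certificate K σ) I K σ refl refl P

-- Reduction from subset sum

data SubsetSum : List ℕ → ℕ → Set where
  []   : SubsetSum [] 0
  omit : ∀ {x xs s} → SubsetSum xs s → SubsetSum (x ∷ xs) s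
  pick : ∀ {x xs s} → SubsetSum xs s → SubsetSum (x ∷ xs) (x + s)

-- Jobs M x with slack M k - 1.  At the end of a busy period of length M k
-- each job is either completed or has received less than one unit, and all
-- these small amounts together do not make up M units.  The first job is
-- too long to be completed.
module Reduction (M k : ℕ) where

  mkJob : ℕ → Job
  mkJob x = job (M * x) 0 (pred (M * (k + x)))

  jobsOf : (xs : List ℕ) → Vec Job (length (map mkJob xs))
  jobsOf xs = Vec.fromList (map mkJob xs)

  instanceOf : List ℕ → Instance
  instanceOf xs = record { jobs = jobsOf (k + k ∷ xs) ; bound = M * k }

  size : List ℕ → ℕ
  size xs = length (map mkJob xs)

  raise : ∀ {n} → Segs n → Segs (suc n)
  raise = map (λ (i , x) → Maybe.map suc i , x)

  segsOf : ∀ {xs s} → SubsetSum xs s → Segs (size xs)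
  segsOf []                = []
  segsOf (omit sel)        = raise (segsOf sel)
  segsOf (pick {x} sel)    = (just zero , M * x) ∷ raise (segsOf sel)

  view-raise : ∀ {n} (j : Fin n) σ → viewFor (suc j) (raise σ) ≡ viewFor j σ
  view-raise j []                  = refl
  view-raise j ((nothing , x) ∷ σ) = cong (_ ∷_) (view-raise j σ)
  view-raise j ((just i , x) ∷ σ)  = cong₂ (λ κ v → (κ , x) ∷ v) (same i) (view-raise j σ)
    where
    same : ∀ i → kind (suc j) (just (suc i)) ≡ kind j (just i)
    same i with i Fin.≟ j
    ... | yes _ = refl
    ... | no _  = refl

  busy-raise : ∀ {n} (σ : Segs n) → busy (raise σ) ≡ busy σ
  busy-raise []                  = refl
  busy-raise ((nothing , x) ∷ σ) = busy-raise σ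
  busy-raise ((just i , x) ∷ σ)  = cong (x +_) (busy-raise σ)

  busy-segs : ∀ {xs s} (sel : SubsetSum xs s) → busy (segsOf sel) ≡ M * s
  busy-segs []                 = sym (*-zeroʳ M)
  busy-segs (omit sel)         = trans (busy-raise (segsOf sel)) (busy-segs sel)
  busy-segs (pick {x} {s = s} sel) = trans (cong (M * x +_) (trans (busy-raise (segsOf sel)) (busy-segs sel))) (sym (*-distribˡ-+ M x s))

  data AllBusy {n} : Segs n → Set where
    []  : AllBusy []
    _∷_ : ∀ {i x σ} → 0 < x → AllBusy σ → AllBusy ((just i , x) ∷ σ)

  raise-busy : ∀ {n} {σ : Segs n} → AllBusy σ → AllBusy (raise σ)
  raise-busy []       = []
  raise-busy (h ∷ hs) = h ∷ raise-busy hs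

  busy-segsOf : ∀ {xs s} → All (0 <_) (map (M *_) xs) → (sel : SubsetSum xs s) → AllBusy (segsOf sel)
  busy-segsOf ps       []         = []
  busy-segsOf (_ ∷ ps) (omit sel) = raise-busy (busy-segsOf ps sel)
  busy-segsOf (p ∷ ps) (pick sel) = p ∷ raise-busy (busy-segsOf ps sel)

  -- While other jobs keep the processor busy nothing is asked of this one; it only has to be dead
  -- when they end.
  idle-rest : ∀ {n T A D} {σ : Segs n} τ y → AllBusy σ → Dead T A D (τ + busy σ) y → Ok T A D τ y (viewFor zero (raise σ))
  idle-rest {T = T} {A} {D} τ y []                  h = subst (λ τ → Dead T A D τ y) (+-identityʳ τ) h
  idle-rest {T = T} {A} {D} τ y (_∷_ {x = x} {σ} _ hs) h = tt , idle-rest (τ + x) y hs (subst (λ τ → Dead T A D τ y) (sym (+-assoc τ x (busy σ))) h)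

  -- A start at M k misses the deadline by exactly the unit that `pred` takes off.
  late : ∀ {x} → 0 < M * x → pred (M * (k + x)) < M * k + M * x
  late {x} h rewrite *-distribˡ-+ M k x with M * k + M * x | ≤-trans h (m≤n+m (M * x) (M * k))
  ... | suc m | _ = ≤-refl

  -- The chosen jobs run back to back and end at M k. Each of them starts before M k, hence in time,
  -- and at M k every other job has just missed its latest start.
  sel-ok : ∀ {xs s} τ (sel : SubsetSum xs s) → All (0 <_) (map (M *_) xs) → τ + M * s ≡ M * k → ∀ j →
    Ok (Job.processing (lookup (jobsOf xs) j)) (Job.arrival (lookup (jobsOf xs) j)) (Job.deadline (lookup (jobsOf xs) j)) τ 0 (viewFor j (segsOf sel))
  sel-ok τ (omit {x} {s = s} sel) (p ∷ ps) e zero = idle-rest τ 0 (busy-segsOf ps sel)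
    (inj₂ (inj₁ (subst₂ _<_ (sym (+-identityʳ _)) (cong (_+ M * x) (sym (trans (cong (τ +_) (busy-segs sel)) e))) (late {x} p))))
  sel-ok τ (omit sel) (p ∷ ps) e (suc j) = subst (Ok _ _ _ τ 0) (sym (view-raise j (segsOf sel))) (sel-ok τ sel ps e j)
  sel-ok τ (pick {x} {s = s} sel) (p ∷ ps) e zero = (z≤n , ≤-refl , in-time) , idle-rest (τ + M * x) (M * x) (busy-segsOf ps sel) (inj₁ ≤-refl)
    where
    τ<Mk : τ < M * k
    τ<Mk = ≤-trans (≤-trans (≤-trans (≤-reflexive (+-comm 1 τ)) (+-monoʳ-≤ τ p)) (+-monoʳ-≤ τ (≤-trans (m≤m+n (M * x) (M * s)) (≤-reflexive (sym (*-distribˡ-+ M x s)))))) (≤-reflexive e)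
    in-time : τ + M * x ≤ pred (M * (k + x)) + 0
    in-time = ≤-trans (<⇒≤pred (≤-trans (+-monoˡ-< (M * x) τ<Mk) (≤-reflexive (sym (*-distribˡ-+ M k x))))) (≤-reflexive (sym (+-identityʳ _)))
  sel-ok τ (pick {x} {s = s} sel) (p ∷ ps) e (suc j) = tt , subst (Ok _ _ _ (τ + M * x) 0) (sym (view-raise j (segsOf sel)))
    (sel-ok (τ + M * x) sel ps (trans (+-assoc τ (M * x) (M * s)) (trans (cong (τ +_) (sym (*-distribˡ-+ M x s))) e)) j)

  subset→plan : ∀ xs → 0 < M * (k + k) → All (0 <_) (map (M *_) xs) → (sel : SubsetSum xs k) → Plan (instanceOf xs) 1 (segsOf (omit {k + k} sel))
  subset→plan xs h ps sel = record
    { unit-positive = s≤s z≤n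
    ; positive      = positive (busy-segsOf (h ∷ ps) (omit sel))
    ; ok            = λ j → unscale (lookup (jobsOf (k + k ∷ xs)) j) (sel-ok 0 (omit sel) (h ∷ ps) refl j)
    ; work          = ≤-reflexive (trans (workload-busy (segsOf (omit {k + k} sel))) (trans (busy-segs (omit {k + k} sel)) (sym (*-identityˡ (M * k)))))
    }
    where
    positive : ∀ {n} {σ : Segs n} → AllBusy σ → All (λ s → 0 < proj₂ s) σ
    positive []       = []
    positive (p ∷ ps) = p ∷ positive ps
    unscale : ∀ jb {v} → Ok (Job.processing jb) (Job.arrival jb) (Job.deadline jb) 0 0 v → Ok (1 * Job.processing jb) (1 * Job.arrival jb) (1 * Job.deadline jb) 0 0 v
    unscale jb h rewrite *-identityˡ (Job.processing jb) | *-identityˡ (Job.arrival jb) | *-identityˡ (Job.deadline jb) = h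

  busyPrefix : ∀ {n} → Segs n → Segs n
  busyPrefix []                  = []
  busyPrefix ((nothing , x) ∷ σ) = []
  busyPrefix ((just i , x) ∷ σ)  = (just i , x) ∷ busyPrefix σ

  busyPrefix≤ : ∀ {n} (σ : Segs n) → busy (busyPrefix σ) ≤ busy σ
  busyPrefix≤ []                  = z≤n
  busyPrefix≤ ((nothing , x) ∷ σ) = z≤n
  busyPrefix≤ ((just i , x) ∷ σ)  = +-monoʳ-≤ x (busyPrefix≤ σ)

  -- With arrival 0 no idling can be excused by a later arrival, so at the end of the first busy
  -- period every job is dead.
  prefix-end : ∀ {n T D} (j : Fin n) σ τ y → All (λ s → 0 < proj₂ s) σ → y ≤ T → Ok T 0 D τ y (viewFor j σ) →
    let Y = y + worked (busyPrefix σ) j in Y ≤ T × Dead T 0 D (τ + busy (busyPrefix σ)) Y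
  prefix-end j [] τ y ps y≤T h rewrite +-identityʳ y | +-identityʳ τ = y≤T , h
  prefix-end j ((nothing , x) ∷ σ) τ y (p ∷ ps) y≤T (h , _) rewrite +-identityʳ y | +-identityʳ τ = y≤T , dead h
    where
    dead : ∀ {T D} → τ + x ≤ 0 ⊎ Dead T 0 D τ y → Dead T 0 D τ y
    dead (inj₁ h) = contradiction (≤-trans (m≤n+m x τ) h) (<⇒≱ p)
    dead (inj₂ h) = h
  prefix-end {T = T} {D} j ((just i , x) ∷ σ) τ y (p ∷ ps) y≤T (h , hs) with prefix-end j σ (τ + x) (credit (kind j (just i)) y x) ps (credit≤ (kind j (just i)) h) hs
    where
    credit≤ : ∀ κ → Allowed κ T 0 D τ y x → credit κ y x ≤ T
    credit≤ mine  (_ , h , _) = h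
    credit≤ idle  _           = y≤T
    credit≤ other _           = y≤T
  ... | Y≤T , dead = subst (_≤ T) eq Y≤T , subst₂ (Dead T 0 D) (+-assoc τ x _) eq dead
    where
    split : ∀ κ → credit κ y x ≡ y + credit κ 0 x
    split mine  = refl
    split idle  = sym (+-identityʳ y)
    split other = sym (+-identityʳ y)
    eq : credit (kind j (just i)) y x + worked (busyPrefix σ) j ≡ y + (credit (kind j (just i)) 0 x + worked (busyPrefix σ) j)
    eq = trans (cong (_+ worked (busyPrefix σ) j) (split (kind j (just i)))) (+-assoc y _ _)

  -- The completed jobs are the subset. Each other job has received at most `K`, that is one
  -- original time unit, which gives the error term.
  select : ∀ K xs (Y : Fin (size xs) → ℕ) → (∀ j → Y j ≡ K * Job.processing (lookup (jobsOf xs) j) ⊎ Y j ≤ K) →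
    ∃[ s ] SubsetSum xs s × K * (M * s) ≤ sum (List.tabulate Y) × sum (List.tabulate Y) ≤ K * (M * s) + length xs * K
  select K [] Y h = 0 , [] , ≤-reflexive (trans (cong (K *_) (*-zeroʳ M)) (*-zeroʳ K)) , z≤n
  select K (x ∷ xs) Y h with select K xs (Y ∘ suc) (h ∘ suc) | h zero
  ... | s , sel , lo , hi | inj₁ e = x + s , pick sel ,
    ≤-trans (≤-reflexive (split K M x s)) (+-mono-≤ (≤-reflexive (sym e)) lo) ,
    ≤-trans (+-mono-≤ (≤-reflexive e) hi) (≤-trans (≤-reflexive (trans (sym (+-assoc (K * (M * x)) (K * (M * s)) (length xs * K))) (cong (_+ length xs * K) (sym (split K M x s))))) (+-monoʳ-≤ (K * (M * (x + s))) (m≤n+m (length xs * K) K)))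
    where
    split : ∀ K M x s → K * (M * (x + s)) ≡ K * (M * x) + K * (M * s)
    split = solve-∀
  ... | s , sel , lo , hi | inj₂ small = s , omit sel , ≤-trans lo (m≤n+m _ (Y zero)) ,
    ≤-trans (+-mono-≤ small hi) (≤-reflexive (lemma K (K * (M * s)) (length xs * K)))
    where
    lemma : ∀ K a b → K + (a + b) ≡ a + (K + b)
    lemma = solve-∀

  plan→subset : ∀ xs {K σ} → 0 < M * k → length xs + 3 ≤ M → Plan (instanceOf xs) K σ → SubsetSum xs k
  plan→subset xs {K} {σ} Mk>0 big P = extract (select K (k + k ∷ xs) Y settled)
    where
    open Plan P
    π : Segs (size (k + k ∷ xs))
    π = busyPrefix σ
    Y : Fin (size (k + k ∷ xs)) → ℕ
    Y = worked π
    E : ℕ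
    E = busy π
    E≤ : E ≤ K * (M * k)
    E≤ = ≤-trans (busyPrefix≤ σ) (≤-trans (≤-reflexive (sym (workload-busy σ))) work)
    ΣY : sum (List.tabulate Y) ≡ E
    ΣY = trans (cong sum (sym (List.map-tabulate {n = size (k + k ∷ xs)} id Y))) (workload-busy π)
    Td Dd : Fin (size (k + k ∷ xs)) → ℕ
    Td j = K * Job.processing (lookup (jobsOf (k + k ∷ xs)) j)
    Dd j = K * Job.deadline (lookup (jobsOf (k + k ∷ xs)) j)
    -- The unit taken off by `pred` becomes `K` after scaling and is moved to the left-hand side.
    deadline-eq : ∀ j → Dd j + K ≡ K * (M * k) + Td j × Job.arrival (lookup (jobsOf (k + k ∷ xs)) j) ≡ 0
    deadline-eq = go (k + k ∷ xs)
      where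
      go : ∀ xs j → K * Job.deadline (lookup (jobsOf xs) j) + K ≡ K * (M * k) + K * Job.processing (lookup (jobsOf xs) j) × Job.arrival (lookup (jobsOf xs) j) ≡ 0
      go (x ∷ xs) zero    = one x , refl
        where
        one : ∀ x → K * pred (M * (k + x)) + K ≡ K * (M * k) + K * (M * x)
        one x = trans (trans (+-comm _ K) (sym (*-suc K (pred (M * (k + x)))))) (trans (cong (K *_) (suc-pred (M * (k + x)) ⦃ >-nonZero (≤-trans Mk>0 (*-monoʳ-≤ M (m≤m+n k x))) ⦄)) (lemma K M k x))
          where
          lemma : ∀ K M k x → K * (M * (k + x)) ≡ K * (M * k) + K * (M * x)
          lemma = solve-∀
      go (x ∷ xs) (suc j) = go xs j
    state : ∀ j → Y j ≤ Td j × Dead (Td j) 0 (Dd j) E (Y j)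
    state j = prefix-end j σ 0 0 positive z≤n (subst (λ A → Ok (Td j) A (Dd j) 0 0 (viewFor j σ)) (trans (cong (K *_) (proj₂ (deadline-eq j))) (*-zeroʳ K)) (ok j))
    unfinished : ∀ j → Td j ≤ Y j ⊎ K * (M * k) + Y j < E + K
    unfinished j with proj₂ (state j)
    ... | inj₁ h = inj₁ h
    ... | inj₂ (inj₁ h) = inj₂ (+-cancelʳ-< (Td j) _ _ (≤-trans (≤-reflexive (cong suc (trans (move₁ (K * (M * k)) (Y j) (Td j)) (trans (cong (_+ Y j) (sym (proj₁ (deadline-eq j)))) (move₁ (Dd j) K (Y j)))))) (≤-trans (+-monoˡ-≤ K h) (≤-reflexive (move₁ E (Td j) K)))))
      where
      move₁ : ∀ a b c → a + b + c ≡ a + c + b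
      move₁ = solve-∀
    ... | inj₂ (inj₂ h) = contradiction (≤-trans (+-monoˡ-≤ K h) (≤-reflexive (+-comm (0 + Td j) K))) (<⇒≱ (s≤s (≤-trans (+-monoˡ-≤ (Td j) K≤) (≤-trans (≤-reflexive (sym (proj₁ (deadline-eq j)))) (+-monoˡ-≤ K (m≤m+n (Dd j) (Y j)))))))
      where
      K≤ : K ≤ K * (M * k)
      K≤ = ≤-trans (≤-reflexive (sym (*-identityʳ K))) (*-monoʳ-≤ K Mk>0)
    settled : ∀ j → Y j ≡ Td j ⊎ Y j ≤ K
    settled j with unfinished j
    ... | inj₁ h = inj₁ (≤-antisym (proj₁ (state j)) h)
    ... | inj₂ h = inj₂ (+-cancelˡ-≤ (K * (M * k)) (Y j) K (≤-trans (<⇒≤ h) (+-monoˡ-≤ K E≤)))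
    -- The first job alone is longer than the bound on the work and cannot be completed; so it must
    -- be late, which forces the busy period to last until less than one unit before M k.
    E-large : K * (M * k) < E + K
    E-large with unfinished zero
    ... | inj₂ h = ≤-trans (s≤s (m≤m+n _ (Y zero))) h
    ... | inj₁ h = contradiction (≤-trans h (≤-trans Y≤E E≤)) (<⇒≱ (≤-trans (m<m+n (K * (M * k)) (*-mono-≤ unit-positive Mk>0)) (≤-reflexive (lemma K M k))))
      where
      lemma : ∀ K M k → K * (M * k) + K * (M * k) ≡ K * (M * (k + k))
      lemma = solve-∀
      Y≤E : Y zero ≤ E
      Y≤E = ≤-trans (m≤m+n (Y zero) _) (≤-reflexive ΣY)
    extract : ∃[ s ] SubsetSum (k + k ∷ xs) s × K * (M * s) ≤ sum (List.tabulate Y) × sum (List.tabulate Y) ≤ K * (M * s) + suc (length xs) * K → SubsetSum xs k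
    extract (s , sel , lo , hi) = drop-first sel (≤-antisym s≤k k≤s)
      where
      instance
        K≢0 : NonZero K
        K≢0 = >-nonZero unit-positive
        M≢0 : NonZero M
        M≢0 = >-nonZero (≤-trans (≤-trans (s≤s z≤n) (m≤n+m 3 (length xs))) big)
      s≤k : s ≤ k
      s≤k = *-cancelˡ-≤ M (*-cancelˡ-≤ K (≤-trans lo (≤-trans (≤-reflexive ΣY) E≤)))
      k≤s : k ≤ s
      -- With l the number of items: K M k < E + K ≤ K (M s + l + 2) ≤ K M (s + 1), since l + 3 ≤ M.
      k≤s = ≤-pred (*-cancelˡ-< M _ _ (*-cancelˡ-< K _ _ (≤-trans E-large (≤-trans (+-monoˡ-≤ K (≤-trans (≤-reflexive (sym ΣY)) hi))
              (≤-trans (≤-reflexive (lemma K (M * s) (length xs))) (≤-trans (*-monoʳ-≤ K (+-monoʳ-≤ (M * s) (≤-trans (+-monoʳ-≤ (length xs) (s≤s (s≤s z≤n))) big))) (≤-reflexive (cong (K *_) (trans (+-comm (M * s) M) (sym (*-suc M s)))))))))))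
        where
        lemma : ∀ K a l → K * a + suc l * K + K ≡ K * (a + (l + 2))
        lemma = solve-∀
      drop-first : ∀ {s} → SubsetSum (k + k ∷ xs) s → s ≡ k → SubsetSum xs k
      drop-first (omit sel) refl = sel
      drop-first (pick {s = s} sel) e = contradiction (≤-reflexive e) (<⇒≱ (≤-trans (m<m+n k k>0) (m≤m+n (k + k) s)))
        where
        k>0 : 0 < k
        k>0 = n≢0⇒n>0 (λ { refl → contradiction Mk>0 (<⇒≱ (s≤s (≤-reflexive (*-zeroʳ M)))) })

-- Reduction from tilings to subset sum

record Tile : Set where
  constructor tile
  field
    west east south north : ℕ
open Tile

-- Rows of tiles read from left to right, row after row: h is the colour
-- of the edge to the left, the list holds the colours of the lower edges
-- of the next tiles, as many as there are in a row.
module Tiling {Cl : Set} (tiles : Cl → List Tile) where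

  data Run : List Cl → ℕ → List ℕ → Set where
    done  : ∀ {vs} → All (_≡ 0) vs → Run [] 0 vs
    place : ∀ {c cs h v vs t} → t ∈ tiles c → west t ≡ h → south t ≡ v → Run cs (east t) (vs ++ north t ∷ []) → Run (c ∷ cs) h (v ∷ vs)

subset-++ : ∀ xs {ys s} → SubsetSum (xs ++ ys) s → ∃[ s₁ ] ∃[ s₂ ] s ≡ s₁ + s₂ × SubsetSum xs s₁ × SubsetSum ys s₂
subset-++ []       sel = 0 , _ , refl , [] , sel
subset-++ (x ∷ xs) (omit sel) with subset-++ xs sel
... | s₁ , s₂ , e , sel₁ , sel₂ = s₁ , s₂ , e , omit sel₁ , sel₂
subset-++ (x ∷ xs) (pick sel) with subset-++ xs sel
... | s₁ , s₂ , e , sel₁ , sel₂ = x + s₁ , s₂ , trans (cong (x +_) e) (sym (+-assoc x s₁ s₂)) , pick sel₁ , sel₂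

++-subset : ∀ {xs ys s₁ s₂} → SubsetSum xs s₁ → SubsetSum ys s₂ → SubsetSum (xs ++ ys) (s₁ + s₂)
++-subset []         sel₂ = sel₂
++-subset (omit sel) sel₂ = omit (++-subset sel sel₂)
++-subset {s₂ = s₂} (pick {x} {s = s} sel) sel₂ = subst (SubsetSum _) (sym (+-assoc x s s₂)) (pick (++-subset sel sel₂))

subset-scale : ∀ b xs {s} → SubsetSum (map (b *_) xs) s → ∃[ s′ ] s ≡ b * s′ × SubsetSum xs s′
subset-scale b []       []         = 0 , sym (*-zeroʳ b) , []
subset-scale b (x ∷ xs) (omit sel) with subset-scale b xs sel
... | s′ , e , sel′ = s′ , e , omit sel′
subset-scale b (x ∷ xs) (pick sel) with subset-scale b xs sel
... | s′ , e , sel′ = x + s′ , trans (cong (b * x +_) e) (sym (*-distribˡ-+ b x s′)) , pick sel′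

scale-subset : ∀ b {xs s} → SubsetSum xs s → SubsetSum (map (b *_) xs) (b * s)
scale-subset b [] = subst (SubsetSum []) (sym (*-zeroʳ b)) []
scale-subset b (omit sel) = omit (scale-subset b sel)
scale-subset b (pick {x} {s = s} sel) = subst (SubsetSum _) (sym (*-distribˡ-+ b x s)) (pick (scale-subset b sel))

subset-none : ∀ xs → SubsetSum xs 0
subset-none []       = []
subset-none (x ∷ xs) = omit (subset-none xs)

subset-one : ∀ {x xs} → x ∈ xs → SubsetSum xs x
subset-one {x} {_ ∷ xs} (here refl) = subst (SubsetSum _) (+-identityʳ x) (pick (subset-none xs))
subset-one (there x∈) = omit (subset-one x∈)

digit-unique : ∀ β {a a′ r r′} → a < β → a′ < β → a + β * r ≡ a′ + β * r′ → a ≡ a′ × r ≡ r′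
digit-unique (suc β) {a} {a′} {r} {r′} a< a′< e = a≡ , *-cancelˡ-≡ r r′ (suc β) (+-cancelˡ-≡ a _ _ (trans e (cong (_+ suc β * r′) (sym a≡))))
  where
  low : ∀ {a} r → a < suc β → (a + suc β * r) % suc β ≡ a
  low {a} r h = trans (cong (λ z → (a + z) % suc β) (*-comm (suc β) r)) (trans ([m+kn]%n≡m%n a r (suc β)) (m<n⇒m%n≡m h))
  a≡ : a ≡ a′
  a≡ = trans (sym (low r a<)) (trans (cong (_% suc β) e) (low r′ a′<))

-- Each position has three digits in base β: the number of tiles placed
-- there, and one each for its lower and its left edge, to which the two
-- tiles at that edge contribute C in total.
module Digits {Cl : Set} (tiles : Cl → List Tile) (C L W′ β : ℕ)
  (colours : ∀ c → All (λ t → west t ≤ C × east t ≤ C × south t ≤ C × north t ≤ C) (tiles c))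
  (few : ∀ c → length (tiles c) ≤ L) (large : C + L * C + L + 1 < β) where

  open Tiling tiles

  b : ℕ
  b = β * β * β

  -- What a tile contributes to later positions. One position on, the right edge fills the digit for
  -- left edges; the upper edge belongs to the tile above, a whole row of W′ + 1 positions on, where
  -- it fills the digit for lower edges.
  rest : Tile → ℕ
  rest t = east t * (β * β) + b ^ W′ * (north t * β)

  loc : Tile → ℕ
  loc t = 1 + β * ((C ∸ south t) + β * ((C ∸ west t) + β * rest t))

  items : List Cl → List ℕ
  items []       = []
  items (c ∷ cs) = map loc (tiles c) ++ map (b *_) (items cs)

  pattern′ : ℕ
  pattern′ = 1 + β * (C + β * C)

  target : List Cl → ℕ
  target []       = 0
  target (c ∷ cs) = pattern′ + b * target cs

  -- The part of the target that tiles already placed have paid in advance for the lower edges of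
  -- the next row of positions.
  pending : List ℕ → ℕ
  pending []       = 0
  pending (v ∷ vs) = v * β + b * pending vs

  pending-snoc : ∀ vs n → pending (vs ++ n ∷ []) ≡ pending vs + b ^ length vs * (n * β)
  pending-snoc []       n = lemma b (n * β)
    where
    lemma : ∀ b x → x + b * 0 ≡ x + 0
    lemma = solve-∀
  pending-snoc (v ∷ vs) n = trans (cong (λ z → v * β + b * z) (pending-snoc vs n)) (lemma (v * β) b (pending vs) (b ^ length vs) (n * β))
    where
    lemma : ∀ v b p q x → v + b * (p + q * x) ≡ v + b * p + b * q * x
    lemma = solve-∀

  -- Describes a subset of the tiles for one position before it is known to have one element: `q`
  -- counts the tiles, and the digit sums are kept apart. The bounds keep them below the base.
  record Chosen (ts : List Tile) (s : ℕ) : Set where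
    field
      q S D R : ℕ
      sum≡    : s ≡ q + β * (S + β * (D + β * R))
      q≤      : q ≤ length ts
      S≤      : S ≤ length ts * C
      D≤      : D ≤ length ts * C
      none    : q ≡ 0 → S ≡ 0 × D ≡ 0 × R ≡ 0
      single₁ : q ≡ 1 → Σ[ t ∈ Tile ] t ∈ ts × S ≡ C ∸ south t × D ≡ C ∸ west t × R ≡ rest t

  chosen : ∀ ts {s} → SubsetSum (map loc ts) s → Chosen ts s
  chosen [] [] = record { q = 0 ; S = 0 ; D = 0 ; R = 0 ; sum≡ = sym (lemma β) ; q≤ = z≤n ; S≤ = z≤n ; D≤ = z≤n ; none = λ _ → refl , refl , refl ; single₁ = λ () }
    where
    lemma : ∀ β → β * (β * (β * 0)) ≡ 0
    lemma = solve-∀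
  chosen (t ∷ ts) (omit sel) with chosen ts sel
  ... | ch = record
    { Chosen ch
    ; q≤ = m≤n⇒m≤1+n (Chosen.q≤ ch) ; S≤ = ≤-trans (Chosen.S≤ ch) (m≤n+m _ C) ; D≤ = ≤-trans (Chosen.D≤ ch) (m≤n+m _ C)
    ; single₁ = λ e → case Chosen.single₁ ch e of λ (t , t∈ , r) → t , there t∈ , r
    }
  chosen (t ∷ ts) (pick {s = s} sel) with chosen ts sel
  ... | ch = record
    { q = suc q ; S = C ∸ south t + S ; D = C ∸ west t + D ; R = rest t + R
    ; sum≡ = trans (cong (loc t +_) sum≡) (lemma β (C ∸ south t) (C ∸ west t) (rest t) q S D R)
    ; q≤ = s≤s q≤ ; S≤ = +-mono-≤ (m∸n≤m C (south t)) S≤ ; D≤ = +-mono-≤ (m∸n≤m C (west t)) D≤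
    ; none = λ ()
    ; single₁ = λ e → case none (suc-injective e) of λ (e₁ , e₂ , e₃) → t , here refl , trans (cong (C ∸ south t +_) e₁) (+-identityʳ _) , trans (cong (C ∸ west t +_) e₂) (+-identityʳ _) , trans (cong (rest t +_) e₃) (+-identityʳ _)
    }
    where
    open Chosen ch
    lemma : ∀ β x y z q S D R → 1 + β * (x + β * (y + β * z)) + (q + β * (S + β * (D + β * R))) ≡ suc q + β * (x + S + β * (y + D + β * (z + R)))
    lemma = solve-∀

  All-snoc : ∀ {P : ℕ → Set} {vs n} → All P vs → P n → All P (vs ++ n ∷ [])
  All-snoc []       p = p ∷ []
  All-snoc (q ∷ qs) p = q ∷ All-snoc qs p

  run→sum : ∀ {cs h vs} → length vs ≡ suc W′ → h ≤ C → All (_≤ C) vs → Run cs h vs → ∃[ s ] SubsetSum (items cs) s × h * (β * β) + pending vs + s ≡ target cs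
  run→sum {vs = vs} len h≤ vs≤ (done z) = 0 , [] , trans (+-identityʳ _) (zeros vs z)
    where
    zeros : ∀ vs → All (_≡ 0) vs → pending vs ≡ 0
    zeros []       []         = refl
    zeros (_ ∷ vs) (refl ∷ z) rewrite zeros vs z = *-zeroʳ b
  run→sum {c ∷ cs} {h} {v ∷ vs} len h≤ (v≤ ∷ vs≤) (place {t = t} t∈ refl refl run) with All.lookup (colours c) t∈
  ... | w≤ , e≤ , s≤ , n≤ with run→sum {cs} (trans (List.length-++ vs) (trans (+-comm _ 1) len)) e≤ (All-snoc vs≤ n≤) run
  ... | s , sel , eq = loc t + b * s , ++-subset (subset-one (∈-map⁺ loc t∈)) (scale-subset b sel) , (begin
    west t * (β * β) + (south t * β + b * pending vs) + (loc t + b * s)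
      ≡⟨ lemma β (west t) (south t) (C ∸ west t) (C ∸ south t) (rest t) (pending vs) s ⟩
    1 + β * ((south t + (C ∸ south t)) + β * ((west t + (C ∸ west t)) + β * (rest t + pending vs + s)))
      ≡⟨ cong₂ (λ x y → 1 + β * (x + β * (y + β * (rest t + pending vs + s)))) (m+[n∸m]≡n s≤) (m+[n∸m]≡n w≤) ⟩
    1 + β * (C + β * (C + β * (rest t + pending vs + s)))
      ≡⟨ cong (λ z → 1 + β * (C + β * (C + β * z))) (trans (cong (λ z → z + pending vs + s) refl) (trans (cong (_+ s) (order t)) eq)) ⟩
    1 + β * (C + β * (C + β * target cs)) ≡⟨ lemma₂ β C (target cs) ⟩
    pattern′ + b * target cs ∎)
    where
    open ≡-Reasoning
    order : ∀ t → rest t + pending vs ≡ east t * (β * β) + pending (vs ++ north t ∷ [])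
    order t = trans (trans (+-assoc (east t * (β * β)) _ (pending vs)) (cong (east t * (β * β) +_) (+-comm _ (pending vs))))
      (cong (east t * (β * β) +_) (sym (trans (pending-snoc vs (north t)) (cong (λ l → pending vs + b ^ l * (north t * β)) (suc-injective len)))))
    lemma : ∀ β w s cw cs r p z → w * (β * β) + (s * β + β * β * β * p) + (1 + β * (cs + β * (cw + β * r)) + β * β * β * z)
            ≡ 1 + β * ((s + cs) + β * ((w + cw) + β * (r + p + z)))
    lemma = solve-∀
    lemma₂ : ∀ β C t → 1 + β * (C + β * (C + β * t)) ≡ 1 + β * (C + β * C) + β * β * β * t
    lemma₂ = solve-∀

  -- The three lowest digits of the equation are split off in turn. The first forces exactly one
  -- tile, the other two its lower and left colours, and what remains is the same equation for the
  -- remaining positions.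
  sum→run : ∀ cs {h vs s} → length vs ≡ suc W′ → h ≤ C → All (_≤ C) vs → SubsetSum (items cs) s → h * (β * β) + pending vs + s ≡ target cs → Run cs h vs
  sum→run [] {h} {vs} len h≤ vs≤ [] eq = subst (λ h → Run [] h vs) (sym h≡0) (done (zeros vs (m+n≡0⇒n≡0 (h * (β * β)) all-zero)))
    where
    instance
      β≢0 : NonZero β
      β≢0 = >-nonZero (≤-<-trans z≤n large)
      ββ≢0 : NonZero (β * β)
      ββ≢0 = m*n≢0 β β
      b≢0 : NonZero b
      b≢0 = m*n≢0 (β * β) β
    all-zero : h * (β * β) + pending vs ≡ 0
    all-zero = trans (sym (+-identityʳ _)) eq
    zero-factor : ∀ x c .{{_ : NonZero c}} → x * c ≡ 0 → x ≡ 0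
    zero-factor x c e = *-cancelʳ-≡ x 0 c e
    h≡0 : h ≡ 0
    h≡0 = zero-factor h (β * β) (m+n≡0⇒m≡0 (h * (β * β)) all-zero)
    zeros : ∀ vs → pending vs ≡ 0 → All (_≡ 0) vs
    zeros []       e = []
    zeros (v ∷ vs) e = zero-factor v β (m+n≡0⇒m≡0 (v * β) e) ∷ zeros vs (zero-factor (pending vs) b (trans (*-comm (pending vs) b) (m+n≡0⇒n≡0 (v * β) e)))
  sum→run (c ∷ cs) {h} {v ∷ vs} len h≤ (v≤ ∷ vs≤) sel eq with subset-++ (map loc (tiles c)) sel
  ... | s₁ , s₂ , refl , sel₁ , sel₂ with subset-scale b (items cs) sel₂ | chosen (tiles c) sel₁
  ... | s₃ , refl , sel₃ | ch = finish (single₁ q≡1)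
    where
    open Chosen ch
    arranged : q + β * ((v + S) + β * ((h + D) + β * (R + pending vs + s₃))) ≡ 1 + β * (C + β * (C + β * target cs))
    arranged = trans (sym (trans (cong (λ z → h * (β * β) + (v * β + b * pending vs) + (z + b * s₃)) sum≡) (lemma β h v q S D R (pending vs) s₃))) (trans eq (lemma₂ β C (target cs)))
      where
      lemma : ∀ β h v q S D R p z → h * (β * β) + (v * β + β * β * β * p) + (q + β * (S + β * (D + β * R)) + β * β * β * z)
              ≡ q + β * ((v + S) + β * ((h + D) + β * (R + p + z)))
      lemma = solve-∀
      lemma₂ : ∀ β C t → 1 + β * (C + β * C) + β * β * β * t ≡ 1 + β * (C + β * (C + β * t))
      lemma₂ = solve-∀
    small : ∀ {x} → x ≤ C + L * C → x < β
    small h = ≤-<-trans (≤-trans h (≤-trans (m≤m+n (C + L * C) L) (m≤m+n _ 1))) large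
    sums : ∀ {x y} → x ≤ C → y ≤ length (tiles c) * C → x + y < β
    sums hx hy = small (+-mono-≤ hx (≤-trans hy (*-monoˡ-≤ C (few c))))
    C<β : C < β
    C<β = small (m≤m+n C (L * C))
    1<β : 1 < β
    1<β = ≤-<-trans (m≤n+m 1 _) large
    q<β : q < β
    q<β = ≤-<-trans (≤-trans (≤-trans q≤ (few c)) (≤-trans (m≤n+m L (C + L * C)) (m≤m+n _ 1))) large
    d₁ : q ≡ 1 × (v + S) + β * ((h + D) + β * (R + pending vs + s₃)) ≡ C + β * (C + β * target cs)
    d₁ = digit-unique β q<β 1<β arranged
    d₂ : v + S ≡ C × (h + D) + β * (R + pending vs + s₃) ≡ C + β * target cs
    d₂ = digit-unique β (sums v≤ S≤) C<β (proj₂ d₁)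
    d₃ : h + D ≡ C × R + pending vs + s₃ ≡ target cs
    d₃ = digit-unique β (sums h≤ D≤) C<β (proj₂ d₂)
    q≡1 : q ≡ 1
    q≡1 = proj₁ d₁
    complement : ∀ {x y} → y ≤ C → x + (C ∸ y) ≡ C → y ≡ x
    complement {x} {y} y≤ e = sym (+-cancelʳ-≡ (C ∸ y) x y (trans e (sym (m+[n∸m]≡n y≤))))
    finish : Σ[ t ∈ Tile ] t ∈ tiles c × S ≡ C ∸ south t × D ≡ C ∸ west t × R ≡ rest t → Run (c ∷ cs) h (v ∷ vs)
    finish (t , t∈ , e₁ , e₂ , e₃) with All.lookup (colours c) t∈
    ... | w≤ , e≤ , s≤ , n≤ = place t∈ (complement w≤ (trans (cong (h +_) (sym e₂)) (proj₁ d₃))) (complement s≤ (trans (cong (v +_) (sym e₁)) (proj₁ d₂)))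
      (sum→run cs (trans (List.length-++ vs) (trans (+-comm _ 1) len)) e≤ (All-snoc vs≤ n≤) sel₃ (trans (cong (_+ s₃) (sym order)) (proj₂ d₃)))
      where
      order : R + pending vs ≡ east t * (β * β) + pending (vs ++ north t ∷ [])
      order = trans (cong (_+ pending vs) e₃) (trans (trans (+-assoc (east t * (β * β)) _ (pending vs)) (cong (east t * (β * β) +_) (+-comm _ (pending vs))))
        (cong (east t * (β * β) +_) (sym (trans (pending-snoc vs (north t)) (cong (λ l → pending vs + b ^ l * (north t * β)) (suc-injective len))))))

-- Tilings that simulate a Turing machine

Symbol-finite : ∀ g → Finite (Symbol g)
Symbol-finite g = via (mk↔ₛ′ to from to-from from-to) (⊤-finite ⊎-finite (Bool-finite ⊎-finite Fin-finite g))
  where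
  to : Symbol g → ⊤ ⊎ (Bool ⊎ Fin g)
  to blank   = inj₁ tt
  to (bit b) = inj₂ (inj₁ b)
  to (aux i) = inj₂ (inj₂ i)
  from : ⊤ ⊎ (Bool ⊎ Fin g) → Symbol g
  from (inj₁ tt)       = blank
  from (inj₂ (inj₁ b)) = bit b
  from (inj₂ (inj₂ i)) = aux i
  to-from : ∀ x → to (from x) ≡ x
  to-from (inj₁ tt)       = refl
  to-from (inj₂ (inj₁ b)) = refl
  to-from (inj₂ (inj₂ i)) = refl
  from-to : ∀ x → from (to x) ≡ x
  from-to blank   = refl
  from-to (bit b) = refl
  from-to (aux i) = refl

Move-finite : Finite Move
Move-finite = via (mk↔ₛ′ to from to-from from-to) (⊤-finite ⊎-finite Bool-finite)
  where
  to : Move → ⊤ ⊎ Bool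
  to stay  = inj₁ tt
  to left  = inj₂ false
  to right = inj₂ true
  from : ⊤ ⊎ Bool → Move
  from (inj₁ tt)    = stay
  from (inj₂ false) = left
  from (inj₂ true)  = right
  to-from : ∀ x → to (from x) ≡ x
  to-from (inj₁ tt)    = refl
  to-from (inj₂ false) = refl
  to-from (inj₂ true)  = refl
  from-to : ∀ x → from (to x) ≡ x
  from-to left  = refl
  from-to stay  = refl
  from-to right = refl

Vec-finite : ∀ {A} → Finite A → ∀ n → Finite (Vec A n)
Vec-finite F zero    = via (mk↔ₛ′ (λ _ → tt) (λ _ → []) (λ _ → refl) (λ { [] → refl })) ⊤-finite
Vec-finite F (suc n) = via (mk↔ₛ′ (λ { (x ∷ xs) → x , xs }) (λ (x , xs) → x ∷ xs) (λ _ → refl) (λ { (x ∷ xs) → refl })) (F ×-finite Vec-finite F n)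

abstract
  elements : ∀ {A} → Finite A → List A
  elements F = map (element F) (List.allFin (card F))

  ∈-elements : ∀ {A} (F : Finite A) x → x ∈ elements F
  ∈-elements F x = subst (_∈ elements F) (element-index F x) (∈-map⁺ (element F) (∈-allFin (index F x)))

  -- Starts at 1, because the colour 0 is reserved for the border.
  code : ∀ {A} → Finite A → A → ℕ
  code F x = suc (toℕ (index F x))

  code-injective : ∀ {A} (F : Finite A) {x y} → code F x ≡ code F y → x ≡ y
  code-injective F {x} {y} e = trans (sym (element-index F x)) (trans (cong (element F) (Fin.toℕ-injective (suc-injective e))) (element-index F y))

  code≤ : ∀ {A} (F : Finite A) x → code F x ≤ card F
  code≤ F x = Fin.toℕ<n (index F x)

nth : ∀ {g} → List (Symbol g) → ℕ → Symbol g
nth []       i       = blank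
nth (x ∷ xs) zero    = x
nth (x ∷ xs) (suc i) = nth xs i

nth-beyond : ∀ {g} (xs : List (Symbol g)) {i} → length xs ≤ i → nth xs i ≡ blank
nth-beyond []       h       = refl
nth-beyond (x ∷ xs) (s≤s h) = nth-beyond xs h

-- Positions are relative to the head: the head stays at 0 and the contents shift. All tapes then
-- have their heads in the same column, so a single tile per row decides the transition.
cell : ∀ {g} → Tape g → ℤ → Symbol g
cell t (ℤ.+ zero)  = Tape.scanned t
cell t (ℤ.+ suc i) = nth (Tape.after t) i
cell t ℤ.-[1+ i ]  = nth (Tape.before t) i

up down : ℤ → ℤ
up (ℤ.+ n)         = ℤ.+ suc n
up ℤ.-[1+ zero ]   = ℤ.+ zero
up ℤ.-[1+ suc n ]  = ℤ.-[1+ n ]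
down (ℤ.+ zero)    = ℤ.-[1+ zero ]
down (ℤ.+ suc n)   = ℤ.+ n
down ℤ.-[1+ n ]    = ℤ.-[1+ suc n ]

down-up : ∀ i → down (up i) ≡ i
down-up (ℤ.+ n)        = refl
down-up ℤ.-[1+ zero ]  = refl
down-up ℤ.-[1+ suc n ] = refl

choose : ∀ {A : Set} → Move → A → A → A → A
choose left  l x r = l
choose stay  l x r = x
choose right l x r = r

chooseV : ∀ {A : Set} {k} → Vec Move k → Vec A k → Vec A k → Vec A k → Vec A k
chooseV []       []       []       []       = []
chooseV (m ∷ ms) (l ∷ ls) (x ∷ xs) (r ∷ rs) = choose m l x r ∷ chooseV ms ls xs rs

write : ∀ {g} → Symbol g → Tape g → Tape g
write s (tape ls _ rs) = tape ls s rs

cell-move : ∀ {g} m (t : Tape g) i → cell (move m t) i ≡ choose m (cell t (down i)) (cell t i) (cell t (up i))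
cell-move stay  t                        i                = refl
cell-move left  (tape [] s rs)           (ℤ.+ zero)       = refl
cell-move left  (tape [] s rs)           (ℤ.+ suc zero)   = refl
cell-move left  (tape [] s rs)           (ℤ.+ suc (suc n)) = refl
cell-move left  (tape [] s rs)           ℤ.-[1+ n ]       = refl
cell-move left  (tape (l ∷ ls) s rs)     (ℤ.+ zero)       = refl
cell-move left  (tape (l ∷ ls) s rs)     (ℤ.+ suc zero)   = refl
cell-move left  (tape (l ∷ ls) s rs)     (ℤ.+ suc (suc n)) = refl
cell-move left  (tape (l ∷ ls) s rs)     ℤ.-[1+ n ]       = refl
cell-move right (tape ls s [])           (ℤ.+ zero)       = refl
cell-move right (tape ls s [])           (ℤ.+ suc n)      = refl
cell-move right (tape ls s [])           ℤ.-[1+ zero ]    = refl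
cell-move right (tape ls s [])           ℤ.-[1+ suc n ]   = refl
cell-move right (tape ls s (r ∷ rs))     (ℤ.+ zero)       = refl
cell-move right (tape ls s (r ∷ rs))     (ℤ.+ suc n)      = refl
cell-move right (tape ls s (r ∷ rs))     ℤ.-[1+ zero ]    = refl
cell-move right (tape ls s (r ∷ rs))     ℤ.-[1+ suc n ]   = refl

content : ∀ {g k} → Vec (Tape g) k → ℤ → Vec (Symbol g) k
content ts i = Vec.map (λ t → cell t i) ts

writes : ∀ {g k} → Vec (Symbol g × Move) k → Vec (Symbol g) k
writes = Vec.map proj₁

moves : ∀ {g k} → Vec (Symbol g × Move) k → Vec Move k
moves = Vec.map proj₂

writeAll : ∀ {g k} → Vec (Symbol g × Move) k → Vec (Tape g) k → Vec (Tape g) k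
writeAll = Vec.zipWith (λ a t → write (proj₁ a) t)

content-act : ∀ {g k} (as : Vec (Symbol g × Move) k) ts i →
  content (act as ts) i ≡ chooseV (moves as) (content (writeAll as ts) (down i)) (content (writeAll as ts) i) (content (writeAll as ts) (up i))
content-act []             []                  i = refl
content-act ((s , m) ∷ as) (tape ls x rs ∷ ts) i = cong₂ _∷_ (cell-move m (tape ls s rs) i) (content-act as ts i)

content-written : ∀ {g k} (as : Vec (Symbol g × Move) k) ts → content (writeAll as ts) (ℤ.+ 0) ≡ writes as
content-written []       []       = refl
content-written (a ∷ as) (t ∷ ts) = cong (_ ∷_) (content-written as ts)

content-right : ∀ {g k} (as : Vec (Symbol g × Move) k) ts n → content (writeAll as ts) (ℤ.+ suc n) ≡ content ts (ℤ.+ suc n)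
content-right []       []       n = refl
content-right (a ∷ as) (t ∷ ts) n = cong (_ ∷_) (content-right as ts n)

content-left : ∀ {g k} (as : Vec (Symbol g × Move) k) ts n → content (writeAll as ts) ℤ.-[1+ n ] ≡ content ts ℤ.-[1+ n ]
content-left []       []       n = refl
content-left (a ∷ as) (t ∷ ts) n = cong (_ ∷_) (content-left as ts n)

Within : ∀ {g} → ℕ → Tape g → Set
Within ρ t = length (Tape.before t) ≤ ρ × length (Tape.after t) ≤ ρ

WithinAll : ∀ {g k} → ℕ → Vec (Tape g) k → Set
WithinAll ρ ts = ∀ j → Within ρ (lookup ts j)

within-move : ∀ {g ρ} a (t : Tape g) → Within ρ t → Within (suc ρ) (writeMove a t)
within-move (s , left)  (tape [] x rs)       (h₁ , h₂) = z≤n , s≤s h₂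
within-move (s , left)  (tape (l ∷ ls) x rs) (h₁ , h₂) = ≤-trans (n≤1+n _) (m≤n⇒m≤1+n h₁) , s≤s h₂
within-move (s , stay)  (tape ls x rs)       (h₁ , h₂) = m≤n⇒m≤1+n h₁ , m≤n⇒m≤1+n h₂
within-move (s , right) (tape ls x [])       (h₁ , h₂) = s≤s h₁ , z≤n
within-move (s , right) (tape ls x (r ∷ rs)) (h₁ , h₂) = s≤s h₁ , ≤-trans (n≤1+n _) (m≤n⇒m≤1+n h₂)

within-act : ∀ {g k ρ} (as : Vec (Symbol g × Move) k) ts → WithinAll ρ ts → WithinAll (suc ρ) (act as ts)
within-act (a ∷ as) (t ∷ ts) h zero    = within-move a t (h zero)
within-act (a ∷ as) (t ∷ ts) h (suc j) = within-act as ts (h ∘ suc) j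

blanks : ∀ {g k} → Vec (Symbol g) k
blanks = Vec.replicate _ blank

content-blank-right : ∀ {g k ρ} (ts : Vec (Tape g) k) {n} → WithinAll ρ ts → ρ ≤ n → content ts (ℤ.+ suc n) ≡ blanks
content-blank-right []       h le = refl
content-blank-right (t ∷ ts) h le = cong₂ _∷_ (nth-beyond (Tape.after t) (≤-trans (proj₂ (h zero)) le)) (content-blank-right ts (h ∘ suc) le)

content-blank-left : ∀ {g k ρ} (ts : Vec (Tape g) k) {n} → WithinAll ρ ts → ρ ≤ n → content ts ℤ.-[1+ n ] ≡ blanks
content-blank-left []       h le = refl
content-blank-left (t ∷ ts) h le = cong₂ _∷_ (nth-beyond (Tape.before t) (≤-trans (proj₁ (h zero)) le)) (content-blank-left ts (h ∘ suc) le)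

table : ∀ {A : Set} → ℤ → ℕ → (ℤ → A) → List A
table i zero    f = []
table i (suc m) f = f i ∷ table (up i) m f

table-cong : ∀ {A : Set} m i {f g : ℤ → A} → (∀ i → f i ≡ g i) → table i m f ≡ table i m g
table-cong zero    i e = refl
table-cong (suc m) i e = cong₂ _∷_ (e i) (table-cong m (up i) e)

length-table : ∀ {A : Set} m i (f : ℤ → A) → length (table i m f) ≡ m
length-table zero    i f = refl
length-table (suc m) i f = cong suc (length-table m (up i) f)

headOr lastOr : ∀ {A : Set} → A → List A → A
headOr x []       = x
headOr x (y ∷ ys) = y
lastOr x []       = x
lastOr x (y ∷ ys) = lastOr y ys

neighbours : ∀ {A : Set} → (A → A → A → A) → A → List A → A → List A
neighbours f l []       r = []
neighbours f l (x ∷ xs) r = f l x (headOr r xs) ∷ neighbours f x xs r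

ups : ℕ → ℤ → ℤ
ups zero    i = i
ups (suc m) i = ups m (up i)

neighbours-table : ∀ {A : Set} (f : A → A → A → A) (Y : ℤ → A) m i →
  neighbours f (Y (down i)) (table i m Y) (Y (ups m i)) ≡ table i m (λ i → f (Y (down i)) (Y i) (Y (up i)))
neighbours-table f Y zero    i = refl
neighbours-table f Y (suc m) i = cong₂ _∷_ (cong (f (Y (down i)) (Y i)) (head-eq m)) (trans (cong (λ l → neighbours f l (table (up i) m Y) (Y (ups m (up i)))) (cong Y (sym (down-up i)))) (neighbours-table f Y m (up i)))
  where
  head-eq : ∀ m → headOr (Y (ups m (up i))) (table (up i) m Y) ≡ Y (up i)
  head-eq zero    = refl
  head-eq (suc m) = refl

ups-left : ∀ m → ups (suc m) ℤ.-[1+ m ] ≡ ℤ.+ 0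
ups-left zero    = refl
ups-left (suc m) = ups-left m

ups-right : ∀ m n → ups m (ℤ.+ n) ≡ ℤ.+ (m + n)
ups-right zero    n = refl
ups-right (suc m) n = trans (ups-right m (suc n)) (cong ℤ.+_ (+-suc m n))

last-table : ∀ {A : Set} (Y : ℤ → A) m i x → lastOr x (table i (suc m) Y) ≡ Y (ups m i)
last-table Y zero    i x = refl
last-table Y (suc m) i x = last-table Y m (up i) (Y i)

ups-left′ : ∀ m → ups m ℤ.-[1+ m ] ≡ ℤ.-[1+ 0 ]
ups-left′ zero    = refl
ups-left′ (suc m) = ups-left′ m

-- The tiles of one row.

data Row : Set where
  guess launch compute : Row

module Rows (M : TM 2) where

  open TM M using (states; workTapes; auxSymbols; δ; start)

  k : ℕ
  k = 2 + workTapes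

  Cell Q Acts′ : Set
  Cell  = Vec (Symbol auxSymbols) k
  Q     = Fin states
  Acts′ = Vec (Symbol auxSymbols × Move) k

  one : Fin k
  one = suc zero

  -- The certificate is guessed symbol by symbol from its end, each new
  -- symbol being written on the blank cell before it.
  options : Row → Q → Cell → List (Q × Acts′)
  options guess   q z = (q , keep z) ∷ (q , keep z [ one ]≔ (bit false , left)) ∷ (q , keep z [ one ]≔ (bit true , left)) ∷ []
  options launch   q z = (q , keep z [ one ]≔ (lookup z one , right)) ∷ []
  options compute q z = maybe′ id (q , keep z) (δ q z) ∷ []

  data Class : Set where
    first mid last : Class
    centre         : Row → Class
    init           : Cell → Class
    final accept   : Class

  -- The edge between two cells carries the new state and the moves, decided in the centre and
  -- handed on in both directions, and the contents of both cells. A tile thus knows its two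
  -- neighbours, all that a shift by one can bring in.
  Edge : Set
  Edge = (Q × Vec Move k) × (Cell × Cell)

  abstract
    Cell-finite : Finite Cell
    Cell-finite = Vec-finite (Symbol-finite auxSymbols) k

    V-finite : Finite (Q × Cell)
    V-finite = Fin-finite states ×-finite Cell-finite

    H-finite : Finite Edge
    H-finite = (Fin-finite states ×-finite Vec-finite Move-finite k) ×-finite (Cell-finite ×-finite Cell-finite)

    control : Finite (Q × (Q × Vec Move k))
    control = Fin-finite states ×-finite (Fin-finite states ×-finite Vec-finite Move-finite k)

  vc : Q × Cell → ℕ
  vc = code V-finite

  hc : Edge → ℕ
  hc = code H-finite

  next-cell : Q × Vec Move k → Cell → Cell → Cell → Q × Cell
  next-cell (q , ms) l x r = q , chooseV ms l x r

  midTile : (Q × (Q × Vec Move k)) × (Cell × (Cell × Cell)) → Tile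
  midTile ((q , u) , l , x , r) = tile (hc (u , l , x)) (hc (u , x , r)) (vc (q , x)) (vc (next-cell u l x r))

  -- The outer edges have the border colour 0, so that a row passes nothing on to the row that is
  -- read after it. Beyond the ends the tape is taken to be blank.
  firstTile lastTile : (Q × (Q × Vec Move k)) × (Cell × Cell) → Tile
  firstTile ((q , u) , x , r) = tile 0 (hc (u , x , r)) (vc (q , x)) (vc (next-cell u blanks x r))
  lastTile  ((q , u) , l , x) = tile (hc (u , l , x)) 0 (vc (q , x)) (vc (next-cell u l x blanks))

  -- The edges show the symbols already written and not `z`, since the tapes are shifted after
  -- writing.
  centreTile : (Q × Cell) × (Cell × Cell) → Q × Acts′ → Tile
  centreTile ((q , z) , l , r) (q′ , as) =
    tile (hc ((q′ , moves as) , l , writes as)) (hc ((q′ , moves as) , writes as , r)) (vc (q , z)) (vc (next-cell (q′ , moves as) l (writes as) r))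

  isTrue : Symbol auxSymbols → Bool
  isTrue (bit true) = true
  isTrue _          = false

  acceptTile : Q × Cell → List Tile
  acceptTile (q , x) = if isTrue (Vec.head x) then tile 0 0 (vc (q , x)) 0 ∷ [] else []

  tiles : Class → List Tile
  tiles first      = map firstTile (elements (control ×-finite (Cell-finite ×-finite Cell-finite)))
  tiles mid        = map midTile (elements (control ×-finite (Cell-finite ×-finite (Cell-finite ×-finite Cell-finite))))
  tiles last       = map lastTile (elements (control ×-finite (Cell-finite ×-finite Cell-finite)))
  tiles (centre ρ) = concatMap (λ c → map (centreTile c) (options ρ (proj₁ (proj₁ c)) (proj₂ (proj₁ c)))) (elements (V-finite ×-finite (Cell-finite ×-finite Cell-finite)))
  tiles (init x)   = tile 0 0 0 (vc (start , x)) ∷ []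
  tiles final      = map (λ p → tile 0 0 (vc p) 0) (elements V-finite)
  tiles accept     = concatMap acceptTile (elements V-finite)

  open Tiling tiles public

  colours : Q → List Cell → List ℕ
  colours q = map (λ x → vc (q , x))

  centre∈ : ∀ ρ q z l r {o} → o ∈ options ρ q z → centreTile ((q , z) , l , r) o ∈ tiles (centre ρ)
  centre∈ ρ q z l r o∈ = ∈-concatMap⁺ (λ c → map (centreTile c) (options ρ (proj₁ (proj₁ c)) (proj₂ (proj₁ c))))
    (Any.map (λ { refl → ∈-map⁺ (centreTile ((q , z) , l , r)) o∈ }) (∈-elements (V-finite ×-finite (Cell-finite ×-finite Cell-finite)) ((q , z) , l , r)))

  centre∋ : ∀ ρ {t} → t ∈ tiles (centre ρ) → ∃[ q ] ∃[ z ] ∃[ l ] ∃[ r ] ∃[ o ] o ∈ options ρ q z × t ≡ centreTile ((q , z) , l , r) o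
  centre∋ ρ t∈ with find (∈-concatMap⁻ (λ c → map (centreTile c) (options ρ (proj₁ (proj₁ c)) (proj₂ (proj₁ c)))) {xs = elements (V-finite ×-finite (Cell-finite ×-finite Cell-finite))} t∈)
  ... | ((q , z) , l , r) , _ , t∈′ with ∈-map⁻ (centreTile ((q , z) , l , r)) t∈′
  ... | o , o∈ , e = q , z , l , r , o , o∈ , e

  -- Each tile guesses its right neighbour and the next tile confirms the guess; the last guess `r`
  -- remains open for the tile that follows the block.
  mids-sound : ∀ xs {cs u l x₀ ws q} → Run (replicate (length xs) mid ++ cs) (hc (u , l , x₀)) (colours q xs ++ ws) →
    ∃[ r ] x₀ ≡ headOr r xs × Run cs (hc (u , lastOr l xs , r)) (ws ++ colours (proj₁ u) (neighbours (chooseV (proj₂ u)) l xs r))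
  mids-sound [] {x₀ = x₀} {ws} run = x₀ , refl , subst (Run _ _) (sym (List.++-identityʳ ws)) run
  mids-sound (x ∷ xs) {ws = ws} {q} (place t∈ ew es run) with ∈-map⁻ midTile t∈
  ... | ((q₁ , u₁) , l₁ , x₁ , r₁) , _ , refl with code-injective H-finite ew | code-injective V-finite es
  ... | refl | refl with mids-sound xs (subst (Run _ _) (List.++-assoc (colours q xs) ws _) run)
  ... | r , refl , run′ = r , refl , subst (Run _ _) (List.++-assoc ws (_ ∷ []) _) run′

  mids-complete : ∀ xs {cs u l r ws} q → Run cs (hc (u , lastOr l xs , r)) (ws ++ colours (proj₁ u) (neighbours (chooseV (proj₂ u)) l xs r)) →
    Run (replicate (length xs) mid ++ cs) (hc (u , l , headOr r xs)) (colours q xs ++ ws)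
  mids-complete [] {ws = ws} q run = subst (Run _ _) (List.++-identityʳ ws) run
  mids-complete (x ∷ xs) {u = u} {l} {r} {ws} q run =
    place (∈-map⁺ midTile (∈-elements (control ×-finite (Cell-finite ×-finite (Cell-finite ×-finite Cell-finite))) ((q , u) , l , x , headOr r xs))) refl refl
      (subst (Run _ _) (sym (List.++-assoc (colours q xs) ws _)) (mids-complete xs q (subst (Run _ _) (sym (List.++-assoc ws (_ ∷ []) _)) run)))

  rowClasses : Row → ℕ → List Class
  rowClasses ρ R = first ∷ replicate R mid ++ centre ρ ∷ replicate R mid ++ last ∷ []

  module _ (ρ : Row) (R : ℕ) (f : Cell) (xs : List Cell) (z : Cell) (ys : List Cell) (e : Cell) (lx : length xs ≡ R) (ly : length ys ≡ R) where

    newRow : Acts′ → List Cell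
    newRow as = chooseV (moves as) blanks f (headOr (writes as) xs) ∷ neighbours (chooseV (moves as)) f xs (writes as) ++
                chooseV (moves as) (lastOr f xs) (writes as) (headOr e ys) ∷ neighbours (chooseV (moves as)) (writes as) ys e ++
                chooseV (moves as) (lastOr (writes as) ys) e blanks ∷ []

    oldRow : List Cell
    oldRow = f ∷ xs ++ z ∷ ys ++ e ∷ []

    colours-++ : ∀ q xs ys → colours q (xs ++ ys) ≡ colours q xs ++ colours q ys
    colours-++ q xs ys = List.map-++ (λ x → vc (q , x)) xs ys

    old-split : ∀ q → colours q oldRow ≡ vc (q , f) ∷ colours q xs ++ vc (q , z) ∷ colours q ys ++ vc (q , e) ∷ []
    old-split q = cong (vc (q , f) ∷_) (trans (colours-++ q xs _) (cong (λ l → colours q xs ++ vc (q , z) ∷ l) (colours-++ q ys _)))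

    split-new : ∀ q as → colours q (newRow as) ≡
      ((((vc (q , chooseV (moves as) blanks f (headOr (writes as) xs)) ∷ []) ++ colours q (neighbours (chooseV (moves as)) f xs (writes as)))
        ++ vc (q , chooseV (moves as) (lastOr f xs) (writes as) (headOr e ys)) ∷ []) ++ colours q (neighbours (chooseV (moves as)) (writes as) ys e))
        ++ vc (q , chooseV (moves as) (lastOr (writes as) ys) e blanks) ∷ []
    split-new q as = trans (cong (A ∷_) (trans (colours-++ q B _) (cong (λ l → colours q B ++ C ∷ l) (colours-++ q D _)))) (sym assoc)
      where
      A C E : ℕ
      A = vc (q , chooseV (moves as) blanks f (headOr (writes as) xs))
      C = vc (q , chooseV (moves as) (lastOr f xs) (writes as) (headOr e ys))
      E = vc (q , chooseV (moves as) (lastOr (writes as) ys) e blanks)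
      B D : List Cell
      B = neighbours (chooseV (moves as)) f xs (writes as)
      D = neighbours (chooseV (moves as)) (writes as) ys e
      assoc : ((((A ∷ []) ++ colours q B) ++ C ∷ []) ++ colours q D) ++ E ∷ [] ≡ A ∷ (colours q B ++ C ∷ (colours q D ++ E ∷ []))
      assoc = trans (List.++-assoc ((A ∷ colours q B) ++ C ∷ []) (colours q D) (E ∷ [])) (List.++-assoc (A ∷ colours q B) (C ∷ []) (colours q D ++ E ∷ []))

    row-sound : ∀ {cs q} → Run (rowClasses ρ R ++ cs) 0 (colours q oldRow) → ∃[ o ] o ∈ options ρ q z × Run cs 0 (colours (proj₁ o) (newRow (proj₂ o)))
    row-sound {cs} {q} run rewrite old-split q with run
    ... | place t∈ _ es run₁ with ∈-map⁻ firstTile t∈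
    ... | ((q₁ , u) , x₁ , r₁) , _ , refl with code-injective V-finite es
    ... | refl with mids-sound xs {cs = centre ρ ∷ replicate R mid ++ last ∷ cs} (subst₂ (λ cls vs → Run cls _ vs)
           (trans (cong (λ l → (replicate l mid ++ centre ρ ∷ replicate R mid ++ last ∷ []) ++ cs) (sym lx)) (trans (List.++-assoc (replicate (length xs) mid) _ cs) (cong (λ l → replicate (length xs) mid ++ centre ρ ∷ l) (List.++-assoc (replicate R mid) _ cs))))
           (List.++-assoc (colours q xs) _ _) run₁)
    ... | r , refl , place t∈₂ ew₂ es₂ run₂ with centre∋ ρ t∈₂
    ... | q₂ , z₂ , l₂ , r₂ , (q′ , as) , o∈ , refl with code-injective H-finite ew₂ | code-injective V-finite es₂
    ... | refl | refl with mids-sound ys {cs = last ∷ cs} (subst₂ (λ cls vs → Run cls _ vs) (cong (λ l → replicate l mid ++ last ∷ cs) (sym ly)) (reassoc (colours q ys) _ _ _ _) run₂)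
      where
      reassoc : ∀ (ws : List ℕ) v a b c → (((ws ++ v ∷ []) ++ a ∷ []) ++ b) ++ c ∷ [] ≡ ws ++ ((((v ∷ []) ++ (a ∷ [])) ++ b) ++ c ∷ [])
      reassoc ws v a b c = trans (cong (λ l → (l ++ b) ++ c ∷ []) (List.++-assoc ws (v ∷ []) (a ∷ []))) (trans (cong (_++ c ∷ []) (List.++-assoc ws _ b)) (List.++-assoc ws _ (c ∷ [])))
    ... | r₃ , refl , place t∈₃ ew₃ es₃ run₃ with ∈-map⁻ lastTile t∈₃
    ... | ((q₄ , u₄) , l₄ , x₄) , _ , refl with code-injective H-finite ew₃ | code-injective V-finite es₃
    ... | refl | refl = (q′ , as) , o∈ , subst (Run cs 0) (sym (split-new q′ as)) run₃

    row-complete : ∀ {cs q o} → o ∈ options ρ q z → Run cs 0 (colours (proj₁ o) (newRow (proj₂ o))) → Run (rowClasses ρ R ++ cs) 0 (colours q oldRow)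
    row-complete {cs} {q} {q′ , as} o∈ run rewrite old-split q =
      place (∈-map⁺ firstTile (∈-elements (control ×-finite (Cell-finite ×-finite Cell-finite)) ((q , u) , f , headOr (writes as) xs))) refl refl
        (subst₂ (λ cls vs → Run cls _ vs)
           (sym (trans (cong (λ l → (replicate l mid ++ centre ρ ∷ replicate R mid ++ last ∷ []) ++ cs) (sym lx)) (trans (List.++-assoc (replicate (length xs) mid) _ cs) (cong (λ l → replicate (length xs) mid ++ centre ρ ∷ l) (List.++-assoc (replicate R mid) _ cs)))))
           (sym (List.++-assoc (colours q xs) _ _))
          (mids-complete xs q (place (centre∈ ρ q z (lastOr f xs) (headOr e ys) o∈) refl refl
            (subst₂ (λ cls vs → Run cls _ vs) (cong (λ l → replicate l mid ++ last ∷ cs) ly) (sym (reassoc (colours q ys) _ _ _ _))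
              (mids-complete ys q (place (∈-map⁺ lastTile (∈-elements (control ×-finite (Cell-finite ×-finite Cell-finite)) ((q , u) , lastOr (writes as) ys , e))) refl refl
                (subst (Run cs 0) (split-new q′ as) run)))))))
      where
      u : Q × Vec Move k
      u = q′ , moves as
      reassoc : ∀ (ws : List ℕ) v a b c → (((ws ++ v ∷ []) ++ a ∷ []) ++ b) ++ c ∷ [] ≡ ws ++ ((((v ∷ []) ++ (a ∷ [])) ++ b) ++ c ∷ [])
      reassoc ws v a b c = trans (cong (λ l → (l ++ b) ++ c ∷ []) (List.++-assoc ws (v ∷ []) (a ∷ []))) (trans (cong (_++ c ∷ []) (List.++-assoc ws _ b)) (List.++-assoc ws _ (c ∷ [])))

table-snoc : ∀ {A : Set} m i (f : ℤ → A) → table i (suc m) f ≡ table i m f ++ f (ups m i) ∷ []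
table-snoc zero    i f = refl
table-snoc (suc m) i f = cong (f i ∷_) (table-snoc m (up i) f)

table-left : ∀ {A : Set} m {f g : ℤ → A} → (∀ n → f ℤ.-[1+ n ] ≡ g ℤ.-[1+ n ]) → table (up ℤ.-[1+ m ]) m f ≡ table (up ℤ.-[1+ m ]) m g
table-left zero    e = refl
table-left (suc m) e = cong₂ _∷_ (e m) (table-left m e)

table-right : ∀ {A : Set} m n {f g : ℤ → A} → (∀ n → f (ℤ.+ suc n) ≡ g (ℤ.+ suc n)) → table (ℤ.+ suc n) m f ≡ table (ℤ.+ suc n) m g
table-right zero    n e = refl
table-right (suc m) n e = cong₂ _∷_ (e n) (table-right m (suc n) e)

head-table : ∀ {A : Set} (f : ℤ → A) m i → headOr (f (ups m i)) (table i m f) ≡ f i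
head-table f zero    i = refl
head-table f (suc m) i = refl

ups-suc : ∀ m → ups m (ℤ.+ 1) ≡ ℤ.+ suc m
ups-suc m = trans (ups-right m 1) (cong ℤ.+_ (+-comm m 1))

multiple : ∀ {A : Set} → ℕ → List A → List A
multiple zero    xs = []
multiple (suc n) xs = xs ++ multiple n xs

-- Rows as steps of the machine.

module Computation (M : TM 2) (R : ℕ) where

  open Rows M public
  open TM M using (workTapes; auxSymbols; start; δ; Config; initial; step; run)

  Tapes′ : Set
  Tapes′ = Vec (Tape auxSymbols) k

  cellsOf : (ℤ → Cell) → List Cell
  cellsOf f = table ℤ.-[1+ R ] (suc R) f ++ f (ℤ.+ 0) ∷ table (ℤ.+ 1) (suc R) f

  cells : Tapes′ → List Cell
  cells ts = cellsOf (content ts)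

  rowOf : Config → List ℕ
  rowOf (q , ts) = colours q (cells ts)

  -- A row shows the cells at distance at most R + 1 from the head, and tapes of extent `ρ′` have
  -- only blanks beyond. The cells that enter at the ends are therefore blank, as the outermost
  -- tiles assume.
  module _ (ts : Tapes′) {ρ′ : ℕ} (within : WithinAll ρ′ ts) (ρ′≤ : ρ′ ≤ suc R) where

    private
      f e : Cell
      f = content ts ℤ.-[1+ R ]
      e = content ts (ups R (ℤ.+ 1))
      xs ys : List Cell
      xs = table (up ℤ.-[1+ R ]) R (content ts)
      ys = table (ℤ.+ 1) R (content ts)
      lx : length xs ≡ R
      lx = length-table R (up ℤ.-[1+ R ]) (content ts)
      ly : length ys ≡ R
      ly = length-table R (ℤ.+ 1) (content ts)

    cells-old : cells ts ≡ oldRow compute R f xs (scan ts) ys e lx ly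
    cells-old = cong (λ l → f ∷ xs ++ scan ts ∷ l) (table-snoc R (ℤ.+ 1) (content ts))

    cells-new : ∀ as → newRow compute R f xs (scan ts) ys e lx ly as ≡ cells (act as ts)
    cells-new as = trans (cong₂ _∷_ p₁ (cong₂ _++_ p₂ (cong₂ _∷_ p₃ (cong₂ _++_ p₄ (cong (_∷ []) p₅))))) (sym new)
      where
      Y G : ℤ → Cell
      Y = content (writeAll as ts)
      F : Cell → Cell → Cell → Cell
      F = chooseV (moves as)
      G i = F (Y (down i)) (Y i) (Y (up i))
      W : Cell
      W = writes as
      W≡ : W ≡ Y (ℤ.+ 0)
      W≡ = sym (content-written as ts)
      f≡ : f ≡ Y ℤ.-[1+ R ]
      f≡ = sym (content-left as ts R)
      xs≡ : xs ≡ table (up ℤ.-[1+ R ]) R Y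
      xs≡ = table-left R (λ n → sym (content-left as ts n))
      ys≡ : ys ≡ table (ℤ.+ 1) R Y
      ys≡ = table-right R 0 (λ n → sym (content-right as ts n))
      e≡ : e ≡ Y (ups R (ℤ.+ 1))
      e≡ = trans (cong (content ts) (ups-suc R)) (trans (sym (content-right as ts R)) (cong Y (sym (ups-suc R))))
      new : cells (act as ts) ≡ G ℤ.-[1+ R ] ∷ table (up ℤ.-[1+ R ]) R G ++ G (ℤ.+ 0) ∷ table (ℤ.+ 1) R G ++ G (ups R (ℤ.+ 1)) ∷ []
      new = cong₂ _++_ (table-cong (suc R) ℤ.-[1+ R ] (content-act as ts))
              (cong₂ _∷_ (content-act as ts (ℤ.+ 0)) (trans (table-cong (suc R) (ℤ.+ 1) (content-act as ts)) (table-snoc R (ℤ.+ 1) G)))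
      p₁ : F blanks f (headOr W xs) ≡ G ℤ.-[1+ R ]
      p₁ = trans (cong₂ (λ a b → F a b (headOr W xs)) (sym (trans (content-left as ts (suc R)) (content-blank-left ts within ρ′≤))) f≡)
        (cong (F (Y ℤ.-[1+ suc R ]) (Y ℤ.-[1+ R ])) (trans (cong₂ headOr (trans W≡ (cong Y (sym (ups-left R)))) xs≡) (head-table Y R (up ℤ.-[1+ R ]))))
      p₂ : neighbours F f xs W ≡ table (up ℤ.-[1+ R ]) R G
      p₂ = trans (cong₂ (λ a b → neighbours F a b W) (trans f≡ (cong Y (sym (down-up ℤ.-[1+ R ])))) xs≡)
        (trans (cong (neighbours F (Y (down (up ℤ.-[1+ R ]))) (table (up ℤ.-[1+ R ]) R Y)) (trans W≡ (cong Y (sym (ups-left R))))) (neighbours-table F Y R (up ℤ.-[1+ R ])))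
      p₃ : F (lastOr f xs) W (headOr e ys) ≡ G (ℤ.+ 0)
      p₃ = trans (cong₂ (λ a b → F a b (headOr e ys)) (trans (cong₂ lastOr f≡ xs≡) (trans (last-table Y R ℤ.-[1+ R ] f) (cong Y (ups-left′ R)))) W≡)
        (cong (F (Y ℤ.-[1+ 0 ]) (Y (ℤ.+ 0))) (trans (cong₂ headOr e≡ ys≡) (head-table Y R (ℤ.+ 1))))
      p₄ : neighbours F W ys e ≡ table (ℤ.+ 1) R G
      p₄ = trans (cong₂ (λ a b → neighbours F a b e) W≡ ys≡) (trans (cong (neighbours F (Y (ℤ.+ 0)) (table (ℤ.+ 1) R Y)) e≡) (neighbours-table F Y R (ℤ.+ 1)))
      p₅ : F (lastOr W ys) e blanks ≡ G (ups R (ℤ.+ 1))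
      p₅ = trans (cong₂ (λ a b → F a b blanks) (trans (cong₂ lastOr W≡ ys≡) (trans (last-table Y R (ℤ.+ 0) f) (cong Y (trans (ups-right R 0) (trans (cong ℤ.+_ (+-identityʳ R)) (cong down (sym (ups-suc R)))))))) e≡)
        (cong (F (Y (down (ups R (ℤ.+ 1)))) (Y (ups R (ℤ.+ 1)))) (sym (trans (cong (Y ∘ up) (ups-suc R)) (trans (content-right as ts (suc R)) (content-blank-right ts within ρ′≤)))))

    step-sound : ∀ ρ {cs q} → Run (rowClasses ρ R ++ cs) 0 (rowOf (q , ts)) → ∃[ o ] o ∈ options ρ q (scan ts) × Run cs 0 (rowOf (proj₁ o , act (proj₂ o) ts))
    step-sound ρ {cs} {q} r with row-sound ρ R f xs (scan ts) ys e lx ly (subst (λ l → Run (rowClasses ρ R ++ cs) 0 (colours q l)) cells-old r)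
    ... | o , o∈ , r′ = o , o∈ , subst (λ l → Run cs 0 (colours (proj₁ o) l)) (cells-new (proj₂ o)) r′

    step-complete : ∀ ρ {cs q o} → o ∈ options ρ q (scan ts) → Run cs 0 (rowOf (proj₁ o , act (proj₂ o) ts)) → Run (rowClasses ρ R ++ cs) 0 (rowOf (q , ts))
    step-complete ρ {cs} {q} {o} o∈ r = subst (λ l → Run (rowClasses ρ R ++ cs) 0 (colours q l)) (sym cells-old)
      (row-complete ρ R f xs (scan ts) ys e lx ly o∈ (subst (λ l → Run cs 0 (colours (proj₁ o) l)) (sym (cells-new (proj₂ o))) r))

  -- A halted configuration is repeated, so that the number of rows can be fixed in advance.
  proceed : Config → Config
  proceed (q , ts) = let o = maybe′ id (q , keep (scan ts)) (δ q (scan ts)) in proj₁ o , act (proj₂ o) ts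

  proceed-step : ∀ c → proceed c ≡ maybe′ id c (step c)
  proceed-step (q , ts) with δ q (scan ts)
  ... | just _  = refl
  ... | nothing = cong (q ,_) (act-keep ts)

  proceed-halted : ∀ {c} → step c ≡ nothing → ∀ T → iter T proceed c ≡ c
  proceed-halted {c} e zero    = refl
  proceed-halted {c} e (suc T) = trans (cong (iter T proceed) (trans (proceed-step c) (cong (maybe′ id c) e))) (proceed-halted e T)

  run-proceed : ∀ t {T c d} → t ≤ T → run t c ≡ just d → iter T proceed c ≡ d
  run-proceed t {T} {c} t≤ e with step c in eq
  run-proceed t       {T}     t≤       refl | nothing = proceed-halted eq T
  run-proceed (suc t) {suc T} {c} (s≤s t≤) e | just c′ = trans (cong (iter T proceed) (trans (proceed-step c) (cong (maybe′ id c) eq))) (run-proceed t t≤ e)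

  only : ∀ {A : Set} {x y : A} → x ∈ y ∷ [] → x ≡ y
  only (here e) = e

  proceed-sound : ∀ {cs ρ′} c → WithinAll ρ′ (proj₂ c) → ρ′ ≤ suc R → Run (rowClasses compute R ++ cs) 0 (rowOf c) → Run cs 0 (rowOf (proceed c))
  proceed-sound {cs} (q , ts) h le r = finish (step-sound ts h le compute r)
    where
    finish : ∃[ o ] o ∈ options compute q (scan ts) × Run cs 0 (rowOf (proj₁ o , act (proj₂ o) ts)) → Run cs 0 (rowOf (proceed (q , ts)))
    finish (o , o∈ , r) = subst (λ o → Run cs 0 (rowOf (proj₁ o , act (proj₂ o) ts))) (only o∈) r

  proceed-within : ∀ {ρ′} c → WithinAll ρ′ (proj₂ c) → WithinAll (suc ρ′) (proj₂ (proceed c))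
  proceed-within (q , ts) = within-act (proj₂ (maybe′ id (q , keep (scan ts)) (δ q (scan ts)))) ts

  compute-sound : ∀ T {cs ρ′} c → WithinAll ρ′ (proj₂ c) → T + ρ′ ≤ suc R → Run (multiple T (rowClasses compute R) ++ cs) 0 (rowOf c) → Run cs 0 (rowOf (iter T proceed c))
  compute-sound zero    c h le r = r
  compute-sound (suc T) {cs} {ρ′} c h le r = compute-sound T (proceed c) (proceed-within c h) (≤-trans (≤-reflexive (+-suc T ρ′)) le)
    (proceed-sound c h (≤-trans (m≤n+m ρ′ (suc T)) le) (subst (λ l → Run l 0 (rowOf c)) (List.++-assoc (rowClasses compute R) (multiple T (rowClasses compute R)) cs) r))

  compute-complete : ∀ T {cs ρ′} c → WithinAll ρ′ (proj₂ c) → T + ρ′ ≤ suc R → Run cs 0 (rowOf (iter T proceed c)) → Run (multiple T (rowClasses compute R) ++ cs) 0 (rowOf c)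
  compute-complete zero    c h le r = r
  compute-complete (suc T) {cs} {ρ′} c h le r = subst (λ l → Run l 0 (rowOf c)) (sym (List.++-assoc (rowClasses compute R) (multiple T (rowClasses compute R)) cs))
    (step-complete (proj₂ c) h (≤-trans (m≤n+m ρ′ (suc T)) le) compute (here refl) (compute-complete T (proceed c) (proceed-within c h) (≤-trans (≤-reflexive (+-suc T ρ′)) le) r))

  emptyTapes : Vec (Tape auxSymbols) workTapes
  emptyTapes = Vec.replicate workTapes (tapeFrom [] [])

  guessing : List Bool → List Bool → Tapes′
  guessing w c = tapeFrom [] (map bit w) ∷ tape [] blank (map bit c) ∷ emptyTapes

  within-input : ∀ ws {ρ′} → length ws ≤ ρ′ → Within {auxSymbols} ρ′ (tapeFrom [] (map bit ws))
  within-input []       h = z≤n , z≤n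
  within-input (b ∷ ws) h = z≤n , ≤-trans (≤-reflexive (List.length-map bit ws)) (≤-trans (n≤1+n _) h)

  within-empty : ∀ n {ρ′} (j : Fin n) → Within {auxSymbols} ρ′ (lookup (Vec.replicate n (tapeFrom [] [])) j)
  within-empty (suc n) zero    = z≤n , z≤n
  within-empty (suc n) (suc j) = within-empty n j

  within-guessing : ∀ w c {ρ′} → length w ≤ ρ′ → length c ≤ ρ′ → WithinAll ρ′ (guessing w c)
  within-guessing w c hw hc zero          = within-input w hw
  within-guessing w c hw hc (suc zero)    = z≤n , ≤-trans (≤-reflexive (List.length-map bit c)) hc
  within-guessing w c hw hc (suc (suc j)) = within-empty workTapes j

  within-initial : ∀ w c {ρ′} → length w ≤ ρ′ → length c ≤ ρ′ → WithinAll ρ′ (proj₂ (initial (w ∷ c ∷ [])))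
  within-initial w c hw hc zero          = within-input w hw
  within-initial w c hw hc (suc zero)    = within-input c hc
  within-initial w c hw hc (suc (suc j)) = within-empty workTapes j

  retape : ∀ {cs q ts ts′} → ts ≡ ts′ → Run cs 0 (rowOf (q , ts)) → Run cs 0 (rowOf (q , ts′))
  retape refl r = r

  guess-step : ∀ {cs} w c → length w ≤ suc R → length c ≤ suc R → Run (rowClasses guess R ++ cs) 0 (rowOf (start , guessing w c)) →
    Run cs 0 (rowOf (start , guessing w c)) ⊎ (∃[ b ] Run cs 0 (rowOf (start , guessing w (b ∷ c))))
  guess-step {cs} w c hw hc r = finish (step-sound (guessing w c) (within-guessing w c hw hc) ≤-refl guess r)
    where
    finish : ∃[ o ] o ∈ options guess start (scan (guessing w c)) × Run cs 0 (rowOf (proj₁ o , act (proj₂ o) (guessing w c))) →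
      Run cs 0 (rowOf (start , guessing w c)) ⊎ (∃[ b ] Run cs 0 (rowOf (start , guessing w (b ∷ c))))
    finish (_ , here refl , r)                 = inj₁ (retape (act-keep (guessing w c)) r)
    finish (_ , there (here refl) , r)         = inj₂ (false , retape (act-at (guessing w c) one (bit false , left)) r)
    finish (_ , there (there (here refl)) , r) = inj₂ (true , retape (act-at (guessing w c) one (bit true , left)) r)

  guess-sound : ∀ P {cs} w c → length w ≤ suc R → P + length c ≤ suc R → Run (multiple P (rowClasses guess R) ++ cs) 0 (rowOf (start , guessing w c)) →
    ∃[ c′ ] length c′ ≤ P + length c × Run cs 0 (rowOf (start , guessing w c′))
  guess-sound zero    w c hw le r = c , ≤-refl , r
  guess-sound (suc P) {cs} w c hw le r =
    continue (guess-step w c hw (≤-trans (m≤n+m _ (suc P)) le) (subst (λ l → Run l 0 (rowOf (start , guessing w c))) (List.++-assoc (rowClasses guess R) (multiple P (rowClasses guess R)) cs) r))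
    where
    continue : Run (multiple P (rowClasses guess R) ++ cs) 0 (rowOf (start , guessing w c)) ⊎ (∃[ b ] Run (multiple P (rowClasses guess R) ++ cs) 0 (rowOf (start , guessing w (b ∷ c)))) →
      ∃[ c′ ] length c′ ≤ suc P + length c × Run cs 0 (rowOf (start , guessing w c′))
    continue (inj₁ r)       = let c′ , le′ , r′ = guess-sound P w c hw (≤-trans (n≤1+n _) le) r in c′ , m≤n⇒m≤1+n le′ , r′
    continue (inj₂ (b , r)) = let c′ , le′ , r′ = guess-sound P w (b ∷ c) hw (≤-trans (≤-reflexive (+-suc P _)) le) r in c′ , ≤-trans le′ (≤-reflexive (+-suc P _)) , r′

  -- Rows that write nothing allow certificates shorter than the number of guessing rows.
  guess-none : ∀ P {cs} w c → length w ≤ suc R → length c ≤ suc R → Run cs 0 (rowOf (start , guessing w c)) → Run (multiple P (rowClasses guess R) ++ cs) 0 (rowOf (start , guessing w c))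
  guess-none zero    w c hw le r = r
  guess-none (suc P) {cs} w c hw le r = subst (λ l → Run l 0 (rowOf (start , guessing w c))) (sym (List.++-assoc (rowClasses guess R) _ cs))
    (step-complete (guessing w c) (within-guessing w c hw le) ≤-refl guess (here refl)
      (retape (sym (act-keep (guessing w c))) (guess-none P w c hw le r)))

  -- c is the part of the certificate guessed so far, and u the rest in
  -- the order of guessing.
  guess-complete : ∀ P u {cs} w c → length w ≤ suc R → length u ≤ P → length u + length c ≤ suc R → Run cs 0 (rowOf (start , guessing w (u List.ʳ++ c))) →
    Run (multiple P (rowClasses guess R) ++ cs) 0 (rowOf (start , guessing w c))
  guess-complete P       []      w c hw lu le r = guess-none P w c hw le r
  guess-complete (suc P) (b ∷ u) {cs} w c hw (s≤s lu) le r = subst (λ l → Run l 0 (rowOf (start , guessing w c))) (sym (List.++-assoc (rowClasses guess R) _ cs))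
    (step-complete (guessing w c) (within-guessing w c hw (≤-trans (m≤n+m _ (suc (length u))) le)) ≤-refl guess (option b)
      (retape (sym (act-at (guessing w c) one (bit b , left))) (guess-complete P u w (b ∷ c) hw lu (≤-trans (≤-reflexive (+-suc (length u) (length c))) le) r)))
    where
    option : ∀ b → (start , keep (scan (guessing w c)) [ one ]≔ (bit b , left)) ∈ options guess start (scan (guessing w c))
    option false = there (here refl)
    option true  = there (there (here refl))

  started : List Bool → List Bool → Tapes′
  started w c = guessing w c [ one ]≔ tapeFrom (blank ∷ []) (map bit c)

  -- The launch leaves an explicit blank to the left of the certificate. As a list the tape differs
  -- from the initial one, but rows depend on the cells only.
  content-started : ∀ w c i → content (started w c) i ≡ content (proj₂ (initial (w ∷ c ∷ []))) i
  content-started w c i = cong (λ s → cell (tapeFrom [] (map bit w)) i ∷ s ∷ content emptyTapes i) (same c i)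
    where
    same : ∀ c i → cell (tapeFrom {auxSymbols} (blank ∷ []) (map bit c)) i ≡ cell (tapeFrom [] (map bit c)) i
    same []      (ℤ.+ zero)       = refl
    same []      (ℤ.+ suc n)      = refl
    same []      ℤ.-[1+ zero ]    = refl
    same []      ℤ.-[1+ suc n ]   = refl
    same (b ∷ c) (ℤ.+ zero)       = refl
    same (b ∷ c) (ℤ.+ suc n)      = refl
    same (b ∷ c) ℤ.-[1+ zero ]    = refl
    same (b ∷ c) ℤ.-[1+ suc n ]   = refl

  cellsOf-cong : ∀ {f g} → (∀ i → f i ≡ g i) → cellsOf f ≡ cellsOf g
  cellsOf-cong e = cong₂ _++_ (table-cong (suc R) ℤ.-[1+ R ] e) (cong₂ _∷_ (e (ℤ.+ 0)) (table-cong (suc R) (ℤ.+ 1) e))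

  launch-row : ∀ w c → rowOf (start , act (keep (scan (guessing w c)) [ one ]≔ (lookup (scan (guessing w c)) one , right)) (guessing w c)) ≡ rowOf (initial (w ∷ c ∷ []))
  launch-row w c = cong (colours start) (trans (cong cells (act-at (guessing w c) one (blank , right))) (cellsOf-cong (content-started w c)))

  launch-sound : ∀ {cs} w c → length w ≤ suc R → length c ≤ suc R → Run (rowClasses launch R ++ cs) 0 (rowOf (start , guessing w c)) → Run cs 0 (rowOf (initial (w ∷ c ∷ [])))
  launch-sound {cs} w c hw hc r = finish (step-sound (guessing w c) (within-guessing w c hw hc) ≤-refl launch r)
    where
    finish : ∃[ o ] o ∈ options launch start (scan (guessing w c)) × Run cs 0 (rowOf (proj₁ o , act (proj₂ o) (guessing w c))) → Run cs 0 (rowOf (initial (w ∷ c ∷ [])))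
    finish (_ , here refl , r) = subst (Run cs 0) (launch-row w c) r

  launch-complete : ∀ {cs} w c → length w ≤ suc R → length c ≤ suc R → Run cs 0 (rowOf (initial (w ∷ c ∷ []))) → Run (rowClasses launch R ++ cs) 0 (rowOf (start , guessing w c))
  launch-complete {cs} w c hw hc r = step-complete (guessing w c) (within-guessing w c hw hc) ≤-refl launch (here refl) (subst (Run cs 0) (sym (launch-row w c)) r)

-- The whole tableau, from the input row to acceptance.

zeros : ℕ → List ℕ
zeros n = replicate n 0

all-zeros : ∀ n → All (_≡ 0) (zeros n)
all-zeros zero    = []
all-zeros (suc n) = refl ∷ all-zeros n

table-replicate : ∀ {A : Set} {x : A} m n f → (∀ n → f (ℤ.+ (m + n)) ≡ x) → table (ℤ.+ m) n f ≡ replicate n x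
table-replicate m zero    f e = refl
table-replicate m (suc n) f e = cong₂ _∷_ (trans (cong (f ∘ ℤ.+_) (sym (+-identityʳ m))) (e 0)) (table-replicate (suc m) n f (λ i → trans (cong (f ∘ ℤ.+_) (sym (+-suc m i))) (e (suc i))))

table-replicateˡ : ∀ {A : Set} {x : A} m f → (∀ n → f ℤ.-[1+ n ] ≡ x) → table (up ℤ.-[1+ m ]) m f ≡ replicate m x
table-replicateˡ zero    f e = refl
table-replicateˡ (suc m) f e = cong₂ _∷_ (e m) (table-replicateˡ m f e)

table-word : ∀ {A : Set} {g} (h : Symbol g → A) ws r m f → (∀ n → f (ℤ.+ (m + n)) ≡ h (nth (map bit ws) n)) →
  table (ℤ.+ m) (length ws + r) f ≡ map (h ∘ bit) ws ++ replicate r (h blank)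
table-word h []       r m f e = table-replicate m r f e
table-word h (b ∷ ws) r m f e = cong₂ _∷_ (trans (cong (f ∘ ℤ.+_) (sym (+-identityʳ m))) (e 0))
  (table-word h ws r (suc m) f (λ i → trans (cong (f ∘ ℤ.+_) (sym (+-suc m i))) (e (suc i))))

-- Input and certificate extend over at most |w| + P cells, and each step adds at most one.
radius : List Bool → ℕ → ℕ → ℕ
radius w P T = length w + (P + T)

module Tableau (M : TM 2) where

  open Rows M
  open TM M using (workTapes; auxSymbols; start; Config; initial; run)

  inputCell : Symbol auxSymbols → Cell
  inputCell s = s ∷ blanks

  inputRow : List Bool → ℕ → ℕ → List Cell
  inputRow w P T = replicate (suc (radius w P T)) blanks ++ map (inputCell ∘ bit) w ++ replicate (suc (suc (P + T))) blanks

  -- Turns every colour into the border colour 0, as the end of a tiling requires, and tests the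
  -- answer of the machine at the centre.
  finalRow : ℕ → List Class
  finalRow R = replicate (suc R) final ++ accept ∷ replicate (suc R) final

  computation : ℕ → ℕ → ℕ → List Class
  computation R P T = multiple P (rowClasses guess R) ++ rowClasses launch R ++ multiple T (rowClasses compute R) ++ finalRow R

  tableau : List Bool → ℕ → ℕ → List Class
  tableau w P T = map init (inputRow w P T) ++ computation (radius w P T) P T

  init-sound : ∀ xs {cs ws} → Run (map init xs ++ cs) 0 (zeros (length xs) ++ ws) → Run cs 0 (ws ++ colours start xs)
  init-sound []       {ws = ws} r = subst (Run _ 0) (sym (List.++-identityʳ ws)) r
  init-sound (x ∷ xs) {ws = ws} (place (here refl) _ _ r) =
    subst (Run _ 0) (List.++-assoc ws _ _) (init-sound xs (subst (Run _ 0) (List.++-assoc (zeros (length xs)) ws _) r))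

  init-complete : ∀ xs {cs ws} → Run cs 0 (ws ++ colours start xs) → Run (map init xs ++ cs) 0 (zeros (length xs) ++ ws)
  init-complete []       {ws = ws} r = subst (Run _ 0) (List.++-identityʳ ws) r
  init-complete (x ∷ xs) {ws = ws} r = place (here refl) refl refl
    (subst (Run _ 0) (sym (List.++-assoc (zeros (length xs)) ws _)) (init-complete xs (subst (Run _ 0) (sym (List.++-assoc ws (_ ∷ []) _)) r)))

  final-sound : ∀ xs {cs ws q} → Run (replicate (length xs) final ++ cs) 0 (colours q xs ++ ws) → Run cs 0 (ws ++ zeros (length xs))
  final-sound []       {ws = ws} r = subst (Run _ 0) (sym (List.++-identityʳ ws)) r
  final-sound (x ∷ xs) {ws = ws} {q} (place t∈ _ _ r) with ∈-map⁻ (λ p → tile 0 0 (vc p) 0) t∈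
  ... | _ , _ , refl = subst (Run _ 0) (List.++-assoc ws _ _) (final-sound xs (subst (Run _ 0) (List.++-assoc (colours q xs) ws _) r))

  final-complete : ∀ xs {cs ws} q → Run cs 0 (ws ++ zeros (length xs)) → Run (replicate (length xs) final ++ cs) 0 (colours q xs ++ ws)
  final-complete []       {ws = ws} q r = subst (Run _ 0) (List.++-identityʳ ws) r
  final-complete (x ∷ xs) {ws = ws} q r = place (∈-map⁺ (λ p → tile 0 0 (vc p) 0) (∈-elements V-finite (q , x))) refl refl
    (subst (Run _ 0) (sym (List.++-assoc (colours q xs) ws _)) (final-complete xs q (subst (Run _ 0) (sym (List.++-assoc ws (_ ∷ []) _)) r)))

  accept-tile : ∀ p {t} → t ∈ acceptTile p → isTrue (Vec.head (proj₂ p)) ≡ true × t ≡ tile 0 0 (vc p) 0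
  accept-tile (q , x) t∈ with isTrue (Vec.head x)
  accept-tile (q , x) (here refl) | true = refl , refl

  tile-accept : ∀ p → isTrue (Vec.head (proj₂ p)) ≡ true → tile 0 0 (vc p) 0 ∈ acceptTile p
  tile-accept (q , x) e rewrite e = here refl

  accept-sound : ∀ {cs q x ws} → Run (accept ∷ cs) 0 (vc (q , x) ∷ ws) → isTrue (Vec.head x) ≡ true × Run cs 0 (ws ++ 0 ∷ [])
  accept-sound (place t∈ _ es r) with find (∈-concatMap⁻ acceptTile {xs = elements V-finite} t∈)
  ... | p , _ , t∈′ with accept-tile p t∈′
  ... | e , refl with code-injective V-finite es
  ... | refl = e , r

  accept-complete : ∀ {cs q x ws} → isTrue (Vec.head x) ≡ true → Run cs 0 (ws ++ 0 ∷ []) → Run (accept ∷ cs) 0 (vc (q , x) ∷ ws)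
  accept-complete {q = q} {x} e r = place (∈-concatMap⁺ acceptTile (Any.map (λ { refl → tile-accept (q , x) e }) (∈-elements V-finite (q , x)))) refl refl r

  AcceptingConfig : Config → Set
  AcceptingConfig c = isTrue (Vec.head (scan (proj₂ c))) ≡ true

  module _ (R : ℕ) where

    open Computation M R using (cells; cellsOf; rowOf; Tapes′; proceed; guessing; emptyTapes; cellsOf-cong; run-proceed;
      guess-sound; guess-complete; launch-sound; launch-complete; compute-sound; compute-complete; within-initial)

    leftHalf rightHalf : Tapes′ → List Cell
    leftHalf ts  = table ℤ.-[1+ R ] (suc R) (content ts)
    rightHalf ts = table (ℤ.+ 1) (suc R) (content ts)

    row-split : ∀ q ts → rowOf (q , ts) ≡ colours q (leftHalf ts) ++ vc (q , scan ts) ∷ colours q (rightHalf ts)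
    row-split q ts = List.map-++ (λ x → vc (q , x)) (leftHalf ts) _

    halves : ∀ i (ts : Tapes′) → length (table i (suc R) (content ts)) ≡ suc R
    halves i ts = length-table (suc R) i (content ts)

    finalRow-sound : ∀ c → Run (finalRow R) 0 (rowOf c) → AcceptingConfig c
    finalRow-sound (q , ts) r = proj₁ (accept-sound (final-sound (leftHalf ts)
      (subst₂ (λ l v → Run l 0 v) (cong (λ l → replicate l final ++ accept ∷ replicate (suc R) final) (sym (halves ℤ.-[1+ R ] ts))) (row-split q ts) r)))

    finalRow-complete : ∀ c → AcceptingConfig c → Run (finalRow R) 0 (rowOf c)
    finalRow-complete (q , ts) acc =
      subst₂ (λ l v → Run l 0 v) (cong (λ l → replicate l final ++ accept ∷ replicate (suc R) final) (halves ℤ.-[1+ R ] ts)) (sym (row-split q ts))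
        (final-complete (leftHalf ts) q (accept-complete acc (subst₂ (λ l v → Run l 0 v) (trans (List.++-identityʳ _) (cong (λ l → replicate l final) (halves (ℤ.+ 1) ts))) (sym (List.++-assoc (colours q (rightHalf ts)) _ _))
          (final-complete (rightHalf ts) {ws = zeros (length (leftHalf ts)) ++ 0 ∷ []} q (done (All.++⁺ (All.++⁺ (all-zeros (length (leftHalf ts))) (refl ∷ [])) (all-zeros (length (rightHalf ts)))))))))

    computation-sound : ∀ w P T → length w + P + T ≤ suc R → Run (computation R P T) 0 (rowOf (start , guessing w [])) →
      ∃[ c ] length c ≤ P × AcceptingConfig (iter T proceed (initial (w ∷ c ∷ [])))
    computation-sound w P T le r = finish (guess-sound P w [] w≤ (≤-trans (≤-reflexive (+-identityʳ P)) P≤) r)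
      where
      w≤ : length w ≤ suc R
      w≤ = ≤-trans (m≤m+n _ P) (≤-trans (m≤m+n _ T) le)
      P≤ : P ≤ suc R
      P≤ = ≤-trans (m≤n+m P (length w)) (≤-trans (m≤m+n _ T) le)
      finish : ∃[ c ] length c ≤ P + 0 × Run (rowClasses launch R ++ multiple T (rowClasses compute R) ++ finalRow R) 0 (rowOf (start , guessing w c)) →
        ∃[ c ] length c ≤ P × AcceptingConfig (iter T proceed (initial (w ∷ c ∷ [])))
      finish (c , lc , r) = c , lc′ , finalRow-sound _ (compute-sound T (initial (w ∷ c ∷ [])) (within-initial w c {length w + P} (m≤m+n _ P) (≤-trans lc′ (m≤n+m P _))) (≤-trans (≤-reflexive (+-comm T _)) le)
        (launch-sound w c w≤ (≤-trans lc′ P≤) r))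
        where
        lc′ : length c ≤ P
        lc′ = ≤-trans lc (≤-reflexive (+-identityʳ P))

    computation-complete : ∀ w P T → length w + P + T ≤ suc R → ∀ c → length c ≤ P → AcceptingConfig (iter T proceed (initial (w ∷ c ∷ []))) →
      Run (computation R P T) 0 (rowOf (start , guessing w []))
    computation-complete w P T le c lc acc = guess-complete P (reverse c) w [] w≤ lr (≤-trans (≤-reflexive (+-identityʳ _)) (≤-trans lr P≤))
      (subst (λ c → Run _ 0 (rowOf (start , guessing w c))) (sym (trans (List.ʳ++-defn (reverse c)) (trans (List.++-identityʳ _) (List.reverse-involutive c))))
        (launch-complete w c w≤ (≤-trans lc P≤) (compute-complete T (initial (w ∷ c ∷ [])) (within-initial w c {length w + P} (m≤m+n _ P) (≤-trans lc (m≤n+m P _))) (≤-trans (≤-reflexive (+-comm T _)) le)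
          (finalRow-complete _ acc))))
      where
      w≤ : length w ≤ suc R
      w≤ = ≤-trans (m≤m+n _ P) (≤-trans (m≤m+n _ T) le)
      P≤ : P ≤ suc R
      P≤ = ≤-trans (m≤n+m P (length w)) (≤-trans (m≤m+n _ T) le)
      lr : length (reverse c) ≤ P
      lr = ≤-trans (≤-reflexive (List.length-reverse c)) lc

    content-input : ∀ w i → content (guessing w []) i ≡ inputCell (cell (tapeFrom [] (map bit w)) i)
    content-input w i = cong₂ (λ s v → cell (tapeFrom [] (map bit w)) i ∷ s ∷ v) (empty i) (empties workTapes)
      where
      empty : ∀ i → cell (tape {auxSymbols} [] blank []) i ≡ blank
      empty (ℤ.+ zero)  = refl
      empty (ℤ.+ suc n) = refl
      empty ℤ.-[1+ n ]  = refl
      empties : ∀ m → content (Vec.replicate m (tape [] blank [])) i ≡ blanks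
      empties zero    = refl
      empties (suc m) = cong₂ _∷_ (empty i) (empties m)

  inputRow-cells : ∀ w P T → Computation.cells M (radius w P T) (Computation.guessing M (radius w P T) w []) ≡ inputRow w P T
  inputRow-cells w P T = trans (Computation.cellsOf-cong M (radius w P T) (content-input (radius w P T) w))
    (cong₂ _++_ (table-replicateˡ (suc (radius w P T)) f (λ n → cong inputCell (left-cell w n)))
      (trans (cong (λ m → table (ℤ.+ 0) m f) (sym (trans (+-suc (length w) (suc (P + T))) (cong suc (+-suc (length w) (P + T)))))) (table-word inputCell w (suc (suc (P + T))) 0 f (λ n → cong inputCell (right-cell w n)))))
    where
    f : ℤ → Cell
    f i = inputCell (cell (tapeFrom [] (map bit w)) i)
    left-cell : ∀ w n → cell (tapeFrom {auxSymbols} [] (map bit w)) ℤ.-[1+ n ] ≡ blank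
    left-cell []      n = refl
    left-cell (_ ∷ _) n = refl
    right-cell : ∀ w n → cell (tapeFrom {auxSymbols} [] (map bit w)) (ℤ.+ n) ≡ nth (map bit w) n
    right-cell []      zero    = refl
    right-cell []      (suc n) = refl
    right-cell (_ ∷ _) zero    = refl
    right-cell (_ ∷ _) (suc n) = refl

  width : List Bool → ℕ → ℕ → ℕ
  width w P T = suc (radius w P T) + suc (suc (radius w P T))

  length-inputRow : ∀ w P T → length (inputRow w P T) ≡ width w P T
  length-inputRow w P T = trans (List.length-++ (replicate (suc (radius w P T)) blanks)) (cong₂ _+_ (List.length-replicate (suc (radius w P T)))
    (trans (List.length-++ (map (inputCell ∘ bit) w)) (trans (cong₂ _+_ (List.length-map (inputCell ∘ bit) w) (List.length-replicate (suc (suc (P + T))))) (trans (+-suc (length w) (suc (P + T))) (cong suc (+-suc (length w) (P + T)))))))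

  enough : ∀ w P T → length w + P + T ≤ suc (radius w P T)
  enough w P T = ≤-trans (≤-reflexive (+-assoc (length w) P T)) (n≤1+n _)

  tableau-sound : ∀ w P T → Run (tableau w P T) 0 (zeros (width w P T)) →
    ∃[ c ] length c ≤ P × AcceptingConfig (iter T (Computation.proceed M (radius w P T)) (initial (w ∷ c ∷ [])))
  tableau-sound w P T r = computation-sound (radius w P T) w P T (enough w P T)
    (subst (λ l → Run (computation (radius w P T) P T) 0 (colours start l)) (sym (inputRow-cells w P T))
      (init-sound (inputRow w P T) {ws = []} (subst (Run _ 0) (trans (cong zeros (sym (length-inputRow w P T))) (sym (List.++-identityʳ _))) r)))

  tableau-complete : ∀ w P T c → length c ≤ P → AcceptingConfig (iter T (Computation.proceed M (radius w P T)) (initial (w ∷ c ∷ []))) → Run (tableau w P T) 0 (zeros (width w P T))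
  tableau-complete w P T c lc acc = subst (Run _ 0) (trans (List.++-identityʳ _) (cong zeros (length-inputRow w P T)))
    (init-complete (inputRow w P T) {ws = []} (subst (λ l → Run (computation (radius w P T) P T) 0 (colours start l)) (inputRow-cells w P T) (computation-complete (radius w P T) w P T (enough w P T) c lc acc)))

  colourBound : ℕ
  colourBound = card V-finite + card H-finite

  SmallTile : Tile → Set
  SmallTile t = west t ≤ colourBound × east t ≤ colourBound × south t ≤ colourBound × north t ≤ colourBound

  vc≤ : ∀ p → vc p ≤ colourBound
  vc≤ p = ≤-trans (code≤ V-finite p) (m≤m+n _ _)

  hc≤ : ∀ p → hc p ≤ colourBound
  hc≤ p = ≤-trans (code≤ H-finite p) (m≤n+m _ _)

  tiles-small : ∀ c → All SmallTile (tiles c)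
  tiles-small first      = All.map⁺ (All.universal (λ _ → z≤n , hc≤ _ , vc≤ _ , vc≤ _) _)
  tiles-small mid        = All.map⁺ (All.universal (λ _ → hc≤ _ , hc≤ _ , vc≤ _ , vc≤ _) _)
  tiles-small last       = All.map⁺ (All.universal (λ _ → hc≤ _ , z≤n , vc≤ _ , vc≤ _) _)
  tiles-small (centre ρ) = All.concat⁺ (All.map⁺ (All.universal {P = λ c → All SmallTile (map (centreTile c) (options ρ (proj₁ (proj₁ c)) (proj₂ (proj₁ c))))} (λ c → All.map⁺ (All.universal (small c) (options ρ (proj₁ (proj₁ c)) (proj₂ (proj₁ c))))) (elements (V-finite ×-finite (Cell-finite ×-finite Cell-finite)))))
    where
    small : ∀ c o → SmallTile (centreTile c o)
    small c o = hc≤ _ , hc≤ _ , vc≤ _ , vc≤ _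
  tiles-small (init x)   = (z≤n , z≤n , z≤n , vc≤ _) ∷ []
  tiles-small final      = All.map⁺ (All.universal (λ _ → z≤n , z≤n , vc≤ _ , z≤n) _)
  tiles-small accept     = All.concat⁺ (All.map⁺ (All.universal small (elements V-finite)))
    where
    small : ∀ p → All SmallTile (acceptTile p)
    small (q , x) with isTrue (Vec.head x)
    ... | true  = (z≤n , z≤n , vc≤ _ , z≤n) ∷ []
    ... | false = []

  tileBound : ℕ
  tileBound = 1 + (length (tiles first) + (length (tiles mid) + (length (tiles last) + (length (tiles (centre guess)) +
    (length (tiles (centre launch)) + (length (tiles (centre compute)) + (length (tiles final) + length (tiles accept))))))))

  later : ∀ {x y} a → x ≤ y → x ≤ a + y
  later a h = ≤-trans h (m≤n+m _ a)

  tiles-few : ∀ c → length (tiles c) ≤ tileBound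
  tiles-few (init x)         = m≤m+n 1 _
  tiles-few first            = later 1 (m≤m+n _ _)
  tiles-few mid              = later 1 (later (length (tiles first)) (m≤m+n _ _))
  tiles-few last             = later 1 (later (length (tiles first)) (later (length (tiles mid)) (m≤m+n _ _)))
  tiles-few (centre guess)   = later 1 (later (length (tiles first)) (later (length (tiles mid)) (later (length (tiles last)) (m≤m+n _ _))))
  tiles-few (centre launch)   = later 1 (later (length (tiles first)) (later (length (tiles mid)) (later (length (tiles last)) (later (length (tiles (centre guess))) (m≤m+n _ _)))))
  tiles-few (centre compute) = later 1 (later (length (tiles first)) (later (length (tiles mid)) (later (length (tiles last)) (later (length (tiles (centre guess))) (later (length (tiles (centre launch))) (m≤m+n _ _))))))
  tiles-few final            = later 1 (later (length (tiles first)) (later (length (tiles mid)) (later (length (tiles last)) (later (length (tiles (centre guess))) (later (length (tiles (centre launch))) (later (length (tiles (centre compute))) (m≤m+n _ _)))))))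
  tiles-few accept           = later 1 (later (length (tiles first)) (later (length (tiles mid)) (later (length (tiles last)) (later (length (tiles (centre guess))) (later (length (tiles (centre launch))) (later (length (tiles (centre compute))) (m≤n+m _ (length (tiles final)))))))))

-- Instances of the scheduling problem from tilings.

module Puzzle {Cl : Set} (tiles : Cl → List Tile) (C L W′ : ℕ)
  (colours : ∀ c → All (λ t → west t ≤ C × east t ≤ C × south t ≤ C × north t ≤ C) (tiles c))
  (few : ∀ c → length (tiles c) ≤ L) where

  β : ℕ
  β = suc (C + L * C + L + 1)

  open Tiling tiles
  open Digits tiles C L W′ β colours few ≤-refl public

  -- A power of the base is easily computed by repeated multiplication, has polynomially many bits,
  -- and exceeds the number of items by `scale-large`.
  scale : List Cl → ℕ
  scale cs = b ^ suc (length cs)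

  reduced : List Cl → Instance
  reduced cs = Reduction.instanceOf (scale cs) (target cs) (items cs)

  L<b : L < b
  L<b = ≤-trans (s≤s (≤-trans (m≤n+m L (C + L * C)) (m≤m+n _ 1))) (≤-trans (m≤n*m β (β * β)) ≤-refl)

  2<b : 2 < b
  2<b = ≤-trans (≤-trans (s≤s (s≤s (s≤s z≤n))) (*-mono-≤ (*-mono-≤ 2≤β 2≤β) 2≤β)) ≤-refl
    where
    2≤β : 2 ≤ β
    2≤β = s≤s (m≤n+m 1 (C + L * C + L))

  scale-positive : ∀ cs → 0 < scale cs
  scale-positive cs = m^n>0 b (suc (length cs))

  length-items : ∀ cs → length (items cs) ≤ length cs * L
  length-items []       = z≤n
  length-items (c ∷ cs) = ≤-trans (≤-reflexive (List.length-++ (map loc (tiles c))))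
    (+-mono-≤ (≤-trans (≤-reflexive (List.length-map loc (tiles c))) (few c)) (≤-trans (≤-reflexive (List.length-map (b *_) (items cs))) (length-items cs)))

  scale-large : ∀ n → n * L + 3 ≤ b ^ suc n
  scale-large zero    = ≤-trans 2<b (≤-reflexive (sym (*-identityʳ b)))
  scale-large (suc n) = ≤-trans (≤-reflexive (+-assoc L (n * L) 3)) (≤-trans (+-mono-≤ (m≤m*n L (b ^ suc n) {{>-nonZero (m^n>0 b (suc n))}}) (scale-large n))
    (≤-trans (≤-reflexive (+-comm (L * b ^ suc n) (b ^ suc n))) (*-monoˡ-≤ (b ^ suc n) L<b)))

  items-positive : ∀ cs → All (0 <_) (items cs)
  items-positive []       = []
  items-positive (c ∷ cs) = All.++⁺ (All.map⁺ (All.universal (λ _ → s≤s z≤n) (tiles c))) (All.map⁺ (All.map (λ h → *-mono-< {0} {b} {0} (≤-trans (s≤s z≤n) 2<b) h) (items-positive cs)))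

  pending-zeros : ∀ n → pending (zeros n) ≡ 0
  pending-zeros zero    = refl
  pending-zeros (suc n) rewrite pending-zeros n = *-zeroʳ b

  zeros≤ : ∀ n → All (_≤ C) (zeros n)
  zeros≤ zero    = []
  zeros≤ (suc n) = z≤n ∷ zeros≤ n

  run→yes : ∀ c cs → Run (c ∷ cs) 0 (zeros (suc W′)) → YesInstance (reduced (c ∷ cs))
  run→yes c cs r = finish (run→sum (List.length-replicate (suc W′)) z≤n (zeros≤ (suc W′)) r)
    where
    finish : ∃[ s ] SubsetSum (items (c ∷ cs)) s × pending (zeros (suc W′)) + s ≡ target (c ∷ cs) → YesInstance (reduced (c ∷ cs))
    finish (s , sel , eq) = plan→yes (reduced (c ∷ cs)) 1 _ (Reduction.subset→plan (scale (c ∷ cs)) (target (c ∷ cs)) (items (c ∷ cs))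
      (*-mono-< {0} {scale (c ∷ cs)} {0} {target (c ∷ cs) + target (c ∷ cs)} (scale-positive (c ∷ cs)) (s≤s z≤n)) (All.map⁺ (All.map (λ h → *-mono-< {0} {scale (c ∷ cs)} {0} (scale-positive (c ∷ cs)) h) (items-positive (c ∷ cs))))
      (subst (SubsetSum (items (c ∷ cs))) (trans (cong (_+ s) (sym (pending-zeros (suc W′)))) eq) sel))

  yes→run : ∀ c cs → YesInstance (reduced (c ∷ cs)) → Run (c ∷ cs) 0 (zeros (suc W′))
  yes→run c cs yes′ = finish (yes→plan (reduced (c ∷ cs)) yes′)
    where
    finish : ∃[ K ] ∃[ σ ] Plan (reduced (c ∷ cs)) K σ → Run (c ∷ cs) 0 (zeros (suc W′))
    finish (K , σ , plan) = sum→run (c ∷ cs) (List.length-replicate (suc W′)) z≤n (zeros≤ (suc W′))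
      (Reduction.plan→subset (scale (c ∷ cs)) (target (c ∷ cs)) (items (c ∷ cs)) (*-mono-< {0} {scale (c ∷ cs)} {0} {target (c ∷ cs)} (scale-positive (c ∷ cs)) (s≤s z≤n))
        (≤-trans (+-monoˡ-≤ 3 (length-items (c ∷ cs))) (scale-large (length (c ∷ cs)))) plan)
      (cong (_+ target (c ∷ cs)) (pending-zeros (suc W′)))

same-instance : ∀ {m n} (xs : Vec Job m) (ys : Vec Job n) {b b′} → Vec.toList xs ≡ Vec.toList ys → b ≡ b′ →
  YesInstance (record { jobs = xs ; bound = b }) → YesInstance (record { jobs = ys ; bound = b′ })
same-instance xs ys {b} e refl = subst YesInstance (trans (listed xs) (trans (cong (λ l → record { jobs = Vec.fromList l ; bound = b }) e) (sym (listed ys))))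
  where
  extend : Job → Instance → Instance
  extend j I = record { jobs = j ∷ Instance.jobs I ; bound = Instance.bound I }
  listed : ∀ {n} (xs : Vec Job n) → record { jobs = xs ; bound = b } ≡ record { jobs = Vec.fromList (Vec.toList xs) ; bound = b }
  listed []       = refl
  listed (x ∷ xs) = cong (extend x) (listed xs)

-- A word belongs to the language if some instance with this code is a yes-instance, so the code
-- must determine the answer.
encode-yes : ∀ I J → encode I ≡ encode J → YesInstance I → YesInstance J
encode-yes I J e = same-instance (Instance.jobs I) (Instance.jobs J) {Instance.bound I} {Instance.bound J} (List.map-injective (λ { refl → refl }) (proj₂ numbers)) (proj₁ numbers)
  where
  triples : Instance → List Triple
  triples I = map jobTriple (Vec.toList (Instance.jobs I))
  numbers : Instance.bound I ≡ Instance.bound J × triples I ≡ triples J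
  numbers = encodeNumbers-injective (Instance.bound I) (Instance.bound J) (triples I) (triples J) (trans (sym (encode-numbers I)) (trans e (encode-numbers J)))

-- Computing the reduction

iter-state : ∀ {A S : Set} (st : A → S) {F : S → S} {f : A → A} → (∀ x → F (st x) ≡ st (f x)) → ∀ n x → iter n F (st x) ≡ st (iter n f x)
iter-state st {F} {f} e zero    x = refl
iter-state st {F} {f} e (suc n) x = trans (cong (iter n F) (e x)) (iter-state st e n (f x))

composeᴾ : ∀ {f g} → IsPolynomial f → IsPolynomial g → IsPolynomial (λ n → f (g n))
composeᴾ {f} {g} (p , ep) G = proj₁ (go p) , λ n → trans (proj₂ (go p) n) (ep (g n))
  where
  go : ∀ p → IsPolynomial (λ n → eval p (g n))
  go []      = constᴾ 0
  go (a ∷ p) = constᴾ a +ᴾ (G *ᴾ go p)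

module _ {m q : ℕ} where

  inRow : ℕ → Arith m q → Arith m q
  inRow zero    c = nil
  inRow (suc a) c = c ›› inRow a c

  repeat : Polynomial → Arith m q → Arith m q
  repeat []      c = nil
  repeat (a ∷ p) c = inRow a c ›› loop (repeat p c)

  inRow-iter : ∀ a c n σ → ⟪ inRow a c ⟫ n σ ≡ iter a (⟪ c ⟫ n) σ
  inRow-iter zero    c n σ = refl
  inRow-iter (suc a) c n σ = inRow-iter a c n (⟪ c ⟫ n σ)

  repeat-iter : ∀ p c n σ → ⟪ repeat p c ⟫ n σ ≡ iter (eval p n) (⟪ c ⟫ n) σ
  repeat-iter []      c n σ = refl
  repeat-iter (a ∷ p) c n σ = trans (cong (iter n (⟪ repeat p c ⟫ n)) (inRow-iter a c n σ))
    (trans (iter-cong n (repeat-iter p c n) _) (trans (sym (iter-* n (eval p n) (⟪ c ⟫ n) _)) (sym (iter-+ a (n * eval p n) (⟪ c ⟫ n) σ))))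

  addTimes : ℕ → Fin m → Fin m → Arith m q
  addTimes a i j = inRow a (add i j)

  addTimes-adds : ∀ a {i j} → i ≢ j → ∀ n r s → ⟪ addTimes a i j ⟫ n (r ∣ s) ≡ ((r [ j ]≔ (lookup r j + a * lookup r i)) ∣ s)
  addTimes-adds zero    {i} {j} i≢j n r s = cong (_∣ s) (sym (trans (cong (r [ j ]≔_) (+-identityʳ _)) (Vec.[]≔-lookup r j)))
  addTimes-adds (suc a) {i} {j} i≢j n r s = trans (addTimes-adds a i≢j n r′ s) (cong (_∣ s)
    (trans (Vec.[]≔-idempotent r j) (cong (r [ j ]≔_) (trans (cong₂ (λ x y → x + a * y) (Vec.lookup∘update j r _) (Vec.lookup∘update′ i≢j r _)) (+-assoc (lookup r j) (lookup r i) (a * lookup r i))))))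
    where
    r′ : Vec ℕ m
    r′ = r [ j ]≔ (lookup r j + lookup r i)

module Writer {Cl : Set} (tiles : Cl → List Tile) (b pat : ℕ) (own carry : Tile → ℕ) where

  infixr 5 _⨾_
  -- Descriptions of lists of classes that depend uniformly on the input. From a description one
  -- obtains both the polynomial for the length of the list and the program that writes its items.
  data Gen : Set where
    one  : Cl → Gen
    _⨾_  : Gen → Gen → Gen
    rep  : ∀ {f} → IsPolynomial f → Gen → Gen
    letters : (Bool → Cl) → Gen

  classes : Gen → List Bool → List Cl
  classes (one c)       w = c ∷ []
  classes (g ⨾ h)       w = classes g w ++ classes h w
  classes (rep {f} p g) w = multiple (f (length w)) (classes g w)
  classes (letters f)      w = map f w

  size : Gen → ℕ → ℕ
  size (one c)       n = 1
  size (g ⨾ h)       n = size g n + size h n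
  size (rep {f} p g) n = f n * size g n
  size (letters f)      n = n

  sizeᴾ : ∀ g → IsPolynomial (size g)
  sizeᴾ (one c)   = constᴾ 1
  sizeᴾ (g ⨾ h)   = sizeᴾ g +ᴾ sizeᴾ h
  sizeᴾ (rep p g) = p *ᴾ sizeᴾ g
  sizeᴾ (letters f)  = varᴾ

  length-multiple : ∀ {A : Set} n (xs : List A) → length (multiple n xs) ≡ n * length xs
  length-multiple zero    xs = refl
  length-multiple (suc n) xs = trans (List.length-++ xs) (cong (length xs +_) (length-multiple n xs))

  size-classes : ∀ g w → length (classes g w) ≡ size g (length w)
  size-classes (one c)       w = refl
  size-classes (g ⨾ h)       w = trans (List.length-++ (classes g w)) (cong₂ _+_ (size-classes g w) (size-classes h w))
  size-classes (rep {f} p g) w = trans (length-multiple (f (length w)) (classes g w)) (cong (f (length w) *_) (size-classes g w))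
  size-classes (letters f)      w = List.length-map f w

  Program : Set
  Program = Arith 6 3

  -- `U` is 1; `Q` is the weight of the current position, multiplied by M; `QW` is the weight one
  -- row further on; `KT` is the target, also multiplied by M. `X` and `T` are scratch registers.
  U Q QW KT X T : Fin 6
  U = # 0
  Q = # 1
  QW = # 2
  KT = # 3
  X = # 4
  T = # 5

  OUT IN IN′ : Fin 3
  OUT = # 0
  IN = # 1
  IN′ = # 2

  store : (q qw k x t : ℕ) (out i i′ : List Bool) → Store 6 3
  store q qw k x t out i i′ = (1 ∷ q ∷ qw ∷ k ∷ x ∷ t ∷ []) ∣ (out ∷ i ∷ i′ ∷ [])

  scaleQ scaleQW : Program
  scaleQ  = add Q T ›› clear Q ›› addTimes b T Q ›› clear T
  scaleQW = add QW T ›› clear QW ›› addTimes b T QW ›› clear T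

  scaleQ-store : ∀ n q qw k out i i′ → ⟪ scaleQ ⟫ n (store q qw k 0 0 out i i′) ≡ store (b * q) qw k 0 0 out i i′
  scaleQ-store n q qw k out i i′ = cong (⟪ clear T ⟫ n) (addTimes-adds b {T} {Q} (λ ()) n (1 ∷ 0 ∷ qw ∷ k ∷ 0 ∷ q ∷ []) (out ∷ i ∷ i′ ∷ []))

  scaleQW-store : ∀ n q qw k out i i′ → ⟪ scaleQW ⟫ n (store q qw k 0 0 out i i′) ≡ store q (b * qw) k 0 0 out i i′
  scaleQW-store n q qw k out i i′ = cong (⟪ clear T ⟫ n) (addTimes-adds b {T} {QW} (λ ()) n (1 ∷ q ∷ 0 ∷ k ∷ 0 ∷ qw ∷ []) (out ∷ i ∷ i′ ∷ []))

  -- The single `false` is the code of the arrival time 0. Both arguments already contain the factor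
  -- M.
  jobBits : ℕ → ℕ → List Bool
  jobBits k x = encodeℕ x ++ false ∷ encodeℕ (pred (x + k))

  writeJob : Program
  -- `emit` writes the predecessor. This is compensated by adding `U` for the length, whereas for
  -- the deadline the predecessor is what is wanted.
  writeJob = add X T ›› add U T ›› emit T OUT ›› clear T ›› pushS OUT false ›› add KT X ›› emit X OUT ›› clear X

  writeJob-store : ∀ n q qw k x out i i′ → ⟪ writeJob ⟫ n (store q qw k x 0 out i i′) ≡ store q qw k 0 0 (jobBits k x List.ʳ++ out) i i′
  writeJob-store n q qw k x out i i′ = cong (λ l → store q qw k 0 0 l i i′)
    (trans (cong (λ y → encodeℕ (pred (x + k)) List.ʳ++ (false ∷ (encodeℕ y List.ʳ++ out))) (cong pred (+-comm x 1))) (sym (List.++-ʳ++ (encodeℕ x))))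

  -- `loc t` times the weight, with the upper edge split off: its factor is a power whose exponent,
  -- the row width, depends on the input, whereas `own t` and `carry t` are constants that can be
  -- built into the program.
  tileValue : ℕ → ℕ → Tile → ℕ
  tileValue q qw t = own t * q + carry t * qw

  writeTile : Tile → Program
  writeTile t = addTimes (own t) Q X ›› addTimes (carry t) QW X ›› writeJob

  writeTile-store : ∀ n q qw k t out i i′ → ⟪ writeTile t ⟫ n (store q qw k 0 0 out i i′) ≡ store q qw k 0 0 (jobBits k (tileValue q qw t) List.ʳ++ out) i i′
  writeTile-store n q qw k t out i i′ = trans
    (cong (λ σ → ⟪ writeJob ⟫ n (⟪ addTimes (carry t) QW X ⟫ n σ)) (addTimes-adds (own t) {Q} {X} (λ ()) n (1 ∷ q ∷ qw ∷ k ∷ 0 ∷ 0 ∷ []) (out ∷ i ∷ i′ ∷ [])))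
    (trans (cong (⟪ writeJob ⟫ n) (addTimes-adds (carry t) {QW} {X} (λ ()) n (1 ∷ q ∷ qw ∷ k ∷ own t * q ∷ 0 ∷ []) (out ∷ i ∷ i′ ∷ [])))
      (writeJob-store n q qw k (tileValue q qw t) out i i′))

  tilesBits : ℕ → ℕ → ℕ → List Tile → List Bool
  tilesBits q qw k = concatMap (λ t → jobBits k (tileValue q qw t))

  writeTiles : List Tile → Program
  writeTiles []       = nil
  writeTiles (t ∷ ts) = writeTile t ›› writeTiles ts

  writeTiles-store : ∀ n q qw k ts out i i′ → ⟪ writeTiles ts ⟫ n (store q qw k 0 0 out i i′) ≡ store q qw k 0 0 (tilesBits q qw k ts List.ʳ++ out) i i′
  writeTiles-store n q qw k []       out i i′ = refl
  writeTiles-store n q qw k (t ∷ ts) out i i′ = trans (cong (⟪ writeTiles ts ⟫ n) (writeTile-store n q qw k t out i i′))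
    (trans (writeTiles-store n q qw k ts _ i i′) (cong (λ l → store q qw k 0 0 l i i′) (sym (List.++-ʳ++ (jobBits k (tileValue q qw t))))))

  Position : Set
  Position = ℕ × ℕ × List Bool

  at : ℕ → List Bool → List Bool → Position → Store 6 3
  at k i i′ (q , qw , out) = store q qw k 0 0 out i i′

  classStep : ℕ → Position → Cl → Position
  classStep k (q , qw , out) c = b * q , b * qw , tilesBits q qw k (tiles c) List.ʳ++ out

  writeClass : Cl → Program
  writeClass c = writeTiles (tiles c) ›› scaleQ ›› scaleQW

  writeClass-store : ∀ n k c i i′ π → ⟪ writeClass c ⟫ n (at k i i′ π) ≡ at k i i′ (classStep k π c)
  writeClass-store n k c i i′ (q , qw , out) = trans (cong (λ σ → ⟪ scaleQW ⟫ n (⟪ scaleQ ⟫ n σ)) (writeTiles-store n q qw k (tiles c) out i i′))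
    (trans (cong (⟪ scaleQW ⟫ n) (scaleQ-store n q qw k _ i i′)) (scaleQW-store n (b * q) qw k _ i i′))

  program : Gen → Program
  program (one c)   = writeClass c
  program (g ⨾ h)   = program g ›› program h
  program (rep p g) = repeat (proj₁ p) (program g)
  program (letters f)  = loop (popS IN nil (λ b → pushS IN′ b)) ›› loop (popS IN′ nil (λ b → pushS IN b ›› writeClass (f b)))

  program-writes : ∀ g w k π → ⟪ program g ⟫ (length w) (at k (reverse w) [] π) ≡ at k (reverse w) [] (List.foldl (classStep k) π (classes g w))
  program-writes (one c) w k π = writeClass-store (length w) k c (reverse w) [] π
  program-writes (g ⨾ h) w k π = trans (cong (⟪ program h ⟫ (length w)) (program-writes g w k π))
    (trans (program-writes h w k _) (cong (at k (reverse w) []) (sym (List.foldl-++ (classStep k) π (classes g w) (classes h w)))))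
  program-writes (rep {f} p g) w k π = trans (repeat-iter (proj₁ p) (program g) (length w) _)
    (trans (cong (λ m → iter m (⟪ program g ⟫ (length w)) (at k (reverse w) [] π)) (proj₂ p (length w)))
      (trans (iter-state (at k (reverse w) []) {f = λ π → List.foldl (classStep k) π (classes g w)} (program-writes g w k) (f (length w)) π)
        (cong (at k (reverse w) []) (multiple-fold (f (length w)) π))))
    where
    multiple-fold : ∀ m π → iter m (λ π → List.foldl (classStep k) π (classes g w)) π ≡ List.foldl (classStep k) π (multiple m (classes g w))
    multiple-fold zero    π = refl
    multiple-fold (suc m) π = trans (multiple-fold m _) (sym (List.foldl-++ (classStep k) π (classes g w) (multiple m (classes g w))))
  program-writes (letters f) w k π = trans (cong (iter (length w) F) first-loop) second-loop
    where
    F : Store 6 3 → Store 6 3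
    F = ⟪ popS IN′ nil (λ b → pushS IN b ›› writeClass (f b)) ⟫ (length w)
    first-loop : iter (length w) (⟪ popS IN nil (λ b → pushS IN′ b) ⟫ (length w)) (at k (reverse w) [] π) ≡ at k [] w π
    first-loop = trans (drain (⟪ popS IN nil (λ b → pushS IN′ b) ⟫ (length w)) (λ i i′ → at k i i′ π) (λ i′ b → b ∷ i′) (λ _ _ _ → refl) (λ _ → refl) (length w) (reverse w) [] (≤-reflexive (List.length-reverse w)))
      (cong (λ i′ → at k [] i′ π) (List.reverse-involutive w))
    second : Store 6 3
    second = at k (reverse w) [] (List.foldl (classStep k) π (map f w))
    folds : ∀ w i π → List.foldl (λ (i , π) b → b ∷ i , classStep k π (f b)) (i , π) w ≡ (w List.ʳ++ i , List.foldl (classStep k) π (map f w))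
    folds []      i π = refl
    folds (b ∷ w) i π = folds w (b ∷ i) (classStep k π (f b))
    second-loop : iter (length w) F (at k [] w π) ≡ second
    second-loop = trans (drain F (λ i′ (i , π) → at k i i′ π) (λ (i , π) b → b ∷ i , classStep k π (f b))
      (λ b xs (i , π) → writeClass-store (length w) k (f b) (b ∷ i) xs π) (λ _ → refl) (length w) w ([] , π) ≤-refl)
      (cong (λ (i , π) → at k i [] π) (folds w [] π))

  targetFrom : ℕ → ℕ → ℕ
  targetFrom q zero    = 0
  targetFrom q (suc m) = pat * q + targetFrom (b * q) m

  accumulate : Program
  accumulate = addTimes pat QW KT ›› scaleQW

  accumulate-store : ∀ n q qw k out i i′ → ⟪ accumulate ⟫ n (store q qw k 0 0 out i i′) ≡ store q (b * qw) (k + pat * qw) 0 0 out i i′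
  accumulate-store n q qw k out i i′ = trans (cong (⟪ scaleQW ⟫ n) (addTimes-adds pat {QW} {KT} (λ ()) n (1 ∷ q ∷ qw ∷ k ∷ 0 ∷ 0 ∷ []) (out ∷ i ∷ i′ ∷ []))) (scaleQW-store n q qw (k + pat * qw) out i i′)

  power : ℕ → ℕ → ℕ
  power q m = iter m (b *_) q

  writeHeader : Program
  writeHeader = add KT X ›› add U X ›› emit X OUT ›› clear X ›› add KT X ›› add KT X ›› writeJob

  module _ {N W : ℕ → ℕ} (Nᴾ : IsPolynomial N) (Wᴾ : IsPolynomial W) (g : Gen) where

    reduction : Program
    -- `Q` is raised to M, one more power of the base than there are positions. `QW` then runs
    -- through the weights M, M b, ... to sum up the target and is reset to start one row ahead of
    -- `Q`.
    reduction = unit U ›› add U Q ›› scaleQ ›› repeat (proj₁ Nᴾ) scaleQ ›› add Q QW ›› repeat (proj₁ Nᴾ) accumulate ››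
      clear QW ›› add Q QW ›› repeat (proj₁ Wᴾ) scaleQW ›› writeHeader ›› program g

    module _ (w : List Bool) where

      private
        n M k : ℕ
        n = length w
        M = power (b * 1) (N n)
        k = targetFrom M (N n)
        i : List Bool
        i = reverse w

      final-position : Position
      final-position = List.foldl (classStep k) (M , power M (W n) , jobBits k (k + k) List.ʳ++ (encodeℕ k List.ʳ++ [])) (classes g w)

      reduction-result : arithResult reduction (λ (_ : Fin 1) → IN) OUT (w ∷ []) ≡ reverse (proj₂ (proj₂ final-position))
      reduction-result = trans (cong (λ n → reverse (lookup (stks (⟪ reduction ⟫ n ((0 ∷ 0 ∷ 0 ∷ 0 ∷ 0 ∷ 0 ∷ []) ∣ ([] ∷ i ∷ [] ∷ [])))) OUT)) (+-identityʳ (length w)))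
        (cong (λ σ → reverse (lookup (stks σ) OUT)) stages)
        where
        s₁ : ⟪ unit U ›› add U Q ›› scaleQ ⟫ n ((0 ∷ 0 ∷ 0 ∷ 0 ∷ 0 ∷ 0 ∷ []) ∣ ([] ∷ i ∷ [] ∷ [])) ≡ store (b * 1) 0 0 0 0 [] i []
        s₁ = scaleQ-store n 1 0 0 [] i []
        repeated : ∀ {f : ℕ → ℕ} (fᴾ : IsPolynomial f) {A : Set} (st : A → Store 6 3) {c : Program} {h : A → A} → (∀ x → ⟪ c ⟫ n (st x) ≡ st (h x)) → ∀ x → ⟪ repeat (proj₁ fᴾ) c ⟫ n (st x) ≡ st (iter (f n) h x)
        repeated {f} fᴾ st {c} {h} e x = trans (repeat-iter (proj₁ fᴾ) c n (st x)) (trans (cong (λ m → iter m (⟪ c ⟫ n) (st x)) (proj₂ fᴾ n)) (iter-state st e (f n) x))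
        s₂ : ⟪ repeat (proj₁ Nᴾ) scaleQ ⟫ n (store (b * 1) 0 0 0 0 [] i []) ≡ store M 0 0 0 0 [] i []
        s₂ = repeated Nᴾ (λ q → store q 0 0 0 0 [] i []) (λ q → scaleQ-store n q 0 0 [] i []) (b * 1)
        targets : ∀ m q k → iter m (λ (q , k) → b * q , k + pat * q) (q , k) ≡ (power q m , k + targetFrom q m)
        targets zero    q k = cong (q ,_) (sym (+-identityʳ k))
        targets (suc m) q k = trans (targets m (b * q) (k + pat * q)) (cong (power q (suc m) ,_) (+-assoc k (pat * q) _))
        s₃ : ⟪ repeat (proj₁ Nᴾ) accumulate ⟫ n (store M M 0 0 0 [] i []) ≡ store M (power M (N n)) k 0 0 [] i []
        s₃ = trans (repeated Nᴾ (λ (q , k) → store M q k 0 0 [] i []) (λ (q , k) → accumulate-store n M q k [] i []) (M , 0)) (cong (λ (q , k) → store M q k 0 0 [] i []) (targets (N n) M 0))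
        s₄ : ⟪ repeat (proj₁ Wᴾ) scaleQW ⟫ n (store M M k 0 0 [] i []) ≡ store M (power M (W n)) k 0 0 [] i []
        s₄ = repeated Wᴾ (λ q → store M q k 0 0 [] i []) (λ q → scaleQW-store n M q k [] i []) M
        s₅ : ⟪ writeHeader ⟫ n (store M (power M (W n)) k 0 0 [] i []) ≡ at k i [] (M , power M (W n) , jobBits k (k + k) List.ʳ++ (encodeℕ k List.ʳ++ []))
        s₅ = trans (cong (λ y → ⟪ writeJob ⟫ n (store M (power M (W n)) k (k + k) 0 (encodeℕ y List.ʳ++ []) i [])) (cong pred (+-comm k 1)))
          (writeJob-store n M (power M (W n)) k (k + k) (encodeℕ k List.ʳ++ []) i [])
        stages : ⟪ reduction ⟫ n ((0 ∷ 0 ∷ 0 ∷ 0 ∷ 0 ∷ 0 ∷ []) ∣ ([] ∷ i ∷ [] ∷ [])) ≡ at k i [] final-position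
        stages = begin
          R₁ (⟪ unit U ›› add U Q ›› scaleQ ⟫ n ((0 ∷ 0 ∷ 0 ∷ 0 ∷ 0 ∷ 0 ∷ []) ∣ ([] ∷ i ∷ [] ∷ []))) ≡⟨ cong R₁ s₁ ⟩
          R₂ (⟪ repeat (proj₁ Nᴾ) scaleQ ⟫ n (store (b * 1) 0 0 0 0 [] i []))                      ≡⟨ cong R₂ s₂ ⟩
          R₃ (⟪ repeat (proj₁ Nᴾ) accumulate ⟫ n (store M M 0 0 0 [] i []))                        ≡⟨ cong R₃ s₃ ⟩
          R₄ (⟪ repeat (proj₁ Wᴾ) scaleQW ⟫ n (store M M k 0 0 [] i []))                           ≡⟨ cong R₄ s₄ ⟩
          ⟪ program g ⟫ n (⟪ writeHeader ⟫ n (store M (power M (W n)) k 0 0 [] i []))               ≡⟨ cong (⟪ program g ⟫ n) s₅ ⟩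
          ⟪ program g ⟫ n (at k i [] (M , power M (W n) , jobBits k (k + k) List.ʳ++ (encodeℕ k List.ʳ++ []))) ≡⟨ program-writes g w k _ ⟩
          at k i [] final-position ∎
          where
          open ≡-Reasoning
          R₄ R₃ R₂ R₁ : Store 6 3 → Store 6 3
          R₄ σ = ⟪ writeHeader ›› program g ⟫ n σ
          R₃ σ = R₄ (⟪ clear QW ›› add Q QW ›› repeat (proj₁ Wᴾ) scaleQW ⟫ n σ)
          R₂ σ = R₃ (⟪ add Q QW ›› repeat (proj₁ Nᴾ) accumulate ⟫ n σ)
          R₁ σ = R₂ (⟪ repeat (proj₁ Nᴾ) scaleQ ⟫ n σ)

-- The written word is the code of the instance.

module Output {Cl : Set} (tiles : Cl → List Tile) (C L : ℕ)
  (colours : ∀ c → All (λ t → west t ≤ C × east t ≤ C × south t ≤ C × north t ≤ C) (tiles c))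
  (few : ∀ c → length (tiles c) ≤ L) where

  base radix pat : ℕ
  base  = suc (C + L * C + L + 1)
  radix = base * base * base
  pat   = 1 + base * (C + base * C)

  own carry : Tile → ℕ
  own t   = 1 + base * ((C ∸ south t) + base * ((C ∸ west t) + base * (east t * (base * base))))
  carry t = north t * base

  open Writer tiles radix pat own carry public

  module _ (W′ : ℕ) where

    open Puzzle tiles C L W′ colours few using (items; target; loc; reduced; scale)

    tileValue-loc : ∀ q qw t → qw ≡ radix ^ suc W′ * q → tileValue q qw t ≡ q * loc t
    tileValue-loc q qw t refl = identity q base (C ∸ south t) (C ∸ west t) (east t) (north t) (radix ^ W′)
      where
      identity : ∀ q β s w e n B → (1 + β * (s + β * (w + β * (e * (β * β))))) * q + n * β * (β * β * β * B * q) ≡ q * (1 + β * (s + β * (w + β * (e * (β * β) + B * (n * β)))))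
      identity = solve-∀

    tilesBits-loc : ∀ q qw k ts → qw ≡ radix ^ suc W′ * q → tilesBits q qw k ts ≡ concatMap (jobBits k) (map (q *_) (map loc ts))
    tilesBits-loc q qw k []       e = refl
    tilesBits-loc q qw k (t ∷ ts) e = cong₂ _++_ (cong (jobBits k) (tileValue-loc q qw t e)) (tilesBits-loc q qw k ts e)

    written-items : ∀ cs k q qw out → qw ≡ radix ^ suc W′ * q →
      proj₂ (proj₂ (List.foldl (classStep k) (q , qw , out) cs)) ≡ concatMap (jobBits k) (map (q *_) (items cs)) List.ʳ++ out
    written-items []       k q qw out e = refl
    written-items (c ∷ cs) k q qw out e = trans (written-items cs k (radix * q) (radix * qw) _ (trans (cong (radix *_) e) (commute radix (radix ^ suc W′) q)))
      (trans (sym (List.++-ʳ++ (tilesBits q qw k (tiles c)))) (cong (List._ʳ++ out) (begin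
        tilesBits q qw k (tiles c) ++ concatMap (jobBits k) (map (radix * q *_) (items cs))
          ≡⟨ cong₂ _++_ (tilesBits-loc q qw k (tiles c) e) (cong (concatMap (jobBits k)) (trans (List.map-cong (regroup radix q) (items cs)) (List.map-∘ (items cs)))) ⟩
        concatMap (jobBits k) (map (q *_) (map loc (tiles c))) ++ concatMap (jobBits k) (map (q *_) (map (radix *_) (items cs)))
          ≡⟨ sym (List.concatMap-++ (jobBits k) (map (q *_) (map loc (tiles c))) _) ⟩
        concatMap (jobBits k) (map (q *_) (map loc (tiles c)) ++ map (q *_) (map (radix *_) (items cs)))
          ≡⟨ cong (concatMap (jobBits k)) (sym (List.map-++ (q *_) (map loc (tiles c)) _)) ⟩
        concatMap (jobBits k) (map (q *_) (items (c ∷ cs))) ∎)))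
      where
      open ≡-Reasoning
      commute : ∀ a b c → a * (b * c) ≡ b * (a * c)
      commute = solve-∀
      regroup : ∀ a q y → a * q * y ≡ q * (a * y)
      regroup = solve-∀

    power-^ : ∀ m q → power q m ≡ radix ^ m * q
    power-^ zero    q = sym (+-identityʳ q)
    power-^ (suc m) q = trans (power-^ m (radix * q)) (regroup radix (radix ^ m) q)
      where
      regroup : ∀ a b q → b * (a * q) ≡ a * b * q
      regroup = solve-∀

    targetFrom-target : ∀ cs q → targetFrom q (length cs) ≡ q * target cs
    targetFrom-target []       q = sym (*-zeroʳ q)
    targetFrom-target (c ∷ cs) q = trans (cong (pat * q +_) (targetFrom-target cs (radix * q))) (regroup pat radix q (target cs))
      where
      regroup : ∀ p a q y → p * q + a * q * y ≡ q * (p + a * y)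
      regroup = solve-∀

    encode-jobs : ∀ M k xs → concatMap (jobBits (M * k)) (map (M *_) xs) ≡ concatMap encodeJob (map (Reduction.mkJob M k) xs)
    encode-jobs M k []       = refl
    encode-jobs M k (x ∷ xs) = cong₂ _++_ (cong (λ y → encodeℕ (M * x) ++ false ∷ encodeℕ (pred y)) (distribute M k x)) (encode-jobs M k xs)
      where
      distribute : ∀ M k x → M * x + M * k ≡ M * (k + x)
      distribute = solve-∀

    encode-instance : ∀ M k xs → encodeℕ (M * k) ++ jobBits (M * k) (M * k + M * k) ++ concatMap (jobBits (M * k)) (map (M *_) xs) ≡ encode (Reduction.instanceOf M k xs)
    encode-instance M k xs = cong (encodeℕ (M * k) ++_) (trans (cong (λ y → jobBits (M * k) y ++ concatMap (jobBits (M * k)) (map (M *_) xs)) (sym (*-distribˡ-+ M k k)))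
      (trans (encode-jobs M k (k + k ∷ xs)) (cong (concatMap encodeJob) (sym (Vec.toList∘fromList (map (Reduction.mkJob M k) (k + k ∷ xs)))))))

    unreversed : ∀ (as bs cs : List Bool) → reverse (cs List.ʳ++ (bs List.ʳ++ (as List.ʳ++ []))) ≡ as ++ bs ++ cs
    unreversed as bs cs = trans (List.ʳ++-ʳ++ cs) (trans (List.ʳ++-ʳ++ bs) (trans (List.ʳ++-ʳ++ as) (cong (λ l → as ++ bs ++ l) (List.++-identityʳ cs))))

    final-output : ∀ cs M k → M ≡ scale cs → k ≡ M * target cs →
      reverse (proj₂ (proj₂ (List.foldl (classStep k) (M , power M (suc W′) , jobBits k (k + k) List.ʳ++ (encodeℕ k List.ʳ++ [])) cs))) ≡ encode (reduced cs)
    final-output cs M k refl refl = trans (cong reverse (written-items cs k M (power M (suc W′)) _ (power-^ (suc W′) M)))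
      (trans (unreversed (encodeℕ k) (jobBits k (k + k)) _) (encode-instance M (target cs) (items cs)))

  reduction-output : ∀ {W : ℕ → ℕ} (g : Gen) (Wᴾ : IsPolynomial (λ n → suc (W n))) w →
    arithResult (reduction (sizeᴾ g) Wᴾ g) (λ (_ : Fin 1) → IN) OUT (w ∷ []) ≡ encode (Puzzle.reduced tiles C L (W (length w)) colours few (classes g w))
  reduction-output {W} g Wᴾ w = trans (reduction-result (sizeᴾ g) Wᴾ g w) (final-output (W n) (classes g w) _ _ scale≡ (trans (cong (targetFrom _) (sym (size-classes g w))) (targetFrom-target (W n) (classes g w) _)))
    where
    n : ℕ
    n = length w
    scale≡ : power (radix * 1) (size g n) ≡ radix ^ suc (length (classes g w))
    scale≡ = trans (cong (power (radix * 1)) (sym (size-classes g w))) (trans (power-^ (W n) (length (classes g w)) (radix * 1)) (rearrange radix (radix ^ length (classes g w))))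
      where
      rearrange : ∀ a x → x * (a * 1) ≡ a * x
      rearrange = solve-∀

-- The reduction from an arbitrary language in NP.

multiple-replicate : ∀ {A : Set} n (x : A) → multiple n (x ∷ []) ≡ replicate n x
multiple-replicate zero    x = refl
multiple-replicate (suc n) x = cong (x ∷_) (multiple-replicate n x)

map-just : ∀ {A B : Set} {f : A → B} {y} m → Maybe.map f m ≡ just y → ∃[ x ] m ≡ just x × f x ≡ y
map-just (just x) refl = x , refl , refl

module Guessing (M : TM 2) (V : List Bool → List Bool → Bool) (p p′ : Polynomial)
  (correct : ∀ w c → Maybe.map (output M) (TM.run M (eval p′ (length w + (length c + 0))) (TM.initial M (w ∷ c ∷ []))) ≡ just (V w c ∷ [])) where

  open Rows M using (Class; tiles; first; mid; last; centre; init; final; accept; isTrue; rowClasses)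
  open Tableau M

  -- `steps` is the time bound of the verifier for a certificate of the greatest admissible length,
  -- so that one tableau serves for all certificates.
  guesses steps reach : ℕ → ℕ
  guesses n = eval p n
  steps n   = eval p′ (n + guesses n)
  reach n   = n + (guesses n + steps n)

  guessesᴾ : IsPolynomial guesses
  guessesᴾ = p , λ _ → refl

  stepsᴾ : IsPolynomial steps
  stepsᴾ = composeᴾ (p′ , λ _ → refl) (varᴾ +ᴾ guessesᴾ)

  reachᴾ : IsPolynomial reach
  reachᴾ = varᴾ +ᴾ (guessesᴾ +ᴾ stepsᴾ)

  puzzle : List Bool → List Class
  puzzle w = tableau w (guesses (length w)) (steps (length w))

  open Output tiles colourBound tileBound tiles-small tiles-few using (Gen; one; _⨾_; rep; letters; classes; sizeᴾ; reduction; reduction-output; IN; OUT)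

  rowGen : Row → Gen
  rowGen ρ = one first ⨾ rep reachᴾ (one mid) ⨾ one (centre ρ) ⨾ rep reachᴾ (one mid) ⨾ one last

  gen : Gen
  gen = (rep (constᴾ 1 +ᴾ reachᴾ) (one (init blanks)) ⨾ letters (init ∘ inputCell ∘ bit) ⨾ rep (constᴾ 2 +ᴾ (guessesᴾ +ᴾ stepsᴾ)) (one (init blanks))) ⨾
    rep guessesᴾ (rowGen guess) ⨾ rowGen launch ⨾ rep stepsᴾ (rowGen compute) ⨾ rep (constᴾ 1 +ᴾ reachᴾ) (one final) ⨾ one accept ⨾ rep (constᴾ 1 +ᴾ reachᴾ) (one final)

  classes-row : ∀ ρ w → classes (rowGen ρ) w ≡ rowClasses ρ (reach (length w))
  classes-row ρ w = cong (λ l → first ∷ l ++ centre ρ ∷ l ++ last ∷ []) (multiple-replicate (reach (length w)) mid)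

  classes-gen : ∀ w → classes gen w ≡ puzzle w
  classes-gen w = cong₂ _++_ initial-row (cong₂ _++_ (cong (multiple P) (classes-row guess w)) (cong₂ _++_ (classes-row launch w) (cong₂ _++_ (cong (multiple S) (classes-row compute w))
    (cong (λ l → l ++ accept ∷ l) (multiple-replicate (suc R) final)))))
    where
    P S R : ℕ
    P = guesses (length w)
    S = steps (length w)
    R = reach (length w)
    blank-classes : ∀ n → multiple n (init blanks ∷ []) ≡ map init (replicate n blanks)
    blank-classes n = trans (multiple-replicate n (init blanks)) (sym (List.map-replicate init n blanks))
    initial-row : multiple (suc R) (init blanks ∷ []) ++ map (init ∘ inputCell ∘ bit) w ++ multiple (suc (suc (P + S))) (init blanks ∷ []) ≡ map init (inputRow w P S)
    initial-row = sym (trans (List.map-++ init (replicate (suc R) blanks) _) (cong₂ _++_ (sym (blank-classes (suc R)))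
      (trans (List.map-++ init (map (inputCell ∘ bit) w) _) (cong₂ _++_ (sym (List.map-∘ w)) (sym (blank-classes (suc (suc (P + S)))))))))

  -- One less than the row width, which counts the centre and `suc (reach n)` cells on either side.
  margin : ℕ → ℕ
  margin n = reach n + suc (suc (reach n))

  instanceFor : List Bool → Instance
  instanceFor w = Puzzle.reduced tiles colourBound tileBound (margin (length w)) tiles-small tiles-few (puzzle w)

  reduce : List Bool → List Bool
  reduce w = encode (instanceFor w)

  reduce-polyTime : PolyTimeFunction reduce
  reduce-polyTime = polyTime-cong (λ { (w ∷ []) → trans (reduction-output {margin} gen widthᴾ w) (cong (λ cs → encode (Puzzle.reduced tiles colourBound tileBound (margin (length w)) tiles-small tiles-few cs)) (classes-gen w)) })
    (arith-polyTime (reduction (sizeᴾ gen) widthᴾ gen) (λ _ → IN) OUT)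
    where
    widthᴾ : IsPolynomial (λ n → suc (margin n))
    widthᴾ = constᴾ 1 +ᴾ (reachᴾ +ᴾ (constᴾ 2 +ᴾ reachᴾ))

  output-isTrue : ∀ d v → output M d ≡ v ∷ [] → isTrue (Vec.head (scan (proj₂ d))) ≡ v
  output-isTrue (q , tape _ s after ∷ _) v e = go s e
    where
    go : ∀ s → leadingBits (s ∷ after) ≡ v ∷ [] → isTrue s ≡ v
    go (bit true)  e = List.∷-injectiveˡ e
    go (bit false) e = List.∷-injectiveˡ e

  -- On a shorter certificate the machine has a smaller time bound; its halting configuration is
  -- repeated up to the last row, where the answer is read for all certificates alike.
  verdict : ∀ w c → length c ≤ guesses (length w) → isTrue (Vec.head (scan (proj₂ (iter (steps (length w)) (Computation.proceed M (reach (length w))) (TM.initial M (w ∷ c ∷ [])))))) ≡ V w c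
  verdict w c lc = finish (map-just _ (correct w c))
    where
    finish : ∃[ d ] TM.run M (eval p′ (length w + (length c + 0))) (TM.initial M (w ∷ c ∷ [])) ≡ just d × output M d ≡ V w c ∷ [] →
      isTrue (Vec.head (scan (proj₂ (iter (steps (length w)) (Computation.proceed M (reach (length w))) (TM.initial M (w ∷ c ∷ [])))))) ≡ V w c
    finish (d , e , o) = trans (cong (λ d → isTrue (Vec.head (scan (proj₂ d)))) (Computation.run-proceed M (reach (length w)) (eval p′ (length w + (length c + 0)))
      (eval-mono p′ (+-monoʳ-≤ (length w) (≤-trans (≤-reflexive (+-identityʳ _)) lc))) e)) (output-isTrue d (V w c) o)

  accepted→yes : ∀ w c → length c ≤ guesses (length w) → V w c ≡ true → PreemptiveLazyBureaucratII (reduce w)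
  accepted→yes w c lc v = instanceFor w , refl , Puzzle.run→yes tiles colourBound tileBound (margin (length w)) tiles-small tiles-few _ _
    (tableau-complete w (guesses (length w)) (steps (length w)) c lc (trans (verdict w c lc) v))

  yes→accepted : ∀ w → PreemptiveLazyBureaucratII (reduce w) → ∃[ c ] length c ≤ guesses (length w) × V w c ≡ true
  yes→accepted w (I , e , feasible) = finish (tableau-sound w (guesses (length w)) (steps (length w))
    (Puzzle.yes→run tiles colourBound tileBound (margin (length w)) tiles-small tiles-few _ _ (encode-yes I (instanceFor w) e feasible)))
    where
    finish : ∃[ c ] length c ≤ guesses (length w) × isTrue (Vec.head (scan (proj₂ (iter (steps (length w)) (Computation.proceed M (reach (length w))) (TM.initial M (w ∷ c ∷ [])))))) ≡ true →
      ∃[ c ] length c ≤ guesses (length w) × V w c ≡ true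
    finish (c , lc , a) = c , lc , trans (sym (verdict w c lc)) a

NP-hard : NPHard PreemptiveLazyBureaucratII
NP-hard K (V , p , (M , p′ , correct) , K⇔) = reduce , reduce-polyTime , λ w → mk⇔
  (λ x → let c , lc , v = Equivalence.to (K⇔ w) x in accepted→yes w c lc v)
  (λ y → Equivalence.from (K⇔ w) (yes→accepted w y))
  where open Guessing M V p p′ (λ w c → correct (w ∷ c ∷ []))

theorem10 : NPComplete PreemptiveLazyBureaucratII
theorem10 = in-NP , NP-hard
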